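{- Let $n\ge 1$ be an integer, $p$ a prime and $k\ge 1$ an integer. Let $f:(\mathbb{Z}/p^k\mathbb{Z})^n\to\mathbb{Z}_{\ge 0}$ be a function that is not identically zero, and put $w=\max_{u\in\mathbb{P}(\mathbb{Z}/p^k\mathbb{Z})^{n-1}} f^*(u)$. (i) If $(w,n)\neq(1,1)$, then $$\sum_{x\in(\mathbb{Z}/p^k\mathbb{Z})^n} |f(x)|^n\ \ge\ \frac{C_{p^k,n}}{|\mathbb{P}(\mathbb{Z}/p^k\mathbb{Z})^{n-1}|}\sum_{u\in\mathbb{P}(\mathbb{Z}/p^k\mathbb{Z})^{n-1}}|f^*(u)|^n$$ with $$C_{p^k,n}=\frac{1}{\left(2\left\lceil\log_p(w)+\log_p(n)\right\rceil\right)^n}.$$ (ii) If $p>n$, the same inequality holds with $$C_{p^k,n}=\left(\lceil\log_p(w)\rceil+1\right)^{ -n}\left(1+\frac{n}{p}\right)^{ -n}.$$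
   Context: The projective space $\mathbb{P}(\mathbb{Z}/p^k\mathbb{Z})^{n-1}$ consists of the vectors $u\in(\mathbb{Z}/p^k\mathbb{Z})^n$ having at least one coordinate that is a unit, taken up to multiplication by units in $(\mathbb{Z}/p^k\mathbb{Z})^\times$; one representative in $(\mathbb{Z}/p^k\mathbb{Z})^n$ is fixed for each element. For $f:(\mathbb{Z}/p^k\mathbb{Z})^n\to\mathbb{Z}_{\ge0}$ the maximal function $f^*:\mathbb{P}(\mathbb{Z}/p^k\mathbb{Z})^{n-1}\to\mathbb{Z}_{\ge0}$ is $$f^*(u)=\sup_{a\in(\mathbb{Z}/p^k\mathbb{Z})^n}\ \sum_{t\in\mathbb{Z}/p^k\mathbb{Z}}f(a+tu).$$ -}

module Defs where

open import Data.Fin.Base using (Fin; zero; suc; toℕ)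
import Data.Fin.Properties as Fin
open import Data.Integer.Base using (+_)
open import Data.List.Base
  using (List; []; _∷_; map; length; allFin; cartesianProductWith; filter; deduplicate)
open import Data.List.Extrema.Nat using (max; xs≤max)
open import Data.List.Membership.Propositional using (_∈_; find; lose)
open import Data.List.Membership.Propositional.Properties
  using (∈-allFin; ∈-cartesianProductWith⁺; ∈-map⁺; ∈-filter⁺)
open import Data.List.Relation.Unary.All as All using (All)
import Data.List.Relation.Unary.All.Properties as All
open import Data.List.Relation.Unary.AllPairs using (AllPairs)
open import Data.List.Relation.Unary.Any using (Any; here; there)
import Data.List.Relation.Unary.Any.Properties as Any
import Data.List.Relation.Unary.Unique.DecSetoid.Properties as Unique
open import Data.Nat.Base hiding (_/_)
open import Data.Nat.DivMod hiding (_/_)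
open import Data.Nat.ListAction using (sum)
open import Data.Nat.Primality using (Prime; prime⇒nonZero; prime⇒nonTrivial)
open import Data.Nat.Properties
open import Data.Product using (∃; _×_; _,_; proj₁; proj₂)
open import Data.Rational.Base as ℚ using (ℚ; 1ℚ; 1/_; _/_)
import Data.Rational.Properties as ℚ
open import Data.Vec.Base as Vec using (Vec; []; _∷_; zipWith; replicate)
import Data.Vec.Properties as Vec
import Data.Vec.Relation.Unary.Any as VecAny
open import Algebra.Definitions.RawSemiring ℚ.+-*-rawSemiring
  using () renaming (_^_ to _^ℚ_)
open import Level using (0ℓ)
open import Relation.Binary.Bundles using (DecSetoid)
open import Relation.Binary.Definitions using (Decidable)
open import Relation.Binary.PropositionalEquality
open import Relation.Nullary using (¬_; Dec; yes; no; contradiction; _×-dec_)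

private
  variable
    N n : ℕ

-- A residue class is represented by its least non-negative member.
ℤ/_ : ℕ → Set
ℤ/ N = Fin N

-- An element of ℤ/ N witnesses N ≢ 0, so no side condition is needed.
infixl 6 _⊕_
_⊕_ : ℤ/ N → ℤ/ N → ℤ/ N
_⊕_ {N} a b = _mod_ (toℕ a + toℕ b) N {{Fin.nonZeroIndex a}}

infixl 7 _⊗_
_⊗_ : ℤ/ N → ℤ/ N → ℤ/ N
_⊗_ {N} a b = _mod_ (toℕ a * toℕ b) N {{Fin.nonZeroIndex a}}

𝟘 𝟙 : .{{NonZero N}} → ℤ/ N
𝟘 {N} = 0 mod N
𝟙 {N} = 1 mod N

IsUnit : ℤ/ N → Set
IsUnit {N} a = ∃ λ (b : ℤ/ N) → a ⊗ b ≡ 𝟙 {{Fin.nonZeroIndex a}}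

infixl 6 _⊕ᵛ_
_⊕ᵛ_ : Vec (ℤ/ N) n → Vec (ℤ/ N) n → Vec (ℤ/ N) n
_⊕ᵛ_ = zipWith _⊕_

infixr 7 _·ᵛ_
_·ᵛ_ : ℤ/ N → Vec (ℤ/ N) n → Vec (ℤ/ N) n
c ·ᵛ v = Vec.map (c ⊗_) v

allVectors : ∀ N n → List (Vec (ℤ/ N) n)
allVectors N zero    = [] ∷ []
allVectors N (suc n) = cartesianProductWith _∷_ (allFin N) (allVectors N n)

∈-allVectors : (v : Vec (ℤ/ N) n) → v ∈ allVectors N n
∈-allVectors []      = here refl
∈-allVectors (a ∷ v) = ∈-cartesianProductWith⁺ _∷_ (∈-allFin a) (∈-allVectors v)

HasUnitCoordinate : Vec (ℤ/ N) n → Set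
HasUnitCoordinate = VecAny.Any IsUnit

infix 4 _∼_
_∼_ : Vec (ℤ/ N) n → Vec (ℤ/ N) n → Set
_∼_ {N} u v = ∃ λ (c : ℤ/ N) → IsUnit c × u ≡ c ·ᵛ v

-- ℙ(ℤ/Nℤ)ⁿ⁻¹, presented by a choice of exactly one representative in
-- (ℤ/Nℤ)ⁿ for each of its elements.
record ProjectiveSpace (N n : ℕ) : Set where
  field
    points     : List (Vec (ℤ/ N) n)
    unimodular : All HasUnitCoordinate points
    exhaustive : ∀ v → HasUnitCoordinate v → Any (v ∼_) points
    distinct   : AllPairs (λ u v → ¬ u ∼ v) points

open ProjectiveSpace public

∣_∣ᴾ : ProjectiveSpace N n → ℕ
∣ P ∣ᴾ = length (points P)

lineSum : (Vec (ℤ/ N) n → ℕ) → Vec (ℤ/ N) n → Vec (ℤ/ N) n → ℕ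
lineSum {N} f u a = sum (map (λ t → f (a ⊕ᵛ t ·ᵛ u)) (allFin N))

-- `max 0` is the supremum, the values being natural numbers.
infix 9 _⋆
_⋆ : (Vec (ℤ/ N) n → ℕ) → Vec (ℤ/ N) n → ℕ
_⋆ {N} {n} f u = max 0 (map (lineSum f u) (allVectors N n))

maxOver : ProjectiveSpace N n → (Vec (ℤ/ N) n → ℕ) → ℕ
maxOver P g = max 0 (map g (points P))

-- For b ≥ 2 and m ≥ 1, log_b m ≤ j iff m ≤ bʲ, for every integer j; as
-- log_b m ≥ 0, its ceiling is the least such j among the naturals.
record CeilLog (b m : ℕ) : Set where
  field
    exponent : ℕ
    above    : m ≤ b ^ exponent
    least    : ∀ j → m ≤ b ^ j → exponent ≤ j

m≤b^m : ∀ b .{{_ : NonTrivial b}} m → m ≤ b ^ m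
m≤b^m b zero = z≤n
m≤b^m b@(suc (suc _)) (suc m) = ≤-trans
  (+-mono-≤ (m^n>0 b m) (m≤b^m b m))
  (+-monoʳ-≤ (b ^ m) (m≤m+n (b ^ m) _))

ceilLog : ∀ b .{{_ : NonTrivial b}} m → CeilLog b m
ceilLog b@(suc (suc _)) m = descend m (m≤b^m b m)
  where
  descend : ∀ e → m ≤ b ^ e → CeilLog b m
  descend zero    m≤ = record { exponent = 0 ; above = m≤ ; least = λ _ _ → z≤n }
  descend (suc e) m≤ with m ≤? b ^ e
  ... | yes m≤′ = descend e m≤′
  ... | no  m≰  = record
    { exponent = suc e
    ; above    = m≤
    ; least    = λ j m≤bʲ → ≰⇒> λ j≤e → m≰ (≤-trans m≤bʲ (^-monoʳ-≤ b j≤e))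
    }

⌈log[_]_⌉ : ∀ b → .{{NonTrivial b}} → ℕ → ℕ
⌈log[ b ] m ⌉ = CeilLog.exponent (ceilLog b m)

⌈log⌉-nonZero : ∀ b .{{_ : NonTrivial b}} {m} → 1 < m → NonZero ⌈log[ b ] m ⌉
⌈log⌉-nonZero b {m} 1<m with ceilLog b m
... | record { exponent = suc _ } = _
... | record { exponent = zero ; above = m≤1 } = contradiction m≤1 (<⇒≱ 1<m)

ℕ→ℚ : ℕ → ℚ
ℕ→ℚ m = + m / 1

infixr 8 _^-_
_^-_ : (q : ℚ) → .{{ℚ.NonZero q}} → ℕ → ℚ
q ^- n = (1/ q) ^ℚ n

-- ⌈log_p w + log_p n⌉ is expressed as ⌈log_p (w n)⌉.  The hypothesis
-- 1 < w n makes it positive.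
C₁ : ∀ {p} → Prime p → (w n : ℕ) → .(1 < w * n) → ℚ
C₁ {p} pr w n 1<wn =
  _/_ (+ 1) ((2 * L) ^ n)
    {{m^n≢0 (2 * L) n {{m*n≢0 2 L {{_}} {{⌈log⌉-nonZero p 1<wn}}}}}}
  where
  instance
    _ : NonTrivial p
    _ = prime⇒nonTrivial pr
  L : ℕ
  L = ⌈log[ p ] w * n ⌉

C₂ : ∀ {p} → Prime p → (w n : ℕ) → ℚ
C₂ {p} pr w n =
  _^-_ (ℕ→ℚ (⌈log[ p ] w ⌉ + 1)) {{log+1≢0}} n
    ℚ.* _^-_ (1ℚ ℚ.+ (+ n) / p) {{1+n/p≢0}} n
  where
  instance
    _ : NonTrivial p
    _ = prime⇒nonTrivial pr
    _ : NonZero p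
    _ = prime⇒nonZero pr
  log+1≢0 : ℚ.NonZero (ℕ→ℚ (⌈log[ p ] w ⌉ + 1))
  log+1≢0 = ℚ.pos⇒nonZero (ℕ→ℚ (⌈log[ p ] w ⌉ + 1))
    {{ℚ.normalize-pos (⌈log[ p ] w ⌉ + 1) 1 {{_}} {{>-nonZero (m≤n+m 1 ⌈log[ p ] w ⌉)}}}}
  1+n/p≢0 : ℚ.NonZero (1ℚ ℚ.+ (+ n) / p)
  1+n/p≢0 = ℚ.pos⇒nonZero (1ℚ ℚ.+ (+ n) / p)
    {{ℚ.pos+nonNeg⇒pos 1ℚ ((+ n) / p) {{ℚ.normalize-nonNeg n p}}}}

MaximalInequality : (P : ProjectiveSpace N n) → .{{NonZero ∣ P ∣ᴾ}} →
                    (Vec (ℤ/ N) n → ℕ) → ℚ → Set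
MaximalInequality {N} {n} P f C =
  ℕ→ℚ (sum (map (λ x → f x ^ n) (allVectors N n)))
    ℚ.≥ (C ℚ.* ((+ 1) / ∣ P ∣ᴾ)) ℚ.* ℕ→ℚ (sum (map (λ u → (f ⋆) u ^ n) (points P)))

private
  toℕ-mod : ∀ m N .{{_ : NonZero N}} → toℕ (m mod N) ≡ m % N
  toℕ-mod m N = Fin.toℕ-fromℕ< (m%n<n m N)

  toℕ-% : .{{_ : NonZero N}} (a : ℤ/ N) → toℕ a % N ≡ toℕ a
  toℕ-% a = m<n⇒m%n≡m (Fin.toℕ<n a)

  toℕ-⊕ : .{{_ : NonZero N}} (a b : ℤ/ N) → toℕ (a ⊕ b) ≡ (toℕ a + toℕ b) % N
  toℕ-⊕ {N} a b = toℕ-mod (toℕ a + toℕ b) N {{Fin.nonZeroIndex a}}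

  toℕ-⊗ : .{{_ : NonZero N}} (a b : ℤ/ N) → toℕ (a ⊗ b) ≡ (toℕ a * toℕ b) % N
  toℕ-⊗ {N} a b = toℕ-mod (toℕ a * toℕ b) N {{Fin.nonZeroIndex a}}

  ⊗-comm : (a b : ℤ/ N) → a ⊗ b ≡ b ⊗ a
  ⊗-comm {N} a b = cong (λ m → _mod_ m N {{Fin.nonZeroIndex a}}) (*-comm (toℕ a) (toℕ b))

  ⊗-identityˡ : .{{_ : NonZero N}} (a : ℤ/ N) → 𝟙 ⊗ a ≡ a
  ⊗-identityˡ {N} a = Fin.toℕ-injective (begin
    toℕ (𝟙 ⊗ a)               ≡⟨ toℕ-⊗ 𝟙 a ⟩
    (toℕ (𝟙 {N}) * toℕ a) % N ≡⟨ cong (λ m → (m * toℕ a) % N) (toℕ-mod 1 N) ⟩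
    (1 % N * toℕ a) % N       ≡⟨ cong (λ m → (1 % N * m) % N) (toℕ-% a) ⟨
    (1 % N * (toℕ a % N)) % N ≡⟨ %-distribˡ-* 1 (toℕ a) N ⟨
    (1 * toℕ a) % N           ≡⟨ cong (_% N) (*-identityˡ (toℕ a)) ⟩
    toℕ a % N                 ≡⟨ toℕ-% a ⟩
    toℕ a                     ∎)
    where open ≡-Reasoning

  ⊗-assoc : (a b c : ℤ/ N) → (a ⊗ b) ⊗ c ≡ a ⊗ (b ⊗ c)
  ⊗-assoc {N} a b c = Fin.toℕ-injective (begin
    toℕ ((a ⊗ b) ⊗ c)                     ≡⟨ toℕ-⊗ (a ⊗ b) c ⟩
    (toℕ (a ⊗ b) * C) % N                 ≡⟨ cong (λ m → (m * C) % N) (toℕ-⊗ a b) ⟩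
    ((A * B) % N * C) % N                 ≡⟨ cong (λ m → ((A * B) % N * m) % N) (toℕ-% c) ⟨
    ((A * B) % N * (C % N)) % N           ≡⟨ %-distribˡ-* (A * B) C N ⟨
    (A * B * C) % N                       ≡⟨ cong (_% N) (*-assoc A B C) ⟩
    (A * (B * C)) % N                     ≡⟨ %-distribˡ-* A (B * C) N ⟩
    (A % N * ((B * C) % N)) % N           ≡⟨ cong (λ m → (m * ((B * C) % N)) % N) (toℕ-% a) ⟩
    (A * ((B * C) % N)) % N               ≡⟨ cong (λ m → (A * m) % N) (toℕ-⊗ b c) ⟨
    (A * toℕ (b ⊗ c)) % N                 ≡⟨ toℕ-⊗ a (b ⊗ c) ⟨
    toℕ (a ⊗ (b ⊗ c))                     ∎)
    where
    open ≡-Reasoning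
    instance
      _ : NonZero N
      _ = Fin.nonZeroIndex a
    A = toℕ a
    B = toℕ b
    C = toℕ c

  ⊕-𝟘⊗ : .{{_ : NonZero N}} (a b : ℤ/ N) → a ⊕ 𝟘 ⊗ b ≡ a
  ⊕-𝟘⊗ {N} a b = Fin.toℕ-injective (begin
    toℕ (a ⊕ 𝟘 ⊗ b)            ≡⟨ toℕ-⊕ a (𝟘 ⊗ b) ⟩
    (toℕ a + toℕ (𝟘 ⊗ b)) % N  ≡⟨ cong (λ m → (toℕ a + m) % N) 𝟘⊗b ⟩
    (toℕ a + 0) % N            ≡⟨ cong (_% N) (+-identityʳ (toℕ a)) ⟩
    toℕ a % N                  ≡⟨ toℕ-% a ⟩
    toℕ a                      ∎)
    where
    open ≡-Reasoning
    𝟘⊗b : toℕ (𝟘 ⊗ b) ≡ 0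
    𝟘⊗b = trans (toℕ-⊗ 𝟘 b)
      (trans (cong (λ m → (m * toℕ b) % N) (trans (toℕ-mod 0 N) (m<n⇒m%n≡m (>-nonZero⁻¹ N))))
             (m<n⇒m%n≡m (>-nonZero⁻¹ N)))

  ⊕ᵛ-𝟘·ᵛ : .{{_ : NonZero N}} (a u : Vec (ℤ/ N) n) → a ⊕ᵛ 𝟘 ·ᵛ u ≡ a
  ⊕ᵛ-𝟘·ᵛ []      []      = refl
  ⊕ᵛ-𝟘·ᵛ (a ∷ v) (b ∷ u) = cong₂ _∷_ (⊕-𝟘⊗ a b) (⊕ᵛ-𝟘·ᵛ v u)

  𝟙-unit : .{{_ : NonZero N}} → IsUnit (𝟙 {N})
  𝟙-unit {{nz}} = 𝟙 {{nz}} , ⊗-identityˡ {{nz}} (𝟙 {{nz}})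

  ∈⇒≤sum : ∀ {m xs} → m ∈ xs → m ≤ sum xs
  ∈⇒≤sum {xs = x ∷ xs} (here refl) = m≤m+n x (sum xs)
  ∈⇒≤sum {xs = x ∷ xs} (there m∈)  = ≤-trans (∈⇒≤sum m∈) (m≤n+m (sum xs) x)

  ∈⇒≤max : ∀ {m xs} → m ∈ xs → m ≤ max 0 xs
  ∈⇒≤max {xs = xs} m∈ = All.lookup (xs≤max 0 xs) m∈

  f≤f⋆ : .{{_ : NonZero N}} (f : Vec (ℤ/ N) n → ℕ) → ∀ x u → f x ≤ (f ⋆) u
  f≤f⋆ f x u = ≤-trans
    (∈⇒≤sum (subst (λ y → f y ∈ map (λ t → f (x ⊕ᵛ t ·ᵛ u)) (allFin _)) (⊕ᵛ-𝟘·ᵛ x u)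
              (∈-map⁺ (λ t → f (x ⊕ᵛ t ·ᵛ u)) (∈-allFin 𝟘))))
    (∈⇒≤max (∈-map⁺ (lineSum f u) (∈-allVectors x)))

  point : .{{_ : NonZero N}} .{{_ : NonZero n}} (P : ProjectiveSpace N n) → ∃ (_∈ points P)
  point {N} {suc n} P
    with u , u∈P , _ ← find (exhaustive P (replicate (suc n) 𝟙) (VecAny.here 𝟙-unit))
    = u , u∈P

∣P∣≢0 : ∀ {p} → Prime p → ∀ k .{{_ : NonZero n}} (P : ProjectiveSpace (p ^ k) n) →
        NonZero ∣ P ∣ᴾ
∣P∣≢0 {p = p} pr k P
  with points P | point {{m^n≢0 p k {{prime⇒nonZero pr}}}} P
... | _ ∷ _ | _      = _
... | []    | _ , ()

1<w*n : ∀ {p} → Prime p → ∀ k .{{_ : NonZero n}}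
        (P : ProjectiveSpace (p ^ k) n) (f : Vec (ℤ/ (p ^ k)) n → ℕ) →
        ¬ (∀ x → f x ≡ 0) → (maxOver P (f ⋆) , n) ≢ (1 , 1) → 1 < maxOver P (f ⋆) * n
1<w*n {n} {p} pr k P f f≢0 ≢11 = go (maxOver P (f ⋆)) n w≢0 ≢11
  where
  instance
    _ : NonZero (p ^ k)
    _ = m^n≢0 p k {{prime⇒nonZero pr}}
  f≤w : ∀ x → f x ≤ maxOver P (f ⋆)
  f≤w x with u , u∈P ← point P = ≤-trans (f≤f⋆ f x u) (∈⇒≤max (∈-map⁺ (f ⋆) u∈P))
  w≢0 : maxOver P (f ⋆) ≢ 0
  w≢0 w≡0 = f≢0 λ x → n≤0⇒n≡0 (subst (f x ≤_) w≡0 (f≤w x))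
  go : ∀ w n .{{_ : NonZero n}} → w ≢ 0 → (w , n) ≢ (1 , 1) → 1 < w * n
  go 0             _             w≢0 _   = contradiction refl w≢0
  go 1             1             _   ≢11 = contradiction refl ≢11
  go 1             (suc (suc n)) _   _   = s≤s (s≤s z≤n)
  go (suc (suc w)) (suc n)       _   _   =
    s≤s (≤-trans (s≤s z≤n) (m≤n+m (suc (n + w * suc n)) n))

private
  isUnit? : (a : ℤ/ N) → Dec (IsUnit a)
  isUnit? a = Fin.any? λ b → a ⊗ b Fin.≟ 𝟙 {{Fin.nonZeroIndex a}}

  module _ {N n : ℕ} .{{_ : NonZero N}} where

    ·ᵛ-identityˡ : (v : Vec (ℤ/ N) n) → 𝟙 ·ᵛ v ≡ v
    ·ᵛ-identityˡ v = trans (Vec.map-cong ⊗-identityˡ v) (Vec.map-id v)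

    ·ᵛ-assoc : ∀ c d (v : Vec (ℤ/ N) n) → (c ⊗ d) ·ᵛ v ≡ c ·ᵛ d ·ᵛ v
    ·ᵛ-assoc c d v = trans (Vec.map-cong (⊗-assoc c d) v) (Vec.map-∘ (c ⊗_) (d ⊗_) v)

    _∼?_ : Decidable (_∼_ {N} {n})
    u ∼? v = Fin.any? λ c → isUnit? c ×-dec Vec.≡-dec Fin._≟_ u (c ·ᵛ v)

    ∼-refl : ∀ {u : Vec (ℤ/ N) n} → u ∼ u
    ∼-refl {u} = 𝟙 , 𝟙-unit , sym (·ᵛ-identityˡ u)

    ∼-sym : ∀ {u v : Vec (ℤ/ N) n} → u ∼ v → v ∼ u
    ∼-sym {u} {v} (c , (d , cd≡𝟙) , refl) =
      d , (c , dc≡𝟙) ,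
      sym (trans (sym (·ᵛ-assoc d c v)) (trans (cong (_·ᵛ v) dc≡𝟙) (·ᵛ-identityˡ v)))
      where
      dc≡𝟙 : d ⊗ c ≡ 𝟙
      dc≡𝟙 = trans (⊗-comm d c) cd≡𝟙

    ∼-trans : ∀ {u v w : Vec (ℤ/ N) n} → u ∼ v → v ∼ w → u ∼ w
    ∼-trans {w = w} (c , (c′ , cc′≡𝟙) , refl) (d , (d′ , dd′≡𝟙) , refl) =
      c ⊗ d , (d′ ⊗ c′ , unit) , sym (·ᵛ-assoc c d w)
      where
      open ≡-Reasoning
      𝟙ᵈ : ℤ/ N
      𝟙ᵈ = 𝟙 {{Fin.nonZeroIndex d}}
      unit : (c ⊗ d) ⊗ (d′ ⊗ c′) ≡ 𝟙 {{Fin.nonZeroIndex c}}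
      unit = begin
        (c ⊗ d) ⊗ (d′ ⊗ c′) ≡⟨ ⊗-assoc c d (d′ ⊗ c′) ⟩
        c ⊗ (d ⊗ (d′ ⊗ c′)) ≡⟨ cong (c ⊗_) (⊗-assoc d d′ c′) ⟨
        c ⊗ ((d ⊗ d′) ⊗ c′) ≡⟨ cong (λ e → c ⊗ (e ⊗ c′)) dd′≡𝟙 ⟩
        c ⊗ (𝟙ᵈ ⊗ c′)       ≡⟨ cong (c ⊗_) (⊗-identityˡ {{Fin.nonZeroIndex d}} c′) ⟩
        c ⊗ c′              ≡⟨ cc′≡𝟙 ⟩
        _                   ∎

    ∼-decSetoid : DecSetoid 0ℓ 0ℓ
    ∼-decSetoid = record
      { Carrier = Vec (ℤ/ N) n
      ; _≈_ = _∼_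
      ; isDecEquivalence = record
        { isEquivalence = record
          { refl = ∼-refl ; sym = ∼-sym ; trans = ∼-trans }
        ; _≟_ = _∼?_
        }
      }

projectiveSpace : ∀ N n .{{_ : NonZero N}} → ProjectiveSpace N n
projectiveSpace N n = record
  { points     = deduplicate _∼?_ unimodulars
  ; unimodular  = All.deduplicate⁺ _∼?_ (All.all-filter unimodular? (allVectors N n))
  ; exhaustive = λ v prim → Any.deduplicate⁺ _∼?_ (λ y∼x v∼x → ∼-trans {u = v} v∼x (∼-sym y∼x))
                   (lose (∈-filter⁺ unimodular? (∈-allVectors v) prim) ∼-refl)
  ; distinct   = Unique.deduplicate-! ∼-decSetoid unimodulars
  }
  where
  unimodular? : (v : Vec (ℤ/ N) n) → Dec (HasUnitCoordinate v)
  unimodular? = VecAny.any? isUnit?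
  unimodulars : List (Vec (ℤ/ N) n)
  unimodulars = filter unimodular? (allVectors N n)

{-# OPTIONS --safe #-}

-- Let ζ be a primitive N-th root of unity, N = pᵏ, and let z = 1 + π.  A polynomial Q over ℤ[ζ] in n
-- variables that vanishes to order m f(x) at (ζ^x₁, …, ζ^xₙ) for every x restricts, along the curve
-- z ↦ (ζ^a₁ z^u₁, …, ζ^aₙ z^uₙ), to a multiple of ∏ₜ (z - ζᵗ)^(m f(a + tu)); modulo 1 - ζ it therefore vanishes
-- to order m f*(u) in π along (z^u₁, …, z^uₙ).  The same holds for the curves that differ from these by
-- multiples of πᴹ, as soon as M bounds the support of f on a line; M = pᵉ with e = min(⌈log_p w⌉, k) will do.
--
-- On the chart u₁ = 1, divided differences at the nodes z^i + πᴹ(…) show that a polynomial over 𝔽ₚ whose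
-- exponents satisfy v₁ + (e + 1)(v₂ + … + vₙ) < t is 0 if it vanishes to order t along all these curves.
-- Orders that vary with u are handled by a basis of the vanishing conditions chosen greedily by increasing
-- order and averaged over the translations of the chart (the monomial substitutions xᵣ ↦ xᵣ x₁^sᵣ): if Σ σₙ(m f(x))
-- equations are imposed, σₙ(D) = #{b ∈ ℕⁿ : b₁ + … + bₙ < D}, then N^(n-1) (e + 1)^(n-1) Σ_x σₙ(m f(x)) is at least
-- Σ_u σₙ(m f*(u)).  Letting m → ∞ gives Σ_u f*(u)ⁿ ≤ N^(n-1) (e + 1)^(n-1) Σ f(x)ⁿ on the chart.
--
-- Every direction lies in at least half of the sheared charts, so averaging over the shears gives
-- Σ_P f*(u)ⁿ ≤ 2 (e + 1)^(n-1) N^(n-1) Σ f(x)ⁿ ≤ (⌈log_p w⌉ + 1)ⁿ |P| Σ f(x)ⁿ, which contains both (i) and (ii).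

module Submission where

open import Defs
open import Data.Nat using (ℕ; _^_; _>_; NonZero)
open import Data.Nat.Primality using (Prime)
open import Data.Product using (_×_; _,_)
open import Data.Vec using (Vec)
open import Relation.Binary.PropositionalEquality using (_≡_; _≢_)
open import Relation.Nullary using (¬_)

-- The obstacle is the cost of interpolation in characteristic p. The order of zⁱ - zʲ in π is p^v,
-- where v is the p-adic valuation of i - j, so d divided differences at powers of z lose an order
-- that grows like d log d, which is fatal as m → ∞. If a line meets the support of f in at most pᵉ
-- points, the curve is free modulo π^(pᵉ). With this freedom the order of a difference of nodes is
-- p^v only for v ≤ e and pᵉ + (v - e) beyond, and the loss drops to (e + 1) d.
--
-- Elements of ℤ[ζ] are integer sequences obeying the cyclotomic recurrence, so that Q is found by
-- integer linear algebra. A solution that is only nonzero could disappear modulo 1 - ζ; it is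
-- therefore divided by p and by ζ - 1 as long as possible.
--
-- Conditions along different curves are dependent, and the orders f*(u) vary with u, so the number
-- of independent conditions cannot be read off directly. A family that is triangular modulo p
-- solves both problems: it may be restricted to any set of its members, and Q is sought among
-- combinations of its witnesses, which cannot satisfy all the restricted conditions without
-- reducing to 0.

-- Integral linear systems and solutions that are nonzero modulo p

module Kernel where

  import Algebra.Properties.Semiring.Sum
  open import Data.Fin.Base using (Fin; zero; suc; punchIn)
  import Data.Fin.Properties as Fin
  open import Data.Integer.Base as ℤ using (ℤ; +_; _+_; _-_; _*_; -_; 0ℤ; 1ℤ; ∣_∣)
  open import Data.Integer.Divisibility.Signed using (_∣_; _∣?_)
  import Data.Integer.Properties as ℤ
  open import Data.Integer.Tactic.RingSolver using (solve-∀)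
  open import Data.Nat.Base as ℕ using (ℕ; zero; suc; NonTrivial)
  open import Data.Nat.Induction using (<-wellFounded)
  import Data.Nat.Properties as ℕ
  open import Data.Product using (∃; _×_; _,_; proj₁; proj₂)
  open import Data.Vec.Functional using (Vector; insertAt)
  open import Data.Vec.Functional.Properties using (insertAt-lookup; insertAt-punchIn)
  open import Function.Base using (_∘_)
  open import Induction.WellFounded using (Acc; acc)
  open import Data.Sum using ([_,_]′)
  open import Relation.Binary.PropositionalEquality
  open import Relation.Nullary using (¬_; yes; no; contradiction)
  open import Relation.Nullary.Decidable using (¬?; decidable-stable)

  private module ∑ = Algebra.Properties.Semiring.Sum ℤ.+-*-semiring
  open ∑ using (sum; sum-cong-≗)

  sum-zero : ∀ {n} (x : Vector ℤ n) → (∀ i → x i ≡ 0ℤ) → sum x ≡ 0ℤ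
  sum-zero {n} x x≡0 = trans (sum-cong-≗ x≡0) (∑.sum-replicate-zero n)

  Solves : ∀ {m n} → (Fin m → Fin n → ℤ) → Vector ℤ n → Set
  Solves A x = ∀ i → sum (λ j → A i j * x j) ≡ 0ℤ

  -- Fraction-free elimination: with a pivot a in column c of the first row, the other rows become a
  -- Aᵢⱼ - Aᵢ꜀ A₀ⱼ. A solution y of the smaller system lifts to a y with -Σ A₀ⱼ yⱼ inserted at c, so
  -- no division occurs.
  nonzero-solution : ∀ {m n} → m ℕ.< n → (A : Fin m → Fin n → ℤ) →
                     ∃ λ x → Solves A x × ∃ λ j → x j ≢ 0ℤ
  nonzero-solution {zero} {suc n} _ A = (λ _ → 1ℤ) , (λ ()) , zero , λ ()
  nonzero-solution {suc m} {suc n} (ℕ.s≤s m<n) A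
    with Fin.any? (λ j → ¬? (A zero j ℤ.≟ 0ℤ))
  ... | no allZero = extend (nonzero-solution (ℕ.m<n⇒m<1+n m<n) (A ∘ suc))
    where
    extend : (∃ λ x → Solves (A ∘ suc) x × ∃ λ j → x j ≢ 0ℤ) → _
    extend (x , solves , nonzero) = x , solves′ , nonzero
      where
      row₀ : ∀ j → A zero j ≡ 0ℤ
      row₀ j with A zero j ℤ.≟ 0ℤ
      ... | yes eq = eq
      ... | no ≢0  = contradiction (j , ≢0) allZero
      solves′ : Solves A x
      solves′ zero    = sum-zero _ λ j → trans (cong (_* x j) (row₀ j)) (ℤ.*-zeroˡ (x j))
      solves′ (suc i) = solves i
  ... | yes (c , a≢0) with nonzero-solution m<n
          (λ i j → A zero c * A (suc i) (punchIn c j) - A (suc i) c * A zero (punchIn c j))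
  ...   | y , solves , j₀ , y≢0 = x , solves′ , punchIn c j₀ , x≢0
    where
    a = A zero c
    S : Fin (suc m) → ℤ
    S i = sum (λ j → A i (punchIn c j) * y j)
    x : Vector ℤ (suc n)
    x = insertAt (λ j → a * y j) c (- S zero)
    x≢0 : x (punchIn c j₀) ≢ 0ℤ
    x≢0 eq = [ a≢0 , y≢0 ]′
      (ℤ.i*j≡0⇒i≡0∨j≡0 a (trans (sym (insertAt-punchIn (λ j → a * y j) c (- S zero) j₀)) eq))
    row : ∀ i → sum (λ j → A i j * x j) ≡ A i c * (- S zero) + a * S i
    row i = begin
      sum (λ j → A i j * x j)
        ≡⟨ ∑.sum-remove {i = c} (λ j → A i j * x j) ⟩
      A i c * x c + sum (λ j → A i (punchIn c j) * x (punchIn c j))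
        ≡⟨ cong₂ (λ u v → A i c * u + v) (insertAt-lookup (λ j → a * y j) c (- S zero))
             (sum-cong-≗ λ j → trans (cong (A i (punchIn c j) *_)
               (insertAt-punchIn (λ j → a * y j) c (- S zero) j)) (swap (A i (punchIn c j)) a (y j))) ⟩
      A i c * (- S zero) + sum (λ j → a * (A i (punchIn c j) * y j))
        ≡⟨ cong (_+_ (A i c * (- S zero))) (∑.*-distribˡ-sum a (λ j → A i (punchIn c j) * y j)) ⟨
      A i c * (- S zero) + a * S i ∎
      where
      open ≡-Reasoning
      swap : ∀ b a y → b * (a * y) ≡ a * (b * y)
      swap = solve-∀
    solves′ : Solves A x
    solves′ zero = trans (row zero) (cancel a (S zero))
      where
      cancel : ∀ a s → a * (- s) + a * s ≡ 0ℤ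
      cancel = solve-∀
    solves′ (suc i) = begin
      sum (λ j → A (suc i) j * x j)
        ≡⟨ row (suc i) ⟩
      A (suc i) c * (- S zero) + a * S (suc i)
        ≡⟨ rearrange (A (suc i) c) (S zero) (a * S (suc i)) ⟩
      a * S (suc i) + (- A (suc i) c) * S zero
        ≡⟨ cong₂ _+_ (∑.*-distribˡ-sum a (λ j → A (suc i) (punchIn c j) * y j))
                     (∑.*-distribˡ-sum (- A (suc i) c) (λ j → A zero (punchIn c j) * y j)) ⟩
      sum (λ j → a * (A (suc i) (punchIn c j) * y j))
        + sum (λ j → (- A (suc i) c) * (A zero (punchIn c j) * y j))
        ≡⟨ ∑.∑-distrib-+ (λ j → a * (A (suc i) (punchIn c j) * y j))
                         (λ j → (- A (suc i) c) * (A zero (punchIn c j) * y j)) ⟨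
      sum (λ j → a * (A (suc i) (punchIn c j) * y j)
                   + (- A (suc i) c) * (A zero (punchIn c j) * y j))
        ≡⟨ sum-cong-≗ (λ j → factor a (A (suc i) (punchIn c j)) (A (suc i) c) (A zero (punchIn c j)) (y j)) ⟩
      sum (λ j → (a * A (suc i) (punchIn c j) - A (suc i) c * A zero (punchIn c j)) * y j)
        ≡⟨ solves i ⟩
      0ℤ ∎
      where
      open ≡-Reasoning
      rearrange : ∀ b s t → b * (- s) + t ≡ t + (- b) * s
      rearrange = solve-∀
      factor : ∀ a b c d y → a * (b * y) + (- c) * (d * y) ≡ (a * b - c * d) * y
      factor = solve-∀

  -- Descent on the absolute value of one fixed nonzero coordinate j: while p divides all
  -- coordinates, the whole solution is divided by p.
  primitive-multiple : ∀ p .{{_ : NonTrivial p}} {m n} (A : Fin m → Fin n → ℤ) x j → x j ≢ 0ℤ →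
              Solves A x → ∃ λ x → Solves A x × ∃ λ j → ¬ + p ∣ x j
  primitive-multiple p@(suc (suc _)) {n = n} A x j x≢0 solves = go x x≢0 solves (<-wellFounded _)
    where
    go : ∀ x → x j ≢ 0ℤ → Solves A x → Acc ℕ._<_ ∣ x j ∣ → ∃ λ x → Solves A x × ∃ λ j → ¬ + p ∣ x j
    go x x≢0 solves (acc rs) with Fin.any? (λ i → ¬? (+ p ∣? x i))
    ... | yes prim = x , solves , prim
    ... | no imprimitive = go y y≢0 solves′ (rs y<x)
      where
      p∣x : ∀ i → + p ∣ x i
      p∣x i = decidable-stable (+ p ∣? x i) λ p∤x → imprimitive (i , p∤x)
      y : Vector ℤ n
      y i = _∣_.quotient (p∣x i)
      x≡y*p : ∀ i → x i ≡ y i * + p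
      x≡y*p i = _∣_.equality (p∣x i)
      y≢0 : y j ≢ 0ℤ
      y≢0 eq = x≢0 (trans (x≡y*p j) (cong (_* + p) eq))
      y<x : ∣ y j ∣ ℕ.< ∣ x j ∣
      y<x = subst (∣ y j ∣ ℕ.<_) (sym (trans (cong ∣_∣ (x≡y*p j)) (ℤ.abs-* (y j) (+ p))))
              (ℕ.m<m*n ∣ y j ∣ p {{ℕ.≢-nonZero λ eq → y≢0 (ℤ.∣i∣≡0⇒i≡0 eq)}} (ℕ.s≤s (ℕ.s≤s ℕ.z≤n)))
      solves′ : Solves A y
      solves′ i = ℤ.*-cancelʳ-≡ _ _ (+ p) (begin
        sum (λ j → A i j * y j) * + p   ≡⟨ ∑.*-distribʳ-sum (+ p) (λ j → A i j * y j) ⟩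
        sum (λ j → A i j * y j * + p)   ≡⟨ sum-cong-≗ (λ j → trans (ℤ.*-assoc (A i j) (y j) (+ p))
                                              (cong (A i j *_) (sym (x≡y*p j)))) ⟩
        sum (λ j → A i j * x j)         ≡⟨ solves i ⟩
        0ℤ                              ∎)
        where open ≡-Reasoning

  -- An additive map to ℤ is automatically homogeneous (`fun-scale`), so an instance supplies only
  -- additivity and respect for pointwise equality.
  record Linear (n : ℕ) : Set where
    field
      fun  : Vector ℤ n → ℤ
      cong-≗ : ∀ {x y} → x ≗ y → fun x ≡ fun y
      +-homo : ∀ x y → fun (λ j → x j + y j) ≡ fun x + fun y

  module _ {n : ℕ} (L : Linear n) where
    open Linear L

    fun-0 : fun (λ _ → 0ℤ) ≡ 0ℤ
    fun-0 = trans (double (fun (λ _ → 0ℤ)))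
      (trans (cong (_- fun (λ _ → 0ℤ)) (sym (+-homo (λ _ → 0ℤ) (λ _ → 0ℤ)))) (ℤ.+-inverseʳ (fun (λ _ → 0ℤ))))
      where
      double : ∀ a → a ≡ a + a - a
      double = solve-∀

    fun-neg : ∀ x → fun (λ j → - x j) ≡ - fun x
    fun-neg x = begin
      fun (λ j → - x j)                      ≡⟨ lemma (fun x) _ ⟩
      - fun x + (fun x + fun (λ j → - x j))  ≡⟨ cong (_+_ (- fun x)) (+-homo x (λ j → - x j)) ⟨
      - fun x + fun (λ j → x j + - x j)      ≡⟨ cong (_+_ (- fun x)) (trans (cong-≗ λ j → ℤ.+-inverseʳ (x j)) fun-0) ⟩
      - fun x + 0ℤ                           ≡⟨ ℤ.+-identityʳ _ ⟩
      - fun x                                ∎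
      where
      open ≡-Reasoning
      lemma : ∀ a b → b ≡ - a + (a + b)
      lemma = solve-∀

    fun-scale : ∀ c x → fun (λ j → c * x j) ≡ c * fun x
    fun-scale (+ m) x = nat m
      where
      step : ∀ c y → (1ℤ + c) * y ≡ y + c * y
      step = solve-∀
      nat : ∀ m → fun (λ j → + m * x j) ≡ + m * fun x
      nat zero    = fun-0
      nat (suc m) = trans (cong-≗ λ j → step (+ m) (x j))
        (trans (+-homo x (λ j → + m * x j)) (trans (cong (_+_ (fun x)) (nat m)) (sym (step (+ m) (fun x)))))
    fun-scale (ℤ.-[1+ m ]) x = trans (cong-≗ λ j → sym (ℤ.neg-distribˡ-* (+ suc m) (x j)))
      (trans (fun-neg (λ j → + suc m * x j))
        (trans (cong -_ (fun-scale (+ suc m) x)) (ℤ.neg-distribˡ-* (+ suc m) (fun x))))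

  -- The matrix entries are the values on the unit vectors. Conditions can thus be given as abstract
  -- functionals, without writing their coefficients down.
  linear-matrix : ∀ {n} (L : Linear n) → ∃ λ (a : Vector ℤ n) →
                  ∀ x → Linear.fun L x ≡ sum (λ j → a j * x j)
  linear-matrix {zero} L = (λ ()) , λ x → trans (Linear.cong-≗ L λ ()) (fun-0 L)
  linear-matrix {suc n} L = a , expand
    where
    open Linear L
    e₀ : Vector ℤ (suc n)
    e₀ zero    = 1ℤ
    e₀ (suc _) = 0ℤ
    0∷_ : Vector ℤ n → Vector ℤ (suc n)
    (0∷ x) zero    = 0ℤ
    (0∷ x) (suc j) = x j
    0∷-cong : ∀ {x y} → x ≗ y → (0∷ x) ≗ (0∷ y)
    0∷-cong eq zero    = refl
    0∷-cong eq (suc j) = eq j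
    L′ : Linear n
    L′ = record
      { fun = fun ∘ 0∷_
      ; cong-≗ = cong-≗ ∘ 0∷-cong
      ; +-homo = λ x y → trans (cong-≗ λ { zero → refl ; (suc j) → refl }) (+-homo (0∷ x) (0∷ y)) }
    tail-matrix = linear-matrix L′
    a : Vector ℤ (suc n)
    a zero    = fun e₀
    a (suc j) = proj₁ tail-matrix j
    expand : ∀ x → fun x ≡ sum (λ j → a j * x j)
    expand x = begin
      fun x                                        ≡⟨ cong-≗ (λ { zero → split₀ (x zero) ; (suc j) → split₁ (x zero) (x (suc j)) }) ⟩
      fun (λ j → x zero * e₀ j + (0∷ (x ∘ suc)) j) ≡⟨ +-homo (λ j → x zero * e₀ j) (0∷ (x ∘ suc)) ⟩
      fun (λ j → x zero * e₀ j) + fun (0∷ (x ∘ suc)) ≡⟨ cong₂ _+_ (trans (fun-scale L (x zero) e₀) (ℤ.*-comm (x zero) (fun e₀)))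
                                                         (proj₂ tail-matrix (x ∘ suc)) ⟩
      fun e₀ * x zero + sum (λ j → a (suc j) * x (suc j)) ∎
      where
      open ≡-Reasoning
      split₀ : ∀ x → x ≡ x * 1ℤ + 0ℤ
      split₀ = solve-∀
      split₁ : ∀ x y → y ≡ x * 0ℤ + y
      split₁ = solve-∀

  -- Nonvanishing modulo p is what matters later: the solution becomes a nonzero polynomial over 𝔽ₚ
  -- in `Basis`, and the starting point for the divisions by ζ - 1 in `reduced-solution`.
  primitive-kernel : ∀ p .{{_ : NonTrivial p}} {m n} → m ℕ.< n → (L : Fin m → Linear n) →
                     ∃ λ x → (∀ i → Linear.fun (L i) x ≡ 0ℤ) × ∃ λ j → ¬ + p ∣ x j
  primitive-kernel p {m} {n} m<n L
    = let x , solves , j , x≢0 = nonzero-solution m<n A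
          y , solves′ , prim   = primitive-multiple p A x j x≢0 solves
      in y , (λ i → trans (proj₂ (linear-matrix (L i)) y) (solves′ i)) , prim
    where
    A : Fin m → Fin n → ℤ
    A i = proj₁ (linear-matrix (L i))

-- Modules over ℤ[ζ,π], their rings of operators, and the Frobenius identity

module Mods where

  open import Algebra.Bundles using (AbelianGroup; CommutativeRing)
  import Algebra.Properties.AbelianGroup
  import Algebra.Properties.CommutativeSemigroup
  import Algebra.Properties.CommutativeSemiring.Binomial
  import Algebra.Properties.Semiring.Exp
  import Algebra.Properties.Semiring.Mult
  import Algebra.Solver.Ring.NaturalCoefficients.Default
  open import Data.Fin.Base using (Fin; zero; suc; toℕ; inject₁; fromℕ)
  import Data.Fin.Properties as Fin
  open import Data.Nat.Base as ℕ using (ℕ; zero; suc; NonTrivial; _∸_)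
  open import Data.Nat.Combinatorics using (_C_; nCn≡1; k![n∸k]!∣n!)
  open import Data.Nat.Combinatorics.Specification using (nCk≡n!/k![n-k]!)
  open import Data.Nat.Divisibility using (_∣_; ∣⇒≤; divides; m∣m*n)
  open import Data.Nat.DivMod using (m/n*n≡m)
  open import Data.Nat.Primality using (Prime; euclidsLemma; prime⇒nonTrivial)
  import Data.Nat.Properties as ℕ
  open import Data.Product using (_×_; _,_)
  open import Data.Sum using (inj₁; inj₂)
  open import Function.Base using (_∘_)
  open import Level using (0ℓ)
  open import Relation.Binary.PropositionalEquality as ≡ using (_≡_; _≢_)
  open import Relation.Nullary using (¬_; contradiction)

  -- A module over ℤ[ζ,π]: an abelian group with two commuting endomorphisms.
  record Mod : Set₁ where
    field
      abelianGroup : AbelianGroup 0ℓ 0ℓ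
    open AbelianGroup abelianGroup public
      renaming (_∙_ to infixl 6 _+_; ε to 0#; _⁻¹ to infix 8 -_; ∙-cong to +-cong; ∙-congˡ to +-congˡ; ∙-congʳ to +-congʳ
               ; identityˡ to +-identityˡ; identityʳ to +-identityʳ; inverseʳ to +-inverseʳ; inverseˡ to +-inverseˡ
               ; assoc to +-assoc; comm to +-comm; ⁻¹-cong to -‿cong)
    field
      ζ π    : Carrier → Carrier
      ζ-cong : ∀ {x y} → x ≈ y → ζ x ≈ ζ y
      π-cong : ∀ {x y} → x ≈ y → π x ≈ π y
      ζ-homo : ∀ x y → ζ (x + y) ≈ ζ x + ζ y
      π-homo : ∀ x y → π (x + y) ≈ π x + π y
      ζπ≈πζ  : ∀ x → ζ (π x) ≈ π (ζ x)

  infixl 7 _⊡_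
  infixl 6 _⊞_
  infix  8 ⊟_
  infixr 9 _⇑_

  -- Formal elements of ℤ[ζ,π]. As syntax, one expression acts on several modules, and compatibility
  -- with homomorphisms (`hom-act`) is an induction on the expression.
  data Op : Set where
    𝟎 𝟏 ζ̂ π̂ : Op
    _⊞_ _⊡_ : Op → Op → Op
    ⊟_      : Op → Op

  _⇑_ : Op → ℕ → Op
  a ⇑ zero  = 𝟏
  a ⇑ suc n = a ⊡ a ⇑ n

  num : ℕ → Op
  num zero    = 𝟎
  num (suc n) = 𝟏 ⊞ num n

  module Act (M : Mod) where
    open Mod M public
    open Algebra.Properties.AbelianGroup abelianGroup using (identityʳ-unique; inverseʳ-unique; ⁻¹-∙-comm)

    act : Op → Carrier → Carrier
    act 𝟎       x = 0#
    act 𝟏       x = x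
    act ζ̂       x = ζ x
    act π̂       x = π x
    act (a ⊞ b) x = act a x + act b x
    act (a ⊡ b) x = act a (act b x)
    act (⊟ a)   x = - act a x

    medial : ∀ a b c d → (a + b) + (c + d) ≈ (a + c) + (b + d)
    medial = Algebra.Properties.CommutativeSemigroup.interchange
               (AbelianGroup.commutativeSemigroup abelianGroup)

    additive⇒0 : ∀ (f : Carrier → Carrier) → (∀ {x y} → x ≈ y → f x ≈ f y) →
                 (∀ x y → f (x + y) ≈ f x + f y) → f 0# ≈ 0#
    additive⇒0 f f-cong f-homo =
      identityʳ-unique (f 0#) (f 0#) (trans (sym (f-homo 0# 0#)) (f-cong (+-identityˡ 0#)))

    additive⇒neg : ∀ (f : Carrier → Carrier) → (∀ {x y} → x ≈ y → f x ≈ f y) →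
                   (∀ x y → f (x + y) ≈ f x + f y) → ∀ x → f (- x) ≈ - f x
    additive⇒neg f f-cong f-homo x = inverseʳ-unique (f x) (f (- x))
      (trans (sym (f-homo x (- x))) (trans (f-cong (+-inverseʳ x)) (additive⇒0 f f-cong f-homo)))

    act-cong : ∀ a {x y} → x ≈ y → act a x ≈ act a y
    act-cong 𝟎       eq = refl
    act-cong 𝟏       eq = eq
    act-cong ζ̂       eq = ζ-cong eq
    act-cong π̂       eq = π-cong eq
    act-cong (a ⊞ b) eq = +-cong (act-cong a eq) (act-cong b eq)
    act-cong (a ⊡ b) eq = act-cong a (act-cong b eq)
    act-cong (⊟ a)   eq = -‿cong (act-cong a eq)

    act-+ : ∀ a x y → act a (x + y) ≈ act a x + act a y
    act-+ 𝟎       x y = sym (+-identityˡ 0#)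
    act-+ 𝟏       x y = refl
    act-+ ζ̂       x y = ζ-homo x y
    act-+ π̂       x y = π-homo x y
    act-+ (a ⊞ b) x y = trans (+-cong (act-+ a x y) (act-+ b x y)) (medial _ _ _ _)
    act-+ (a ⊡ b) x y = trans (act-cong a (act-+ b x y)) (act-+ a (act b x) (act b y))
    act-+ (⊟ a)   x y = trans (-‿cong (act-+ a x y)) (sym (⁻¹-∙-comm _ _))

    act-0 : ∀ a → act a 0# ≈ 0#
    act-0 a = additive⇒0 (act a) (act-cong a) (act-+ a)

    act-neg : ∀ a x → act a (- x) ≈ - act a x
    act-neg a = additive⇒neg (act a) (act-cong a) (act-+ a)

    private
      -- The generators suffice. Used with f = ζ and f = π, and then with f an arbitrary operator,
      -- this gives `act-comm`.
      commutes-with : (f : Carrier → Carrier) → (∀ {x y} → x ≈ y → f x ≈ f y) →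
        (∀ x y → f (x + y) ≈ f x + f y) → (∀ x → f (ζ x) ≈ ζ (f x)) → (∀ x → f (π x) ≈ π (f x)) →
        ∀ a x → f (act a x) ≈ act a (f x)
      commutes-with f f-cong f-homo fζ fπ = go
        where
        go : ∀ a x → f (act a x) ≈ act a (f x)
        go 𝟎       x = additive⇒0 f f-cong f-homo
        go 𝟏       x = refl
        go ζ̂       x = fζ x
        go π̂       x = fπ x
        go (a ⊞ b) x = trans (f-homo _ _) (+-cong (go a x) (go b x))
        go (a ⊡ b) x = trans (go a (act b x)) (act-cong a (go b x))
        go (⊟ a)   x = trans (additive⇒neg f f-cong f-homo _) (-‿cong (go a x))

    act-comm : ∀ a b x → act a (act b x) ≈ act b (act a x)
    act-comm a = commutes-with (act a) (act-cong a) (act-+ a)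
      (λ x → sym (commutes-with ζ ζ-cong ζ-homo (λ _ → refl) ζπ≈πζ a x))
      (λ x → sym (commutes-with π π-cong π-homo (λ x → sym (ζπ≈πζ x)) (λ _ → refl) a x))

    infix 4 _≋_
    -- Equality of operators is relative to the module: on `series p` one has `ζ̂ ≋ 𝟏`, while on
    -- `polynomials` the relation is `ζ̂ ⇑ N ≋ 𝟏`.
    record _≋_ (a b : Op) : Set where
      constructor mk≋
      field on : ∀ x → act a x ≈ act b x
    open _≋_ public

    opRing : CommutativeRing 0ℓ 0ℓ
    opRing = record
      { Carrier = Op ; _≈_ = _≋_ ; _+_ = _⊞_ ; _*_ = _⊡_ ; -_ = ⊟_ ; 0# = 𝟎 ; 1# = 𝟏
      ; isCommutativeRing = record
        { isRing = record
          { +-isAbelianGroup = record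
            { isGroup = record
              { isMonoid = record
                { isSemigroup = record
                  { isMagma = record
                    { isEquivalence = record
                      { refl  = mk≋ λ _ → refl
                      ; sym   = λ e → mk≋ λ x → sym (on e x)
                      ; trans = λ e f → mk≋ λ x → trans (on e x) (on f x) }
                    ; ∙-cong = λ e f → mk≋ λ x → +-cong (on e x) (on f x) }
                  ; assoc = λ a b c → mk≋ λ x → +-assoc _ _ _ }
                ; identity = (λ a → mk≋ λ x → +-identityˡ _) , (λ a → mk≋ λ x → +-identityʳ _) }
              ; inverse = (λ a → mk≋ λ x → +-inverseˡ _) , (λ a → mk≋ λ x → +-inverseʳ _)
              ; ⁻¹-cong = λ e → mk≋ λ x → -‿cong (on e x) }
            ; comm = λ a b → mk≋ λ x → +-comm _ _ }
          ; *-cong = λ {a} {b} {c} {d} e f → mk≋ λ x → trans (on e _) (act-cong b (on f x))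
          ; *-assoc = λ a b c → mk≋ λ x → refl
          ; *-identity = (λ a → mk≋ λ x → refl) , (λ a → mk≋ λ x → refl)
          ; distrib = (λ a b c → mk≋ λ x → act-+ a _ _) , (λ a b c → mk≋ λ x → refl) }
        ; *-comm = λ a b → mk≋ λ x → act-comm a b x } }

    module R = CommutativeRing opRing
    module Solve = Algebra.Solver.Ring.NaturalCoefficients.Default R.commutativeSemiring
    module ≋-Reasoning where
      open import Relation.Binary.Reasoning.Setoid R.setoid public

    ⇑-cong : ∀ {a b} n → a ≋ b → a ⇑ n ≋ b ⇑ n
    ⇑-cong zero    eq = R.refl
    ⇑-cong (suc n) eq = R.*-cong eq (⇑-cong n eq)

    ⇑-+ : ∀ a m n → a ⇑ (m ℕ.+ n) ≋ a ⇑ m ⊡ a ⇑ n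
    ⇑-+ a zero    n = R.sym (R.*-identityˡ _)
    ⇑-+ a (suc m) n = R.trans (R.*-congˡ {a} (⇑-+ a m n)) (R.sym (R.*-assoc a (a ⇑ m) (a ⇑ n)))

    𝟏⇑ : ∀ n → 𝟏 ⇑ n ≋ 𝟏
    𝟏⇑ zero    = R.refl
    𝟏⇑ (suc n) = R.trans (R.*-identityˡ (𝟏 ⇑ n)) (𝟏⇑ n)

    ⊡-⇑ : ∀ a b n → (a ⊡ b) ⇑ n ≋ a ⇑ n ⊡ b ⇑ n
    ⊡-⇑ a b zero    = R.sym (R.*-identityˡ _)
    ⊡-⇑ a b (suc n) = R.trans (R.*-congˡ {a ⊡ b} (⊡-⇑ a b n))
      (solve 4 (λ a b x y → (a :* b) :* (x :* y) := (a :* x) :* (b :* y)) R.refl a b (a ⇑ n) (b ⇑ n))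
      where open Solve

    ⇑-* : ∀ a m n → a ⇑ (m ℕ.* n) ≋ (a ⇑ n) ⇑ m
    ⇑-* a zero    n = R.refl
    ⇑-* a (suc m) n = R.trans (⇑-+ a n (m ℕ.* n)) (R.*-congˡ {a ⇑ n} (⇑-* a m n))

    private
      module E = Algebra.Properties.Semiring.Exp R.semiring
      module Mul = Algebra.Properties.Semiring.Mult R.semiring
      module Bin = Algebra.Properties.CommutativeSemiring.Binomial R.commutativeSemiring
      open import Algebra.Properties.CommutativeMonoid.Sum R.+-commutativeMonoid
        using (sum; sum-init-last; sum-replicate-zero; sum-cong-≋)

      ⇑≋^ : ∀ a n → a ⇑ n ≋ a E.^ n
      ⇑≋^ a zero    = R.refl
      ⇑≋^ a (suc n) = R.*-congˡ {a} (⇑≋^ a n)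

      prime∤! : ∀ {p} → Prime p → ∀ k → k ℕ.< p → ¬ p ∣ (k ℕ.!)
      prime∤! {p} pr zero    _   p∣1 = ℕ.<⇒≱ (ℕ.nonTrivial⇒n>1 p {{prime⇒nonTrivial pr}}) (∣⇒≤ p∣1)
      prime∤! {p} pr (suc k) k<p p∣! with euclidsLemma (suc k) (k ℕ.!) pr p∣!
      ... | inj₁ p∣k  = ℕ.<⇒≱ k<p (∣⇒≤ p∣k)
      ... | inj₂ p∣k! = prime∤! pr k (ℕ.<-trans (ℕ.n<1+n k) k<p) p∣k!

      prime∣C : ∀ {p} → Prime p → ∀ k → 0 ℕ.< k → k ℕ.< p → p ∣ p C k
      prime∣C {p@(suc p-1)} pr k 0<k k<p
        with euclidsLemma (p C k) (k ℕ.! ℕ.* (p ∸ k) ℕ.!) pr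
               (≡.subst (p ∣_) (≡.sym expand) (m∣m*n (p-1 ℕ.!)))
        where
        instance
          _ : ℕ.NonZero (k ℕ.! ℕ.* (p ∸ k) ℕ.!)
          _ = k ℕ.!* (p ∸ k) !≢0
        expand : (p C k) ℕ.* (k ℕ.! ℕ.* (p ∸ k) ℕ.!) ≡ p ℕ.!
        expand = ≡.trans (≡.cong (ℕ._* (k ℕ.! ℕ.* (p ∸ k) ℕ.!)) (nCk≡n!/k![n-k]! (ℕ.<⇒≤ k<p)))
                         (m/n*n≡m (k![n∸k]!∣n! (ℕ.<⇒≤ k<p)))
      ... | inj₁ p∣C = p∣C
      ... | inj₂ p∣!! with euclidsLemma (k ℕ.!) ((p ∸ k) ℕ.!) pr p∣!!
      ...   | inj₁ p∣k! = contradiction p∣k! (prime∤! pr k k<p)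
      ...   | inj₂ p∣k! = contradiction p∣k! (prime∤! pr (p ∸ k) (ℕ.∸-monoʳ-< 0<k (ℕ.<⇒≤ k<p)))

      ×≋num : ∀ n a → n Mul.× a ≋ num n ⊡ a
      ×≋num zero    a = R.sym (R.zeroˡ a)
      ×≋num (suc n) a = R.trans (R.+-cong (R.sym (R.*-identityˡ a)) (×≋num n a)) (R.sym (R.distribʳ a 𝟏 (num n)))

    num-+ : ∀ m n → num (m ℕ.+ n) ≋ num m ⊞ num n
    num-+ zero    n = R.sym (R.+-identityˡ (num n))
    num-+ (suc m) n = R.trans (R.+-congˡ {𝟏} (num-+ m n)) (R.sym (R.+-assoc 𝟏 (num m) (num n)))

    num-* : ∀ m n → num (m ℕ.* n) ≋ num m ⊡ num n
    num-* zero    n = R.sym (R.zeroˡ (num n))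
    num-* (suc m) n = R.trans (num-+ n (m ℕ.* n))
      (R.trans (R.+-cong (R.sym (R.*-identityˡ (num n))) (num-* m n)) (R.sym (R.distribʳ (num n) 𝟏 (num m))))

    module _ {p} (pr : Prime p) (char : num p ≋ 𝟎) where

      private
        multiple : ∀ {n} a → p ∣ n → n Mul.× a ≋ 𝟎
        multiple a (divides q ≡.refl) = begin
          (q ℕ.* p) Mul.× a    ≈⟨ ×≋num (q ℕ.* p) a ⟩
          num (q ℕ.* p) ⊡ a    ≈⟨ R.*-congʳ {a} (num-* q p) ⟩
          (num q ⊡ num p) ⊡ a  ≈⟨ R.*-congʳ {a} (R.trans (R.*-congˡ {num q} char) (R.zeroʳ (num q))) ⟩
          𝟎 ⊡ a                ≈⟨ R.zeroˡ a ⟩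
          𝟎                    ∎
          where open ≋-Reasoning

      frobenius : ∀ a b → (a ⊞ b) ⇑ p ≋ a ⇑ p ⊞ b ⇑ p
      frobenius a b = go p ≡.refl
        where
        open ≋-Reasoning
        go : ∀ n → n ≡ p → (a ⊞ b) ⇑ n ≋ a ⇑ n ⊞ b ⇑ n
        go zero    eq = contradiction (≡.subst NonTrivial (≡.sym eq) (prime⇒nonTrivial pr)) λ ()
        go n@(suc m) eq = begin
          (a ⊞ b) ⇑ n       ≈⟨ ⇑≋^ (a ⊞ b) n ⟩
          (a ⊞ b) E.^ n     ≈⟨ Bin.theorem n a b ⟩
          Bin.binomialTerm a b n zero ⊞ sum (Bin.binomialTerm a b n ∘ suc)
            ≈⟨ R.+-cong first (sum-init-last (Bin.binomialTerm a b n ∘ suc)) ⟩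
          b ⇑ n ⊞ (sum (Bin.binomialTerm a b n ∘ suc ∘ inject₁) ⊞ Bin.binomialTerm a b n (fromℕ n))
            ≈⟨ R.+-congˡ {b ⇑ n} (R.+-cong (R.trans (sum-cong-≋ middle) (sum-replicate-zero m)) last) ⟩
          b ⇑ n ⊞ (𝟎 ⊞ a ⇑ n) ≈⟨ R.+-congˡ {b ⇑ n} (R.+-identityˡ (a ⇑ n)) ⟩
          b ⇑ n ⊞ a ⇑ n     ≈⟨ R.+-comm (b ⇑ n) (a ⇑ n) ⟩
          a ⇑ n ⊞ b ⇑ n     ∎
          where
          first : Bin.binomialTerm a b n zero ≋ b ⇑ n
          first = R.trans (R.+-identityʳ _) (R.trans (R.*-identityˡ _) (R.sym (⇑≋^ b n)))
          last : Bin.binomialTerm a b n (fromℕ n) ≋ a ⇑ n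
          last rewrite Fin.toℕ-fromℕ m | nCn≡1 n | ℕ.n∸n≡0 m =
            R.trans (R.+-identityʳ _) (R.trans (R.*-identityʳ _) (R.sym (⇑≋^ a n)))
          middle : ∀ i → Bin.binomialTerm a b n (suc (inject₁ i)) ≋ 𝟎
          middle i rewrite Fin.toℕ-inject₁ i =
            multiple _ (≡.subst (λ x → p ∣ x C suc (toℕ i)) (≡.sym eq)
              (prime∣C pr (suc (toℕ i)) (ℕ.s≤s ℕ.z≤n) (≡.subst (suc (toℕ i) ℕ.<_) eq (ℕ.s≤s (Fin.toℕ<n i)))))

      𝟏⊞-frobenius : ∀ a → (𝟏 ⊞ a) ⇑ p ≋ 𝟏 ⊞ a ⇑ p
      𝟏⊞-frobenius a = R.trans (frobenius 𝟏 a) (R.+-congʳ {a ⇑ p} (𝟏⇑ p))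

      𝟏⊞-frobenius^ : ∀ k a → (𝟏 ⊞ a) ⇑ (p ℕ.^ k) ≋ 𝟏 ⊞ a ⇑ (p ℕ.^ k)
      𝟏⊞-frobenius^ zero    a = R.trans (R.*-identityʳ _) (R.+-congˡ {𝟏} (R.sym (R.*-identityʳ _)))
      𝟏⊞-frobenius^ (suc k) a = begin
        (𝟏 ⊞ a) ⇑ (p ℕ.* p ℕ.^ k)    ≈⟨ ⇑-* (𝟏 ⊞ a) p (p ℕ.^ k) ⟩
        ((𝟏 ⊞ a) ⇑ (p ℕ.^ k)) ⇑ p    ≈⟨ ⇑-cong p (𝟏⊞-frobenius^ k a) ⟩
        (𝟏 ⊞ a ⇑ (p ℕ.^ k)) ⇑ p      ≈⟨ 𝟏⊞-frobenius (a ⇑ (p ℕ.^ k)) ⟩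
        𝟏 ⊞ (a ⇑ (p ℕ.^ k)) ⇑ p      ≈⟨ R.+-congˡ {𝟏} (⇑-* a p (p ℕ.^ k)) ⟨
        𝟏 ⊞ a ⇑ (p ℕ.* p ℕ.^ k)      ∎
        where open ≋-Reasoning

  record Hom (M N : Mod) : Set where
    private module M = Mod M
    private module N = Mod N
    field
      map    : M.Carrier → N.Carrier
      cong   : ∀ {x y} → x M.≈ y → map x N.≈ map y
      homo   : ∀ x y → map (x M.+ y) N.≈ map x N.+ map y
      ζ-homo : ∀ x → map (M.ζ x) N.≈ N.ζ (map x)
      π-homo : ∀ x → map (M.π x) N.≈ N.π (map x)

  module _ {M N : Mod} (h : Hom M N) where
    private
      module M = Act M
      module N = Act N
      open Hom h
      module PN = Algebra.Properties.AbelianGroup N.abelianGroup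

    hom-0 : map M.0# N.≈ N.0#
    hom-0 = PN.identityʳ-unique (map M.0#) (map M.0#)
              (N.trans (N.sym (homo M.0# M.0#)) (cong (M.+-identityˡ M.0#)))

    hom-neg : ∀ x → map (M.- x) N.≈ N.- map x
    hom-neg x = PN.inverseʳ-unique (map x) (map (M.- x))
      (N.trans (N.sym (homo x (M.- x))) (N.trans (cong (M.+-inverseʳ x)) hom-0))

    hom-act : ∀ a x → map (M.act a x) N.≈ N.act a (map x)
    hom-act 𝟎       x = hom-0
    hom-act 𝟏       x = N.refl
    hom-act ζ̂       x = ζ-homo x
    hom-act π̂       x = π-homo x
    hom-act (a ⊞ b) x = N.trans (homo _ _) (N.+-cong (hom-act a x) (hom-act b x))
    hom-act (a ⊡ b) x = N.trans (hom-act a (M.act b x)) (N.act-cong a (hom-act b x))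
    hom-act (⊟ a)   x = N.trans (hom-neg (M.act a x)) (N.-‿cong (hom-act a x))

-- Weighted sums of p-adic valuations and the cost of interpolation

module Weights where

  open import Data.List.Base using (List; []; _∷_; replicate)
  open import Data.Nat.Base
  open import Data.Nat.DivMod
  open import Data.Nat.Divisibility using (divides-refl)
  open import Data.Nat.Properties
  open import Data.Nat.Tactic.RingSolver using (solve-∀)
  open import Data.Product using (_×_; _,_; proj₁; proj₂)
  open import Data.Sum using (_⊎_; inj₁; inj₂)
  open import Relation.Binary.PropositionalEquality
  open import Relation.Nullary using (yes; no; contradiction)

  module _ (p : ℕ) .{{_ : NonZero p}} where

    divMod-unique : ∀ r q → r < p → (r + q * p) % p ≡ r × (r + q * p) / p ≡ q
    divMod-unique r q r<p = trans ([m+kn]%n≡m%n r q p) (m<n⇒m%n≡m r<p) ,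
      (begin
        (r + q * p) / p     ≡⟨ +-distrib-/-∣ʳ r (divides-refl q) ⟩
        r / p + q * p / p   ≡⟨ cong₂ _+_ (m<n⇒m/n≡0 r<p) (m*n/n≡m q p) ⟩
        q                   ∎)
      where open ≡-Reasoning

    suc-divMod : ∀ n → (suc (n % p) < p × suc n / p ≡ n / p × suc n % p ≡ suc (n % p))
                     ⊎ (suc n / p ≡ suc (n / p) × suc n % p ≡ 0)
    suc-divMod n with suc (n % p) <? p
    ... | yes <p = inj₁ (<p , trans (cong (_/ p) eq) (proj₂ (divMod-unique (suc (n % p)) (n / p) <p))
                            , trans (cong (_% p) eq) (proj₁ (divMod-unique (suc (n % p)) (n / p) <p)))
      where
      eq : suc n ≡ suc (n % p) + n / p * p
      eq = cong suc (m≡m%n+[m/n]*n n p)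
    ... | no ≮p = inj₂ (trans (cong (_/ p) eq) (proj₂ (divMod-unique 0 (suc (n / p)) (>-nonZero⁻¹ p)))
                       , trans (cong (_% p) eq) (proj₁ (divMod-unique 0 (suc (n / p)) (>-nonZero⁻¹ p))))
      where
      eq : suc n ≡ suc (n / p) * p
      eq = trans (cong suc (m≡m%n+[m/n]*n n p))
             (cong (_+ n / p * p) (≤-antisym (m%n<n n p) (≮⇒≥ ≮p)))

    private
      when₀ : ℕ → ℕ → ℕ
      when₀ zero    x = x
      when₀ (suc _) x = 0

    -- Σ over those s for which pˢ divides n of the s-th entry of the list.
    order deeper : List ℕ → ℕ → ℕ
    order []       n = 0
    order (w ∷ ws) n = w + deeper ws n
    deeper ws n = when₀ (n % p) (order ws (n / p))

    deeper-∣ : ∀ ws q → deeper ws (q * p) ≡ order ws q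
    deeper-∣ ws q = cong₂ (λ r q → when₀ r (order ws q)) (m*n%n≡0 q p) (m*n/n≡m q p)

    deeper-∤ : ∀ ws n → n % p ≢ 0 → deeper ws n ≡ 0
    deeper-∤ ws n ≢0 with n % p
    ... | zero  = contradiction refl ≢0
    ... | suc _ = refl

    orderSum : List ℕ → ℕ → ℕ
    orderSum ws zero    = 0
    orderSum ws (suc n) = orderSum ws n + order ws (suc n)

    orderSum-[] : ∀ n → orderSum [] n ≡ 0
    orderSum-[] zero    = refl
    orderSum-[] (suc n) = trans (+-identityʳ _) (orderSum-[] n)

    -- As in Legendre's formula: each of 1, ..., n contributes w, and the deeper entries are seen
    -- only by the multiples qp with q ≤ ⌊n/p⌋, where they contribute the order of q.
    orderSum-∷ : ∀ w ws n → orderSum (w ∷ ws) n ≡ w * n + orderSum ws (n / p)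
    orderSum-∷ w ws zero = sym (cong₂ _+_ (*-zeroʳ w) (cong (orderSum ws) (0/n≡0 p)))
    orderSum-∷ w ws (suc n) rewrite orderSum-∷ w ws n with suc-divMod n
    ... | inj₁ (_ , eq/ , eq%) rewrite eq/ | eq% = lemma w n (orderSum ws (n / p))
      where
      lemma : ∀ w n s → w * n + s + (w + 0) ≡ w * suc n + s
      lemma = solve-∀
    ... | inj₂ (eq/ , eq%) rewrite eq/ | eq% = lemma w n (orderSum ws (n / p)) (order ws (suc (n / p)))
      where
      lemma : ∀ w n s o → w * n + s + (w + o) ≡ w * suc n + (s + o)
      lemma = solve-∀

    orderSum-mono : ∀ ws {m n} → m ≤ n → orderSum ws m ≤ orderSum ws n
    orderSum-mono ws {m} {n} m≤n with ≤⇒≤′ m≤n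
    ... | ≤′-refl = ≤-refl
    ... | ≤′-step {n} m≤′n = ≤-trans (orderSum-mono ws (≤′⇒≤ m≤′n)) (m≤m+n _ _)

    /-superadditive : ∀ a b → a / p + b / p ≤ (a + b) / p
    /-superadditive a b = begin
      a / p + b / p                                     ≡⟨ m*n/n≡m (a / p + b / p) p ⟨
      (a / p + b / p) * p / p                           ≤⟨ /-monoˡ-≤ p (begin
        (a / p + b / p) * p      ≡⟨ *-distribʳ-+ p (a / p) (b / p) ⟩
        a / p * p + b / p * p    ≤⟨ +-mono-≤ (m/n*n≤m a p) (m/n*n≤m b p) ⟩
        a + b ∎) ⟩
      (a + b) / p ∎
      where open ≤-Reasoning

    -- Each entry of the list is a nonnegative weight on some ⌊n/pˢ⌋, and these floors are
    -- superadditive.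
    orderSum-superadditive : ∀ ws a b → orderSum ws a + orderSum ws b ≤ orderSum ws (a + b)
    orderSum-superadditive [] a b rewrite orderSum-[] a | orderSum-[] b = z≤n
    orderSum-superadditive (w ∷ ws) a b
      rewrite orderSum-∷ w ws a | orderSum-∷ w ws b | orderSum-∷ w ws (a + b) = begin
        w * a + A + (w * b + B)             ≡⟨ lemma w a b A B ⟩
        w * (a + b) + (A + B)               ≤⟨ +-monoʳ-≤ (w * (a + b)) (orderSum-superadditive ws (a / p) (b / p)) ⟩
        w * (a + b) + orderSum ws (a / p + b / p) ≤⟨ +-monoʳ-≤ (w * (a + b)) (orderSum-mono ws (/-superadditive a b)) ⟩
        w * (a + b) + orderSum ws ((a + b) / p) ∎
      where
      open ≤-Reasoning
      A = orderSum ws (a / p)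
      B = orderSum ws (b / p)
      lemma : ∀ w a b A B → w * a + A + (w * b + B) ≡ w * (a + b) + (A + B)
      lemma = solve-∀

    -- The sum of the orders of i + 1, ..., i + r, that is, of the differences between node r + i
    -- and the nodes 0, ..., r - 1: the power of π lost at node r + i after r divisions.
    window : List ℕ → ℕ → ℕ → ℕ
    window ws zero    i = 0
    window ws (suc r) i = order ws (suc i) + window ws r (suc i)

    window+orderSum : ∀ ws r i → window ws r i + orderSum ws i ≡ orderSum ws (r + i)
    window+orderSum ws zero    i = refl
    window+orderSum ws (suc r) i = begin
      order ws (suc i) + window ws r (suc i) + orderSum ws i   ≡⟨ lemma (order ws (suc i)) (window ws r (suc i)) (orderSum ws i) ⟩
      window ws r (suc i) + orderSum ws (suc i)                ≡⟨ window+orderSum ws r (suc i) ⟩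
      orderSum ws (r + suc i)                                  ≡⟨ cong (orderSum ws) (+-suc r i) ⟩
      orderSum ws (suc r + i)                                  ∎
      where
      open ≡-Reasoning
      lemma : ∀ a b c → a + b + c ≡ b + (c + a)
      lemma = solve-∀

    window-initial : ∀ ws r → window ws r 0 ≡ orderSum ws r
    window-initial ws r = trans (sym (+-identityʳ _))
      (trans (window+orderSum ws r 0) (cong (orderSum ws) (+-identityʳ r)))

    -- Lets the condition at node r be used at every later node: it carries the smallest power of π,
    -- and further factors π are harmless.
    window-min : ∀ ws r i → window ws r 0 ≤ window ws r i
    window-min ws r i = +-cancelʳ-≤ (orderSum ws i) _ _ (begin
      window ws r 0 + orderSum ws i   ≡⟨ cong (_+ orderSum ws i) (window-initial ws r) ⟩
      orderSum ws r + orderSum ws i   ≤⟨ orderSum-superadditive ws r i ⟩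
      orderSum ws (r + i)             ≡⟨ window+orderSum ws r i ⟨
      window ws r i + orderSum ws i   ∎)
      where open ≤-Reasoning

    -- Successive increments of r, rp, …, rpᵉ, rpᵉ + 1, rpᵉ + 2, …
    increments : ℕ → ℕ → ℕ → List ℕ
    increments F zero    r = replicate F 1
    increments F (suc e) r = (r * p ∸ r) ∷ increments F e (r * p)

    module _ (1<p : 1 < p) (F : ℕ) where
      open ≤-Reasoning

      half : ∀ m → 2 * (m / p) ≤ m
      half m = begin
        2 * (m / p)   ≤⟨ *-monoˡ-≤ (m / p) 1<p ⟩
        p * (m / p)   ≡⟨ *-comm p (m / p) ⟩
        m / p * p     ≤⟨ m/n*n≤m m p ⟩
        m             ∎

      orderSum-ones : ∀ F m → orderSum (replicate F 1) m ≤ 2 * m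
      orderSum-ones zero    m rewrite orderSum-[] m = z≤n
      orderSum-ones (suc F) m rewrite orderSum-∷ 1 (replicate F 1) m = begin
        1 * m + orderSum (replicate F 1) (m / p)  ≤⟨ +-monoʳ-≤ (1 * m) (orderSum-ones F (m / p)) ⟩
        1 * m + 2 * (m / p)                       ≤⟨ +-monoʳ-≤ (1 * m) (half m) ⟩
        1 * m + m                                 ≡⟨ lemma m ⟩
        2 * m                                     ∎
        where
        lemma : ∀ m → 1 * m + m ≡ 2 * m
        lemma = solve-∀

      -- Each level adds (rp - r) m ≤ rp m, and passing from r, m to rp, ⌊m/p⌋ does not increase rp
      -- m. In the last level the subtracted r m pays for the trailing ones, whose total is at most
      -- 2⌊m/p⌋ ≤ m.
      orderSum-increments : ∀ e r → 1 ≤ r → ∀ m → orderSum (increments F (suc e) r) m ≤ suc e * (r * p) * m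
      orderSum-increments zero r 1≤r m
        rewrite orderSum-∷ (r * p ∸ r) (replicate F 1) m = begin
          (r * p ∸ r) * m + orderSum (replicate F 1) (m / p) ≤⟨ +-monoʳ-≤ ((r * p ∸ r) * m) (orderSum-ones F (m / p)) ⟩
          (r * p ∸ r) * m + 2 * (m / p)     ≤⟨ +-monoʳ-≤ ((r * p ∸ r) * m) (half m) ⟩
          (r * p ∸ r) * m + m               ≤⟨ +-monoʳ-≤ ((r * p ∸ r) * m) (m≤n*m m r {{>-nonZero 1≤r}}) ⟩
          (r * p ∸ r) * m + r * m           ≡⟨ *-distribʳ-+ m (r * p ∸ r) r ⟨
          (r * p ∸ r + r) * m               ≡⟨ cong (_* m) (m∸n+n≡m (m≤m*n r p)) ⟩
          r * p * m                         ≡⟨ cong (_* m) (*-identityˡ (r * p)) ⟨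
          1 * (r * p) * m                   ∎
      orderSum-increments (suc e) r 1≤r m
        rewrite orderSum-∷ (r * p ∸ r) (increments F (suc e) (r * p)) m = begin
          (r * p ∸ r) * m + orderSum (increments F (suc e) (r * p)) (m / p)
            ≤⟨ +-mono-≤ (*-monoˡ-≤ m (m∸n≤m (r * p) r))
                 (orderSum-increments e (r * p) (≤-trans 1≤r (m≤m*n r p)) (m / p)) ⟩
          r * p * m + suc e * (r * p * p) * (m / p)     ≡⟨ lemma₁ (r * p * m) (suc e) (r * p) p (m / p) ⟩
          r * p * m + suc e * (r * p) * (m / p * p)     ≤⟨ +-monoʳ-≤ (r * p * m) (*-monoʳ-≤ (suc e * (r * p)) (m/n*n≤m m p)) ⟩
          r * p * m + suc e * (r * p) * m               ≡⟨ lemma₂ (r * p) m (suc e) ⟩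
          suc (suc e) * (r * p) * m                     ∎
        where
        lemma₁ : ∀ x e r p q → x + e * (r * p) * q ≡ x + e * r * (q * p)
        lemma₁ = solve-∀
        lemma₂ : ∀ r m e → r * m + e * r * m ≡ (1 + e) * r * m
        lemma₂ = solve-∀

      -- The origin of the factor e + 1: the entry 1 costs n, and each of the e geometric levels
      -- costs at most n more. For e = 0 no level would absorb the trailing ones, hence e ≥ 1.
      orderSum-bound : ∀ e .{{_ : NonZero e}} n → orderSum (1 ∷ increments F e 1) n ≤ suc e * n
      orderSum-bound (suc e) n rewrite orderSum-∷ 1 (increments F (suc e) 1) n = begin
        1 * n + orderSum (increments F (suc e) 1) (n / p)  ≤⟨ +-monoʳ-≤ (1 * n) (orderSum-increments e 1 ≤-refl (n / p)) ⟩
        1 * n + suc e * (1 * p) * (n / p)                  ≡⟨ lemma₁ (1 * n) (suc e) p (n / p) ⟩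
        1 * n + suc e * (n / p * p)                        ≤⟨ +-monoʳ-≤ (1 * n) (*-monoʳ-≤ (suc e) (m/n*n≤m n p)) ⟩
        1 * n + suc e * n                                  ≡⟨ lemma₂ n (suc e) ⟩
        suc (suc e) * n                                    ∎
        where
        lemma₁ : ∀ x e p q → x + e * (1 * p) * q ≡ x + e * (q * p)
        lemma₁ = solve-∀
        lemma₂ : ∀ n e → 1 * n + e * n ≡ (1 + e) * n
        lemma₂ = solve-∀

-- Orders of vanishing in 𝔽ₚ[[π]] and divided differences

module Newton where

  open Mods
  open Weights
  open import Algebra.Bundles using (AbelianGroup)
  open import Data.Integer.Base as ℤ using (ℤ; +_; 0ℤ; 1ℤ; ∣_∣)
  open import Data.Integer.Divisibility.Signed
  import Data.Integer.Properties as ℤ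
  import Data.Integer.Tactic.RingSolver as ℤSolver
  open import Data.Nat.Base as ℕ using (ℕ; zero; suc; NonZero; _≤_; _<_; z≤n; s≤s; _∸_)
  import Data.Nat.DivMod as ℕ
  import Data.Nat.Divisibility as ℕ∣
  open import Data.Nat.Induction using (<-rec)
  open import Data.Nat.Primality using (Prime; euclidsLemma; prime⇒nonTrivial; prime⇒nonZero)
  import Data.Nat.Properties as ℕ
  open import Data.Product using (∃; _×_; _,_)
  open import Data.Sum using (_⊎_; inj₁; inj₂)
  open import Function.Base using (_∘_)
  open import Level using (0ℓ)
  open import Relation.Binary.PropositionalEquality as ≡ using (_≡_; _≢_)
  open import Relation.Nullary using (¬_; contradiction)

  module _ (p : ℕ) where

    infix 4 _≡ₚ_
    _≡ₚ_ : ℤ → ℤ → Set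
    a ≡ₚ b = + p ∣ a ℤ.- b

    ≡ₚ-reflexive : ∀ {a b} → a ≡ b → a ≡ₚ b
    ≡ₚ-reflexive {a} ≡.refl = divides 0ℤ (ℤ.+-inverseʳ a)

    ≡ₚ-sym : ∀ {a b} → a ≡ₚ b → b ≡ₚ a
    ≡ₚ-sym {a} {b} a≡b = ≡.subst (+ p ∣_) (lemma a b) (∣m⇒∣-m a≡b)
      where
      lemma : ∀ a b → ℤ.- (a ℤ.- b) ≡ b ℤ.- a
      lemma = ℤSolver.solve-∀

    ≡ₚ-trans : ∀ {a b c} → a ≡ₚ b → b ≡ₚ c → a ≡ₚ c
    ≡ₚ-trans {a} {b} {c} a≡b b≡c = ≡.subst (+ p ∣_) (lemma a b c) (∣m∣n⇒∣m+n a≡b b≡c)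
      where
      lemma : ∀ a b c → (a ℤ.- b) ℤ.+ (b ℤ.- c) ≡ a ℤ.- c
      lemma = ℤSolver.solve-∀

    ≡ₚ-+ : ∀ {a b c d} → a ≡ₚ b → c ≡ₚ d → a ℤ.+ c ≡ₚ b ℤ.+ d
    ≡ₚ-+ {a} {b} {c} {d} a≡b c≡d = ≡.subst (+ p ∣_) (lemma a b c d) (∣m∣n⇒∣m+n a≡b c≡d)
      where
      lemma : ∀ a b c d → (a ℤ.- b) ℤ.+ (c ℤ.- d) ≡ (a ℤ.+ c) ℤ.- (b ℤ.+ d)
      lemma = ℤSolver.solve-∀

    ≡ₚ-neg : ∀ {a b} → a ≡ₚ b → ℤ.- a ≡ₚ ℤ.- b
    ≡ₚ-neg {a} {b} a≡b = ≡.subst (+ p ∣_) (lemma a b) (∣m⇒∣-m a≡b)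
      where
      lemma : ∀ a b → ℤ.- (a ℤ.- b) ≡ (ℤ.- a) ℤ.- (ℤ.- b)
      lemma = ℤSolver.solve-∀

    ≡ₚ-∣ : ∀ {a b} → a ≡ₚ b → + p ∣ b → + p ∣ a
    ≡ₚ-∣ {a} {b} a≡b p∣b = ≡.subst (+ p ∣_) (lemma a b) (∣m∣n⇒∣m+n a≡b p∣b)
      where
      lemma : ∀ a b → (a ℤ.- b) ℤ.+ b ≡ a
      lemma = ℤSolver.solve-∀

    infix 4 _≈ˢ_
    record _≈ˢ_ (x y : ℕ → ℤ) : Set where
      constructor mk≈
      field at : ∀ i → x i ≡ₚ y i
    open _≈ˢ_ public

    sequences : AbelianGroup 0ℓ 0ℓ
    sequences = record
      { Carrier = ℕ → ℤ ; _≈_ = _≈ˢ_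
      ; _∙_ = λ x y i → x i ℤ.+ y i ; ε = λ _ → 0ℤ ; _⁻¹ = λ x i → ℤ.- x i
      ; isAbelianGroup = record
        { isGroup = record
          { isMonoid = record
            { isSemigroup = record
              { isMagma = record
                { isEquivalence = record
                  { refl = λ {x} → mk≈ λ i → ≡ₚ-reflexive {x i} ≡.refl
                  ; sym = λ {x} {y} e → mk≈ λ i → ≡ₚ-sym {x i} {y i} (at e i)
                  ; trans = λ {x} {y} {z} e f → mk≈ λ i → ≡ₚ-trans {x i} {y i} {z i} (at e i) (at f i) }
                ; ∙-cong = λ {x} {y} {u} {v} e f → mk≈ λ i → ≡ₚ-+ {x i} {y i} {u i} {v i} (at e i) (at f i) }
              ; assoc = λ x y z → mk≈ λ i → ≡ₚ-reflexive (ℤ.+-assoc (x i) (y i) (z i)) }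
            ; identity = (λ x → mk≈ λ i → ≡ₚ-reflexive (ℤ.+-identityˡ (x i)))
                       , (λ x → mk≈ λ i → ≡ₚ-reflexive (ℤ.+-identityʳ (x i))) }
          ; inverse = (λ x → mk≈ λ i → ≡ₚ-reflexive (ℤ.+-inverseˡ (x i)))
                    , (λ x → mk≈ λ i → ≡ₚ-reflexive (ℤ.+-inverseʳ (x i)))
          ; ⁻¹-cong = λ {x} {y} e → mk≈ λ i → ≡ₚ-neg {x i} {y i} (at e i) }
        ; comm = λ x y → mk≈ λ i → ≡ₚ-reflexive (ℤ.+-comm (x i) (y i)) }
      }

    -- 𝔽ₚ[[π]], with ζ acting trivially.
    series : Mod
    series = record
      { abelianGroup = sequences
      ; ζ = λ x → x
      ; π = shift
      ; ζ-cong = λ e → e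
      ; π-cong = λ e → mk≈ λ { zero → ≡ₚ-reflexive {0ℤ} ≡.refl ; (suc i) → at e i }
      ; ζ-homo = λ x y → mk≈ λ i → ≡ₚ-reflexive {x i ℤ.+ y i} ≡.refl
      ; π-homo = λ x y → mk≈ λ { zero → ≡ₚ-reflexive {0ℤ} ≡.refl ; (suc i) → ≡ₚ-reflexive {x i ℤ.+ y i} ≡.refl }
      ; ζπ≈πζ = λ x → mk≈ λ i → ≡ₚ-reflexive {shift x i} ≡.refl
      }
      where
      shift : (ℕ → ℤ) → ℕ → ℤ
      shift x zero    = 0ℤ
      shift x (suc i) = x i

  module Horner (M : Mod) where
    open Act M

    -- Σ_{j≤d} gʲ cⱼ
    horner : ℕ → (ℕ → Carrier) → Op → Carrier
    horner zero    c g = c 0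
    horner (suc d) c g = c 0 + act g (horner d (c ∘ suc) g)

    -- Synthetic division: the coefficients of (c(x) - c(g)) / (x - g), for c of degree at most d.
    quotient-by : Op → ℕ → (ℕ → Carrier) → ℕ → Carrier
    quotient-by g zero    c i       = 0#
    quotient-by g (suc d) c zero    = horner d (c ∘ suc) g
    quotient-by g (suc d) c (suc i) = quotient-by g d (c ∘ suc) i

    quotient-lead : ∀ g d c → quotient-by g (suc d) c d ≡ c (suc d)
    quotient-lead g zero    c = ≡.refl
    quotient-lead g (suc d) c = quotient-lead g d (c ∘ suc)

    -- Here δ plays the part of x - g. The coefficients are module elements, and Horner's scheme
    -- still applies because the operators acting on them commute.
    horner-quotient : ∀ d c {x g δ} → x ≋ g ⊞ δ →
      horner (suc d) c x ≈ horner (suc d) c g + act δ (horner d (quotient-by g (suc d) c) x)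
    horner-quotient zero    c e = trans (+-congˡ (on e (c 1))) (sym (+-assoc _ _ _))
    horner-quotient (suc d) c {x} {g} {δ} e = begin
      c 0 + act x (horner (suc d) (c ∘ suc) x)         ≈⟨ +-congˡ (act-cong x (horner-quotient d (c ∘ suc) e)) ⟩
      c 0 + act x (A + act δ B)                        ≈⟨ +-congˡ (trans (act-+ x A (act δ B)) (+-cong (on e A) (act-comm x δ B))) ⟩
      c 0 + ((act g A + act δ A) + act δ (act x B))    ≈⟨ +-congˡ (trans (+-assoc _ _ _) (+-congˡ (sym (act-+ δ A (act x B))))) ⟩
      c 0 + (act g A + act δ (A + act x B))            ≈⟨ +-assoc _ _ _ ⟨
      (c 0 + act g A) + act δ (A + act x B)            ∎
      where
      open import Relation.Binary.Reasoning.Setoid setoid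
      A = horner (suc d) (c ∘ suc) g
      B = horner d (quotient-by g (suc d) (c ∘ suc)) x

  module Series {p : ℕ} (pr : Prime p) where
    open Act (series p)
    private
      instance
        p≢0 : NonZero p
        p≢0 = prime⇒nonZero pr
      1<p : 1 < p
      1<p = ℕ.nonTrivial⇒n>1 p {{prime⇒nonTrivial pr}}

    act-num : ∀ n x i → act (num n) x i ≡ + n ℤ.* x i
    act-num zero    x i = ≡.sym (ℤ.*-zeroˡ (x i))
    act-num (suc n) x i = ≡.trans (≡.cong (ℤ._+_ (x i)) (act-num n x i)) (lemma (+ n) (x i))
      where
      lemma : ∀ n x → x ℤ.+ n ℤ.* x ≡ (1ℤ ℤ.+ n) ℤ.* x
      lemma = ℤSolver.solve-∀

    char : num p ≋ 𝟎
    char = mk≋ λ x → mk≈ λ i → ≡.subst (+ p ∣_) (≡.sym (≡.trans (ℤ.+-identityʳ (act (num p) x i)) (act-num p x i)))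
                         (∣m⇒∣m*n (x i) ∣-refl)

    prime-∣ : ∀ a b → + p ∣ a ℤ.* b → (+ p ∣ a) ⊎ (+ p ∣ b)
    prime-∣ a b p∣ab with euclidsLemma ∣ a ∣ ∣ b ∣ pr (≡.subst (p ℕ∣.∣_) (ℤ.abs-* a b) (∣⇒∣ᵤ p∣ab))
    ... | inj₁ p∣a = inj₁ (∣ᵤ⇒∣ p∣a)
    ... | inj₂ p∣b = inj₂ (∣ᵤ⇒∣ p∣b)

    record Vanishes (t : ℕ) (x : Carrier) : Set where
      constructor vanishes
      field below : ∀ i → i < t → + p ∣ x i
    open Vanishes public

    Vanishes-≈ : ∀ {t x y} → x ≈ y → Vanishes t y → Vanishes t x
    Vanishes-≈ {x = x} {y} e v = vanishes λ i i<t → ≡ₚ-∣ p {x i} {y i} (at e i) (below v i i<t)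

    Vanishes-0 : ∀ {t} → Vanishes t 0#
    Vanishes-0 = vanishes λ i _ → divides 0ℤ ≡.refl

    Vanishes-+ : ∀ {t x y} → Vanishes t x → Vanishes t y → Vanishes t (x + y)
    Vanishes-+ u v = vanishes λ i i<t → ∣m∣n⇒∣m+n (below u i i<t) (below v i i<t)

    Vanishes-neg : ∀ {t x} → Vanishes t x → Vanishes t (- x)
    Vanishes-neg u = vanishes λ i i<t → ∣m⇒∣-m (below u i i<t)

    Vanishes-cancel-+ : ∀ {t} x y → Vanishes t (x + y) → Vanishes t x → Vanishes t y
    Vanishes-cancel-+ x y u v = vanishes λ i i<t → ∣m+n∣m⇒∣n (below u i i<t) (below v i i<t)

    Vanishes-≤ : ∀ {s t x} → s ≤ t → Vanishes t x → Vanishes s x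
    Vanishes-≤ s≤t v = vanishes λ i i<s → below v i (ℕ.<-≤-trans i<s s≤t)

    Vanishes-π : ∀ {t x} → Vanishes t x → Vanishes (suc t) (π x)
    Vanishes-π v = vanishes λ { zero _ → divides 0ℤ ≡.refl ; (suc i) (s≤s i<t) → below v i i<t }

    Vanishes-act : ∀ a {t x} → Vanishes t x → Vanishes t (act a x)
    Vanishes-act 𝟎       v = Vanishes-0
    Vanishes-act 𝟏       v = v
    Vanishes-act ζ̂       v = v
    Vanishes-act π̂       v = Vanishes-≤ (ℕ.n≤1+n _) (Vanishes-π v)
    Vanishes-act (a ⊞ b) v = Vanishes-+ (Vanishes-act a v) (Vanishes-act b v)
    Vanishes-act (a ⊡ b) v = Vanishes-act a (Vanishes-act b v)
    Vanishes-act (⊟ a)   v = Vanishes-neg (Vanishes-act a v)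

    Vanishes-π⇑ : ∀ r {t x} → Vanishes t x → Vanishes (r ℕ.+ t) (act (π̂ ⇑ r) x)
    Vanishes-π⇑ zero    v = v
    Vanishes-π⇑ (suc r) v = Vanishes-π (Vanishes-π⇑ r v)

    Vanishes-cancel-π⇑ : ∀ r {t} x → Vanishes t (act (π̂ ⇑ r) x) → Vanishes (t ∸ r) x
    Vanishes-cancel-π⇑ zero            x v = v
    Vanishes-cancel-π⇑ (suc r) {zero}  x v = vanishes λ _ ()
    Vanishes-cancel-π⇑ (suc r) {suc t} x v =
      Vanishes-cancel-π⇑ r x (vanishes λ i i<t → below v (suc i) (s≤s i<t))

    -- Invertibility in 𝔽ₚ[[π]] in the form in which it is used: multiplication by u does not raise
    -- the order of vanishing.
    Unit : Op → Set
    Unit u = ∀ t x → Vanishes t (act u x) → Vanishes t x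

    Unit-≋ : ∀ {u v} → u ≋ v → Unit v → Unit u
    Unit-≋ e unit t x van = unit t x (Vanishes-≈ (sym (on e x)) van)

    Unit-⊡ : ∀ {u v} → Unit u → Unit v → Unit (u ⊡ v)
    Unit-⊡ {v = v} unit-u unit-v t x van = unit-v t x (unit-u t (act v x) van)

    -- The constant term a - b is prime to p. By strong induction, once p divides the coefficients
    -- of x below i, the term π v x contributes a multiple of p to coefficient i, and a - b can be
    -- cancelled there.
    unit : ∀ a b v → ¬ + p ∣ + a ℤ.- + b → Unit (num a ⊞ ⊟ num b ⊞ π̂ ⊡ v)
    unit a b v p∤ t x van = vanishes λ i i<t → <-rec (λ i → i < t → + p ∣ x i) step i i<t
      where
      c = + a ℤ.- + b
      lemma : ∀ a b x → a ℤ.* x ℤ.+ ℤ.- (b ℤ.* x) ≡ (a ℤ.- b) ℤ.* x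
      lemma = ℤSolver.solve-∀
      coeff : ∀ i → act (num a ⊞ ⊟ num b) x i ≡ c ℤ.* x i
      coeff i = ≡.trans (≡.cong₂ (λ m n → m ℤ.+ ℤ.- n) (act-num a x i) (act-num b x i)) (lemma (+ a) (+ b) (x i))
      cancel : ∀ i → + p ∣ act (π̂ ⊡ v) x i → i < t → + p ∣ x i
      cancel i p∣πv i<t with prime-∣ c (x i) (≡.subst (+ p ∣_) (coeff i) (∣m+n∣n⇒∣m (below van i i<t) p∣πv))
      ... | inj₁ p∣c = contradiction p∣c p∤
      ... | inj₂ p∣x = p∣x
      step : ∀ i → (∀ {j} → j < i → j < t → + p ∣ x j) → i < t → + p ∣ x i
      step zero    rec i<t = cancel 0 (divides 0ℤ ≡.refl) i<t
      step (suc i) rec i<t = cancel (suc i) (below (Vanishes-act v earlier) i ℕ.≤-refl) i<t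
        where
        earlier : Vanishes (suc i) x
        earlier = vanishes λ j j<1+i → rec j<1+i (ℕ.<-trans j<1+i i<t)

    p∤1 : ¬ + p ∣ 1ℤ
    p∤1 p∣1 = ℕ.<⇒≱ 1<p (ℕ∣.∣⇒≤ (∣⇒∣ᵤ p∣1))

    unit-𝟏⊞π : ∀ v → Unit (𝟏 ⊞ π̂ ⊡ v)
    unit-𝟏⊞π v = Unit-≋ eq (unit 1 0 v p∤1)
      where
      eq : 𝟏 ⊞ π̂ ⊡ v ≋ num 1 ⊞ ⊟ num 0 ⊞ π̂ ⊡ v
      eq = R.+-congʳ {π̂ ⊡ v} (R.sym (R.trans (R.+-congˡ {num 1} -0≋0) (R.trans (R.+-identityʳ (num 1)) (R.+-identityʳ 𝟏))))
        where
        open import Algebra.Properties.Ring R.ring using (-0#≈0#)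
        -0≋0 : ⊟ 𝟎 ≋ 𝟎
        -0≋0 = -0#≈0#

    unit-𝟏 : Unit 𝟏
    unit-𝟏 t x v = v

    unit-⇑ : ∀ {u} n → Unit u → Unit (u ⇑ n)
    unit-⇑ zero    unit = unit-𝟏
    unit-⇑ {u} (suc n) unit = Unit-⊡ {u} {u ⇑ n} unit (unit-⇑ {u} n unit)


    open Horner (series p)

    -- Each division by x - g r costs a factor π^(order of g (r + i) - g r) at the node g (r + i).
    divided-differences : ∀ ws t B (g : ℕ → Op) →
      (∀ r i → r ℕ.+ suc i < B → ∃ λ u → Unit u × g (r ℕ.+ suc i) ≋ g r ⊞ π̂ ⇑ order p ws (suc i) ⊡ u) →
      ∀ d r c → r ℕ.+ d < B →
      (∀ i → i ≤ d → Vanishes t (act (π̂ ⇑ window p ws r i) (horner d c (g (r ℕ.+ i))))) →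
      Vanishes t (act (π̂ ⇑ window p ws (r ℕ.+ d) 0) (c d))
    divided-differences ws t B g differences = go
      where
      W = window p ws
      go : ∀ d r c → r ℕ.+ d < B →
        (∀ i → i ≤ d → Vanishes t (act (π̂ ⇑ W r i) (horner d c (g (r ℕ.+ i))))) →
        Vanishes t (act (π̂ ⇑ W (r ℕ.+ d) 0) (c d))
      go zero    r c r<B v = ≡.subst (λ s → Vanishes t (act (π̂ ⇑ W s 0) (c 0))) (≡.sym (ℕ.+-identityʳ r)) (v 0 z≤n)
      go (suc d) r c r<B v =
        ≡.subst₂ (λ s y → Vanishes t (act (π̂ ⇑ W s 0) y)) (≡.sym (ℕ.+-suc r d)) (quotient-lead (g r) d c)
          (go d (suc r) c′ (≡.subst (_< B) (ℕ.+-suc r d) r<B) v′)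
        where
        c′ = quotient-by (g r) (suc d) c
        v′ : ∀ i → i ≤ d → Vanishes t (act (π̂ ⇑ W (suc r) i) (horner d c′ (g (suc r ℕ.+ i))))
        v′ i i≤d
          with u , unit-u , e ← differences r i (ℕ.≤-<-trans (ℕ.+-monoʳ-≤ r (s≤s i≤d)) r<B)
          = ≡.subst (λ k → Vanishes t (act (π̂ ⇑ W (suc r) i) (horner d c′ (g k)))) (ℕ.+-suc r i)
              (unit-u t _ (Vanishes-≈ (trans (act-comm u (π̂ ⇑ (o ℕ.+ w)) y) (on (⇑-+ π̂ o w) (act u y)))
                (Vanishes-≈ (act-comm (π̂ ⇑ o) (π̂ ⇑ w) (act u y)) quotient-vanishes)))
          where
          k = r ℕ.+ suc i
          o = order p ws (suc i)
          w = W r (suc i)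
          y = horner d c′ (g k)
          at-r : Vanishes t (act (π̂ ⇑ w) (horner (suc d) c (g r)))
          at-r = ≡.subst (λ n → Vanishes t (act (π̂ ⇑ n) (horner (suc d) c (g r)))) (ℕ.m∸n+n≡m (window-min p ws r (suc i)))
            (Vanishes-≈ (on (⇑-+ π̂ (w ∸ W r 0) (W r 0)) _) (Vanishes-act (π̂ ⇑ (w ∸ W r 0))
              (≡.subst (λ k → Vanishes t (act (π̂ ⇑ W r 0) (horner (suc d) c (g k)))) (ℕ.+-identityʳ r) (v 0 z≤n))))
          quotient-vanishes : Vanishes t (act (π̂ ⇑ w) (act (π̂ ⇑ o) (act u y)))
          quotient-vanishes = Vanishes-cancel-+ _ _
            (Vanishes-≈ (sym (trans (act-cong (π̂ ⇑ w) (horner-quotient d c e)) (act-+ (π̂ ⇑ w) _ _))) (v (suc i) (s≤s i≤d)))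
            at-r

-- Interpolation nodes and the orders of their differences

module Nodes where

  open Mods
  open Weights
  open Newton
  open import Data.Integer.Base as ℤ using (ℤ; +_; ∣_∣)
  open import Data.Integer.Divisibility.Signed
  import Data.Integer.Properties as ℤ
  open import Data.List.Base using (_∷_; replicate)
  open import Data.Nat.Base as ℕ using (ℕ; zero; suc; NonZero; _≤_; _<_; _∸_; _^_; _/_; _%_)
  import Data.Nat.DivMod as ℕ
  import Data.Nat.Divisibility as ℕ∣
  open import Data.Nat.Primality using (Prime; prime⇒nonTrivial; prime⇒nonZero)
  import Data.Nat.Properties as ℕ
  import Data.Nat.Tactic.RingSolver as ℕSolver
  open import Data.Product using (∃; _×_; _,_)
  open import Relation.Binary.PropositionalEquality as ≡ using (_≡_; _≢_)
  open import Relation.Nullary using (¬_; Dec; yes; no; contradiction)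

  module Node (p : ℕ) .{{_ : NonZero p}} where

    -- The π-adic expansion whose digits are those of k in base p, so that the valuation of a
    -- difference of indices becomes the order in π of a difference of expansions, one unit per
    -- digit. F is the number of digits kept.
    digits : ℕ → ℕ → Op
    digits zero    k = 𝟎
    digits (suc F) k = num (k % p) ⊞ π̂ ⊡ digits F (k / p)

    -- The order of node k - node k′ depends only on the p-adic valuation of k - k′, and node F e 1 k is
    -- congruent to (1 + π)ᵏ modulo π^(pᵉ), because (1 + π)^(pʲ) = 1 + π^(pʲ) in characteristic p.
    node : ℕ → ℕ → ℕ → ℕ → Op
    node F zero    r k = 𝟏 ⊞ π̂ ⇑ r ⊡ digits F k
    node F (suc e) r k = (𝟏 ⊞ π̂ ⇑ r) ⇑ (k % p) ⊡ node F e (r ℕ.* p) (k / p)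

    -- `low e k` and `high e k` are the remainder and the quotient of k by pᵉ: the digits that enter
    -- a power of z and those that enter the perturbation.
    low : ℕ → ℕ → ℕ
    low zero    k = 0
    low (suc e) k = k % p ℕ.+ low e (k / p) ℕ.* p

    high : ℕ → ℕ → ℕ
    high zero    k = k
    high (suc e) k = high e (k / p)

  module NodeProperties {p : ℕ} (pr : Prime p) (M : Mod) (char : Act._≋_ M (num p) 𝟎)
    (Unit : Op → Set)
    (unit : ∀ a b v → ¬ + p ∣ + a ℤ.- + b → Unit (num a ⊞ ⊟ num b ⊞ π̂ ⊡ v))
    (unit-𝟏⊞π : ∀ v → Unit (𝟏 ⊞ π̂ ⊡ v))
    (unit-⇑ : ∀ {u} n → Unit u → Unit (u ⇑ n))
    (Unit-⊡ : ∀ {u v} → Unit u → Unit v → Unit (u ⊡ v)) where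
    open Act M
    private
      instance
        p≢0 : NonZero p
        p≢0 = prime⇒nonZero pr
      1<p : 1 < p
      1<p = ℕ.nonTrivial⇒n>1 p {{prime⇒nonTrivial pr}}
    open Node p public

    -- Frobenius, (1 + πʳ)ᵖ = 1 + πʳᵖ, collects the factors of the first e levels into one power.
    -- For r = 1 a node is a power of z times 1 + π^(pᵉ) (...), the shape of curve that
    -- `line-vanishing` admits.
    node-expansion : ∀ F e r k →
      node F e r k ≋ (𝟏 ⊞ π̂ ⇑ r) ⇑ low e k ⊡ (𝟏 ⊞ π̂ ⇑ (r ℕ.* p ^ e) ⊡ digits F (high e k))
    node-expansion F zero    r k rewrite ℕ.*-identityʳ r = R.sym (R.*-identityˡ _)
    node-expansion F (suc e) r k = begin
      z ⇑ (k % p) ⊡ node F e (r ℕ.* p) k′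
        ≈⟨ R.*-congˡ {z ⇑ (k % p)} (node-expansion F e (r ℕ.* p) k′) ⟩
      z ⇑ (k % p) ⊡ ((𝟏 ⊞ π̂ ⇑ (r ℕ.* p)) ⇑ low e k′ ⊡ D (r ℕ.* p ℕ.* p ^ e))
        ≈⟨ R.*-congˡ {z ⇑ (k % p)} (R.*-congʳ {D (r ℕ.* p ℕ.* p ^ e)} (⇑-cong (low e k′) frob)) ⟨
      z ⇑ (k % p) ⊡ ((z ⇑ p) ⇑ low e k′ ⊡ D (r ℕ.* p ℕ.* p ^ e))
        ≈⟨ R.*-congˡ {z ⇑ (k % p)} (R.*-congʳ {D (r ℕ.* p ℕ.* p ^ e)} (⇑-* z (low e k′) p)) ⟨
      z ⇑ (k % p) ⊡ (z ⇑ (low e k′ ℕ.* p) ⊡ D (r ℕ.* p ℕ.* p ^ e))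
        ≈⟨ R.*-assoc (z ⇑ (k % p)) _ _ ⟨
      (z ⇑ (k % p) ⊡ z ⇑ (low e k′ ℕ.* p)) ⊡ D (r ℕ.* p ℕ.* p ^ e)
        ≈⟨ R.*-congʳ {D (r ℕ.* p ℕ.* p ^ e)} (⇑-+ z (k % p) (low e k′ ℕ.* p)) ⟨
      z ⇑ low (suc e) k ⊡ D (r ℕ.* p ℕ.* p ^ e)
        ≡⟨ ≡.cong (λ n → z ⇑ low (suc e) k ⊡ D n) (ℕ.*-assoc r p (p ^ e)) ⟩
      z ⇑ low (suc e) k ⊡ D (r ℕ.* p ^ suc e) ∎
      where
      open ≋-Reasoning
      k′ = k / p
      z = 𝟏 ⊞ π̂ ⇑ r
      D : ℕ → Op
      D n = 𝟏 ⊞ π̂ ⇑ n ⊡ digits F (high e k′)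
      frob : z ⇑ p ≋ 𝟏 ⊞ π̂ ⇑ (r ℕ.* p)
      frob = R.trans (𝟏⊞-frobenius pr char (π̂ ⇑ r))
        (R.+-congˡ {𝟏} (R.trans (R.sym (⇑-* π̂ p r)) (R.reflexive (≡.cong (π̂ ⇑_) (ℕ.*-comm p r)))))

    private
      -- Equal last digits of n + k and k force p to divide n, so the division by p produces no
      -- carry.
      quotient-split : ∀ k n → (n ℕ.+ k) % p ≡ k % p →
        ∃ λ q → n ≡ q ℕ.* p × (n ℕ.+ k) / p ≡ q ℕ.+ k / p
      quotient-split k n eq = q , n≡qp , ≡.trans (≡.cong (λ n → (n ℕ.+ k) / p) n≡qp) [qp+k]/p
        where
        q = (n ℕ.+ k) / p ∸ k / p
        lemma : ∀ a b c n → n ℕ.+ (a ℕ.+ b) ≡ a ℕ.+ c → n ℕ.+ b ≡ c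
        lemma a b c n eq = ℕ.+-cancelˡ-≡ a _ _ (≡.trans (arith a b n) eq)
          where
          arith : ∀ a b n → a ℕ.+ (n ℕ.+ b) ≡ n ℕ.+ (a ℕ.+ b)
          arith = ℕSolver.solve-∀
        n+kp : n ℕ.+ k / p ℕ.* p ≡ (n ℕ.+ k) / p ℕ.* p
        n+kp = lemma (k % p) _ _ n (≡.trans (≡.cong (n ℕ.+_) (≡.sym (ℕ.m≡m%n+[m/n]*n k p)))
          (≡.trans (ℕ.m≡m%n+[m/n]*n (n ℕ.+ k) p) (≡.cong (ℕ._+ (n ℕ.+ k) / p ℕ.* p) eq)))
        n≡qp : n ≡ q ℕ.* p
        n≡qp = ≡.trans (≡.sym (ℕ.m+n∸n≡m n (k / p ℕ.* p)))
          (≡.trans (≡.cong (_∸ k / p ℕ.* p) n+kp) (≡.sym (ℕ.*-distribʳ-∸ p ((n ℕ.+ k) / p) (k / p))))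
        [qp+k]/p : (q ℕ.* p ℕ.+ k) / p ≡ q ℕ.+ k / p
        [qp+k]/p = ≡.trans (ℕ.+-distrib-/-∣ˡ k (ℕ∣.divides-refl q)) (≡.cong (ℕ._+ k / p) (ℕ.m*n/n≡m q p))

      p∤difference : ∀ {a b} → a < p → b < p → a ≢ b → ¬ + p ∣ + a ℤ.- + b
      p∤difference {a} {b} a<p b<p a≢b p∣ with ∣⇒∣ᵤ p∣
      ... | p∣∣a-b∣ = ℕ.<⇒≱ ∣a-b∣<p (ℕ∣.∣⇒≤ {{ℕ.≢-nonZero ∣a-b∣≢0}} p∣∣a-b∣)
        where
        ∣a-b∣≢0 : ∣ + a ℤ.- + b ∣ ≢ 0
        ∣a-b∣≢0 eq = a≢b (ℤ.+-injective (ℤ.i-j≡0⇒i≡j (+ a) (+ b) (ℤ.∣i∣≡0⇒i≡0 eq)))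
        ∣a-b∣<p : ∣ + a ℤ.- + b ∣ < p
        ∣a-b∣<p = ℕ.≤-<-trans (≡.subst (λ x → ∣ x ∣ ≤ a ℕ.⊔ b) (≡.sym (ℤ.m-n≡m⊖n a b)) (ℤ.∣m⊝n∣≤m⊔n a b))
                    (ℕ.⊔-pres-<m a<p b<p)

      cancel : ∀ x y → x ≋ y ⊞ (x ⊞ ⊟ y)
      cancel x y = begin
        x               ≈⟨ R.+-identityʳ x ⟨
        x ⊞ 𝟎           ≈⟨ R.+-congˡ {x} (R.-‿inverseˡ y) ⟨
        x ⊞ (⊟ y ⊞ y)   ≈⟨ R.+-assoc x (⊟ y) y ⟨
        x ⊞ ⊟ y ⊞ y     ≈⟨ R.+-comm (x ⊞ ⊟ y) y ⟩
        y ⊞ (x ⊞ ⊟ y)   ∎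
        where open ≋-Reasoning

      difference : ∀ P a b D D′ → P ⊡ (a ⊞ π̂ ⊡ D) ≋ P ⊡ (b ⊞ π̂ ⊡ D′) ⊞ P ⊡ (a ⊞ ⊟ b ⊞ π̂ ⊡ (D ⊞ ⊟ D′))
      difference P a b D D′ = R.trans (R.*-congˡ {P} (begin
        a ⊞ π̂ ⊡ D
          ≈⟨ R.+-cong (cancel a b) (R.*-congˡ {π̂} (cancel D D′)) ⟩
        (b ⊞ (a ⊞ ⊟ b)) ⊞ π̂ ⊡ (D′ ⊞ (D ⊞ ⊟ D′))
          ≈⟨ R.+-congˡ {b ⊞ (a ⊞ ⊟ b)} (R.distribˡ π̂ D′ (D ⊞ ⊟ D′)) ⟩
        (b ⊞ (a ⊞ ⊟ b)) ⊞ (π̂ ⊡ D′ ⊞ π̂ ⊡ (D ⊞ ⊟ D′))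
          ≈⟨ interchange b (a ⊞ ⊟ b) (π̂ ⊡ D′) (π̂ ⊡ (D ⊞ ⊟ D′)) ⟩
        (b ⊞ π̂ ⊡ D′) ⊞ (a ⊞ ⊟ b ⊞ π̂ ⊡ (D ⊞ ⊟ D′)) ∎))
        (R.distribˡ P _ _)
        where
        open ≋-Reasoning
        open import Algebra.Properties.CommutativeSemigroup R.+-commutativeSemigroup using (interchange)

      unit-difference : ∀ k n v v′ → (n ℕ.+ k) % p ≢ k % p →
        Unit (num ((n ℕ.+ k) % p) ⊞ ⊟ num (k % p) ⊞ π̂ ⊡ (v ⊞ ⊟ v′))
      unit-difference k n v v′ ≢% = unit ((n ℕ.+ k) % p) (k % p) (v ⊞ ⊟ v′)
        (p∤difference (ℕ.m%n<n (n ℕ.+ k) p) (ℕ.m%n<n k p) ≢%)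

      ≢%⇒∤ : ∀ k n → (n ℕ.+ k) % p ≢ k % p → n % p ≢ 0
      ≢%⇒∤ k n ≢% n%p≡0 = ≢% (ℕ.%-remove-+ˡ k (ℕ∣.m%n≡0⇒n∣m n p n%p≡0))

      q≢0 : ∀ {n} q → n ≡ q ℕ.* p → n ≢ 0 → q ≢ 0
      q≢0 zero eq n≢0 _ = n≢0 eq

    -- If the last digits differ, the difference is a unit; otherwise p divides n, the remaining
    -- digits are compared, and one factor π is gained. The bound p^F ensures that F digits tell n +
    -- k and k apart.
    digits-difference : ∀ F n k → n ≢ 0 → n ℕ.+ k < p ^ F →
      ∃ λ u → Unit u × digits F (n ℕ.+ k) ≋ digits F k ⊞ π̂ ⇑ deeper p (replicate F 1) n ⊡ u
    digits-difference zero n k n≢0 n+k<1 = contradiction (ℕ.n<1⇒n≡0 (ℕ.≤-<-trans (ℕ.m≤m+n n k) n+k<1)) n≢0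
    digits-difference (suc F) n k n≢0 n+k< with (n ℕ.+ k) % p ℕ.≟ k % p
    ... | no ≢% = u , unit-difference k n D D′ ≢% , (begin
        a ⊞ π̂ ⊡ D              ≈⟨ R.*-identityˡ _ ⟨
        𝟏 ⊡ (a ⊞ π̂ ⊡ D)        ≈⟨ difference 𝟏 a b D D′ ⟩
        𝟏 ⊡ (b ⊞ π̂ ⊡ D′) ⊞ 𝟏 ⊡ u ≈⟨ R.+-congʳ {𝟏 ⊡ u} (R.*-identityˡ _) ⟩
        b ⊞ π̂ ⊡ D′ ⊞ 𝟏 ⊡ u     ≡⟨ ≡.cong (λ o → b ⊞ π̂ ⊡ D′ ⊞ π̂ ⇑ o ⊡ u) (deeper-∤ p (replicate (suc F) 1) n (≢%⇒∤ k n ≢%)) ⟨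
        b ⊞ π̂ ⊡ D′ ⊞ π̂ ⇑ deeper p (replicate (suc F) 1) n ⊡ u ∎)
      where
      open ≋-Reasoning
      a = num ((n ℕ.+ k) % p)
      b = num (k % p)
      D = digits F ((n ℕ.+ k) / p)
      D′ = digits F (k / p)
      u = a ⊞ ⊟ b ⊞ π̂ ⊡ (D ⊞ ⊟ D′)
    ... | yes ≡%
      with q , n≡qp , /≡ ← quotient-split k n ≡%
      with u , unit-u , e ← digits-difference F q (k / p) (q≢0 q n≡qp n≢0)
             (≡.subst (_< p ^ F) /≡ (ℕ.m<n*o⇒m/o<n (≡.subst (n ℕ.+ k <_) (ℕ.*-comm p (p ^ F)) n+k<)))
      = u , unit-u , (begin
        num ((n ℕ.+ k) % p) ⊞ π̂ ⊡ digits F ((n ℕ.+ k) / p)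
          ≡⟨ ≡.cong₂ (λ r q → num r ⊞ π̂ ⊡ digits F q) ≡% /≡ ⟩
        b ⊞ π̂ ⊡ digits F (q ℕ.+ k / p)
          ≈⟨ R.+-congˡ {b} (R.*-congˡ {π̂} e) ⟩
        b ⊞ π̂ ⊡ (digits F (k / p) ⊞ π̂ ⇑ o ⊡ u)
          ≈⟨ lemma b π̂ (digits F (k / p)) (π̂ ⇑ o) u ⟩
        b ⊞ π̂ ⊡ digits F (k / p) ⊞ π̂ ⇑ suc o ⊡ u
          ≡⟨ ≡.cong (λ o → b ⊞ π̂ ⊡ digits F (k / p) ⊞ π̂ ⇑ o ⊡ u)
               (≡.trans (≡.cong (deeper p (replicate (suc F) 1)) n≡qp) (deeper-∣ p (replicate (suc F) 1) q)) ⟨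
        b ⊞ π̂ ⊡ digits F (k / p) ⊞ π̂ ⇑ deeper p (replicate (suc F) 1) n ⊡ u ∎)
      where
      open ≋-Reasoning
      open Solve
      b = num (k % p)
      o = deeper p (replicate F 1) q
      lemma : ∀ b π D s u → b ⊞ π ⊡ (D ⊞ s ⊡ u) ≋ b ⊞ π ⊡ D ⊞ (π ⊡ s) ⊡ u
      lemma = solve 5 (λ b π D s u → b :+ π :* (D :+ s :* u) := b :+ π :* D :+ (π :* s) :* u) R.refl

    private
      -- With P a positive power of π, all terms of the binomial expansion beyond 1 + aP are
      -- divisible by P², hence by πP.
      power-expansion : ∀ r a → ∃ λ v → (𝟏 ⊞ π̂ ⇑ suc r) ⇑ a ≋ 𝟏 ⊞ π̂ ⇑ suc r ⊡ (num a ⊞ π̂ ⊡ v)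
      power-expansion r zero = 𝟎 , R.sym (R.trans (R.+-congˡ {𝟏}
        (R.trans (R.*-congˡ {π̂ ⇑ suc r} (R.trans (R.+-identityˡ (π̂ ⊡ 𝟎)) (R.zeroʳ π̂))) (R.zeroʳ (π̂ ⇑ suc r))))
        (R.+-identityʳ 𝟏))
      power-expansion r (suc a) with v , e ← power-expansion r a =
        v ⊞ π̂ ⇑ r ⊡ (num a ⊞ π̂ ⊡ v) , R.trans (R.*-congˡ {𝟏 ⊞ π̂ ⇑ suc r} e) (lemma π̂ (π̂ ⇑ r) (num a) v)
        where
        open Solve
        lemma : ∀ π s a v → (𝟏 ⊞ π ⊡ s) ⊡ (𝟏 ⊞ (π ⊡ s) ⊡ (a ⊞ π ⊡ v))
                  ≋ 𝟏 ⊞ (π ⊡ s) ⊡ (𝟏 ⊞ a ⊞ π ⊡ (v ⊞ s ⊡ (a ⊞ π ⊡ v)))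
        lemma = solve 4 (λ π s a v → (con 1 :+ π :* s) :* (con 1 :+ (π :* s) :* (a :+ π :* v))
                           := con 1 :+ (π :* s) :* (con 1 :+ a :+ π :* (v :+ s :* (a :+ π :* v)))) R.refl

      -- Because p ≥ 2, the exponent of the next level is at least r + 2, so the deeper factors of a
      -- node are 1 modulo π^(r+2).
      split-scale : ∀ r → ∃ λ s → suc r ℕ.* p ≡ suc (r ℕ.+ suc s)
      split-scale r = suc r ℕ.* p ∸ suc (suc r) , ≡.sym (≡.trans (≡.cong suc (ℕ.+-suc r _))
        (ℕ.m+[n∸m]≡n (ℕ.≤-trans (ℕ.≤-trans (ℕ.+-monoʳ-≤ 1 (ℕ.m≤n*m (suc r) 1)) (lemma r)) (ℕ.*-monoʳ-≤ (suc r) 1<p))))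
        where
        lemma : ∀ r → 1 ℕ.+ 1 ℕ.* suc r ≤ suc r ℕ.* 2
        lemma r = ℕ.≤-trans (ℕ.m≤m+n _ r) (ℕ.≤-reflexive (arith r))
          where
          arith : ∀ r → 1 ℕ.+ 1 ℕ.* suc r ℕ.+ r ≡ suc r ℕ.* 2
          arith = ℕSolver.solve-∀

      -- Proved together with `node-residue`: to first order past π^(r+1) a node depends only on the
      -- last digit of its index, and so nodes with different last digits differ by π^(r+1) times a
      -- unit.
      node≡1 : ∀ F e r k → ∃ λ x → node F e (suc r) k ≋ 𝟏 ⊞ π̂ ⇑ suc r ⊡ x
      node-residue : ∀ F e r k → ∃ λ v →
        node F (suc e) (suc r) k ≋ 𝟏 ⊞ π̂ ⇑ suc r ⊡ (num (k % p) ⊞ π̂ ⊡ v)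

      node≡1 F zero    r k = digits F k , R.refl
      node≡1 F (suc e) r k with v , eq ← node-residue F e r k = num (k % p) ⊞ π̂ ⊡ v , eq

      node-residue F e r k
        with v , eq ← power-expansion r (k % p)
        with s , eq-s ← split-scale r
        with x , eq-x ← ≡.subst (λ s → ∃ λ x → node F e s (k / p) ≋ 𝟏 ⊞ π̂ ⇑ s ⊡ x) (≡.sym eq-s) (node≡1 F e (r ℕ.+ suc s) (k / p))
        = v ⊞ (π̂ ⇑ s ⊡ x ⊞ (a ⊞ π̂ ⊡ v) ⊡ (P ⊡ (π̂ ⇑ s ⊡ x))) , (begin
          (𝟏 ⊞ π̂ ⇑ suc r) ⇑ (k % p) ⊡ node F e (suc r ℕ.* p) (k / p)
            ≈⟨ R.*-cong eq eq-x ⟩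
          (𝟏 ⊞ P ⊡ (a ⊞ π̂ ⊡ v)) ⊡ (𝟏 ⊞ π̂ ⇑ (suc r ℕ.* p) ⊡ x)
            ≈⟨ R.*-congˡ {𝟏 ⊞ P ⊡ (a ⊞ π̂ ⊡ v)} (R.+-congˡ {𝟏} (R.trans (R.*-congʳ {x}
                 (R.trans (R.reflexive (≡.cong (π̂ ⇑_) eq-s)) (⇑-+ π̂ (suc r) (suc s))))
                 (R.trans (R.*-assoc P (π̂ ⊡ π̂ ⇑ s) x) (R.*-congˡ {P} (R.*-assoc π̂ (π̂ ⇑ s) x))))) ⟩
          (𝟏 ⊞ P ⊡ (a ⊞ π̂ ⊡ v)) ⊡ (𝟏 ⊞ P ⊡ (π̂ ⊡ (π̂ ⇑ s ⊡ x)))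
            ≈⟨ lemma₁ P (a ⊞ π̂ ⊡ v) π̂ (π̂ ⇑ s ⊡ x) ⟩
          𝟏 ⊞ P ⊡ (a ⊞ π̂ ⊡ v ⊞ π̂ ⊡ (π̂ ⇑ s ⊡ x ⊞ (a ⊞ π̂ ⊡ v) ⊡ (P ⊡ (π̂ ⇑ s ⊡ x))))
            ≈⟨ R.+-congˡ {𝟏} (R.*-congˡ {P} (lemma₂ a π̂ v _)) ⟩
          𝟏 ⊞ P ⊡ (a ⊞ π̂ ⊡ (v ⊞ (π̂ ⇑ s ⊡ x ⊞ (a ⊞ π̂ ⊡ v) ⊡ (P ⊡ (π̂ ⇑ s ⊡ x))))) ∎)
        where
        open ≋-Reasoning
        open Solve
        a = num (k % p)
        P = π̂ ⇑ suc r
        lemma₁ : ∀ P y π w → (𝟏 ⊞ P ⊡ y) ⊡ (𝟏 ⊞ P ⊡ (π ⊡ w)) ≋ 𝟏 ⊞ P ⊡ (y ⊞ π ⊡ (w ⊞ y ⊡ (P ⊡ w)))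
        lemma₁ = solve 4 (λ P y π w → (con 1 :+ P :* y) :* (con 1 :+ P :* (π :* w))
                            := con 1 :+ P :* (y :+ π :* (w :+ y :* (P :* w)))) R.refl
        lemma₂ : ∀ a π v w → a ⊞ π ⊡ v ⊞ π ⊡ w ≋ a ⊞ π ⊡ (v ⊞ w)
        lemma₂ = solve 4 (λ a π v w → a :+ π :* v :+ π :* w := a :+ π :* (v :+ w)) R.refl

    NodeDifference : ℕ → ℕ → ℕ → ℕ → ℕ → Set
    NodeDifference F e r n k = ∃ λ u → Unit u ×
      node F e r (n ℕ.+ k) ≋ node F e r k ⊞ π̂ ⇑ (r ℕ.+ deeper p (increments p F e r) n) ⊡ u

    private
      differ-base : ∀ F r n k →
        (∃ λ u → Unit u × digits F (n ℕ.+ k) ≋ digits F k ⊞ π̂ ⇑ deeper p (replicate F 1) n ⊡ u) →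
        NodeDifference F zero r n k
      differ-base F r n k (u , unit-u , e) = u , unit-u ,
        R.trans (R.+-congˡ {𝟏} (R.*-congˡ {P} e))
          (R.trans (lemma 𝟏 P (digits F k) (π̂ ⇑ o) u)
            (R.+-congˡ {𝟏 ⊞ P ⊡ digits F k} (R.*-congʳ {u} (R.sym (⇑-+ π̂ r o)))))
        where
        open Solve
        P = π̂ ⇑ r
        o = deeper p (replicate F 1) n
        lemma : ∀ a P D s u → a ⊞ P ⊡ (D ⊞ s ⊡ u) ≋ a ⊞ P ⊡ D ⊞ (P ⊡ s) ⊡ u
        lemma = solve 5 (λ a P D s u → a :+ P :* (D :+ s :* u) := a :+ P :* D :+ (P :* s) :* u) R.refl

      differ-now : ∀ F e r n k → (n ℕ.+ k) % p ≢ k % p →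
        (∃ λ v → node F (suc e) r (n ℕ.+ k) ≋ 𝟏 ⊞ π̂ ⇑ r ⊡ (num ((n ℕ.+ k) % p) ⊞ π̂ ⊡ v)) →
        (∃ λ v → node F (suc e) r k ≋ 𝟏 ⊞ π̂ ⇑ r ⊡ (num (k % p) ⊞ π̂ ⊡ v)) →
        NodeDifference F (suc e) r n k
      differ-now F e r n k ≢% (v , eq) (v′ , eq′) = u , unit-difference k n v v′ ≢% ,
        R.trans eq (R.trans (R.+-congˡ {𝟏} (difference P a b v v′))
          (R.trans (R.sym (R.+-assoc 𝟏 (P ⊡ (b ⊞ π̂ ⊡ v′)) (P ⊡ u)))
            (R.trans (R.+-congʳ {P ⊡ u} (R.sym eq′))
              (R.+-congˡ {node F (suc e) r k} (R.*-congʳ {u} (R.reflexive (≡.cong (π̂ ⇑_) o≡)))))))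
        where
        ws = increments p F (suc e) r
        P = π̂ ⇑ r
        a = num ((n ℕ.+ k) % p)
        b = num (k % p)
        u = a ⊞ ⊟ b ⊞ π̂ ⊡ (v ⊞ ⊟ v′)
        o≡ : r ≡ r ℕ.+ deeper p ws n
        o≡ = ≡.sym (≡.trans (≡.cong (r ℕ.+_) (deeper-∤ p ws n (≢%⇒∤ k n ≢%))) (ℕ.+-identityʳ r))

      differ-later : ∀ F e r n k q → (n ℕ.+ k) % p ≡ k % p → n ≡ q ℕ.* p → (n ℕ.+ k) / p ≡ q ℕ.+ k / p →
        Unit ((𝟏 ⊞ π̂ ⇑ r) ⇑ (k % p)) → NodeDifference F e (r ℕ.* p) q (k / p) → NodeDifference F (suc e) r n k
      differ-later F e r n k q ≡% n≡qp /≡ unit-Z (u , unit-u , eq) = Z ⊡ u , Unit-⊡ {Z} {u} unit-Z unit-u ,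
        R.trans (R.reflexive (≡.cong₂ (λ a q → (𝟏 ⊞ π̂ ⇑ r) ⇑ a ⊡ node F e (r ℕ.* p) q) ≡% /≡))
          (R.trans (R.*-congˡ {Z} eq) (R.trans (lemma Z X (π̂ ⇑ o) u)
            (R.+-congˡ {Z ⊡ X} (R.*-congʳ {Z ⊡ u} (R.reflexive (≡.cong (π̂ ⇑_) o≡))))))
        where
        open Solve
        Z = (𝟏 ⊞ π̂ ⇑ r) ⇑ (k % p)
        X = node F e (r ℕ.* p) (k / p)
        ws = increments p F e (r ℕ.* p)
        o = r ℕ.* p ℕ.+ deeper p ws q
        lemma : ∀ Z X s u → Z ⊡ (X ⊞ s ⊡ u) ≋ Z ⊡ X ⊞ s ⊡ (Z ⊡ u)
        lemma = solve 4 (λ Z X s u → Z :* (X :+ s :* u) := Z :* X :+ s :* (Z :* u)) R.refl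
        o≡ : o ≡ r ℕ.+ deeper p (increments p F (suc e) r) n
        o≡ = ≡.sym (≡.trans (≡.cong (r ℕ.+_) (≡.trans (≡.cong (deeper p (increments p F (suc e) r)) n≡qp)
                 (deeper-∣ p (increments p F (suc e) r) q)))
               (≡.trans (≡.sym (ℕ.+-assoc r (r ℕ.* p ∸ r) (deeper p ws q)))
                 (≡.cong (ℕ._+ deeper p ws q) (ℕ.m+[n∸m]≡n (ℕ.m≤m*n r p)))))

      node-residue′ : ∀ F e r .{{_ : NonZero r}} k → ∃ λ v →
        node F (suc e) r k ≋ 𝟏 ⊞ π̂ ⇑ r ⊡ (num (k % p) ⊞ π̂ ⊡ v)
      node-residue′ F e (suc r) k = node-residue F e r k

      unit-power : ∀ r .{{_ : NonZero r}} a → Unit ((𝟏 ⊞ π̂ ⇑ r) ⇑ a)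
      unit-power (suc r) a = unit-⇑ a (unit-𝟏⊞π (π̂ ⇑ r))

    -- Different last digits give order exactly r, by `node-residue′`. Equal last digits leave a
    -- common factor (1 + πʳ)^(k mod p), which is a unit, and the other factors are nodes of the
    -- next level with indices divided by p.
    node-difference : ∀ F e r .{{_ : NonZero r}} n k → n ≢ 0 → n ℕ.+ k < p ^ (e ℕ.+ F) → NodeDifference F e r n k
    node-difference F zero    r n k n≢0 n+k< = differ-base F r n k (digits-difference F n k n≢0 n+k<)
    node-difference F (suc e) r n k n≢0 n+k< = by-residue ((n ℕ.+ k) % p ℕ.≟ k % p)
      where
      by-residue : Dec ((n ℕ.+ k) % p ≡ k % p) → NodeDifference F (suc e) r n k
      by-residue (no ≢%) = differ-now F e r n k ≢% (node-residue′ F e r (n ℕ.+ k)) (node-residue′ F e r k)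
      by-residue (yes ≡%) = let q , n≡qp , /≡ = quotient-split k n ≡% in
        differ-later F e r n k q ≡% n≡qp /≡ (unit-power r (k % p))
          (node-difference F e (r ℕ.* p) {{ℕ.m*n≢0 r p}} q (k / p) (q≢0 q n≡qp n≢0)
            (≡.subst (_< p ^ (e ℕ.+ F)) /≡ (ℕ.m<n*o⇒m/o<n (≡.subst (n ℕ.+ k <_) (ℕ.*-comm p (p ^ (e ℕ.+ F))) n+k<))))

    node-differences : ∀ F e r i → r ℕ.+ suc i < p ^ (e ℕ.+ F) →
      ∃ λ u → Unit u × node F e 1 (r ℕ.+ suc i) ≋ node F e 1 r ⊞ π̂ ⇑ order p (1 ∷ increments p F e 1) (suc i) ⊡ u
    node-differences F e r i < =
      ≡.subst (λ k → ∃ λ u → Unit u × node F e 1 k ≋ node F e 1 r ⊞ π̂ ⇑ order p (1 ∷ increments p F e 1) (suc i) ⊡ u)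
        (ℕ.+-comm (suc i) r)
        (node-difference F e 1 (suc i) r (λ ()) (≡.subst (_< p ^ (e ℕ.+ F)) (ℕ.+-comm r (suc i)) <))

  module _ {p : ℕ} (pr : Prime p) where
    open Act (series p)
    open Series pr
    open Node p {{prime⇒nonZero pr}}
    private
      instance
        p≢0 : NonZero p
        p≢0 = prime⇒nonZero pr
      1<p : 1 < p
      1<p = ℕ.nonTrivial⇒n>1 p {{prime⇒nonTrivial pr}}
      module N = NodeProperties pr (series p) char Unit unit unit-𝟏⊞π (λ {u} n → unit-⇑ {u} n) (λ {u} {v} → Unit-⊡ {u} {v})

    -- After d divisions only c d is left, multiplied by π to the sum of the orders of 1, ..., d,
    -- which is at most (e + 1) d.
    leading-coefficient : ∀ F e .{{_ : NonZero e}} t d c → d < p ^ (e ℕ.+ F) →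
      (∀ i → i ≤ d → Vanishes t (Horner.horner (series p) d c (node F e 1 i))) →
      Vanishes (t ∸ suc e ℕ.* d) (c d)
    leading-coefficient F e t d c d< v =
      Vanishes-≤ (ℕ.∸-monoʳ-≤ t (≡.subst (_≤ suc e ℕ.* d) (≡.sym (window-initial p ws d)) (orderSum-bound p 1<p F e d)))
        (Vanishes-cancel-π⇑ (window p ws d 0) (c d)
          (divided-differences ws t (p ^ (e ℕ.+ F)) (node F e 1) (N.node-differences F e) d 0 c d< v))
      where
      ws = 1 ∷ increments p F e 1

-- Polynomials over 𝔽ₚ with exponents in a weighted simplex

module Simplex where

  open Mods
  open Newton
  open Nodes
  open import Data.Integer.Base as ℤ using (ℤ; +_; 0ℤ; 1ℤ)
  open import Data.Integer.Divisibility.Signed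
  import Data.Integer.Properties as ℤ
  import Data.Integer.Tactic.RingSolver as ℤSolver
  open import Data.List.Base using (List; []; _∷_; _++_; map)
  open import Data.List.Properties using (∷-injective)
  open import Data.List.Relation.Unary.All as All using (All; []; _∷_)
  import Data.List.Relation.Unary.All.Properties as All
  open import Data.Nat.Base as ℕ using (ℕ; zero; suc; NonZero; _≤_; _<_; z≤n; s≤s; _∸_; _^_)
  open import Data.Nat.Primality using (Prime; prime⇒nonZero)
  import Data.Nat.Properties as ℕ
  open import Data.Product using (∃; ∃₂; _×_; _,_; proj₁; proj₂; map₂)
  open import Data.Vec.Base as Vec using (Vec; []; _∷_)
  import Data.Vec.Relation.Unary.All as VecAll
  open import Function.Base using (_∘_)
  open import Relation.Binary.PropositionalEquality as ≡ using (_≡_; _≢_)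
  open import Relation.Nullary using (contradiction)

  concatUpTo : {A : Set} → ℕ → (ℕ → List A) → List A
  concatUpTo zero    f = []
  concatUpTo (suc n) f = f 0 ++ concatUpTo n (f ∘ suc)

  -- The first variable stays in front because it is eliminated last: its value is z on every curve,
  -- and it carries no weight E.
  insert₁ : ∀ {n} → ℕ → Vec ℕ (suc n) → Vec ℕ (suc (suc n))
  insert₁ j (i ∷ v) = i ∷ j ∷ v

  -- The exponents v with v₁ + E (v₂ + … + vₙ) < t, n = 1 + n′.
  simplex : (E n′ t : ℕ) → List (Vec ℕ (suc n′))
  simplex E zero     t = concatUpTo t λ j → map (j ∷_) ([] ∷ [])
  simplex E (suc n′) t = concatUpTo t λ j → map (insert₁ j) (simplex E n′ (t ∸ E ℕ.* j))

  module _ {A B : Set} where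

    private
      split-++ : (w : List (ℤ × A)) (xs : List A) {ys : List A} → map proj₂ w ≡ xs ++ ys →
        ∃₂ λ u v → w ≡ u ++ v × map proj₂ u ≡ xs × map proj₂ v ≡ ys
      split-++ w       []       eq = [] , w , ≡.refl , ≡.refl , eq
      split-++ (c ∷ w) (x ∷ xs) eq
        with eq₁ , eq₂ ← ∷-injective eq
        with u , v , w≡ , u≡ , v≡ ← split-++ w xs eq₂
        = c ∷ u , v , ≡.cong (c ∷_) w≡ , ≡.cong₂ _∷_ eq₁ u≡ , v≡

      split-map : (f : B → A) (w : List (ℤ × A)) (xs : List B) → map proj₂ w ≡ map f xs →
        ∃ λ u → w ≡ map (map₂ f) u × map proj₂ u ≡ xs
      split-map f []            []       eq = [] , ≡.refl , ≡.refl
      split-map f ((c , a) ∷ w) (x ∷ xs) eq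
        with eq₁ , eq₂ ← ∷-injective eq
        with u , w≡ , u≡ ← split-map f w xs eq₂
        = (c , x) ∷ u , ≡.cong₂ _∷_ (≡.cong (c ,_) eq₁) w≡ , ≡.cong (x ∷_) u≡

    -- A polynomial is a list of terms whose exponents match the simplex position by position; the
    -- coefficients of each power of the singled-out variable are then again polynomials of this
    -- kind.
    split-concatUpTo : ∀ t (ins : ℕ → B → A) (f : ℕ → List B) (w : List (ℤ × A)) →
      map proj₂ w ≡ concatUpTo t (λ j → map (ins j) (f j)) →
      ∃ λ (ws : ℕ → List (ℤ × B)) → w ≡ concatUpTo t (λ j → map (map₂ (ins j)) (ws j)) × (∀ j → j < t → map proj₂ (ws j) ≡ f j)
    split-concatUpTo zero    ins f [] eq = (λ _ → []) , ≡.refl , λ _ ()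
    split-concatUpTo (suc t) ins f w eq
      with u , v , w≡ , u≡ , v≡ ← split-++ w (map (ins 0) (f 0)) eq
      with u′ , u≡′ , u′≡ ← split-map (ins 0) u (f 0) u≡
      with ws , v≡′ , ws≡ ← split-concatUpTo t (ins ∘ suc) (f ∘ suc) v v≡
      = (λ { zero → u′ ; (suc j) → ws j }) , ≡.trans w≡ (≡.cong₂ _++_ u≡′ v≡′)
      , λ { zero _ → u′≡ ; (suc j) (s≤s j<t) → ws≡ j j<t }

  All-concatUpTo : {A : Set} {P : A → Set} → ∀ t (f : ℕ → List A) → (∀ j → j < t → All P (f j)) → All P (concatUpTo t f)
  All-concatUpTo zero    f all = []
  All-concatUpTo (suc t) f all = All.++⁺ (all 0 (s≤s z≤n)) (All-concatUpTo t (f ∘ suc) λ j j<t → all (suc j) (s≤s j<t))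

  monomial : ∀ {n} → Vec Op n → Vec ℕ n → Op
  monomial []       []       = 𝟏
  monomial (γ ∷ γs) (j ∷ js) = γ ⇑ j ⊡ monomial γs js

  ẑ : Op
  ẑ = 𝟏 ⊞ π̂

  module Sums (M : Mod) where
    open Act M
    open Horner M

    sumUpTo : ℕ → (ℕ → Carrier) → Carrier
    sumUpTo zero    c = 0#
    sumUpTo (suc t) c = c 0 + sumUpTo t (c ∘ suc)

    sumUpTo-cong : ∀ t {c d} → (∀ j → j < t → c j ≈ d j) → sumUpTo t c ≈ sumUpTo t d
    sumUpTo-cong zero    eq = refl
    sumUpTo-cong (suc t) eq = +-cong (eq 0 (s≤s z≤n)) (sumUpTo-cong t λ j j<t → eq (suc j) (s≤s j<t))

    sumUpTo-truncate : ∀ {s t} → s ≤ t → ∀ c → (∀ j → s ≤ j → j < t → c j ≈ 0#) → sumUpTo t c ≈ sumUpTo s c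
    sumUpTo-truncate {zero} {zero}  s≤t c c≈0 = refl
    sumUpTo-truncate {zero} {suc t} s≤t c c≈0 =
      trans (+-cong (c≈0 0 z≤n (s≤s z≤n)) (sumUpTo-truncate {zero} {t} z≤n (c ∘ suc) λ j _ j<t → c≈0 (suc j) z≤n (s≤s j<t)))
            (+-identityˡ 0#)
    sumUpTo-truncate (s≤s s≤t) c c≈0 = +-congˡ (sumUpTo-truncate s≤t (c ∘ suc) λ j s≤j j<t → c≈0 (suc j) (s≤s s≤j) (s≤s j<t))

    act-sumUpTo : ∀ a t c → act a (sumUpTo t c) ≈ sumUpTo t (act a ∘ c)
    act-sumUpTo a zero    c = act-0 a
    act-sumUpTo a (suc t) c = trans (act-+ a _ _) (+-congˡ (act-sumUpTo a t (c ∘ suc)))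

    sumUpTo-horner : ∀ d c g → sumUpTo (suc d) (λ j → act (g ⇑ j) (c j)) ≈ horner d c g
    sumUpTo-horner zero    c g = +-identityʳ (c 0)
    sumUpTo-horner (suc d) c g =
      +-congˡ (trans (sym (act-sumUpTo g (suc d) (λ j → act (g ⇑ j) (c (suc j))))) (act-cong g (sumUpTo-horner d (c ∘ suc) g)))

  module Evaluation (p : ℕ) where
    open Act (series p)

    one : Carrier
    one zero    = 1ℤ
    one (suc _) = 0ℤ

    scale : ℤ → Hom (series p) (series p)
    scale c = record
      { map    = λ x i → c ℤ.* x i
      ; cong   = λ {x} {y} e → mk≈ λ i → ≡.subst (+ p ∣_) (lemma₁ c (x i) (y i)) (∣n⇒∣m*n c (at e i))
      ; homo   = λ x y → mk≈ λ i → ≡ₚ-reflexive p (ℤ.*-distribˡ-+ c (x i) (y i))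
      ; ζ-homo = λ x → refl
      ; π-homo = λ x → mk≈ λ { zero → ≡ₚ-reflexive p (ℤ.*-zeroʳ c) ; (suc i) → ≡ₚ-reflexive p {c ℤ.* x i} ≡.refl } }
      where
      lemma₁ : ∀ c x y → c ℤ.* (x ℤ.- y) ≡ c ℤ.* x ℤ.- c ℤ.* y
      lemma₁ = ℤSolver.solve-∀

    infixr 7 _·_
    _·_ : ℤ → Carrier → Carrier
    (c · x) i = c ℤ.* x i

    act-· : ∀ a c x → act a (c · x) ≈ c · act a x
    act-· a c x = sym (hom-act (scale c) a x)

    evaluate : ∀ {n} → List (ℤ × Vec ℕ n) → Vec Op n → Carrier
    evaluate []            γs = 0#
    evaluate ((c , v) ∷ w) γs = c · act (monomial γs v) one + evaluate w γs

    evaluate-++ : ∀ {n} (u v : List (ℤ × Vec ℕ n)) γs → evaluate (u ++ v) γs ≈ evaluate u γs + evaluate v γs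
    evaluate-++ []      v γs = sym (+-identityˡ _)
    evaluate-++ (c ∷ u) v γs = trans (+-congˡ {x} (evaluate-++ u v γs)) (sym (+-assoc x (evaluate u γs) (evaluate v γs)))
      where x = proj₁ c · act (monomial γs (proj₂ c)) one

    evaluate-map : ∀ {m n} (ins : Vec ℕ m → Vec ℕ n) γs γs′ a →
      (∀ v → monomial γs (ins v) ≋ a ⊡ monomial γs′ v) →
      ∀ w → evaluate (map (map₂ ins) w) γs ≈ act a (evaluate w γs′)
    evaluate-map ins γs γs′ a eq []            = sym (act-0 a)
    evaluate-map ins γs γs′ a eq ((c , v) ∷ w) =
      trans (+-cong (trans (Hom.cong (scale c) (on (eq v) one)) (sym (act-· a c (act (monomial γs′ v) one))))
                    (evaluate-map ins γs γs′ a eq w))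
            (sym (act-+ a (c · act (monomial γs′ v) one) (evaluate w γs′)))

    evaluate-0 : ∀ {n} {w : List (ℤ × Vec ℕ n)} γs → All (λ (c , _) → + p ∣ c) w → evaluate w γs ≈ 0#
    evaluate-0 γs [] = refl
    evaluate-0 {w = (c , v) ∷ w} γs (p∣c ∷ all) = trans (+-cong zero-term (evaluate-0 γs all)) (+-identityˡ 0#)
      where
      zero-term : c · act (monomial γs v) one ≈ 0#
      zero-term = mk≈ λ i → ≡.subst (+ p ∣_) (≡.sym (ℤ.+-identityʳ _)) (∣m⇒∣m*n (act (monomial γs v) one i) p∣c)

    open Horner (series p)
    open Sums (series p)

    evaluate-concatUpTo : ∀ {n} t (f : ℕ → List (ℤ × Vec ℕ n)) γs →
      evaluate (concatUpTo t f) γs ≈ sumUpTo t (λ j → evaluate (f j) γs)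
    evaluate-concatUpTo zero    f γs = refl
    evaluate-concatUpTo (suc t) f γs =
      trans (evaluate-++ (f 0) (concatUpTo t (f ∘ suc)) γs) (+-congˡ {evaluate (f 0) γs} (evaluate-concatUpTo t (f ∘ suc) γs))

    -- Collects the terms by powers of the variable with value g and drops the blocks above d, which
    -- are already known to vanish modulo p.
    evaluate-blocks : ∀ {m n} t (ins : ℕ → Vec ℕ m → Vec ℕ n) (ws : ℕ → List (ℤ × Vec ℕ m)) γs γs′ g →
      (∀ j v → monomial γs (ins j v) ≋ g ⇑ j ⊡ monomial γs′ v) →
      ∀ d → d < t → (∀ j → d < j → j < t → All (λ (c , _) → + p ∣ c) (ws j)) →
      evaluate (concatUpTo t (λ j → map (map₂ (ins j)) (ws j))) γs ≈ horner d (λ j → evaluate (ws j) γs′) g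
    evaluate-blocks t ins ws γs γs′ g eq d d<t all = begin
      evaluate (concatUpTo t (λ j → map (map₂ (ins j)) (ws j))) γs
        ≈⟨ evaluate-concatUpTo t (λ j → map (map₂ (ins j)) (ws j)) γs ⟩
      sumUpTo t (λ j → evaluate (map (map₂ (ins j)) (ws j)) γs)
        ≈⟨ sumUpTo-cong t (λ j _ → evaluate-map (ins j) γs γs′ (g ⇑ j) (eq j) (ws j)) ⟩
      sumUpTo t (λ j → act (g ⇑ j) (evaluate (ws j) γs′))
        ≈⟨ sumUpTo-truncate d<t (λ j → act (g ⇑ j) (evaluate (ws j) γs′))
             (λ j d<j j<t → trans (act-cong (g ⇑ j) (evaluate-0 γs′ (all j d<j j<t))) (act-0 (g ⇑ j))) ⟩
      sumUpTo (suc d) (λ j → act (g ⇑ j) (evaluate (ws j) γs′))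
        ≈⟨ sumUpTo-horner d (λ j → evaluate (ws j) γs′) g ⟩
      horner d (λ j → evaluate (ws j) γs′) g ∎
      where open import Relation.Binary.Reasoning.Setoid setoid

    constant-coefficient : ∀ (w : List (ℤ × Vec ℕ 0)) i → evaluate w [] (suc i) ≡ 0ℤ
    constant-coefficient []            i = ≡.refl
    constant-coefficient ((c , []) ∷ w) i = ≡.cong₂ ℤ._+_ (ℤ.*-zeroʳ c) (constant-coefficient w i)

    -- Σ cⱼ (1 + π)ʲ with constant cⱼ has degree at most d in π, and its coefficient of π^d is that
    -- of c d. So the first variable is eliminated by reading off a coefficient, without loss of
    -- order.
    horner-ẑ : ∀ d (c : ℕ → Carrier) → (∀ j i → c j (suc i) ≡ 0ℤ) →
      horner d c ẑ d ≡ c d 0 × ∀ i → d < i → horner d c ẑ i ≡ 0ℤ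
    horner-ẑ zero    c const = ≡.refl , λ { (suc i) _ → const 0 i }
    horner-ẑ (suc d) c const with lead , above ← horner-ẑ d (c ∘ suc) (λ j → const (suc j)) =
      ≡.trans (≡.cong₂ ℤ._+_ (const 0 d) (≡.cong₂ ℤ._+_ (above (suc d) ℕ.≤-refl) lead))
        (≡.trans (ℤ.+-identityˡ _) (ℤ.+-identityˡ _)) ,
      λ { (suc i) (s≤s d<i) → ≡.cong₂ ℤ._+_ (const 0 i) (≡.cong₂ ℤ._+_ (above (suc i) (ℕ.<-trans d<i (ℕ.n<1+n i))) (above i d<i)) }

  descend : (P : ℕ → Set) → ∀ t → (∀ d → d < t → (∀ j → d < j → j < t → P j) → P d) → ∀ j → j < t → P j
  descend P t step j j<t = go t j (ℕ.m∸n≤m t j) j<t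
    where
    go : ∀ s j → t ∸ j ≤ s → j < t → P j
    go zero    j t∸j≤s j<t = contradiction (ℕ.n≤0⇒n≡0 t∸j≤s) (ℕ.m>n⇒m∸n≢0 j<t)
    go (suc s) j t∸j≤s j<t = step j j<t λ j′ j<j′ j′<t →
      go s j′ (ℕ.≤-pred (ℕ.<-≤-trans (ℕ.∸-monoʳ-< j<j′ (ℕ.<⇒≤ j′<t)) t∸j≤s)) j′<t

  module _ {p : ℕ} (pr : Prime p) (F e : ℕ) .{{_ : NonZero e}} where
    private
      instance
        p≢0 : NonZero p
        p≢0 = prime⇒nonZero pr
    open Act (series p)
    open Series pr
    open Evaluation p
    open Horner (series p)
    open Node p

    curve : ∀ {n′} → Vec ℕ n′ → Vec Op (suc n′)
    curve κ = ẑ ∷ Vec.map (node F e 1) κ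

    private
      D = p ^ (e ℕ.+ F)

    -- Leading coefficients are killed variable by variable; an exponent j of a variable other than the first
    -- costs π^((e + 1) j), which is why the simplex is weighted.
    vanishing⇒zero : ∀ n′ t → t ≤ D → (w : List (ℤ × Vec ℕ (suc n′))) → map proj₂ w ≡ simplex (suc e) n′ t →
      (∀ (κ : Vec ℕ n′) → VecAll.All (_< t) κ → Vanishes t (evaluate w (curve κ))) → All (λ (c , _) → + p ∣ c) w
    vanishing⇒zero zero t t≤D w w≡ v
      with ws , ≡.refl , ws≡ ← split-concatUpTo t _∷_ (λ _ → [] ∷ []) w w≡
      = All-concatUpTo t _ λ j j<t → All.map⁺ (descend P t step j j<t)
      where
      P : ℕ → Set
      P j = All (λ (c , _) → + p ∣ c) (ws j)
      single : ∀ (u : List (ℤ × Vec ℕ 0)) → map proj₂ u ≡ [] ∷ [] → + p ∣ evaluate u [] 0 → All (λ (c , _) → + p ∣ c) u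
      single ((c , []) ∷ []) _ p∣ = ≡.subst (+ p ∣_) (≡.trans (ℤ.+-identityʳ (c ℤ.* 1ℤ)) (ℤ.*-identityʳ c)) p∣ ∷ []
      step : ∀ d → d < t → (∀ j → d < j → j < t → P j) → P d
      step d d<t above = single (ws d) (ws≡ d d<t) (≡.subst (+ p ∣_)
        (proj₁ (horner-ẑ d (λ j → evaluate (ws j) []) (λ j → constant-coefficient (ws j))))
        (below (Vanishes-≈ (sym (evaluate-blocks t _∷_ ws (ẑ ∷ []) [] ẑ (λ j v → R.refl) d d<t above)) (v [] VecAll.[])) d d<t))
    vanishing⇒zero (suc n′) t t≤D w w≡ v
      with ws , ≡.refl , ws≡ ← split-concatUpTo t insert₁ (λ j → simplex (suc e) n′ (t ∸ suc e ℕ.* j)) w w≡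
      = All-concatUpTo t _ λ j j<t → All.map⁺ (descend P t step j j<t)
      where
      P : ℕ → Set
      P j = All (λ (c , _) → + p ∣ c) (ws j)
      step : ∀ d → d < t → (∀ j → d < j → j < t → P j) → P d
      step d d<t above = vanishing⇒zero n′ (t ∸ suc e ℕ.* d) (ℕ.≤-trans (ℕ.m∸n≤m t (suc e ℕ.* d)) t≤D) (ws d) (ws≡ d d<t)
        λ κ κ< → leading-coefficient pr F e t d (λ j → evaluate (ws j) (curve κ)) (ℕ.<-≤-trans d<t t≤D)
          λ i i≤d → Vanishes-≈ (sym (evaluate-blocks t insert₁ ws (curve (i ∷ κ)) (curve κ) (node F e 1 i)
            (λ { j (j₁ ∷ js) → swap (ẑ ⇑ j₁) (node F e 1 i ⇑ j) (monomial (Vec.map (node F e 1) κ) js) }) d d<t above))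
            (v (i ∷ κ) (ℕ.≤-<-trans i≤d d<t VecAll.∷ VecAll.map (λ κ<t → ℕ.<-≤-trans κ<t (ℕ.m∸n≤m t (suc e ℕ.* d))) κ<))
        where
        swap : ∀ a b c → a ⊡ (b ⊡ c) ≋ b ⊡ (a ⊡ c)
        swap a b c = R.trans (R.sym (R.*-assoc a b c)) (R.trans (R.*-congʳ {c} (R.*-comm a b)) (R.*-assoc b a c))

-- A triangular basis of the vanishing conditions, chosen by increasing order

module Greedy where

  open import Defs using (allVectors; ∈-allVectors; m≤b^m)
  open Kernel
  open Mods
  open Newton
  open Nodes
  open Simplex
  open import Data.Fin.Base as Fin using (Fin; zero; suc; toℕ)
  import Data.Fin.Properties as Fin
  open import Data.Integer.Base as ℤ using (ℤ; +_; 0ℤ)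
  open import Data.Integer.Divisibility.Signed
  import Data.Integer.Properties as ℤ
  import Data.Integer.Tactic.RingSolver as ℤSolver
  open import Data.List.Base using (List; []; _∷_; _++_; map; length; filter; lookup)
  open import Data.List.Membership.Propositional using (_∈_)
  open import Data.List.Membership.Propositional.Properties using (∈-map⁺)
  open import Data.List.Properties using (filter-++; length-++; filter-all)
  open import Data.List.Relation.Unary.All as All using (All; []; _∷_)
  import Data.List.Relation.Unary.All.Properties as All
  open import Data.List.Relation.Unary.Any using (here; there)
  open import Data.Nat.Base as ℕ using (ℕ; zero; suc; NonZero; _≤_; _<_; z≤n; s≤s; _^_)
  open import Data.Nat.Primality using (Prime; prime⇒nonTrivial; prime⇒nonZero)
  import Data.Nat.Properties as ℕ
  open import Data.Product using (∃; _×_; _,_; proj₁; proj₂)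
  open import Data.Vec.Base as Vec using (Vec; []; _∷_)
  open import Data.Vec.Functional using (Vector)
  import Data.Vec.Relation.Unary.All as VecAll
  open import Function.Base using (_∘_)
  open import Relation.Binary.PropositionalEquality as ≡ using (_≡_; _≢_; _≗_)
  open import Relation.Nullary using (¬_; Dec; yes; no)
  open import Relation.Nullary.Decidable using (decidable-stable; ¬¬-excluded-middle)

  module Triangular (p : ℕ) {L W : Set} (φ : L → W → ℤ) where

    Kills : List (L × W) → W → Set
    Kills B w = All (λ (l , _) → + p ∣ φ l w) B

    -- Each functional comes with a witness on which it is nonzero and which the functionals after
    -- it kill. Modulo p the matrix of values is triangular with nonzero diagonal, a property
    -- inherited by sublists.
    data IsTriangular : List (L × W) → Set where
      []  : IsTriangular []
      _∷_ : ∀ {l w B} → (¬ + p ∣ φ l w) × Kills B w → IsTriangular B → IsTriangular ((l , w) ∷ B)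

    IsTriangular-filter : ∀ {P : L × W → Set} (P? : ∀ b → Dec (P b)) {B} → IsTriangular B → IsTriangular (filter P? B)
    IsTriangular-filter P? [] = []
    IsTriangular-filter P? (_∷_ {l} {w} (p∤ , kills) B) with P? (l , w)
    ... | yes _ = (p∤ , All.filter⁺ P? kills) ∷ IsTriangular-filter P? B
    ... | no  _ = IsTriangular-filter P? B

    -- Whether some w detects l is a question about infinitely many polynomials, so the choice is
    -- made under double negation. This suffices because the claims drawn from it are inequalities
    -- between natural numbers, which are stable.
    extend : ∀ ls {B} → IsTriangular B → ¬ ¬ ∃ λ B′ → IsTriangular (B′ ++ B) ×
      All (λ (l , _) → l ∈ ls) B′ × (∀ w → Kills (B′ ++ B) w → All (λ l → + p ∣ φ l w) ls)
    extend []       tri k = k ([] , tri , [] , λ _ _ → [])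
    extend (l ∷ ls) {B} tri k = extend ls tri λ (B′ , tri′ , new , maximal) →
      ¬¬-excluded-middle {A = ∃ λ w → (¬ + p ∣ φ l w) × Kills (B′ ++ B) w} λ
        { (yes (w , p∤ , kills)) → k ((l , w) ∷ B′ , (p∤ , kills) ∷ tri′ , here ≡.refl ∷ All.map there new
                                     , λ { w (p∣ ∷ kills) → p∣ ∷ maximal w kills })
        ; (no ∄) → k (B′ , tri′ , All.map there new
                     , λ w kills → decidable-stable (+ p ∣? φ l w) (λ p∤ → ∄ (w , p∤ , kills)) ∷ maximal w kills) }

    module _ (level : L → ℕ) (labels : ℕ → List L) (labels-level : ∀ t → All (λ l → level l ≡ t) (labels t))
             (R : ℕ → ℕ) where

      Complete : ℕ → List (L × W) → Set
      Complete t B = ∀ w → Kills B w → ∀ s → s < t → All (λ l → + p ∣ φ l w) (labels s)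

      restrict : ℕ → List (L × W) → List (L × W)
      restrict t = filter (λ (l , _) → level l ℕ.<? t)

      -- Extending level by level makes the functionals of level < t in B a maximal independent family
      -- among all those of level < t, simultaneously for all t ≤ T.
      triangular-basis : ∀ T → (∀ t → t ≤ T → ∀ B → Complete t B → R t ≤ length B) →
        ¬ ¬ ∃ λ B → IsTriangular B × (∀ t → t ≤ T → R t ≤ length (restrict t B))
      triangular-basis T large k = go T large λ (B , tri , _ , _ , bound) → k (B , tri , bound)
        where
        Large : ℕ → Set
        Large T = ∀ t → t ≤ T → ∀ B → Complete t B → R t ≤ length B
        Good : ℕ → List (L × W) → Set
        Good T B = IsTriangular B × All (λ (l , _) → level l < T) B × Complete T B ×
                   (∀ t → t ≤ T → R t ≤ length (restrict t B))
        step : ∀ T → Large (suc T) → ∀ {B} B′ → Good T B → IsTriangular (B′ ++ B) → All (λ (l , _) → l ∈ labels T) B′ →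
          (∀ w → Kills (B′ ++ B) w → All (λ l → + p ∣ φ l w) (labels T)) → Good (suc T) (B′ ++ B)
        step T large {B} B′ (_ , levels , complete , bound) tri′ new maximal = tri′ , levels′ , complete′ , bound′
          where
          open ℕ.≤-Reasoning
          levels′ : All (λ (l , _) → level l < suc T) (B′ ++ B)
          levels′ = All.++⁺ (All.map (λ l∈ → s≤s (ℕ.≤-reflexive (All.lookup (labels-level T) l∈))) new)
                            (All.map ℕ.m<n⇒m<1+n levels)
          complete′ : Complete (suc T) (B′ ++ B)
          complete′ w kills s s<1+T with s ℕ.≟ T
          ... | yes ≡.refl = maximal w kills
          ... | no  s≢T    = complete w (All.++⁻ʳ B′ kills) s (ℕ.≤∧≢⇒< (ℕ.≤-pred s<1+T) s≢T)
          bound′ : ∀ t → t ≤ suc T → R t ≤ length (restrict t (B′ ++ B))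
          bound′ t t≤1+T with t ℕ.≟ suc T
          ... | yes ≡.refl = ℕ.≤-trans (large (suc T) ℕ.≤-refl (B′ ++ B) complete′)
                               (ℕ.≤-reflexive (≡.cong length (≡.sym (filter-all (λ (l , _) → level l ℕ.<? suc T) levels′))))
          ... | no  t≢1+T  = begin
            R t                                            ≤⟨ bound t (ℕ.≤-pred (ℕ.≤∧≢⇒< t≤1+T t≢1+T)) ⟩
            length (restrict t B)                          ≤⟨ ℕ.m≤n+m _ (length (restrict t B′)) ⟩
            length (restrict t B′) ℕ.+ length (restrict t B) ≡⟨ length-++ (restrict t B′) ⟨
            length (restrict t B′ ++ restrict t B)         ≡⟨ ≡.cong length (filter-++ (λ (l , _) → level l ℕ.<? t) B′ B) ⟨
            length (restrict t (B′ ++ B))                  ∎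
        go : ∀ T → Large T → ¬ ¬ ∃ (Good T)
        go zero    large k = k ([] , [] , [] , (λ _ _ _ ()) , λ { zero z≤n → large 0 z≤n [] λ _ _ _ () })
        go (suc T) large k = go T (λ t t≤T → large t (ℕ.m≤n⇒m≤1+n t≤T)) λ (B , good) →
          extend (labels T) (proj₁ good) λ (B′ , tri′ , new , maximal) →
            k (B′ ++ B , step T large B′ good tri′ new maximal)

  withCoefficients : ∀ {n} (J : List (Vec ℕ n)) → Vector ℤ (length J) → List (ℤ × Vec ℕ n)
  withCoefficients []      x = []
  withCoefficients (v ∷ J) x = (x zero , v) ∷ withCoefficients J (x ∘ suc)

  withCoefficients-exponents : ∀ {n} (J : List (Vec ℕ n)) x → map proj₂ (withCoefficients J x) ≡ J
  withCoefficients-exponents []      x = ≡.refl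
  withCoefficients-exponents (v ∷ J) x = ≡.cong (v ∷_) (withCoefficients-exponents J (x ∘ suc))

  withCoefficients-All : ∀ {n} {P : ℤ → Set} (J : List (Vec ℕ n)) x →
    All (λ (c , _) → P c) (withCoefficients J x) → ∀ j → P (x j)
  withCoefficients-All (v ∷ J) x (px ∷ all) zero    = px
  withCoefficients-All (v ∷ J) x (px ∷ all) (suc j) = withCoefficients-All J (x ∘ suc) all j

  module _ (p : ℕ) where
    open Evaluation p

    coefficient : ∀ {n} (J : List (Vec ℕ n)) → Vec Op n → ℕ → Linear (length J)
    coefficient J γs i = record { fun = fun J ; cong-≗ = fun-cong J ; +-homo = fun-+ J }
      where
      fun : ∀ J → Vector ℤ (length J) → ℤ
      fun J x = evaluate (withCoefficients J x) γs i
      a : Vec ℕ _ → ℤ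
      a v = Act.act (series p) (monomial γs v) one i
      fun-cong : ∀ J {x y} → x ≗ y → fun J x ≡ fun J y
      fun-cong []      eq = ≡.refl
      fun-cong (v ∷ J) eq = ≡.cong₂ (λ c s → c ℤ.* a v ℤ.+ s) (eq zero) (fun-cong J (eq ∘ suc))
      fun-+ : ∀ J x y → fun J (λ j → x j ℤ.+ y j) ≡ fun J x ℤ.+ fun J y
      fun-+ []      x y = ≡.refl
      fun-+ (v ∷ J) x y = ≡.trans (≡.cong (ℤ._+_ ((x zero ℤ.+ y zero) ℤ.* a v)) (fun-+ J (x ∘ suc) (y ∘ suc)))
        (lemma (x zero) (y zero) (a v) (fun J (x ∘ suc)) (fun J (y ∘ suc)))
        where
        lemma : ∀ x y a s t → (x ℤ.+ y) ℤ.* a ℤ.+ (s ℤ.+ t) ≡ (x ℤ.* a ℤ.+ s) ℤ.+ (y ℤ.* a ℤ.+ t)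
        lemma = ℤSolver.solve-∀

  module Basis {p : ℕ} (pr : Prime p) (e : ℕ) .{{_ : NonZero e}} (n′ T : ℕ) where
    open Evaluation p
    open Series pr
    private
      instance
        p>1 : ℕ.NonTrivial p
        p>1 = prime⇒nonTrivial pr

    -- The pair (κ, i) stands for the coefficient of πⁱ along the curve with node indices κ; i is
    -- its level.
    Label : Set
    Label = Vec (Fin T) n′ × ℕ

    labelled : Vec (Fin T) n′ → Vec Op (suc n′)
    labelled κ = curve pr T e (Vec.map toℕ κ)

    functional : Label → List (ℤ × Vec ℕ (suc n′)) → ℤ
    functional (κ , i) w = evaluate w (labelled κ) i

    open Triangular p functional public

    -- A complete family smaller than the simplex would have a common zero with exponents in the
    -- simplex that is primitive modulo p. By completeness this polynomial vanishes to order t along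
    -- all curves with indices below t, against `vanishing⇒zero`.
    basis : ¬ ¬ ∃ λ B → IsTriangular B ×
      (∀ t → t ≤ T → length (simplex (suc e) n′ t) ≤ length (filter (λ ((_ , i) , _) → i ℕ.<? t) B))
    basis = triangular-basis proj₂ (λ i → map (_, i) (allVectors T n′)) (λ t → All.map⁺ (All.universal (λ _ → ≡.refl) _))
      (λ t → length (simplex (suc e) n′ t)) T large
      where
      -- With F = T digits beyond the first e there are p^(e+T) ≥ T nodes, enough for every order t
      -- ≤ T.
      T≤ : T ≤ p ^ (e ℕ.+ T)
      T≤ = ℕ.≤-trans (m≤b^m p T) (ℕ.^-monoʳ-≤ p {{prime⇒nonZero pr}} (ℕ.m≤n+m T e))
      toFin : ∀ {n t} → t ≤ T → (κ : Vec ℕ n) → VecAll.All (_< t) κ → ∃ λ (κ′ : Vec (Fin T) n) → Vec.map toℕ κ′ ≡ κ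
      toFin t≤T []      VecAll.[] = [] , ≡.refl
      toFin t≤T (k ∷ κ) (k<t VecAll.∷ κ<t) with κ′ , eq ← toFin t≤T κ κ<t =
        Fin.fromℕ< (ℕ.<-≤-trans k<t t≤T) ∷ κ′ , ≡.cong₂ _∷_ (Fin.toℕ-fromℕ< _) eq
      large : ∀ t → t ≤ T → ∀ B →
        (∀ w → Kills B w → ∀ s → s < t → All (λ l → + p ∣ functional l w) (map (_, s) (allVectors T n′))) →
        length (simplex (suc e) n′ t) ≤ length B
      large t t≤T B complete = decidable-stable (_ ℕ.≤? _) λ B≱ → impossible (ℕ.≰⇒> B≱)
        where
        J = simplex (suc e) n′ t
        impossible : ¬ length B < length J
        impossible B<J
          with x , solves , j , p∤x ← primitive-kernel p B<J (λ b → let ((κ , i) , _) = lookup B b in coefficient p J (labelled κ) i)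
          = p∤x (withCoefficients-All J x (vanishing⇒zero pr T e n′ t (ℕ.≤-trans t≤T T≤) w (withCoefficients-exponents J x) vanish) j)
          where
          w = withCoefficients J x
          kills : ∀ B → (∀ b → functional (proj₁ (lookup B b)) w ≡ 0ℤ) → Kills B w
          kills []      eq = []
          kills (_ ∷ B) eq = ≡.subst (+ p ∣_) (≡.sym (eq zero)) (divides 0ℤ ≡.refl) ∷ kills B (eq ∘ suc)
          vanish : ∀ κ → VecAll.All (_< t) κ → Vanishes t (evaluate w (curve pr T e κ))
          vanish κ κ<t with κ′ , ≡.refl ← toFin t≤T κ κ<t = vanishes λ i i<t →
            All.lookup (complete w (kills B solves) i i<t) (∈-map⁺ (_, i) (∈-allVectors κ′))

-- The cyclotomic integers as recurrent sequences, and linear systems over them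

module Recurrence where

  open Kernel using (Linear; primitive-kernel)
  open Mods
  open Newton
  open import Algebra.Bundles using (AbelianGroup)
  open import Data.Fin.Base as Fin using (Fin; zero; suc; toℕ; combine; remainder)
  import Data.Fin.Properties as Fin
  open import Data.Integer.Base as ℤ using (ℤ; +_; 0ℤ; 1ℤ)
  open import Data.Integer.Divisibility.Signed
  import Data.Integer.Properties as ℤ
  import Data.Integer.Tactic.RingSolver as ℤSolver
  open import Data.Nat.Base as ℕ using (ℕ; zero; suc; NonZero; _≤_; _<_; z≤n; s≤s; _^_; _∸_)
  open import Data.Nat.Coprimality using (coprime-divisor; gcd≡1⇒coprime)
  import Data.Nat.Divisibility as ℕ∣
  open import Data.Nat.GCD using (gcd; gcd-GCD; gcd[m,n]∣m; gcd[m,n]∣n; module Bézout)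
  open import Data.Nat.Induction using (<-rec)
  open import Data.Nat.Primality using (Prime; prime⇒nonTrivial; prime⇒nonZero; prime⇒irreducible)
  import Data.Nat.Properties as ℕ
  import Data.Nat.Tactic.RingSolver as ℕSolver
  open import Data.Product using (∃; _×_; _,_; proj₁; proj₂)
  open import Data.Sum using (_⊎_; inj₁; inj₂)
  open import Data.Vec.Functional using (Vector)
  open import Function.Base using (_∘_)
  open import Level using (0ℓ)
  open import Relation.Binary.Definitions using (tri<; tri≈; tri>)
  open import Relation.Binary.PropositionalEquality as ≡ using (_≡_; _≢_; _≗_)
  open import Relation.Nullary using (¬_; yes; no; contradiction)
  open import Relation.Nullary.Decidable using (decidable-stable; ¬?)

  ∑ : ℕ → (ℕ → ℤ) → ℤ
  ∑ zero    f = 0ℤ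
  ∑ (suc n) f = ∑ n f ℤ.+ f n

  ∑-cong : ∀ n {f g} → (∀ i → f i ≡ g i) → ∑ n f ≡ ∑ n g
  ∑-cong zero    eq = ≡.refl
  ∑-cong (suc n) eq = ≡.cong₂ ℤ._+_ (∑-cong n eq) (eq n)

  ∑-zero : ∀ n {f} → (∀ i → i < n → f i ≡ 0ℤ) → ∑ n f ≡ 0ℤ
  ∑-zero zero    eq = ≡.refl
  ∑-zero (suc n) eq = ≡.cong₂ ℤ._+_ (∑-zero n λ i i<n → eq i (ℕ.m<n⇒m<1+n i<n)) (eq n (ℕ.n<1+n n))

  ∑-+ : ∀ n f g → ∑ n (λ i → f i ℤ.+ g i) ≡ ∑ n f ℤ.+ ∑ n g
  ∑-+ zero    f g = ≡.refl
  ∑-+ (suc n) f g = ≡.trans (≡.cong (ℤ._+ (f n ℤ.+ g n)) (∑-+ n f g)) (lemma (∑ n f) (∑ n g) (f n) (g n))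
    where
    lemma : ∀ a b c d → a ℤ.+ b ℤ.+ (c ℤ.+ d) ≡ a ℤ.+ c ℤ.+ (b ℤ.+ d)
    lemma = ℤSolver.solve-∀

  ∑-neg : ∀ n f → ∑ n (λ i → ℤ.- f i) ≡ ℤ.- ∑ n f
  ∑-neg zero    f = ≡.refl
  ∑-neg (suc n) f = ≡.trans (≡.cong (ℤ._+ ℤ.- f n) (∑-neg n f)) (≡.sym (ℤ.neg-distrib-+ (∑ n f) (f n)))

  ∑-const : ∀ n c → ∑ n (λ _ → c) ≡ + n ℤ.* c
  ∑-const zero    c = ≡.sym (ℤ.*-zeroˡ c)
  ∑-const (suc n) c = ≡.trans (≡.cong (ℤ._+ c) (∑-const n c)) (lemma (+ n) c)
    where
    lemma : ∀ n c → n ℤ.* c ℤ.+ c ≡ (1ℤ ℤ.+ n) ℤ.* c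
    lemma = ℤSolver.solve-∀

  ∑-* : ∀ c n f → ∑ n (λ i → c ℤ.* f i) ≡ c ℤ.* ∑ n f
  ∑-* c zero    f = ≡.sym (ℤ.*-zeroʳ c)
  ∑-* c (suc n) f = ≡.trans (≡.cong (ℤ._+ c ℤ.* f n) (∑-* c n f)) (≡.sym (ℤ.*-distribˡ-+ c (∑ n f) (f n)))

  ∑-head : ∀ n f → ∑ (suc n) f ≡ f 0 ℤ.+ ∑ n (f ∘ suc)
  ∑-head zero    f = ℤ.+-comm 0ℤ (f 0)
  ∑-head (suc n) f = ≡.trans (≡.cong (ℤ._+ f (suc n)) (∑-head n f)) (ℤ.+-assoc (f 0) (∑ n (f ∘ suc)) (f (suc n)))

  ∣prime^⇒ : ∀ {p} → Prime p → ∀ k {c} → c ℕ∣.∣ p ^ k → c ≡ 1 ⊎ p ℕ∣.∣ c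
  ∣prime^⇒ pr zero    c∣ = inj₁ (ℕ∣.∣1⇒≡1 c∣)
  ∣prime^⇒ {p} pr (suc k) {c} c∣ with prime⇒irreducible pr (gcd[m,n]∣n c p)
  ... | inj₁ gcd≡1 = ∣prime^⇒ pr k (coprime-divisor (gcd≡1⇒coprime gcd≡1) c∣)
  ... | inj₂ gcd≡p = inj₂ (≡.subst (ℕ∣._∣ c) gcd≡p (gcd[m,n]∣m c p))

  ∣prime^-proper : ∀ {p} (pr : Prime p) k {g} → g ℕ∣.∣ p ^ suc k → g ≢ p ^ suc k → g ℕ∣.∣ p ^ k
  ∣prime^-proper {p} pr k {g} (ℕ∣.divides c eq) g≢ with ∣prime^⇒ pr (suc k) {c} (ℕ∣.divides g (≡.trans eq (ℕ.*-comm c g)))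
  ... | inj₁ c≡1 = contradiction (≡.sym (≡.trans eq (≡.trans (≡.cong (ℕ._* g) c≡1) (ℕ.*-identityˡ g)))) g≢
  ... | inj₂ (ℕ∣.divides d c≡dp) = ℕ∣.divides d (ℕ.*-cancelˡ-≡ _ _ p {{prime⇒nonZero pr}}
          (≡.trans eq (≡.trans (≡.cong (ℕ._* g) c≡dp) (lemma d p g))))
    where
    lemma : ∀ d p g → d ℕ.* p ℕ.* g ≡ p ℕ.* (d ℕ.* g)
    lemma = ℕSolver.solve-∀

  module Seq {p : ℕ} (pr : Prime p) (k : ℕ) where
    private
      instance
        p≢0 : NonZero p
        p≢0 = prime⇒nonZero pr
        p>1 : ℕ.NonTrivial p
        p>1 = prime⇒nonTrivial pr
      1<p : 1 < p
      1<p = ℕ.nonTrivial⇒n>1 p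

    -- φ is Euler's function of N = pᵏ⁺¹: the degree of the recurrence and the rank of `Seq`.
    q N φ : ℕ
    q = p ^ k
    N = p ^ suc k
    φ = ℕ.pred p ℕ.* q

    -- Integer sequences annihilated by the p^{k+1}-th cyclotomic polynomial 1 + ζ^q + … + ζ^{(p-1)q} in the shift ζ.
    record Seq : Set where
      field
        seq : ℕ → ℤ
        rec : ∀ s → ∑ p (λ i → seq (s ℕ.+ i ℕ.* q)) ≡ 0ℤ
    open Seq public

    infix 4 _≈ᵛ_
    record _≈ᵛ_ (u v : Seq) : Set where
      constructor mkᵛ
      field at : ∀ s → seq u s ≡ seq v s
    open _≈ᵛ_ public

    seqGroup : AbelianGroup 0ℓ 0ℓ
    seqGroup = record
      { Carrier = Seq ; _≈_ = _≈ᵛ_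
      ; _∙_ = λ u v → record
        { seq = λ s → seq u s ℤ.+ seq v s
        ; rec = λ s → ≡.trans (∑-+ p _ _) (≡.cong₂ ℤ._+_ (rec u s) (rec v s)) }
      ; ε = record { seq = λ _ → 0ℤ ; rec = λ s → ∑-zero p λ _ _ → ≡.refl }
      ; _⁻¹ = λ u → record
        { seq = λ s → ℤ.- seq u s
        ; rec = λ s → ≡.trans (∑-neg p _) (≡.cong ℤ.-_ (rec u s)) }
      ; isAbelianGroup = record
        { isGroup = record
          { isMonoid = record
            { isSemigroup = record
              { isMagma = record
                { isEquivalence = record
                  { refl = mkᵛ λ s → ≡.refl
                  ; sym = λ e → mkᵛ λ s → ≡.sym (at e s)
                  ; trans = λ e f → mkᵛ λ s → ≡.trans (at e s) (at f s) }
                ; ∙-cong = λ e f → mkᵛ λ s → ≡.cong₂ ℤ._+_ (at e s) (at f s) }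
              ; assoc = λ u v w → mkᵛ λ s → ℤ.+-assoc (seq u s) (seq v s) (seq w s) }
            ; identity = (λ u → mkᵛ λ s → ℤ.+-identityˡ (seq u s)) , (λ u → mkᵛ λ s → ℤ.+-identityʳ (seq u s)) }
          ; inverse = (λ u → mkᵛ λ s → ℤ.+-inverseˡ (seq u s)) , (λ u → mkᵛ λ s → ℤ.+-inverseʳ (seq u s))
          ; ⁻¹-cong = λ e → mkᵛ λ s → ≡.cong ℤ.-_ (at e s) }
        ; comm = λ u v → mkᵛ λ s → ℤ.+-comm (seq u s) (seq v s) } }

    module V = AbelianGroup seqGroup
      renaming (_∙_ to infixl 6 _+_; ε to 0#; _⁻¹ to infix 8 -_)

    shift : ℕ → Seq → Seq
    shift a u = record
      { seq = λ s → seq u (s ℕ.+ a)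
      ; rec = λ s → ≡.trans (∑-cong p λ i → ≡.cong (seq u) (lemma s (i ℕ.* q) a)) (rec u (s ℕ.+ a)) }
      where
      lemma : ∀ s t a → s ℕ.+ t ℕ.+ a ≡ s ℕ.+ a ℕ.+ t
      lemma = ℕSolver.solve-∀

    private
      p≡ : p ≡ suc (ℕ.pred p)
      p≡ = ≡.sym (ℕ.suc-pred p)

      ∑-first : ∀ f → ∑ p f ≡ f 0 ℤ.+ ∑ (ℕ.pred p) (f ∘ suc)
      ∑-first f = ≡.trans (≡.cong (λ n → ∑ n f) p≡) (∑-head (ℕ.pred p) f)

      ∑-last : ∀ f → ∑ p f ≡ ∑ (ℕ.pred p) f ℤ.+ f (ℕ.pred p)
      ∑-last f = ≡.cong (λ n → ∑ n f) p≡

      φ+q≡N : φ ℕ.+ q ≡ N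
      φ+q≡N = ≡.trans (ℕ.+-comm φ q) (≡.cong (ℕ._* q) (≡.sym p≡))

    seq-rec : ∀ u s → seq u (s ℕ.+ φ) ≡ ℤ.- ∑ (ℕ.pred p) (λ i → seq u (s ℕ.+ i ℕ.* q))
    seq-rec u s = ≡.trans (lemma (∑ (ℕ.pred p) (λ i → seq u (s ℕ.+ i ℕ.* q))) (seq u (s ℕ.+ φ)))
      (≡.trans (≡.cong (ℤ._+ ℤ.- ∑ (ℕ.pred p) (λ i → seq u (s ℕ.+ i ℕ.* q)))
        (≡.trans (≡.sym (∑-last λ i → seq u (s ℕ.+ i ℕ.* q))) (rec u s))) (ℤ.+-identityˡ _))
      where
      lemma : ∀ a b → b ≡ (a ℤ.+ b) ℤ.+ ℤ.- a
      lemma = ℤSolver.solve-∀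

    seq-zero : ∀ u → (∀ s → s < φ → seq u s ≡ 0ℤ) → ∀ s → seq u s ≡ 0ℤ
    seq-zero u initial = <-rec (λ s → seq u s ≡ 0ℤ) step
      where
      step : ∀ s → (∀ {r} → r < s → seq u r ≡ 0ℤ) → seq u s ≡ 0ℤ
      step s ih with s ℕ.<? φ
      ... | yes s<φ = initial s s<φ
      ... | no  s≮φ = ≡.subst (λ s → seq u s ≡ 0ℤ) s≡ (≡.trans (seq-rec u (s ∸ φ))
          (≡.cong ℤ.-_ (∑-zero (ℕ.pred p) λ i i<p′ → ih (≡.subst (s ∸ φ ℕ.+ i ℕ.* q <_) s≡
            (ℕ.+-monoʳ-< (s ∸ φ) (ℕ.*-monoˡ-< q {{ℕ.m^n≢0 p k}} i<p′))))))
        where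
        s≡ : s ∸ φ ℕ.+ φ ≡ s
        s≡ = ℕ.m∸n+n≡m (ℕ.≮⇒≥ s≮φ)

    -- From ζᴺ - 1 = (ζ^q - 1)(1 + ζ^q + ... + ζ^((p-1)q)).
    seq-periodic : ∀ u s → seq u (s ℕ.+ N) ≡ seq u s
    seq-periodic u s = ≡.trans (≡.cong (seq u) (≡.trans (≡.cong (s ℕ.+_) (≡.trans (≡.sym φ+q≡N) (ℕ.+-comm φ q)))
        (≡.sym (ℕ.+-assoc s q φ))))
      (≡.trans (seq-rec u (s ℕ.+ q)) (≡.trans (≡.cong ℤ.-_ (∑-cong (ℕ.pred p) λ i → ≡.cong (seq u) (ℕ.+-assoc s q (i ℕ.* q))))
        (≡.sym (≡.trans (lemma (seq u s) S) (≡.trans (≡.cong (ℤ._+ ℤ.- S) total) (ℤ.+-identityˡ (ℤ.- S)))))))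
      where
      S = ∑ (ℕ.pred p) (λ i → seq u (s ℕ.+ suc i ℕ.* q))
      lemma : ∀ a b → a ≡ (a ℤ.+ b) ℤ.+ ℤ.- b
      lemma = ℤSolver.solve-∀
      total : seq u s ℤ.+ S ≡ 0ℤ
      total = ≡.trans (≡.cong (λ r → seq u r ℤ.+ S) (≡.sym (ℕ.+-identityʳ s)))
        (≡.trans (≡.sym (∑-first λ i → seq u (s ℕ.+ i ℕ.* q))) (rec u s))

    private
      Period : Seq → ℕ → Set
      Period u d = ∀ s → seq u (s ℕ.+ d) ≡ seq u s

      Period-* : ∀ u {d} c → Period u d → Period u (c ℕ.* d)
      Period-* u zero    per s = ≡.cong (seq u) (ℕ.+-identityʳ s)
      Period-* u {d} (suc c) per s = ≡.trans (≡.cong (seq u) (≡.sym (ℕ.+-assoc s d (c ℕ.* d))))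
        (≡.trans (Period-* u c per (s ℕ.+ d)) (per s))

      Period-gcd : ∀ u m n → Period u m → Period u n → Period u (gcd m n)
      Period-gcd u m n per-m per-n with Bézout.identity (gcd-GCD m n)
      ... | Bézout.+- x y eq = λ s → ≡.trans (≡.sym (Period-* u y per-n (s ℕ.+ gcd m n)))
        (≡.trans (≡.cong (seq u) (≡.trans (ℕ.+-assoc s (gcd m n) (y ℕ.* n)) (≡.cong (s ℕ.+_) eq))) (Period-* u x per-m s))
      ... | Bézout.-+ x y eq = λ s → ≡.trans (≡.sym (Period-* u x per-m (s ℕ.+ gcd m n)))
        (≡.trans (≡.cong (seq u) (≡.trans (ℕ.+-assoc s (gcd m n) (x ℕ.* m)) (≡.cong (s ℕ.+_) eq))) (Period-* u y per-n s))

      -- The p terms of each relation coincide, so p u s = 0 in ℤ.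
      Period-q⇒0 : ∀ u → Period u q → ∀ s → seq u s ≡ 0ℤ
      Period-q⇒0 u per s with ℤ.i*j≡0⇒i≡0∨j≡0 (+ p) (≡.trans (≡.sym (∑-const p (seq u s)))
                                (≡.trans (∑-cong p λ i → ≡.sym (Period-* u i per s)) (rec u s)))
      ... | inj₁ p≡0 = contradiction (ℤ.+-injective p≡0) (ℕ.≢-nonZero⁻¹ p)
      ... | inj₂ eq = eq

      -- The sequence has the periods d and N, hence gcd(d, N). As 0 < d < N, this is a proper
      -- divisor of pᵏ⁺¹ and so divides q = pᵏ, and `Period-q⇒0` applies.
      shift-torsion-free′ : ∀ u t d → t ℕ.+ d < N → d ≢ 0 → (∀ s → seq u (s ℕ.+ t) ≡ seq u (s ℕ.+ (t ℕ.+ d))) → u ≈ᵛ V.0#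
      shift-torsion-free′ u t d <N d≢0 eq = mkᵛ (Period-q⇒0 u per-q)
        where
        N′ = ℕ.pred N
        -- The hypothesis speaks only of indices from t on. Replacing s by s + t (N - 1) moves them
        -- by the period tN and so covers every s.
        per-d : Period u d
        per-d s = ≡.trans (≡.sym (per-tN (s ℕ.+ d))) (≡.trans (≡.cong (seq u) (lemma₁ s d t N′ N N≡))
          (≡.trans (≡.sym (eq (s ℕ.+ t ℕ.* N′))) (≡.trans (≡.cong (seq u) (lemma₂ s t N′ N N≡)) (per-tN s))))
          where
          per-tN = Period-* u t (seq-periodic u)
          N≡ : N ≡ suc N′
          N≡ = ≡.sym (ℕ.suc-pred N {{ℕ.m^n≢0 p (suc k)}})
          lemma₁ : ∀ s d t N′ N → N ≡ suc N′ → s ℕ.+ d ℕ.+ t ℕ.* N ≡ s ℕ.+ t ℕ.* N′ ℕ.+ (t ℕ.+ d)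
          lemma₁ s d t N′ .(suc N′) ≡.refl = arith s d t N′
            where
            arith : ∀ s d t N′ → s ℕ.+ d ℕ.+ t ℕ.* (1 ℕ.+ N′) ≡ s ℕ.+ t ℕ.* N′ ℕ.+ (t ℕ.+ d)
            arith = ℕSolver.solve-∀
          lemma₂ : ∀ s t N′ N → N ≡ suc N′ → s ℕ.+ t ℕ.* N′ ℕ.+ t ≡ s ℕ.+ t ℕ.* N
          lemma₂ s t N′ .(suc N′) ≡.refl = arith s t N′
            where
            arith : ∀ s t N′ → s ℕ.+ t ℕ.* N′ ℕ.+ t ≡ s ℕ.+ t ℕ.* (1 ℕ.+ N′)
            arith = ℕSolver.solve-∀
        g≢N : gcd d N ≢ N
        g≢N g≡N = ℕ.<⇒≱ (ℕ.≤-<-trans (ℕ.m≤n+m d t) <N)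
          (ℕ.≤-trans (ℕ.≤-reflexive (≡.sym g≡N)) (ℕ∣.∣⇒≤ {{ℕ.≢-nonZero d≢0}} (gcd[m,n]∣m d N)))
        per-q : Period u q
        per-q with ∣prime^-proper pr k (gcd[m,n]∣n d N) g≢N
        ... | ℕ∣.divides c q≡cg = ≡.subst (Period u) (≡.sym q≡cg) (Period-* u c (Period-gcd u d N per-d (seq-periodic u)))

    -- In other words ζᵗ - ζˢ is a non-zero-divisor; this is how the distinctness of the powers of ζ
    -- enters.
    shift-torsion-free : ∀ u t s → t < N → s < N → t ≢ s → shift t u ≈ᵛ shift s u → u ≈ᵛ V.0#
    shift-torsion-free u t s t<N s<N t≢s e with ℕ.<-cmp t s
    ... | tri≈ _ t≡s _ = contradiction t≡s t≢s
    ... | tri< t<s _ _ = shift-torsion-free′ u t (s ∸ t) (≡.subst (_< N) (≡.sym s≡) s<N) (ℕ.m>n⇒m∸n≢0 t<s)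
        λ r → ≡.trans (at e r) (≡.cong (λ s → seq u (r ℕ.+ s)) (≡.sym s≡))
      where
      s≡ : t ℕ.+ (s ∸ t) ≡ s
      s≡ = ℕ.m+[n∸m]≡n (ℕ.<⇒≤ t<s)
    ... | tri> _ _ s<t = shift-torsion-free′ u s (t ∸ s) (≡.subst (_< N) (≡.sym t≡) t<N) (ℕ.m>n⇒m∸n≢0 s<t)
        λ r → ≡.trans (≡.sym (at e r)) (≡.cong (λ t → seq u (r ℕ.+ t)) (≡.sym t≡))
      where
      t≡ : s ℕ.+ (t ∸ s) ≡ t
      t≡ = ℕ.m+[n∸m]≡n (ℕ.<⇒≤ s<t)

    -- The reduction of Seq modulo p and modulo 1 - ζ.
    ρ : Seq → ℤ
    ρ u = ∑ p (λ i → ∑ (i ℕ.* q) (seq u))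

    ρ-cong : ∀ {u v} → u ≈ᵛ v → ρ u ≡ ρ v
    ρ-cong e = ∑-cong p λ i → ∑-cong (i ℕ.* q) (at e)

    ρ-+ : ∀ u v → ρ (u V.+ v) ≡ ρ u ℤ.+ ρ v
    ρ-+ u v = ≡.trans (∑-cong p λ i → ∑-+ (i ℕ.* q) (seq u) (seq v)) (∑-+ p _ _)

    private
      ∑-tele : ∀ n f → ∑ n (f ∘ suc) ≡ ∑ n f ℤ.+ (f n ℤ.- f 0)
      ∑-tele zero    f = ≡.sym (≡.trans (ℤ.+-identityˡ _) (ℤ.+-inverseʳ (f 0)))
      ∑-tele (suc n) f = ≡.trans (≡.cong (ℤ._+ f (suc n)) (∑-tele n f)) (lemma (∑ n f) (f n) (f 0) (f (suc n)))
        where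
        lemma : ∀ a b c d → a ℤ.+ (b ℤ.- c) ℤ.+ d ≡ a ℤ.+ b ℤ.+ (d ℤ.- c)
        lemma = ℤSolver.solve-∀

    -- The inner sums telescope, so the difference is Σ (u(iq) - u 0). The first part is 0 by the
    -- recurrence, and the second is -p u 0.
    ρ-shift : ∀ u → _≡ₚ_ p (ρ (shift 1 u)) (ρ u)
    ρ-shift u = divides (ℤ.- seq u 0) (begin
      ρ (shift 1 u) ℤ.- ρ u
        ≡⟨ ≡.cong (ℤ._- ρ u) (∑-cong p λ i → ≡.trans (∑-cong (i ℕ.* q) λ s → ≡.cong (seq u) (ℕ.+-comm s 1))
             (∑-tele (i ℕ.* q) (seq u))) ⟩
      ∑ p (λ i → ∑ (i ℕ.* q) (seq u) ℤ.+ (seq u (i ℕ.* q) ℤ.- seq u 0)) ℤ.- ρ u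
        ≡⟨ ≡.cong (ℤ._- ρ u) (≡.trans (∑-+ p _ _) (≡.cong (ℤ._+_ (ρ u)) (∑-+ p _ _))) ⟩
      ρ u ℤ.+ (∑ p (λ i → seq u (i ℕ.* q)) ℤ.+ ∑ p (λ _ → ℤ.- seq u 0)) ℤ.- ρ u
        ≡⟨ ≡.cong₂ (λ a b → ρ u ℤ.+ (a ℤ.+ b) ℤ.- ρ u) (rec u 0) (∑-const p (ℤ.- seq u 0)) ⟩
      ρ u ℤ.+ (0ℤ ℤ.+ + p ℤ.* (ℤ.- seq u 0)) ℤ.- ρ u
        ≡⟨ lemma (ρ u) (+ p) (ℤ.- seq u 0) ⟩
      (ℤ.- seq u 0) ℤ.* + p ∎)
      where
      open ≡.≡-Reasoning
      lemma : ∀ r p a → r ℤ.+ (0ℤ ℤ.+ p ℤ.* a) ℤ.- r ≡ a ℤ.* p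
      lemma = ℤSolver.solve-∀

    -- If ρ u = c p then u = (ζ - 1) v, where v s = u 0 + … + u (s - 1) - c.
    antidifference : ∀ u → + p ∣ ρ u → ∃ λ v → ∀ s → seq v (suc s) ≡ seq v s ℤ.+ seq u s
    antidifference u (divides c ρu≡cp) = record { seq = f ; rec = f-rec } , λ s → lemma (∑ s (seq u)) (seq u s) c
      where
      f : ℕ → ℤ
      f s = ∑ s (seq u) ℤ.- c
      lemma : ∀ a b c → a ℤ.+ b ℤ.- c ≡ a ℤ.- c ℤ.+ b
      lemma = ℤSolver.solve-∀
      f-rec : ∀ s → ∑ p (λ i → f (s ℕ.+ i ℕ.* q)) ≡ 0ℤ
      f-rec zero = ≡.trans (∑-+ p _ _) (≡.trans (≡.cong₂ ℤ._+_ ρu≡cp (∑-const p (ℤ.- c))) (cancel c (+ p)))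
        where
        cancel : ∀ c p → c ℤ.* p ℤ.+ p ℤ.* (ℤ.- c) ≡ 0ℤ
        cancel = ℤSolver.solve-∀
      f-rec (suc s) = ≡.trans (∑-cong p λ i → lemma (∑ (s ℕ.+ i ℕ.* q) (seq u)) (seq u (s ℕ.+ i ℕ.* q)) c)
        (≡.trans (∑-+ p _ _) (≡.cong₂ ℤ._+_ (f-rec s) (rec u s)))

    private
      -- The companion map of the recurrence, which moves a window of φ consecutive terms forward by
      -- one. Only the positions r < φ carry meaning.
      step : (ℕ → ℤ) → ℕ → ℤ
      step c r with suc r ℕ.<? φ
      ... | yes _ = c (suc r)
      ... | no  _ = ℤ.- ∑ (ℕ.pred p) (λ i → c (i ℕ.* q))

      step-cong : ∀ {c d} → c ≗ d → step c ≗ step d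
      step-cong e r with suc r ℕ.<? φ
      ... | yes _ = e (suc r)
      ... | no  _ = ≡.cong ℤ.-_ (∑-cong (ℕ.pred p) λ i → e (i ℕ.* q))

      step-+ : ∀ c d r → step (λ s → c s ℤ.+ d s) r ≡ step c r ℤ.+ step d r
      step-+ c d r with suc r ℕ.<? φ
      ... | yes _ = ≡.refl
      ... | no  _ = ≡.trans (≡.cong ℤ.-_ (∑-+ (ℕ.pred p) _ _)) (ℤ.neg-distrib-+ (∑ (ℕ.pred p) (λ i → c (i ℕ.* q))) _)

      steps : ℕ → (ℕ → ℤ) → ℕ → ℤ
      steps zero    c = c
      steps (suc s) c = steps s (step c)

      steps-cong : ∀ s {c d} → c ≗ d → steps s c ≗ steps s d
      steps-cong zero    e = e
      steps-cong (suc s) e = steps-cong s (step-cong e)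

      steps-+ : ∀ s c d r → steps s (λ r → c r ℤ.+ d r) r ≡ steps s c r ℤ.+ steps s d r
      steps-+ zero    c d r = ≡.refl
      steps-+ (suc s) c d r = ≡.trans (steps-cong s (step-+ c d) r) (steps-+ s (step c) (step d) r)

      steps-initial : ∀ r c → r < φ → steps r c 0 ≡ c r
      steps-initial r c r<φ = ≡.trans (go r 0 c (≡.subst (_< φ) (≡.sym (ℕ.+-identityʳ r)) r<φ)) (≡.cong c (ℕ.+-identityʳ r))
        where
        go : ∀ r i c → r ℕ.+ i < φ → steps r c i ≡ c (r ℕ.+ i)
        go zero    i c _   = ≡.refl
        go (suc r) i c <φ = ≡.trans (go r i (step c) (ℕ.<-trans (ℕ.n<1+n _) <φ)) (step-yes (r ℕ.+ i) <φ)
          where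
          step-yes : ∀ r → suc r < φ → step c r ≡ c (suc r)
          step-yes r <φ with suc r ℕ.<? φ
          ... | yes _  = ≡.refl
          ... | no ≮φ = contradiction <φ ≮φ

      steps-+ℕ : ∀ m n c → steps (m ℕ.+ n) c ≡ steps n (steps m c)
      steps-+ℕ zero    n c = ≡.refl
      steps-+ℕ (suc m) n c = steps-+ℕ m n (step c)

      q≢0 : NonZero q
      q≢0 = ℕ.m^n≢0 p k

      p′≢0 : NonZero (ℕ.pred p)
      p′≢0 = ℕ.>-nonZero (ℕ.≤-pred (≡.subst (2 ≤_) p≡ 1<p))

    φ>0 : 0 < φ
    φ>0 = ℕ.>-nonZero⁻¹ φ {{ℕ.m*n≢0 (ℕ.pred p) q {{p′≢0}} {{q≢0}}}}

    -- Together with `seq-zero` this identifies Seq with ℤ^φ through the initial terms, so an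
    -- equation in Seq is a system of φ integer equations.
    extension : (ℕ → ℤ) → Seq
    extension c = record { seq = λ s → steps s c 0 ; rec = rec′ }
      where
      last-step : ∀ c → steps φ c 0 ≡ ℤ.- ∑ (ℕ.pred p) (λ i → c (i ℕ.* q))
      last-step c = ≡.trans (≡.cong (λ n → steps n c 0) φ≡) (≡.trans (steps-initial φ-1 (step c) (≡.subst (φ-1 <_) (≡.sym φ≡) (ℕ.n<1+n φ-1))) stop)
        where
        φ-1 = ℕ.pred φ
        φ≡ : φ ≡ suc φ-1
        φ≡ = ≡.sym (ℕ.suc-pred φ {{ℕ.>-nonZero φ>0}})
        stop : step c φ-1 ≡ ℤ.- ∑ (ℕ.pred p) (λ i → c (i ℕ.* q))
        stop with suc φ-1 ℕ.<? φ
        ... | yes <φ = contradiction <φ (ℕ.<-irrefl (≡.sym φ≡))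
        ... | no  _  = ≡.refl
      rec′ : ∀ s → ∑ p (λ i → steps (s ℕ.+ i ℕ.* q) c 0) ≡ 0ℤ
      rec′ s = ≡.trans (∑-last λ i → steps (s ℕ.+ i ℕ.* q) c 0)
        (≡.trans (≡.cong₂ ℤ._+_ (∑-cong′ (ℕ.pred p) λ i i<p′ → ≡.trans (≡.cong (λ f → f 0) (steps-+ℕ s (i ℕ.* q) c))
                                     (steps-initial (i ℕ.* q) (steps s c) (ℕ.*-monoˡ-< q {{q≢0}} i<p′)))
                    (≡.trans (≡.cong (λ f → f 0) (steps-+ℕ s φ c)) (last-step (steps s c))))
                 (ℤ.+-inverseʳ (∑ (ℕ.pred p) (λ i → steps s c (i ℕ.* q)))))
        where
        ∑-cong′ : ∀ n {f g} → (∀ i → i < n → f i ≡ g i) → ∑ n f ≡ ∑ n g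
        ∑-cong′ zero    eq = ≡.refl
        ∑-cong′ (suc n) eq = ≡.cong₂ ℤ._+_ (∑-cong′ n λ i i<n → eq i (ℕ.m<n⇒m<1+n i<n)) (eq n (ℕ.n<1+n n))

    extension-cong : ∀ {c d} → c ≗ d → extension c ≈ᵛ extension d
    extension-cong e = mkᵛ λ s → steps-cong s e 0

    extension-+ : ∀ c d → extension (λ r → c r ℤ.+ d r) ≈ᵛ extension c V.+ extension d
    extension-+ c d = mkᵛ λ s → steps-+ s c d 0

    extension-initial : ∀ c r → r < φ → seq (extension c) r ≡ c r
    extension-initial c r = steps-initial r c

    private
      shifts : Mod
      shifts = record
        { abelianGroup = sequences p
        ; ζ = _∘ suc
        ; π = λ x → x
        ; ζ-cong = λ e → mk≈ λ s → _≈ˢ_.at e (suc s)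
        ; π-cong = λ e → e
        ; ζ-homo = λ x y → mk≈ λ s → ≡ₚ-reflexive p {x (suc s) ℤ.+ y (suc s)} ≡.refl
        ; π-homo = λ x y → mk≈ λ s → ≡ₚ-reflexive p {x s ℤ.+ y s} ≡.refl
        ; ζπ≈πζ = λ x → mk≈ λ s → ≡ₚ-reflexive p {x (suc s)} ≡.refl
        }
      module S = Act shifts

      S-char : num p S.≋ 𝟎
      S-char = S.mk≋ λ x → mk≈ λ s → ≡.subst (+ p ∣_) (≡.sym (≡.trans (ℤ.+-identityʳ _) (act-num p x s))) (∣m⇒∣m*n (x s) ∣-refl)
        where
        lemma : ∀ n x → x ℤ.+ n ℤ.* x ≡ (1ℤ ℤ.+ n) ℤ.* x
        lemma = ℤSolver.solve-∀
        act-num : ∀ n x s → S.act (num n) x s ≡ + n ℤ.* x s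
        act-num zero    x s = ≡.sym (ℤ.*-zeroˡ (x s))
        act-num (suc n) x s = ≡.trans (≡.cong (ℤ._+_ (x s)) (act-num n x s)) (lemma (+ n) (x s))

      δ : Op
      δ = ζ̂ ⊞ ⊟ 𝟏

      ζ≋𝟏⊞δ : ζ̂ S.≋ 𝟏 ⊞ δ
      ζ≋𝟏⊞δ = S.mk≋ λ x → mk≈ λ s → ≡ₚ-reflexive p (lemma (x s) (x (suc s)))
        where
        lemma : ∀ a b → b ≡ a ℤ.+ (b ℤ.+ ℤ.- a)
        lemma = ℤSolver.solve-∀

      ζ⇑ : ∀ n x s → S.act (ζ̂ ⇑ n) x s ≡ x (s ℕ.+ n)
      ζ⇑ zero    x s = ≡.cong x (≡.sym (ℕ.+-identityʳ s))
      ζ⇑ (suc n) x s = ≡.trans (ζ⇑ n x (suc s)) (≡.cong x (≡.sym (ℕ.+-suc s n)))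

      δ⇑N-vanishes : ∀ u s → + p ∣ S.act (δ ⇑ N) (seq u) s
      δ⇑N-vanishes u s = ≡.subst (+ p ∣_)
        (≡.trans (≡.cong (λ a → seq u s ℤ.+ S.act (δ ⇑ N) (seq u) s ℤ.- a) (≡.trans (ζ⇑ N (seq u) s) (seq-periodic u s)))
          (lemma (seq u s) (S.act (δ ⇑ N) (seq u) s)))
        (≡ₚ-sym p {S.act (ζ̂ ⇑ N) (seq u) s} (_≈ˢ_.at (S.on (S.R.trans (S.⇑-cong N ζ≋𝟏⊞δ) (S.𝟏⊞-frobenius^ pr S-char (suc k) δ)) (seq u)) s))
        where
        lemma : ∀ a b → a ℤ.+ b ℤ.- a ≡ b
        lemma = ℤSolver.solve-∀

    -- ℤ[ζ]-linear forms in b unknowns: additive maps that commute with ζ.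
    record Equivariant (b : ℕ) : Set where
      field
        fun   : (Fin b → Seq) → Seq
        cong  : ∀ {x y} → (∀ j → x j ≈ᵛ y j) → fun x ≈ᵛ fun y
        homo  : ∀ x y → fun (λ j → x j V.+ y j) ≈ᵛ fun x V.+ fun y
        shift-homo : ∀ x → fun (λ j → shift 1 (x j)) ≈ᵛ shift 1 (fun x)

    module _ {m b : ℕ} (m<b : m < b) (C : Fin m → Equivariant b) where
      private
        module C i = Equivariant (C i)

        Solution : (Fin b → Seq) → Set
        Solution y = ∀ i → C.fun i y ≈ᵛ V.0#

        block : Vector ℤ (b ℕ.* φ) → Fin b → ℕ → ℤ
        block x j r with r ℕ.<? φ
        ... | yes r<φ = x (combine j (Fin.fromℕ< r<φ))
        ... | no  _   = 0ℤ

        block-cong : ∀ {x y} → x ≗ y → ∀ j r → block x j r ≡ block y j r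
        block-cong e j r with r ℕ.<? φ
        ... | yes r<φ = e _
        ... | no  _   = ≡.refl

        block-+ : ∀ x y j r → block (λ i → x i ℤ.+ y i) j r ≡ block x j r ℤ.+ block y j r
        block-+ x y j r with r ℕ.<? φ
        ... | yes r<φ = ≡.refl
        ... | no  _   = ≡.refl

        block-combine : ∀ x j r → block x j (toℕ r) ≡ x (combine j r)
        block-combine x j r with toℕ r ℕ.<? φ
        ... | yes r<φ = ≡.cong (x ∘ combine j) (Fin.fromℕ<-toℕ r r<φ)
        ... | no  r≮φ = contradiction (Fin.toℕ<n r) r≮φ

        unknowns : Vector ℤ (b ℕ.* φ) → Fin b → Seq
        unknowns x j = extension (block x j)

        equation : Fin m → Fin φ → Linear (b ℕ.* φ)
        equation i r = record
          { fun = λ x → seq (C.fun i (unknowns x)) (toℕ r)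
          ; cong-≗ = λ e → at (C.cong i λ j → extension-cong (block-cong e j)) (toℕ r)
          ; +-homo = λ x y → at (V.trans (C.cong i λ j → V.trans (extension-cong (block-+ x y j)) (extension-+ (block x j) (block y j)))
                                         (C.homo i (unknowns x) (unknowns y))) (toℕ r) }

        Primitive : (Fin b → Seq) → Set
        Primitive y = ∃ λ j → ∃ λ s → ¬ + p ∣ seq (y j) s

        -- In the coordinates given by initial terms, m equations in b unknowns over ℤ[ζ] become mφ
        -- integer equations in bφ unknowns, and m < b leaves a primitive solution.
        initial : ∃ λ y → Solution y × Primitive y
        initial = unknowns x , solution , Fin.quotient φ i , toℕ (remainder {b} φ i) ,
            λ p∣ → p∤x (≡.subst (+ p ∣_) value p∣)
          where
          kernel = primitive-kernel p (ℕ.*-monoˡ-< φ {{ℕ.>-nonZero φ>0}} m<b) λ e → equation (Fin.quotient φ e) (remainder {m} φ e)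
          x = proj₁ kernel
          solves = proj₁ (proj₂ kernel)
          i = proj₁ (proj₂ (proj₂ kernel))
          p∤x = proj₂ (proj₂ (proj₂ kernel))
          value : seq (unknowns x (Fin.quotient φ i)) (toℕ (remainder {b} φ i)) ≡ x i
          value = ≡.trans (extension-initial (block x (Fin.quotient φ i)) _ (Fin.toℕ<n (remainder {b} φ i)))
            (≡.trans (block-combine x (Fin.quotient φ i) (remainder {b} φ i)) (≡.cong x (Fin.combine-remQuot {b} φ i)))
          solution : Solution (unknowns x)
          solution c = mkᵛ (seq-zero (C.fun c (unknowns x)) λ s s<φ →
            ≡.subst (λ s → seq (C.fun c (unknowns x)) s ≡ 0ℤ) (Fin.toℕ-fromℕ< s<φ) (at-coordinate (Fin.fromℕ< s<φ)))
            where
            at-coordinate : ∀ r → seq (C.fun c (unknowns x)) (toℕ r) ≡ 0ℤ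
            at-coordinate r = ≡.subst (λ e → Linear.fun (equation (proj₁ e) (proj₂ e)) x ≡ 0ℤ)
              (Fin.remQuot-combine {m} {φ} c r) (solves (combine c r))

        Lift : ℕ → (Fin b → Seq) → Set
        Lift n y = ∃ λ y′ → Solution y′ × ∀ j → seq (y j) S.≈ S.act (δ ⇑ n) (seq (y′ j))

        Reduced : Set
        Reduced = ∃ λ y → Solution y × ∃ λ j → ¬ + p ∣ ρ (y j)

        lift : ∀ n y → Solution y → Reduced ⊎ Lift n y
        lift zero    y sol = inj₂ (y , sol , λ j → S.refl {seq (y j)})
        lift (suc n) y sol with lift n y sol
        ... | inj₁ reduced = inj₁ reduced
        ... | inj₂ (y′ , sol′ , eq) with Fin.any? (λ j → ¬? (+ p ∣? ρ (y′ j)))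
        ...   | yes reduced = inj₁ (y′ , sol′ , reduced)
        ...   | no  allZero = inj₂ (y″ , sol″ , λ j → S.trans (eq j) (S.trans
                  (S.act-cong (δ ⇑ n) (mk≈ λ s → ≡ₚ-reflexive p (lemma (seq (y″ j) s) (seq (y′ j) s) _ (antidiff j s))))
                  (S.act-comm (δ ⇑ n) δ (seq (y″ j)))))
          where
          p∣ρ : ∀ j → + p ∣ ρ (y′ j)
          p∣ρ j = decidable-stable (+ p ∣? ρ (y′ j)) λ p∤ → allZero (j , p∤)
          y″ : Fin b → Seq
          y″ j = proj₁ (antidifference (y′ j) (p∣ρ j))
          antidiff : ∀ j s → seq (y″ j) (suc s) ≡ seq (y″ j) s ℤ.+ seq (y′ j) s
          antidiff j = proj₂ (antidifference (y′ j) (p∣ρ j))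
          lemma : ∀ a b c → c ≡ a ℤ.+ b → b ≡ c ℤ.+ ℤ.- a
          lemma a b .(a ℤ.+ b) ≡.refl = arith a b
            where
            arith : ∀ a b → b ≡ a ℤ.+ b ℤ.+ ℤ.- a
            arith = ℤSolver.solve-∀
          shifted : ∀ j → shift 1 (y″ j) ≈ᵛ y″ j V.+ y′ j
          shifted j = mkᵛ λ s → ≡.trans (≡.cong (seq (y″ j)) (ℕ.+-comm s 1)) (antidiff j s)
          -- Since (ζ - 1) y″ = y′ solves the system, ζ - 1 kills the value of each form at y″. As ζ
          -- - 1 is injective, y″ is a solution too.
          invariant : ∀ i → shift 1 (C.fun i y″) ≈ᵛ C.fun i y″
          invariant i = V.trans (V.sym (C.shift-homo i y″)) (V.trans (C.cong i shifted)
            (V.trans (C.homo i y″ y′) (V.trans (V.∙-congˡ {C.fun i y″} (sol′ i)) (V.identityʳ (C.fun i y″)))))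
          sol″ : Solution y″
          sol″ i = shift-torsion-free (C.fun i y″) 1 0 1<N (ℕ.<-trans (s≤s z≤n) 1<N) (λ ())
            (V.trans (invariant i) (mkᵛ λ s → ≡.cong (seq (C.fun i y″)) (≡.sym (ℕ.+-identityʳ s))))
            where
            1<N : 1 < N
            1<N = ℕ.<-≤-trans 1<p (ℕ.m≤m*n p q {{q≢0}})

      -- A primitive integral solution is divided by ζ - 1 as long as its reduction vanishes; this stops
      -- within N steps because (ζ - 1)^N = ζ^N - 1 = 0 modulo p.
      reduced-solution : ∃ λ y → (∀ i → Equivariant.fun (C i) y ≈ᵛ V.0#) × ∃ λ j → ¬ + p ∣ ρ (y j)
      reduced-solution with initial
      ... | y , sol , j , s , p∤ with lift N y sol
      ...   | inj₁ reduced = reduced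
      ...   | inj₂ (y′ , _ , eq) = contradiction
              (≡ₚ-∣ p {seq (y j) s} (_≈ˢ_.at (eq j) s) (δ⇑N-vanishes (y′ j) s)) p∤

-- Arithmetic and linear algebra over ℤ/N

module Residues where

  open import Defs
  open import Algebra.Bundles using (CommutativeRing)
  import Algebra.Properties.Ring
  import Algebra.Solver.Ring.NaturalCoefficients.Default
  open import Data.Fin.Base as Fin using (Fin; zero; suc; toℕ)
  import Data.Fin.Properties as Fin
  open import Data.Nat.Base as ℕ using (ℕ; zero; suc; NonZero; _≤_; _<_; _^_; _∸_; _%_; _/_)
  open import Data.Nat.Coprimality using (Coprime; coprime-divisor; gcd≡1⇒coprime; coprime-Bézout)
  open import Data.Nat.Divisibility using (_∣_; _∤_; divides; _∣?_; ∣m∣n⇒∣m+n; ∣n⇒∣m*n; ∣m+n∣m⇒∣n; %-presˡ-∣; m∣m*n; ∣⇒≤; ∣1⇒≡1; ∣-trans)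
  open import Data.Nat.DivMod using (_mod_; m%n<n; m<n⇒m%n≡m; %-distribˡ-+; %-distribˡ-*; m≡m%n+[m/n]*n; n%n≡0; [m+kn]%n≡m%n)
  open import Data.Nat.GCD using (gcd[m,n]∣m; gcd[m,n]∣n; module Bézout)
  open import Data.Nat.Primality using (Prime; prime⇒nonTrivial; prime⇒nonZero; prime⇒irreducible)
  import Data.Nat.Properties as ℕ
  open import Data.Product using (∃; _,_)
  open import Data.Sum using (inj₁; inj₂)
  open import Data.Vec.Base as Vec using (Vec; []; _∷_)
  import Data.Vec.Relation.Unary.Any as VecAny
  open import Level using (0ℓ)
  open import Relation.Binary.PropositionalEquality
  open import Relation.Nullary using (¬_; Dec; yes; no; contradiction)

  module Ring (N : ℕ) .{{N≢0 : NonZero N}} where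
    open import Data.Nat.Base using (_+_; _*_)

    toℕ-mod : ∀ m → toℕ (m mod N) ≡ m % N
    toℕ-mod m = Fin.toℕ-fromℕ< (m%n<n m N)

    mod-toℕ : ∀ (i : Fin N) → toℕ i mod N ≡ i
    mod-toℕ i = Fin.toℕ-injective (trans (toℕ-mod (toℕ i)) (m<n⇒m%n≡m (Fin.toℕ<n i)))

    mod-≡ : ∀ {m n} → m % N ≡ n % N → m mod N ≡ n mod N
    mod-≡ {m} {n} eq = Fin.toℕ-injective (trans (toℕ-mod m) (trans eq (sym (toℕ-mod n))))

    mod-⊕ : ∀ m n → m mod N ⊕ n mod N ≡ (m + n) mod N
    mod-⊕ m n = mod-≡ (trans (cong₂ (λ a b → (a + b) % N) (toℕ-mod m) (toℕ-mod n)) (sym (%-distribˡ-+ m n N)))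

    mod-⊗ : ∀ m n → (m mod N) ⊗ (n mod N) ≡ (m * n) mod N
    mod-⊗ m n = mod-≡ (trans (cong₂ (λ a b → (a * b) % N) (toℕ-mod m) (toℕ-mod n)) (sym (%-distribˡ-* m n N)))

    neg : Fin N → Fin N
    neg a = (N ∸ toℕ a) mod N

    private
      lift₃ : ∀ {f g : Fin N → Fin N → Fin N → Fin N} →
        (∀ a b c → f (a mod N) (b mod N) (c mod N) ≡ g (a mod N) (b mod N) (c mod N)) → ∀ a b c → f a b c ≡ g a b c
      lift₃ {f} {g} eq a b c = subst (λ a → f a b c ≡ g a b c) (mod-toℕ a) (subst (λ b → f (toℕ a mod N) b c ≡ g (toℕ a mod N) b c) (mod-toℕ b)
        (subst (λ c → f (toℕ a mod N) (toℕ b mod N) c ≡ g (toℕ a mod N) (toℕ b mod N) c) (mod-toℕ c) (eq (toℕ a) (toℕ b) (toℕ c))))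

    ⊕-comm : ∀ a b → a ⊕ b ≡ b ⊕ a
    ⊕-comm a b = cong (_mod N) (ℕ.+-comm (toℕ a) (toℕ b))

    ⊗-comm : ∀ a b → a ⊗ b ≡ b ⊗ a
    ⊗-comm a b = cong (_mod N) (ℕ.*-comm (toℕ a) (toℕ b))

    ⊕-assoc : ∀ a b c → (a ⊕ b) ⊕ c ≡ a ⊕ (b ⊕ c)
    ⊕-assoc = lift₃ λ a b c → trans (cong (_⊕ c mod N) (mod-⊕ a b)) (trans (mod-⊕ (a + b) c)
      (trans (cong (_mod N) (ℕ.+-assoc a b c)) (sym (trans (cong (a mod N ⊕_) (mod-⊕ b c)) (mod-⊕ a (b + c))))))

    ⊗-assoc : ∀ a b c → (a ⊗ b) ⊗ c ≡ a ⊗ (b ⊗ c)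
    ⊗-assoc = lift₃ λ a b c → trans (cong (_⊗ (c mod N)) (mod-⊗ a b)) (trans (mod-⊗ (a * b) c)
      (trans (cong (_mod N) (ℕ.*-assoc a b c)) (sym (trans (cong ((a mod N) ⊗_) (mod-⊗ b c)) (mod-⊗ a (b * c))))))

    ⊗-distribˡ-⊕ : ∀ a b c → a ⊗ (b ⊕ c) ≡ a ⊗ b ⊕ a ⊗ c
    ⊗-distribˡ-⊕ = lift₃ λ a b c → trans (cong ((a mod N) ⊗_) (mod-⊕ b c)) (trans (mod-⊗ a (b + c))
      (trans (cong (_mod N) (ℕ.*-distribˡ-+ a b c)) (sym (trans (cong₂ _⊕_ (mod-⊗ a b) (mod-⊗ a c)) (mod-⊕ (a * b) (a * c))))))

    ⊕-identityˡ : ∀ a → 𝟘 ⊕ a ≡ a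
    ⊕-identityˡ a = trans (cong (𝟘 ⊕_) (sym (mod-toℕ a))) (trans (mod-⊕ 0 (toℕ a)) (mod-toℕ a))

    ⊗-identityˡ : ∀ a → 𝟙 ⊗ a ≡ a
    ⊗-identityˡ a = trans (cong (𝟙 ⊗_) (sym (mod-toℕ a))) (trans (mod-⊗ 1 (toℕ a)) (trans (cong (_mod N) (ℕ.*-identityˡ (toℕ a))) (mod-toℕ a)))

    ⊕-inverseʳ : ∀ a → a ⊕ neg a ≡ 𝟘
    ⊕-inverseʳ a = trans (cong (_⊕ neg a) (sym (mod-toℕ a))) (trans (mod-⊕ (toℕ a) (N ∸ toℕ a))
      (trans (cong (_mod N) (ℕ.m+[n∸m]≡n (ℕ.<⇒≤ (Fin.toℕ<n a)))) (mod-≡ (trans (n%n≡0 N) (sym (m<n⇒m%n≡m (ℕ.>-nonZero⁻¹ N)))))))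

    residueRing : CommutativeRing 0ℓ 0ℓ
    residueRing = record
      { Carrier = Fin N ; _≈_ = _≡_ ; _+_ = _⊕_ ; _*_ = _⊗_ ; -_ = neg ; 0# = 𝟘 ; 1# = 𝟙
      ; isCommutativeRing = record
        { isRing = record
          { +-isAbelianGroup = record
            { isGroup = record
              { isMonoid = record
                { isSemigroup = record { isMagma = record { isEquivalence = isEquivalence ; ∙-cong = cong₂ _⊕_ } ; assoc = ⊕-assoc }
                ; identity = ⊕-identityˡ , λ a → trans (⊕-comm a 𝟘) (⊕-identityˡ a) }
              ; inverse = (λ a → trans (⊕-comm (neg a) a) (⊕-inverseʳ a)) , ⊕-inverseʳ
              ; ⁻¹-cong = cong neg }
            ; comm = ⊕-comm }
          ; *-cong = cong₂ _⊗_
          ; *-assoc = ⊗-assoc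
          ; *-identity = ⊗-identityˡ , λ a → trans (⊗-comm a 𝟙) (⊗-identityˡ a)
          ; distrib = ⊗-distribˡ-⊕ , λ a b c → trans (⊗-comm (b ⊕ c) a) (trans (⊗-distribˡ-⊕ a b c) (cong₂ _⊕_ (⊗-comm a b) (⊗-comm a c))) }
        ; *-comm = ⊗-comm } }

  module LinearAlgebra {c ℓ} (R : CommutativeRing c ℓ) where
    open CommutativeRing R renaming (refl to ≈-refl; trans to ≈-trans)
    open Algebra.Solver.Ring.NaturalCoefficients.Default commutativeSemiring

    pairing-step : ∀ c a t u x y → c * (a + t * u) + (x + t * y) ≈ (c * a + x) + t * (c * u + y)
    pairing-step = solve 6 (λ c a t u x y → c :* (a :+ t :* u) :+ (x :+ t :* y) := (c :* a :+ x) :+ t :* (c :* u :+ y)) ≈-refl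

    add-step : ∀ c d u x y → (c + d) * u + (x + y) ≈ (c * u + x) + (d * u + y)
    add-step = solve 5 (λ c d u x y → (c :+ d) :* u :+ (x :+ y) := (c :* u :+ x) :+ (d :* u :+ y)) ≈-refl

    shear-step : ∀ a t u x y → (a + t * u) + (x + t * y) ≈ (a + x) + t * (u + y)
    shear-step = solve 5 (λ a t u x y → (a :+ t :* u) :+ (x :+ t :* y) := (a :+ x) :+ t :* (u :+ y)) ≈-refl

    scale-step : ∀ c l u y → c * (l * u) + l * y ≈ l * (c * u + y)
    scale-step = solve 4 (λ c l u y → c :* (l :* u) :+ l :* y := l :* (c :* u :+ y)) ≈-refl

    unshear : ∀ x y → x + - y + y ≈ x
    unshear x y = ≈-trans (+-assoc x (- y) y) (≈-trans (+-congˡ (-‿inverseˡ y)) (+-identityʳ x))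

    translate : ∀ d u → d + (u + - d) ≈ u
    translate d u = ≈-trans (+-comm d (u + - d)) (unshear u d)

  module Vectors (N : ℕ) .{{N≢0 : NonZero N}} where
    open Ring N public
    open LinearAlgebra residueRing
    open CommutativeRing residueRing using (zeroˡ; zeroʳ; *-identityʳ; +-identityʳ)

    𝟙-unit : IsUnit (𝟙 {{N≢0}})
    𝟙-unit = 𝟙 {{N≢0}} , ⊗-identityˡ (𝟙 {{N≢0}})

    negᵛ : ∀ {n} → Vec (Fin N) n → Vec (Fin N) n
    negᵛ = Vec.map neg

    translateᵛ : ∀ {n} (d u : Vec (Fin N) n) → d ⊕ᵛ (u ⊕ᵛ negᵛ d) ≡ u
    translateᵛ []      []      = refl
    translateᵛ (d ∷ ds) (u ∷ us) = cong₂ _∷_ (translate d u) (translateᵛ ds us)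

    ·ᵛ-⊗ : ∀ {n} t l (u : Vec (Fin N) n) → t ·ᵛ l ·ᵛ u ≡ (t ⊗ l) ·ᵛ u
    ·ᵛ-⊗ t l []      = refl
    ·ᵛ-⊗ t l (u ∷ us) = cong₂ _∷_ (sym (⊗-assoc t l u)) (·ᵛ-⊗ t l us)

    ·ᵛ-identityˡ : ∀ {n} (u : Vec (Fin N) n) → 𝟙 ·ᵛ u ≡ u
    ·ᵛ-identityˡ []      = refl
    ·ᵛ-identityˡ (u ∷ us) = cong₂ _∷_ (⊗-identityˡ u) (·ᵛ-identityˡ us)

    pairing : ∀ {n} → Vec (Fin N) n → Vec (Fin N) n → Fin N
    pairing []      []      = 𝟘
    pairing (c ∷ cs) (u ∷ us) = c ⊗ u ⊕ pairing cs us

    pairing-line : ∀ {n} (c a : Vec (Fin N) n) t u → pairing c (a ⊕ᵛ t ·ᵛ u) ≡ pairing c a ⊕ t ⊗ pairing c u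
    pairing-line []      []      t []      = sym (trans (cong (𝟘 ⊕_) (zeroʳ t)) (⊕-identityˡ 𝟘))
    pairing-line (c ∷ cs) (a ∷ as) t (u ∷ us) = trans (cong (c ⊗ (a ⊕ t ⊗ u) ⊕_) (pairing-line cs as t us))
      (pairing-step c a t u (pairing cs as) (pairing cs us))

    pairing-⊕ : ∀ {n} (c d u : Vec (Fin N) n) → pairing (c ⊕ᵛ d) u ≡ pairing c u ⊕ pairing d u
    pairing-⊕ []      []      []      = sym (⊕-identityˡ 𝟘)
    pairing-⊕ (c ∷ cs) (d ∷ ds) (u ∷ us) = trans (cong ((c ⊕ d) ⊗ u ⊕_) (pairing-⊕ cs ds us)) (add-step c d u (pairing cs us) (pairing ds us))

    pairing-scale : ∀ {n} (c : Vec (Fin N) n) l u → pairing c (l ·ᵛ u) ≡ l ⊗ pairing c u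
    pairing-scale []      l []      = sym (zeroʳ l)
    pairing-scale (c ∷ cs) l (u ∷ us) = trans (cong (c ⊗ (l ⊗ u) ⊕_) (pairing-scale cs l us)) (scale-step c l u (pairing cs us))

    -- Linear automorphisms that carry lines to lines; composing f with one of them replaces the
    -- chart u₁ = 1 by another chart.
    shear unshearᵛ : ∀ {n} → Vec (Fin N) n → Vec (Fin N) (suc n) → Vec (Fin N) (suc n)
    shear    c (x ∷ xs) = (x ⊕ pairing c xs) ∷ xs
    unshearᵛ c (x ∷ xs) = (x ⊕ neg (pairing c xs)) ∷ xs

    shear-unshear : ∀ {n} (c : Vec (Fin N) n) x → shear c (unshearᵛ c x) ≡ x
    shear-unshear c (x ∷ xs) = cong (_∷ xs) (unshear x (pairing c xs))

    shear-injective : ∀ {n} (c : Vec (Fin N) n) {x y} → shear c x ≡ shear c y → x ≡ y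
    shear-injective c {x ∷ xs} {y ∷ ys} eq = trans (sym (undo x xs)) (trans (cong (unshearᵛ c) eq) (undo y ys))
      where
      open import Algebra.Properties.Group (CommutativeRing.+-group residueRing) using (//-rightDividesʳ)
      undo : ∀ x xs → unshearᵛ c (shear c (x ∷ xs)) ≡ x ∷ xs
      undo x xs = cong (_∷ xs) (//-rightDividesʳ (pairing c xs) x)

    shear-line : ∀ {n} (c : Vec (Fin N) n) a t u → shear c (a ⊕ᵛ t ·ᵛ u) ≡ shear c a ⊕ᵛ t ·ᵛ shear c u
    shear-line c (a ∷ as) t (u ∷ us) = cong (_∷ (as ⊕ᵛ t ·ᵛ us)) (trans (cong ((a ⊕ t ⊗ u) ⊕_) (pairing-line c as t us))
      (shear-step a t u (pairing c as) (pairing c us)))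

    shear-scale : ∀ {n} (c : Vec (Fin N) n) l u → shear c (l ·ᵛ u) ≡ l ·ᵛ shear c u
    shear-scale c l (u ∷ us) = cong (_∷ l ·ᵛ us) (trans (cong (l ⊗ u ⊕_) (pairing-scale c l us)) (sym (⊗-distribˡ-⊕ l u (pairing c us))))

    IsUnit-cancelʳ : ∀ {l} → IsUnit l → ∀ {s t} → s ⊗ l ≡ t ⊗ l → s ≡ t
    IsUnit-cancelʳ {l} (m , lm≡𝟙) {s} {t} eq = trans (sym (undo s)) (trans (cong (_⊗ m) eq) (undo t))
      where
      undo : ∀ s → (s ⊗ l) ⊗ m ≡ s
      undo s = trans (⊗-assoc s l m) (trans (cong (s ⊗_) lm≡𝟙) (*-identityʳ s))

  module Units {p : ℕ} (pr : Prime p) (k : ℕ) where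
    open import Data.Nat.Base using (_+_; _*_)
    N = p ^ suc k
    private
      instance
        p≢0 : NonZero p
        p≢0 = prime⇒nonZero pr
        N≢0 : NonZero N
        N≢0 = ℕ.m^n≢0 p (suc k)
    open Vectors N
    open CommutativeRing residueRing using (-‿cong; zeroˡ; +-identityʳ)
    open import Algebra.Properties.Group (CommutativeRing.+-group residueRing) using (//-rightDividesʳ)

    p∣N : p ∣ N
    p∣N = m∣m*n (p ^ k)

    p∣mod : ∀ {m} → p ∣ m → p ∣ toℕ (m mod N)
    p∣mod {m} p∣m = subst (p ∣_) (sym (toℕ-mod m)) (%-presˡ-∣ p∣m p∣N)

    p∣mod⁻ : ∀ {m} → p ∣ toℕ (m mod N) → p ∣ m
    p∣mod⁻ {m} p∣ = subst (p ∣_) (sym (m≡m%n+[m/n]*n m N)) (∣m∣n⇒∣m+n (subst (p ∣_) (toℕ-mod m) p∣) (∣n⇒∣m*n (m / N) p∣N))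

    p∣⊕ : ∀ a b → p ∣ toℕ a → p ∣ toℕ b → p ∣ toℕ (a ⊕ b)
    p∣⊕ a b p∣a p∣b = p∣mod (∣m∣n⇒∣m+n p∣a p∣b)

    p∣⊗ : ∀ a b → p ∣ toℕ b → p ∣ toℕ (a ⊗ b)
    p∣⊗ a b p∣b = p∣mod (∣n⇒∣m*n (toℕ a) p∣b)

    p∣⊕⁻ : ∀ a b → p ∣ toℕ a → p ∣ toℕ (a ⊕ b) → p ∣ toℕ b
    p∣⊕⁻ a b p∣a p∣ab = ∣m+n∣m⇒∣n (p∣mod⁻ {toℕ a + toℕ b} p∣ab) p∣a

    p∤⇒unit : ∀ {a} → ¬ p ∣ toℕ a → IsUnit a
    p∤⇒unit {a} p∤a with prime⇒irreducible pr (gcd[m,n]∣n (toℕ a) p)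
    ... | inj₂ gcd≡p = contradiction (subst (_∣ toℕ a) gcd≡p (gcd[m,n]∣m (toℕ a) p)) p∤a
    ... | inj₁ gcd≡1 = from-Bézout (coprime-Bézout (coprime-power (suc k)))
      where
      coprime-power : ∀ k → Coprime (toℕ a) (p ^ k)
      coprime-power zero    (_ , d∣1) = ∣1⇒≡1 d∣1
      coprime-power (suc k) {d} (d∣a , d∣pk) = coprime-power k (d∣a , coprime-divisor d⊥p d∣pk)
        where
        d⊥p : Coprime d p
        d⊥p (c∣d , c∣p) = gcd≡1⇒coprime {toℕ a} {p} gcd≡1 (∣-trans c∣d d∣a , c∣p)
      from-Bézout : Bézout.Identity 1 (toℕ a) N → IsUnit a
      from-Bézout (Bézout.+- x y eq) = x mod N , (begin
        a ⊗ (x mod N)                  ≡⟨ cong (_⊗ (x mod N)) (mod-toℕ a) ⟨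
        (toℕ a mod N) ⊗ (x mod N)        ≡⟨ mod-⊗ (toℕ a) x ⟩
        (toℕ a * x) mod N            ≡⟨ cong (_mod N) (ℕ.*-comm (toℕ a) x) ⟩
        (x * toℕ a) mod N            ≡⟨ cong (_mod N) eq ⟨
        (1 + y * N) mod N            ≡⟨ mod-≡ ([m+kn]%n≡m%n 1 y N) ⟩
        _                            ∎)
        where open ≡-Reasoning
      from-Bézout (Bézout.-+ x y eq) = neg (x mod N) , (begin
        a ⊗ neg (x mod N)            ≡⟨ x*-y≈-[x*y] a (x mod N) ⟩
        neg (a ⊗ (x mod N))            ≡⟨ cong (λ a → neg (a ⊗ (x mod N))) (mod-toℕ a) ⟨
        neg ((toℕ a mod N) ⊗ (x mod N))  ≡⟨ cong neg (trans (mod-⊗ (toℕ a) x) (cong (_mod N) (ℕ.*-comm (toℕ a) x))) ⟩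
        neg ((x * toℕ a) mod N)      ≡⟨ inverseʳ-unique _ _ (trans (⊕-comm _ 𝟙) (trans (mod-⊕ 1 (x * toℕ a)) (trans (cong (_mod N) eq)
                                          (mod-≡ ([m+kn]%n≡m%n 0 y N))))) ⟨
        _                            ∎)
        where
        open ≡-Reasoning
        open import Algebra.Properties.Ring (CommutativeRing.ring residueRing) using () renaming (-‿distribʳ-* to neg-distribʳ)
        open import Algebra.Properties.Group (CommutativeRing.+-group residueRing) using (inverseʳ-unique)
        x*-y≈-[x*y] : ∀ x y → x ⊗ neg y ≡ neg (x ⊗ y)
        x*-y≈-[x*y] x y = sym (neg-distribʳ x y)

    unit⇒p∤ : ∀ {a} → IsUnit a → ¬ p ∣ toℕ a
    unit⇒p∤ {a} (b , ab≡𝟙) p∣a = ℕ.<⇒≱ (ℕ.nonTrivial⇒n>1 p {{prime⇒nonTrivial pr}}) (∣⇒≤ p∣1)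
      where
      p∣1 : p ∣ 1
      p∣1 = p∣mod⁻ (subst (λ c → p ∣ toℕ c) ab≡𝟙 (subst (λ c → p ∣ toℕ c) (⊗-comm b a) (p∣⊗ b a p∣a)))

    isUnit? : ∀ (a : Fin N) → Dec (IsUnit a)
    isUnit? a with p ∣? toℕ a
    ... | yes p∣a = no λ unit → unit⇒p∤ unit p∣a
    ... | no  p∤a = yes (p∤⇒unit p∤a)

    nonunit⇒p∣ : ∀ {a} → ¬ IsUnit a → p ∣ toℕ a
    nonunit⇒p∣ {a} nonunit with p ∣? toℕ a
    ... | yes p∣a = p∣a
    ... | no  p∤a = contradiction (p∤⇒unit p∤a) nonunit

    -- The dual vector e is the standard basis vector at a unit coordinate of u.
    unit-pairing : ∀ {n} {u : Vec (Fin N) n} → HasUnitCoordinate u → ∃ λ e → IsUnit (pairing e u)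
    unit-pairing {u = u ∷ us} (VecAny.here unit) = 𝟙 ∷ Vec.replicate _ 𝟘 ,
      subst IsUnit (sym (trans (cong₂ _⊕_ (⊗-identityˡ u) (zero-pairing us)) (+-identityʳ u))) unit
      where
      zero-pairing : ∀ {n} (u : Vec (Fin N) n) → pairing (Vec.replicate n 𝟘) u ≡ 𝟘
      zero-pairing []      = refl
      zero-pairing (u ∷ us) = trans (cong₂ _⊕_ (zeroˡ u) (zero-pairing us)) (⊕-identityˡ 𝟘)
    unit-pairing {u = u ∷ us} (VecAny.there unit) with e , unit-e ← unit-pairing unit =
      𝟘 ∷ e , subst IsUnit (sym (trans (cong (_⊕ pairing e us) (zeroˡ u)) (⊕-identityˡ _))) unit-e

    nonunit-pairing : ∀ {n} (c u : Vec (Fin N) n) → ¬ HasUnitCoordinate u → p ∣ toℕ (pairing c u)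
    nonunit-pairing []      []      _       = p∣mod {0} (divides 0 refl)
    nonunit-pairing (c ∷ cs) (u ∷ us) nonunit = p∣⊕ (c ⊗ u) (pairing cs us) (p∣⊗ c u (nonunit⇒p∣ λ unit → nonunit (VecAny.here unit)))
      (nonunit-pairing cs us λ unit → nonunit (VecAny.there unit))

-- Divisibility by products of z - ζᵗ in polynomials over ℤ[ζ]

module Cyclotomic where

  open Mods
  open Newton
  open Recurrence
  open Simplex using (ẑ; module Evaluation)
  open import Data.Integer.Base as ℤ using (ℤ; +_; 0ℤ)
  open import Data.Integer.Divisibility.Signed
  import Data.Integer.Properties as ℤ
  import Data.Integer.Tactic.RingSolver as ℤSolver
  open import Data.List.Base using (List; []; _∷_)
  open import Data.List.Relation.Unary.All as All using (All; []; _∷_)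
  open import Data.List.Relation.Unary.AllPairs using (AllPairs; []; _∷_)
  open import Data.Nat.Base as ℕ using (ℕ; zero; suc; NonZero; _≤_; _<_; z≤n; s≤s; _∸_)
  open import Data.Nat.Primality using (Prime; prime⇒nonZero)
  import Data.Nat.Properties as ℕ
  open import Data.Product using (∃; ∃₂; _,_; proj₁; proj₂)
  open import Function.Base using (_∘_)
  open import Relation.Binary.PropositionalEquality as ≡ using (_≡_; _≢_)

  θ : ℕ → Op
  θ t = ẑ ⊞ ⊟ ζ̂ ⇑ t

  product : (ℕ → ℕ) → List ℕ → Op
  product m []       = 𝟏
  product m (t ∷ ts) = θ t ⇑ m t ⊡ product m ts

  module Theta (M : Mod) where
    open Act M
    open import Relation.Binary.Reasoning.Setoid setoid

    θ+ζ⇑ : ∀ t → θ t ⊞ ζ̂ ⇑ t ≋ ẑ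
    θ+ζ⇑ t = R.trans (R.+-assoc ẑ (⊟ ζ̂ ⇑ t) (ζ̂ ⇑ t)) (R.trans (R.+-congˡ {ẑ} (R.-‿inverseˡ (ζ̂ ⇑ t))) (R.+-identityʳ ẑ))

    π≋ : ∀ t → π̂ ≋ θ t ⊞ (ζ̂ ⇑ t ⊞ ⊟ 𝟏)
    π≋ t = R.sym (R.trans (R.sym (R.+-assoc (θ t) (ζ̂ ⇑ t) (⊟ 𝟏))) (R.trans (R.+-congʳ {⊟ 𝟏} (R.trans (θ+ζ⇑ t) (R.+-comm 𝟏 π̂)))
      (R.trans (R.+-assoc π̂ 𝟏 (⊟ 𝟏)) (R.trans (R.+-congˡ {π̂} (R.-‿inverseʳ 𝟏)) (R.+-identityʳ π̂)))))

    θ-difference : ∀ t s → θ s ≋ θ t ⊞ (ζ̂ ⇑ t ⊞ ⊟ ζ̂ ⇑ s)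
    θ-difference t s = R.sym (R.trans (R.sym (R.+-assoc (θ t) (ζ̂ ⇑ t) (⊟ ζ̂ ⇑ s))) (R.+-congʳ {⊟ ζ̂ ⇑ s} (θ+ζ⇑ t)))

    -- The inductive step of division by z - ζᵗ, based on π = (z - ζᵗ) + (ζᵗ - 1).
    division-step : ∀ t {x x′ c y r} → x ≈ c + act π̂ x′ → x′ ≈ act (θ t) y + r →
      x ≈ act (θ t) (act π̂ y + r) + (c + (act (ζ̂ ⇑ t) r + - r))
    division-step t {x} {x′} {c} {y} {r} e e′ = begin
      x                                                      ≈⟨ e ⟩
      c + act π̂ x′                                           ≈⟨ +-congˡ (act-cong π̂ e′) ⟩
      c + act π̂ (act (θ t) y + r)                            ≈⟨ +-congˡ (act-+ π̂ (act (θ t) y) r) ⟩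
      c + (act π̂ (act (θ t) y) + act π̂ r)                    ≈⟨ +-congˡ (+-cong (act-comm π̂ (θ t) y) (on (π≋ t) r)) ⟩
      c + (act (θ t) (act π̂ y) + (act (θ t) r + ζr-r))       ≈⟨ +-congˡ (+-assoc _ _ _) ⟨
      c + (act (θ t) (act π̂ y) + act (θ t) r + ζr-r)         ≈⟨ +-congˡ (+-congʳ (act-+ (θ t) (act π̂ y) r)) ⟨
      c + (act (θ t) (act π̂ y + r) + ζr-r)                   ≈⟨ trans (sym (+-assoc _ _ _)) (trans (+-congʳ (+-comm _ _)) (+-assoc _ _ _)) ⟩
      act (θ t) (act π̂ y + r) + (c + ζr-r)                   ∎
      where ζr-r = act (ζ̂ ⇑ t) r + - r

    -- Modulo θ t, multiplication by θ s is multiplication by ζᵗ - ζˢ; hence this multiple of the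
    -- remainder r is divisible by θ t.
    remainder-multiple : ∀ t s {x y y′ r} → act (θ t) x ≈ act (θ s) y → y ≈ act (θ t) y′ + r →
      act (θ t) (x + - (act (θ s) y′ + r)) ≈ act (ζ̂ ⇑ t ⊞ ⊟ ζ̂ ⇑ s) r
    remainder-multiple t s {x} {y} {y′} {r} e y≈ = begin
      act (θ t) (x + - w)                      ≈⟨ trans (act-+ (θ t) x (- w)) (+-cong e (act-neg (θ t) w)) ⟩
      act (θ s) y + - act (θ t) w              ≈⟨ +-congʳ (trans (act-cong (θ s) y≈) (act-+ (θ s) _ _)) ⟩
      act (θ s) (act (θ t) y′) + act (θ s) r + - act (θ t) w
        ≈⟨ +-congʳ (+-cong (act-comm (θ s) (θ t) y′) (on (θ-difference t s) r)) ⟩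
      act (θ t) (act (θ s) y′) + (act (θ t) r + act d r) + - act (θ t) w
        ≈⟨ +-congʳ (trans (sym (+-assoc _ _ _)) (+-congʳ (sym (act-+ (θ t) _ _)))) ⟩
      act (θ t) w + act d r + - act (θ t) w
        ≈⟨ trans (+-congʳ (+-comm _ _)) (trans (+-assoc _ _ _) (trans (+-congˡ (+-inverseʳ _)) (+-identityʳ _))) ⟩
      act d r ∎
      where
      d = ζ̂ ⇑ t ⊞ ⊟ ζ̂ ⇑ s
      w = act (θ s) y′ + r

    Divides : Op → Carrier → Set
    Divides a x = ∃ λ y → x ≈ act a y

    module _ (N : ℕ) (θ-injective : ∀ t x → act (θ t) x ≈ 0# → x ≈ 0#)
             (θ-regular : ∀ t s → t < N → s < N → t ≢ s → ∀ x y → act (θ t) x ≈ act (θ s) y → Divides (θ t) y) where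

      open import Algebra.Properties.AbelianGroup abelianGroup using (x∙y⁻¹≈ε⇒x≈y; x≈y⇒x∙y⁻¹≈ε)

      θ-cancel : ∀ t x y → act (θ t) x ≈ act (θ t) y → x ≈ y
      θ-cancel t x y e = x∙y⁻¹≈ε⇒x≈y x y (θ-injective t (x + - y)
        (trans (act-+ (θ t) x (- y)) (trans (+-congˡ (act-neg (θ t) y)) (x≈y⇒x∙y⁻¹≈ε e))))

      -- Multiplication by θ s is injective modulo θ t, and powers of θ t follow by peeling off one
      -- factor at a time with `θ-cancel`.
      θ⇑-regular : ∀ t s → t < N → s < N → t ≢ s → ∀ m y → Divides (θ t ⇑ m) (act (θ s) y) → Divides (θ t ⇑ m) y
      θ⇑-regular t s t<N s<N t≢s zero    y _       = y , refl
      θ⇑-regular t s t<N s<N t≢s (suc m) y (x , e)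
        with y′ , y≈ ← θ-regular t s t<N s<N t≢s (act (θ t ⇑ m) x) y (sym e)
        with x′ , y′≈ ← θ⇑-regular t s t<N s<N t≢s m y′ (x , θ-cancel t _ _
               (trans (act-comm (θ t) (θ s) y′) (trans (act-cong (θ s) (sym y≈)) e)))
        = x′ , trans y≈ (act-cong (θ t) y′≈)

      θ⇑-coprime : ∀ t s → t < N → s < N → t ≢ s → ∀ m n y → Divides (θ t ⇑ m) (act (θ s ⇑ n) y) → Divides (θ t ⇑ m) y
      θ⇑-coprime t s t<N s<N t≢s m zero    y d = d
      θ⇑-coprime t s t<N s<N t≢s m (suc n) y d =
        θ⇑-coprime t s t<N s<N t≢s m n y (θ⇑-regular t s t<N s<N t≢s m _ d)

      module _ (m : ℕ → ℕ) where

        product-coprime : ∀ t → t < N → ∀ ts → All (_< N) ts → All (t ≢_) ts →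
          ∀ y → Divides (θ t ⇑ m t) (act (product m ts) y) → Divides (θ t ⇑ m t) y
        product-coprime t t<N []       []           []           y d = d
        product-coprime t t<N (s ∷ ts) (s<N ∷ ts<N) (t≢s ∷ t≢ts) y d =
          product-coprime t t<N ts ts<N t≢ts y (θ⇑-coprime t s t<N s<N t≢s (m t) (m s) (act (product m ts) y) d)

        -- Regularity takes the place of unique factorisation: after division by the product over
        -- `ts`, the quotient is still divisible by the power of θ t.
        product-divides : ∀ ts → All (_< N) ts → AllPairs _≢_ ts → ∀ x → All (λ t → Divides (θ t ⇑ m t) x) ts → Divides (product m ts) x
        product-divides []       [] [] x [] = x , refl
        product-divides (t ∷ ts) (t<N ∷ ts<N) (t≢ ∷ distinct) x (d ∷ ds)
          with y , x≈ ← product-divides ts ts<N distinct x ds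
          with y′ , y≈ ← product-coprime t t<N ts ts<N t≢ y (proj₁ d , trans (sym x≈) (proj₂ d))
          = y′ , trans x≈ (trans (act-cong (product m ts) y≈) (act-comm (product m ts) (θ t ⇑ m t) y′))

  module Poly {p : ℕ} (pr : Prime p) (k : ℕ) where
    open Seq pr k

    record Polynomial : Set where
      field
        coeff  : ℕ → Seq
        degree : ℕ
        beyond   : ∀ i → degree ≤ i → coeff i ≈ᵛ V.0#
    open Polynomial public

    infix 4 _≈ᴾ_
    record _≈ᴾ_ (x y : Polynomial) : Set where
      constructor mkᴾ
      field atᴾ : ∀ i → coeff x i ≈ᵛ coeff y i
    open _≈ᴾ_ public

    private
      neg-0 : ∀ {u} → u ≈ᵛ V.0# → V.- u ≈ᵛ V.0#
      neg-0 e = mkᵛ λ s → ≡.cong ℤ.-_ (at e s)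

      add-0 : ∀ {u v} → u ≈ᵛ V.0# → v ≈ᵛ V.0# → u V.+ v ≈ᵛ V.0#
      add-0 e f = mkᵛ λ s → ≡.cong₂ ℤ._+_ (at e s) (at f s)

      π-coeff : (ℕ → Seq) → ℕ → Seq
      π-coeff c zero    = V.0#
      π-coeff c (suc i) = c i

    polynomials : Mod
    polynomials = record
      { abelianGroup = record
        { Carrier = Polynomial ; _≈_ = _≈ᴾ_
        ; _∙_ = λ x y → record
          { coeff = λ i → coeff x i V.+ coeff y i
          ; degree = degree x ℕ.+ degree y
          ; beyond = λ i d≤i → add-0 (beyond x i (ℕ.≤-trans (ℕ.m≤m+n _ _) d≤i)) (beyond y i (ℕ.≤-trans (ℕ.m≤n+m _ _) d≤i)) }
        ; ε = record { coeff = λ _ → V.0# ; degree = 0 ; beyond = λ _ _ → V.refl }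
        ; _⁻¹ = λ x → record { coeff = λ i → V.- coeff x i ; degree = degree x ; beyond = λ i d≤i → neg-0 (beyond x i d≤i) }
        ; isAbelianGroup = record
          { isGroup = record
            { isMonoid = record
              { isSemigroup = record
                { isMagma = record
                  { isEquivalence = record
                    { refl = mkᴾ λ i → V.refl
                    ; sym = λ e → mkᴾ λ i → V.sym (atᴾ e i)
                    ; trans = λ e f → mkᴾ λ i → V.trans (atᴾ e i) (atᴾ f i) }
                  ; ∙-cong = λ e f → mkᴾ λ i → V.∙-cong (atᴾ e i) (atᴾ f i) }
                ; assoc = λ x y z → mkᴾ λ i → V.assoc (coeff x i) (coeff y i) (coeff z i) }
              ; identity = (λ x → mkᴾ λ i → V.identityˡ (coeff x i)) , (λ x → mkᴾ λ i → V.identityʳ (coeff x i)) }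
            ; inverse = (λ x → mkᴾ λ i → V.inverseˡ (coeff x i)) , (λ x → mkᴾ λ i → V.inverseʳ (coeff x i))
            ; ⁻¹-cong = λ e → mkᴾ λ i → V.⁻¹-cong (atᴾ e i) }
          ; comm = λ x y → mkᴾ λ i → V.comm (coeff x i) (coeff y i) } }
      ; ζ = λ x → record
        { coeff = λ i → shift 1 (coeff x i) ; degree = degree x ; beyond = λ i d≤i → mkᵛ λ s → at (beyond x i d≤i) (s ℕ.+ 1) }
      ; π = λ x → record
        { coeff = π-coeff (coeff x) ; degree = suc (degree x) ; beyond = λ { (suc i) (s≤s d≤i) → beyond x i d≤i } }
      ; ζ-cong = λ e → mkᴾ λ i → mkᵛ λ s → at (atᴾ e i) (s ℕ.+ 1)
      ; π-cong = λ e → mkᴾ λ { zero → V.refl ; (suc i) → atᴾ e i }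
      ; ζ-homo = λ x y → mkᴾ λ i → mkᵛ λ s → ≡.refl
      ; π-homo = λ x y → mkᴾ λ { zero → mkᵛ λ s → ≡.refl ; (suc i) → V.refl }
      ; ζπ≈πζ = λ x → mkᴾ λ { zero → mkᵛ λ s → ≡.refl ; (suc i) → V.refl }
      }

    open Act polynomials

    ι : Seq → Polynomial
    ι u = record { coeff = λ { zero → u ; (suc _) → V.0# } ; degree = 1 ; beyond = λ { (suc i) _ → V.refl } }

    ι-cong : ∀ {u v} → u ≈ᵛ v → ι u ≈ ι v
    ι-cong e = mkᴾ λ { zero → e ; (suc i) → V.refl }

    ι-+ : ∀ u v → ι (u V.+ v) ≈ ι u + ι v
    ι-+ u v = mkᴾ λ { zero → V.refl ; (suc i) → mkᵛ λ s → ≡.refl }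

    ι-neg : ∀ u → ι (V.- u) ≈ - ι u
    ι-neg u = mkᴾ λ { zero → V.refl ; (suc i) → mkᵛ λ s → ≡.refl }

    ι-shift : ∀ u → ι (shift 1 u) ≈ act ζ̂ (ι u)
    ι-shift u = mkᴾ λ { zero → V.refl ; (suc i) → mkᵛ λ s → ≡.refl }

    act-ζ⇑ : ∀ n x i s → seq (coeff (act (ζ̂ ⇑ n) x) i) s ≡ seq (coeff x i) (s ℕ.+ n)
    act-ζ⇑ zero    x i s = ≡.cong (seq (coeff x i)) (≡.sym (ℕ.+-identityʳ s))
    act-ζ⇑ (suc n) x i s = ≡.trans (act-ζ⇑ n x i (s ℕ.+ 1)) (≡.cong (seq (coeff x i)) (ℕ.+-assoc s 1 n))

    ι-shift⇑ : ∀ n u → ι (shift n u) ≈ act (ζ̂ ⇑ n) (ι u)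
    ι-shift⇑ n u = mkᴾ λ { zero → mkᵛ λ s → ≡.sym (act-ζ⇑ n (ι u) 0 s) ; (suc i) → mkᵛ λ s → ≡.sym (act-ζ⇑ n (ι u) (suc i) s) }

    ζ⇑N : ζ̂ ⇑ N ≋ 𝟏
    ζ⇑N = mk≋ λ x → mkᴾ λ i → mkᵛ λ s → ≡.trans (act-ζ⇑ N x i s) (seq-periodic (coeff x i) s)

    open Theta polynomials

    private
      coeff-θ : ∀ t x i s → seq (coeff (act (θ t) x) i) s ≡
        seq (coeff x i) s ℤ.+ seq (π-coeff (coeff x) i) s ℤ.+ ℤ.- seq (coeff x i) (s ℕ.+ t)
      coeff-θ t x zero    s = ≡.cong (λ a → seq (coeff x 0) s ℤ.+ 0ℤ ℤ.+ ℤ.- a) (act-ζ⇑ t x 0 s)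
      coeff-θ t x (suc i) s = ≡.cong (λ a → seq (coeff x (suc i)) s ℤ.+ seq (coeff x i) s ℤ.+ ℤ.- a) (act-ζ⇑ t x (suc i) s)

    -- θ t is monic of degree 1 in π, so a nonzero multiple of it has a nonzero coefficient in
    -- positive degree. The coefficients of x are shown to vanish from the top down.
    constant-multiple⇒0 : ∀ t x → (∀ i → coeff (act (θ t) x) (suc i) ≈ᵛ V.0#) → x ≈ 0#
    constant-multiple⇒0 t x high≈0 = mkᴾ λ i → go (degree x) i (ℕ.m∸n≤m (degree x) i)
      where
      lemma : ∀ a → 0ℤ ℤ.+ a ℤ.+ ℤ.- 0ℤ ≡ a
      lemma = ℤSolver.solve-∀
      go : ∀ d i → degree x ∸ i ≤ d → coeff x i ≈ᵛ V.0#
      go zero    i d≤ = beyond x i (ℕ.m∸n≡0⇒m≤n (ℕ.n≤0⇒n≡0 d≤))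
      go (suc d) i d≤ = mkᵛ λ s → ≡.trans (≡.sym (lemma (seq (coeff x i) s)))
        (≡.trans (≡.sym (≡.cong₂ (λ a b → a ℤ.+ seq (coeff x i) s ℤ.+ ℤ.- b) (at above s) (at above (s ℕ.+ t))))
          (≡.trans (≡.sym (coeff-θ t x (suc i) s)) (at (high≈0 i) s)))
        where
        above : coeff x (suc i) ≈ᵛ V.0#
        above = go d (suc i) (ℕ.≤-trans (ℕ.≤-reflexive (≡.sym (ℕ.pred[m∸n]≡m∸[1+n] (degree x) i))) (ℕ.pred-mono-≤ d≤))

    θ-injective : ∀ t x → act (θ t) x ≈ 0# → x ≈ 0#
    θ-injective t x e = constant-multiple⇒0 t x λ i → atᴾ e (suc i)

    private
      lower : Polynomial → Polynomial
      lower x = record { coeff = coeff x ∘ suc ; degree = degree x ; beyond = λ i d≤i → beyond x (suc i) (ℕ.m≤n⇒m≤1+n d≤i) }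

      lower-split : ∀ x → x ≈ ι (coeff x 0) + act π̂ (lower x)
      lower-split x = mkᴾ λ { zero → V.sym (V.identityʳ (coeff x 0)) ; (suc i) → V.sym (V.identityˡ (coeff x (suc i))) }

    -- θ t = π - (ζᵗ - 1) is monic in π.
    division : ∀ t x → ∃₂ λ y r → x ≈ act (θ t) y + ι r
    division t x = go (degree x) x (beyond x)
      where
      go : ∀ d x → (∀ i → d ≤ i → coeff x i ≈ᵛ V.0#) → ∃₂ λ y r → x ≈ act (θ t) y + ι r
      go zero x x≈0 = 0# , V.0# , mkᴾ λ i → V.trans (x≈0 i z≤n) (V.sym (V.trans (V.∙-cong (atᴾ (act-0 (θ t)) i) (ι0 i)) (V.identityˡ V.0#)))
        where
        ι0 : ∀ i → coeff (ι V.0#) i ≈ᵛ V.0#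
        ι0 zero    = V.refl
        ι0 (suc i) = V.refl
      go (suc d) x x≈0 with y , r , e ← go d (lower x) (λ i d≤i → x≈0 (suc i) (s≤s d≤i)) =
        act π̂ y + ι r , coeff x 0 V.+ (shift t r V.+ V.- r) ,
        trans (division-step t {x} {lower x} {ι (coeff x 0)} {y} {ι r} (lower-split x) e) (+-congˡ {act (θ t) (act π̂ y + ι r)} (sym
          (trans (ι-+ (coeff x 0) (shift t r V.+ V.- r)) (+-congˡ {ι (coeff x 0)}
            (trans (ι-+ (shift t r) (V.- r)) (+-cong (ι-shift⇑ t r) (ι-neg r)))))))

    -- Let r be the remainder of y by θ t. By `remainder-multiple` the constant (ζᵗ - ζˢ) r is a
    -- multiple of θ t, hence 0 by degree, and r = 0 because ζᵗ - ζˢ is a non-zero-divisor.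
    θ-regular : ∀ t s → t < N → s < N → t ≢ s → ∀ x y → act (θ t) x ≈ act (θ s) y → Divides (θ t) y
    θ-regular t s t<N s<N t≢s x y e with y′ , r , y≈ ← division t y = y′ , trans y≈ (trans (+-congˡ {act (θ t) y′} (trans (ι-cong r≈0) ι0)) (+-identityʳ (act (θ t) y′)))
      where
      ι0 : ι V.0# ≈ 0#
      ι0 = mkᴾ λ { zero → V.refl ; (suc i) → V.refl }
      d = ζ̂ ⇑ t ⊞ ⊟ ζ̂ ⇑ s
      w = act (θ s) y′ + ι r
      multiple : act (θ t) (x + - w) ≈ act d (ι r)
      multiple = remainder-multiple t s {x} {y} {y′} {ι r} e y≈
      d-coeff : ∀ i s′ → seq (coeff (act d (ι r)) i) s′ ≡ seq (coeff (ι r) i) (s′ ℕ.+ t) ℤ.+ ℤ.- seq (coeff (ι r) i) (s′ ℕ.+ s)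
      d-coeff i s′ = ≡.cong₂ (λ a b → a ℤ.+ ℤ.- b) (act-ζ⇑ t (ι r) i s′) (act-ζ⇑ s (ι r) i s′)
      x-w≈0 : x + - w ≈ 0#
      x-w≈0 = constant-multiple⇒0 t (x + - w) λ i → V.trans (atᴾ multiple (suc i)) (mkᵛ λ s′ → d-coeff (suc i) s′)
      r≈0 : r ≈ᵛ V.0#
      r≈0 = shift-torsion-free r t s t<N s<N t≢s (mkᵛ λ s′ → ℤ.i-j≡0⇒i≡j _ _
        (≡.trans (≡.sym (d-coeff 0 s′)) (at (atᴾ (trans (sym multiple) (trans (act-cong (θ t) x-w≈0) (act-0 (θ t)))) 0) s′)))

    private
      instance
        p≢0 : NonZero p
        p≢0 = prime⇒nonZero pr

    -- Reduction modulo the prime 1 - ζ above p in each coefficient: ζ becomes 1, and every θ t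
    -- becomes π.
    reduction : Hom polynomials (series p)
    reduction = record
      { map    = λ x i → ρ (coeff x i)
      ; cong   = λ e → mk≈ λ i → ≡ₚ-reflexive p (ρ-cong (atᴾ e i))
      ; homo   = λ x y → mk≈ λ i → ≡ₚ-reflexive p (ρ-+ (coeff x i) (coeff y i))
      ; ζ-homo = λ x → mk≈ λ i → ρ-shift (coeff x i)
      ; π-homo = λ x → mk≈ λ { zero → ≡ₚ-reflexive p ρ-0 ; (suc i) → ≡ₚ-reflexive p {ρ (coeff x i)} ≡.refl } }
      where
      ρ-0 : ρ V.0# ≡ 0ℤ
      ρ-0 = ∑-zero p λ i _ → ∑-zero (i ℕ.* q) λ _ _ → ≡.refl

    open Evaluation p using (one; _·_)

    reduction-ι : ∀ u → Mod._≈_ (series p) (Hom.map reduction (ι u)) (ρ u · one)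
    reduction-ι u = mk≈ λ
      { zero → ≡ₚ-reflexive p (≡.sym (ℤ.*-identityʳ (ρ u)))
      ; (suc i) → ≡ₚ-reflexive p (≡.trans (∑-zero p λ i _ → ∑-zero (i ℕ.* q) λ _ _ → ≡.refl) (≡.sym (ℤ.*-zeroʳ (ρ u)))) }

-- Taylor expansion at points (ζᵃ¹, ..., ζᵃⁿ) and vanishing as linear equations

module Taylor where

  open Mods
  open Newton
  open Recurrence
  open Simplex using (ẑ; monomial; concatUpTo)
  open Cyclotomic
  open import Data.Fin.Base using (Fin)
  open import Data.Integer.Base as ℤ using (+_)
  open import Data.List.Base using (List; []; _∷_; _++_; map; length)
  open import Data.List.Properties using (length-++)
  open import Data.List.Relation.Unary.All as All using (All; []; _∷_)
  import Data.List.Relation.Unary.All.Properties as All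
  open import Data.List.Membership.Propositional using (_∈_)
  open import Data.Nat.Base as ℕ using (ℕ; zero; suc; _≤_; _<_; s≤s; _∸_)
  open import Data.Nat.Primality using (Prime)
  import Data.Nat.Properties as ℕ
  open import Data.Product using (∃; _×_; _,_)
  open import Data.Vec.Base as Vec using (Vec; []; _∷_)
  open import Data.Vec.Relation.Binary.Pointwise.Inductive as Pointwise using (Pointwise; []; _∷_)
  open import Function.Base using (_∘_)
  open import Relation.Binary.PropositionalEquality as ≡ using (_≡_; _≢_)
  open import Relation.Nullary using (contradiction)

  -- The number of exponents b ∈ ℕⁿ with b₁ + … + bₙ < D.
  σ : ℕ → ℕ → ℕ
  σ zero    zero    = 0
  σ zero    (suc D) = 1
  σ (suc n) zero    = 0
  σ (suc n) (suc D) = σ n (suc D) ℕ.+ σ (suc n) D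

  -- The coefficient of yʲ in (a + y)ᵛ.
  taylor : Op → ℕ → ℕ → Op
  taylor a zero    zero    = 𝟏
  taylor a (suc j) zero    = 𝟎
  taylor a zero    (suc v) = a ⊡ taylor a zero v
  taylor a (suc j) (suc v) = a ⊡ taylor a (suc j) v ⊞ taylor a j v

  -- The quotient of (a + y)ᵛ - Σ_{i<j} (taylor a i v) yⁱ by yʲ, where γ = a + y.
  tail : Op → Op → ℕ → ℕ → Op
  tail a γ zero    v       = γ ⇑ v
  tail a γ (suc j) zero    = 𝟎
  tail a γ (suc j) (suc v) = a ⊡ tail a γ (suc j) v ⊞ tail a γ j v

  module TaylorAlgebra (M : Mod) where
    open Act M
    open Theta M

    private
      lemma₁ : ∀ a y t k → (a ⊞ y) ⊡ (t ⊞ y ⊡ k) ≋ a ⊡ t ⊞ y ⊡ (a ⊡ k ⊞ (t ⊞ y ⊡ k))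
      lemma₁ = solve 4 (λ a y t k → (a :+ y) :* (t :+ y :* k) := a :* t :+ y :* (a :* k :+ (t :+ y :* k))) R.refl
        where open Solve
      lemma₂ : ∀ a y t₁ k₂ t₀ k₁ → a ⊡ (t₁ ⊞ y ⊡ k₂) ⊞ (t₀ ⊞ y ⊡ k₁) ≋ (a ⊡ t₁ ⊞ t₀) ⊞ y ⊡ (a ⊡ k₂ ⊞ k₁)
      lemma₂ = solve 6 (λ a y t₁ k₂ t₀ k₁ → a :* (t₁ :+ y :* k₂) :+ (t₀ :+ y :* k₁) := (a :* t₁ :+ t₀) :+ y :* (a :* k₂ :+ k₁)) R.refl
        where open Solve

    tail-step : ∀ {a γ y} → γ ≋ a ⊞ y → ∀ j v → tail a γ j v ≋ taylor a j v ⊞ y ⊡ tail a γ (suc j) v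
    tail-step {a} {γ} {y} e zero    zero    = R.sym (R.trans (R.+-congˡ {𝟏} (R.zeroʳ y)) (R.+-identityʳ 𝟏))
    tail-step {a} {γ} {y} e (suc j) zero    = R.sym (R.trans (R.+-identityˡ (y ⊡ 𝟎)) (R.zeroʳ y))
    tail-step {a} {γ} {y} e zero    (suc v) = R.trans (R.*-cong e ih)
      (R.trans (lemma₁ a y (taylor a 0 v) (tail a γ 1 v))
        (R.+-congˡ {a ⊡ taylor a 0 v} (R.*-congˡ {y} (R.+-congˡ {a ⊡ tail a γ 1 v} (R.sym ih)))))
      where ih = tail-step e zero v
    tail-step {a} {γ} {y} e (suc j) (suc v) =
      R.trans (R.+-cong (R.*-congˡ {a} (tail-step e (suc j) v)) (tail-step e j v))
        (lemma₂ a y (taylor a (suc j) v) (tail a γ (suc (suc j)) v) (taylor a j v) (tail a γ (suc j) v))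

    Divides-+ : ∀ a x y → Divides a x → Divides a y → Divides a (x + y)
    Divides-+ a x y (u , e) (v , f) = u + v , trans (+-cong e f) (sym (act-+ a u v))

    Divides-0 : ∀ a {x} → x ≈ 0# → Divides a x
    Divides-0 a e = 0# , trans e (sym (act-0 a))

    Divides-≈ : ∀ a {x y} → x ≈ y → Divides a y → Divides a x
    Divides-≈ a e (u , f) = u , trans e f

    Divides-suc : ∀ θ Δ i x → Divides (θ ⇑ i) x → Divides (θ ⇑ suc i) (act (θ ⊡ Δ) x)
    Divides-suc θ Δ i x (u , e) = act Δ u , act-cong θ (trans (act-cong Δ e) (act-comm Δ (θ ⇑ i) u))

    eval : ∀ {n} → List (Carrier × Vec ℕ n) → Vec Op n → Carrier
    eval []            Γ = 0#
    eval ((c , v) ∷ f) Γ = act (monomial Γ v) c + eval f Γ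

    eval-tail : ∀ {n} → Op → Op → ℕ → List (Carrier × Vec ℕ (suc n)) → Vec Op n → Carrier
    eval-tail a γ j []                Γ = 0#
    eval-tail a γ j ((c , v₁ ∷ v) ∷ f) Γ = act (tail a γ j v₁) (act (monomial Γ v) c) + eval-tail a γ j f Γ

    expand : ∀ {n} → Op → ℕ → List (Carrier × Vec ℕ (suc n)) → List (Carrier × Vec ℕ n)
    expand a j = map λ { (c , v₁ ∷ v) → act (taylor a j v₁) c , v }

    eval-tail-0 : ∀ {n} a γ (f : List (Carrier × Vec ℕ (suc n))) Γ → eval-tail a γ 0 f Γ ≈ eval f (γ ∷ Γ)
    eval-tail-0 a γ []                Γ = refl
    eval-tail-0 a γ ((c , v₁ ∷ v) ∷ f) Γ = +-congˡ (eval-tail-0 a γ f Γ)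

    eval-tail-step : ∀ {n a γ y} → γ ≋ a ⊞ y → ∀ j (f : List (Carrier × Vec ℕ (suc n))) Γ →
      eval-tail a γ j f Γ ≈ eval (expand a j f) Γ + act y (eval-tail a γ (suc j) f Γ)
    eval-tail-step {y = y} e j [] Γ = sym (trans (+-congˡ (act-0 y)) (+-identityˡ 0#))
    eval-tail-step {a = a} {γ} {y} e j ((c , v₁ ∷ v) ∷ f) Γ = begin
      act (tail a γ j v₁) x + eval-tail a γ j f Γ
        ≈⟨ +-cong (on (tail-step e j v₁) x) (eval-tail-step e j f Γ) ⟩
      act (taylor a j v₁) x + act y (act (tail a γ (suc j) v₁) x) + (eval (expand a j f) Γ + act y (eval-tail a γ (suc j) f Γ))
        ≈⟨ medial _ _ _ _ ⟩
      act (taylor a j v₁) x + eval (expand a j f) Γ + (act y (act (tail a γ (suc j) v₁) x) + act y (eval-tail a γ (suc j) f Γ))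
        ≈⟨ +-cong (+-congʳ (act-comm (taylor a j v₁) (monomial Γ v) c)) (sym (act-+ y _ _)) ⟩
      act (monomial Γ v) (act (taylor a j v₁) c) + eval (expand a j f) Γ
        + act y (act (tail a γ (suc j) v₁) x + eval-tail a γ (suc j) f Γ) ∎
      where
      open import Relation.Binary.Reasoning.Setoid setoid
      x = act (monomial Γ v) c

    -- f vanishes to order D at the point (ζᵃ¹, …, ζᵃⁿ).
    VanishesTo : ∀ n → ℕ → Vec ℕ n → List (Carrier × Vec ℕ n) → Set
    VanishesTo zero    D []       f = D ≢ 0 → eval f [] ≈ 0#
    VanishesTo (suc n) D (a ∷ as) f = ∀ j → j < D → VanishesTo n (D ∸ j) as (expand (ζ̂ ⇑ a) j f)

    -- The congruence γ ≡ ζᵃ modulo θ: the coordinate γ of a curve takes the value ζᵃ at the root of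
    -- θ.
    Contact : Op → Op → ℕ → Set
    Contact θ γ a = ∃ λ Δ → γ ≋ ζ̂ ⇑ a ⊞ θ ⊡ Δ

    -- By induction on the number of variables: the first coordinate is ζᵃ + y with y = θ Δ. The
    -- coefficient of yʲ vanishes to order D - j in the other variables, and yʲ supplies the missing
    -- θʲ.
    vanishes-along : ∀ θ n D as f Γ → VanishesTo n D as f → Pointwise (Contact θ) Γ as → Divides (θ ⇑ D) (eval f Γ)
    vanishes-along θ zero zero    [] f [] v [] = eval f [] , refl
    vanishes-along θ zero (suc D) [] f [] v [] = Divides-0 (θ ⇑ suc D) (v λ ())
    vanishes-along θ (suc n) D (a ∷ as) f (γ ∷ Γ) v ((Δ , e) ∷ contact) =
      Divides-≈ (θ ⇑ D) (sym (eval-tail-0 (ζ̂ ⇑ a) γ f Γ)) (go D 0 (ℕ.+-identityʳ D))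
      where
      go : ∀ i j → i ℕ.+ j ≡ D → Divides (θ ⇑ i) (eval-tail (ζ̂ ⇑ a) γ j f Γ)
      go zero    j eq = _ , refl
      go (suc i) j eq = Divides-≈ (θ ⇑ suc i) (eval-tail-step e j f Γ)
        (Divides-+ (θ ⇑ suc i) _ _
          (≡.subst (λ i → Divides (θ ⇑ i) (eval (expand (ζ̂ ⇑ a) j f) Γ)) D∸j≡
            (vanishes-along θ n (D ∸ j) as (expand (ζ̂ ⇑ a) j f) Γ (v j j<D) contact))
          (Divides-suc θ Δ i _ (go i (suc j) (≡.trans (ℕ.+-suc i j) eq))))
        where
        j<D : j < D
        j<D = ≡.subst (j <_) eq (s≤s (ℕ.m≤n+m j i))
        D∸j≡ : D ∸ j ≡ suc i
        D∸j≡ = ≡.trans (≡.cong (_∸ j) (≡.sym eq)) (ℕ.m+n∸n≡m (suc i) j)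

    power-contact : ∀ {z a θ} → z ≋ a ⊞ θ → ∀ u → ∃ λ Δ → z ⇑ u ≋ a ⇑ u ⊞ θ ⊡ Δ
    power-contact {θ = θ} e zero = 𝟎 , R.sym (R.trans (R.+-congˡ {𝟏} (R.zeroʳ θ)) (R.+-identityʳ 𝟏))
    power-contact {z} {a} {θ} e (suc u) with Δ , eq ← power-contact e u =
      a ⊡ Δ ⊞ (a ⇑ u ⊞ θ ⊡ Δ) , R.trans (R.*-cong e eq) (lemma a θ (a ⇑ u) Δ)
      where
      open Solve
      lemma : ∀ a θ s Δ → (a ⊞ θ) ⊡ (s ⊞ θ ⊡ Δ) ≋ a ⊡ s ⊞ θ ⊡ (a ⊡ Δ ⊞ (s ⊞ θ ⊡ Δ))
      lemma = solve 4 (λ a θ s Δ → (a :+ θ) :* (s :+ θ :* Δ) := a :* s :+ θ :* (a :* Δ :+ (s :+ θ :* Δ))) R.refl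

    -- At the root of θ t one has z = ζᵗ, so ζᵃ zᵘ becomes ζ^(a+ut), a coordinate of the line at
    -- parameter t. The perturbation H G, a multiple of θ t, vanishes there.
    curve-contact : ∀ t a u {H} H′ G b → H ≋ θ t ⊡ H′ → ζ̂ ⇑ (a ℕ.+ u ℕ.* t) ≋ ζ̂ ⇑ b →
      Contact (θ t) (ζ̂ ⇑ a ⊡ ẑ ⇑ u ⊞ H ⊡ G) b
    curve-contact t a u {H} H′ G b H≋ ζ≋ with Δ , eq ← power-contact (R.sym (R.trans (R.+-comm (ζ̂ ⇑ t) (θ t)) (θ+ζ⇑ t))) u =
      ζ̂ ⇑ a ⊡ Δ ⊞ H′ ⊡ G , (begin
        ζ̂ ⇑ a ⊡ ẑ ⇑ u ⊞ H ⊡ G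
          ≈⟨ R.+-cong (R.*-congˡ {ζ̂ ⇑ a} eq) (R.*-congʳ {G} H≋) ⟩
        ζ̂ ⇑ a ⊡ ((ζ̂ ⇑ t) ⇑ u ⊞ θ t ⊡ Δ) ⊞ (θ t ⊡ H′) ⊡ G
          ≈⟨ lemma (ζ̂ ⇑ a) ((ζ̂ ⇑ t) ⇑ u) (θ t) Δ H′ G ⟩
        ζ̂ ⇑ a ⊡ (ζ̂ ⇑ t) ⇑ u ⊞ θ t ⊡ (ζ̂ ⇑ a ⊡ Δ ⊞ H′ ⊡ G)
          ≈⟨ R.+-congʳ {θ t ⊡ (ζ̂ ⇑ a ⊡ Δ ⊞ H′ ⊡ G)} (R.trans (R.*-congˡ {ζ̂ ⇑ a} (R.sym (⇑-* ζ̂ u t)))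
               (R.trans (R.sym (⇑-+ ζ̂ a (u ℕ.* t))) ζ≋)) ⟩
        ζ̂ ⇑ b ⊞ θ t ⊡ (ζ̂ ⇑ a ⊡ Δ ⊞ H′ ⊡ G) ∎)
      where
      open ≋-Reasoning
      lemma : ∀ a s θ Δ H G → a ⊡ (s ⊞ θ ⊡ Δ) ⊞ (θ ⊡ H) ⊡ G ≋ a ⊡ s ⊞ θ ⊡ (a ⊡ Δ ⊞ H ⊡ G)
      lemma = solve 6 (λ a s θ Δ H G → a :* (s :+ θ :* Δ) :+ (θ :* H) :* G := a :* s :+ θ :* (a :* Δ :+ H :* G)) R.refl
        where open Solve

  σ-sum : ∀ {A : Set} n D (f : ℕ → List A) → (∀ j → length (f j) ≡ σ n (D ∸ j)) → length (concatUpTo D f) ≡ σ (suc n) D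
  σ-sum n zero    f eq = ≡.refl
  σ-sum n (suc D) f eq = ≡.trans (length-++ (f 0)) (≡.cong₂ ℕ._+_ (eq 0) (σ-sum n D (f ∘ suc) (eq ∘ suc)))

  All-concatUpTo⁻ : {A : Set} {P : A → Set} → ∀ t (f : ℕ → List A) → All P (concatUpTo t f) → ∀ j → j < t → All P (f j)
  All-concatUpTo⁻ (suc t) f all zero    _         = All.++⁻ˡ (f 0) all
  All-concatUpTo⁻ (suc t) f all (suc j) (s≤s j<t) = All-concatUpTo⁻ t (f ∘ suc) (All.++⁻ʳ (f 0) all) j j<t

  module Constraints {p : ℕ} (pr : Prime p) (k b : ℕ) where
    open Seq pr k
    open Poly pr k

    -- Seq, on which only the polynomials in ζ act faithfully.
    seqMod : Mod
    seqMod = record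
      { abelianGroup = seqGroup
      ; ζ = shift 1 ; π = λ _ → V.0#
      ; ζ-cong = λ e → mkᵛ λ s → at e (s ℕ.+ 1) ; π-cong = λ _ → V.refl
      ; ζ-homo = λ x y → mkᵛ λ s → ≡.refl ; π-homo = λ x y → V.sym (V.identityˡ V.0#)
      ; ζπ≈πζ = λ x → mkᵛ λ s → ≡.refl }

    private
      module A = Act seqMod
      module X = Act polynomials
    open TaylorAlgebra polynomials using (eval; expand; VanishesTo)

    -- The Taylor coefficients at ζᵃ contain no π, so their action on constant polynomials can be
    -- computed in `Seq`.
    ι-taylor : ∀ a j v u → X.act (taylor (ζ̂ ⇑ a) j v) (ι u) X.≈ ι (A.act (taylor (ζ̂ ⇑ a) j v) u)
    ι-ζ⇑ : ∀ a u → X.act (ζ̂ ⇑ a) (ι u) X.≈ ι (A.act (ζ̂ ⇑ a) u)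
    ι-ζ⇑ zero    u = X.refl
    ι-ζ⇑ (suc a) u = X.trans {X.act (ζ̂ ⇑ suc a) (ι u)} {X.act ζ̂ (ι (A.act (ζ̂ ⇑ a) u))} {ι (A.act (ζ̂ ⇑ suc a) u)}
      (X.act-cong ζ̂ {X.act (ζ̂ ⇑ a) (ι u)} {ι (A.act (ζ̂ ⇑ a) u)} (ι-ζ⇑ a u)) (X.sym {ι (A.act (ζ̂ ⇑ suc a) u)} (ι-shift (A.act (ζ̂ ⇑ a) u)))

    private
      ι-mul : ∀ a t {x} u → x X.≈ ι (A.act t u) → X.act (ζ̂ ⇑ a) x X.≈ ι (A.act (ζ̂ ⇑ a ⊡ t) u)
      ι-mul a t {x} u e = X.trans {X.act (ζ̂ ⇑ a) x} {X.act (ζ̂ ⇑ a) (ι (A.act t u))} {ι (A.act (ζ̂ ⇑ a ⊡ t) u)}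
        (X.act-cong (ζ̂ ⇑ a) {x} {ι (A.act t u)} e) (ι-ζ⇑ a (A.act t u))

    ι-taylor a zero    zero    u = X.refl
    ι-taylor a (suc j) zero    u = mkᴾ λ { zero → V.refl ; (suc i) → V.refl }
    ι-taylor a zero    (suc v) u = ι-mul a (taylor (ζ̂ ⇑ a) zero v) u (ι-taylor a zero v u)
    ι-taylor a (suc j) (suc v) u =
      X.trans {X.act (taylor (ζ̂ ⇑ a) (suc j) (suc v)) (ι u)} {ι x X.+ ι y} {ι (x V.+ y)}
        (X.+-cong {X.act (ζ̂ ⇑ a ⊡ taylor (ζ̂ ⇑ a) (suc j) v) (ι u)} {ι x} {X.act (taylor (ζ̂ ⇑ a) j v) (ι u)} {ι y}
          (ι-mul a (taylor (ζ̂ ⇑ a) (suc j) v) u (ι-taylor a (suc j) v u)) (ι-taylor a j v u))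
        (X.sym {ι (x V.+ y)} (ι-+ x y))
      where
      x = A.act (ζ̂ ⇑ a ⊡ taylor (ζ̂ ⇑ a) (suc j) v) u
      y = A.act (taylor (ζ̂ ⇑ a) j v) u

    open Equivariant

    compose : Op → Equivariant b → Equivariant b
    compose a C = record
      { fun = λ y → A.act a (fun C y)
      ; cong = λ e → A.act-cong a (cong C e)
      ; homo = λ x y → V.trans (A.act-cong a (homo C x y)) (A.act-+ a (fun C x) (fun C y))
      ; shift-homo = λ x → V.trans (A.act-cong a (shift-homo C x)) (A.act-comm a ζ̂ (fun C x)) }

    total : List (Equivariant b × Vec ℕ 0) → Equivariant b
    total [] = record { fun = λ _ → V.0# ; cong = λ _ → V.refl ; homo = λ _ _ → V.sym (V.identityˡ V.0#) ; shift-homo = λ _ → mkᵛ λ s → ≡.refl }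
    total ((C , _) ∷ f) = record
      { fun = λ y → fun C y V.+ fun (total f) y
      ; cong = λ e → V.∙-cong (cong C e) (cong (total f) e)
      ; homo = λ x y → V.trans (V.∙-cong (homo C x y) (homo (total f) x y)) (A.medial (fun C x) (fun C y) (fun (total f) x) (fun (total f) y))
      ; shift-homo = λ x → V.trans (V.∙-cong (shift-homo C x) (shift-homo (total f) x)) (mkᵛ λ s → ≡.refl) }

    at-solution : ∀ {n} → (Fin b → Seq) → List (Equivariant b × Vec ℕ n) → List (Polynomial × Vec ℕ n)
    at-solution y = map λ (C , v) → ι (fun C y) , v

    differentiate : ∀ {n} → ℕ → ℕ → List (Equivariant b × Vec ℕ (suc n)) → List (Equivariant b × Vec ℕ n)
    differentiate a j = map λ { (C , v₁ ∷ v) → compose (taylor (ζ̂ ⇑ a) j v₁) C , v }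

    -- Parallel to `VanishesTo`, but for a polynomial whose coefficients are ℤ[ζ]-linear forms in b
    -- unknowns; each condition is then one such form.
    constraints : ∀ n → ℕ → Vec ℕ n → List (Equivariant b × Vec ℕ n) → List (Equivariant b)
    constraints zero    zero    []       f = []
    constraints zero    (suc D) []       f = total f ∷ []
    constraints (suc n) D       (a ∷ as) f = concatUpTo D λ j → constraints n (D ∸ j) as (differentiate a j f)

    length-constraints : ∀ n D as f → length (constraints n D as f) ≡ σ n D
    length-constraints zero    zero    []       f = ≡.refl
    length-constraints zero    (suc D) []       f = ≡.refl
    length-constraints (suc n) D       (a ∷ as) f = σ-sum n D _ λ j → length-constraints n (D ∸ j) as (differentiate a j f)

    private
      Same : ∀ {n} → List (Polynomial × Vec ℕ n) → List (Polynomial × Vec ℕ n) → Set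
      Same f g = ListPointwise (λ (c , v) (d , w) → c X.≈ d × v ≡ w) f g
        where open import Data.List.Relation.Binary.Pointwise using () renaming (Pointwise to ListPointwise)

    -- Stated for all g that agree with the substituted polynomial, because substituting a solution
    -- and expanding at ζᵃ are compared only up to the equality of the module.
    constraints⇒VanishesTo : ∀ n D as f y → All (λ C → fun C y ≈ᵛ V.0#) (constraints n D as f) →
      ∀ g → Same g (at-solution y f) → VanishesTo n D as g
    constraints⇒VanishesTo zero    zero    []       f y zs g same D≢0 = contradiction ≡.refl D≢0
    constraints⇒VanishesTo zero    (suc D) []       f y (z ∷ []) g same D≢0 =
      X.trans {eval g []} {ι (fun (total f) y)} {X.0#} (value f g same)
        (X.trans {ι (fun (total f) y)} {ι V.0#} {X.0#} (ι-cong z) (mkᴾ λ { zero → V.refl ; (suc i) → V.refl }))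
      where
      open import Data.List.Relation.Binary.Pointwise using ([]; _∷_)
      value : ∀ f g → Same g (at-solution y f) → eval g [] X.≈ ι (fun (total f) y)
      value []             [] [] = mkᴾ λ { zero → V.refl ; (suc i) → V.refl }
      value ((C , []) ∷ f) ((c , []) ∷ g) ((e , _) ∷ same) =
        X.trans {c X.+ eval g []} {ι (fun C y) X.+ ι (fun (total f) y)} {ι (fun C y V.+ fun (total f) y)}
          (X.+-cong {c} {ι (fun C y)} {eval g []} {ι (fun (total f) y)} e (value f g same))
          (X.sym {ι (fun C y V.+ fun (total f) y)} (ι-+ (fun C y) (fun (total f) y)))
    constraints⇒VanishesTo (suc n) D (a ∷ as) f y zs g same j j<D =
      constraints⇒VanishesTo n (D ∸ j) as (differentiate a j f) y (All-concatUpTo⁻ D _ zs j j<D) (expand (ζ̂ ⇑ a) j g) (expanded f g same)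
      where
      open import Data.List.Relation.Binary.Pointwise using ([]; _∷_)
      expanded : ∀ f g → Same g (at-solution y f) → Same (expand (ζ̂ ⇑ a) j g) (at-solution y (differentiate a j f))
      expanded []                  [] [] = []
      expanded ((C , v₁ ∷ v) ∷ f) ((c , .(v₁ ∷ v)) ∷ g) ((e , ≡.refl) ∷ same) =
        (X.trans {X.act (taylor (ζ̂ ⇑ a) j v₁) c} {X.act (taylor (ζ̂ ⇑ a) j v₁) (ι (fun C y))} {ι (A.act (taylor (ζ̂ ⇑ a) j v₁) (fun C y))}
          (X.act-cong (taylor (ζ̂ ⇑ a) j v₁) {c} {ι (fun C y)} e) (ι-taylor a j v₁ (fun C y)) , ≡.refl) ∷ expanded f g same

-- Curves along the lines of (ℤ/N)ⁿ and the vanishing of reductions on them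

module Lines where

  open import Defs
  open Mods
  open Newton
  open Recurrence
  open Simplex using (ẑ; monomial)
  open Cyclotomic
  open Taylor
  open import Data.Fin.Base as Fin using (Fin; zero; suc; toℕ)
  import Data.Fin.Properties as Fin
  open import Data.Integer.Base as ℤ using (+_)
  open import Data.List.Base using (List; []; _∷_; map; allFin)
  open import Data.List.Properties using (map-∘; map-cong)
  open import Data.List.Relation.Unary.All as All using (All; []; _∷_)
  import Data.List.Relation.Unary.All.Properties as All
  open import Data.List.Relation.Unary.Any using (here; there)
  open import Data.List.Membership.Propositional using (_∈_)
  open import Data.List.Membership.Propositional.Properties using (∈-map⁺; ∈-allFin)
  import Data.List.Relation.Unary.Unique.Propositional.Properties as Unique
  open import Data.Nat.Base as ℕ using (ℕ; zero; suc; NonZero; _≤_; _<_; _^_; _∸_; _%_; _/_)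
  import Data.Nat.DivMod as ℕ
  open import Data.Nat.DivMod using (_mod_)
  open import Data.Nat.ListAction using (sum)
  open import Data.Nat.Primality using (Prime; prime⇒nonZero)
  import Data.Nat.Properties as ℕ
  open import Data.Product using (∃; _×_; _,_; proj₁; proj₂)
  open import Data.Vec.Base as Vec using (Vec; []; _∷_)
  open import Data.Vec.Relation.Binary.Pointwise.Inductive as Pointwise using (Pointwise; []; _∷_)
  open import Function.Base using (_∘_)
  open import Relation.Binary.PropositionalEquality as ≡ using (_≡_; _≢_)

  module HomEval {M N : Mod} (h : Hom M N) where
    private
      module M = Act M
      module N = Act N
      module TM = TaylorAlgebra M
      module TN = TaylorAlgebra N

    hom-eval : ∀ {n} (f : List (M.Carrier × Vec ℕ n)) Γ →
      Hom.map h (TM.eval f Γ) N.≈ TN.eval (map (λ (c , v) → Hom.map h c , v) f) Γ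
    hom-eval []            Γ = hom-0 h
    hom-eval ((c , v) ∷ f) Γ = N.trans (Hom.homo h _ _) (N.+-cong (hom-act h (monomial Γ v) c) (hom-eval f Γ))

  module EvalCong (M : Mod) where
    open Act M
    open TaylorAlgebra M

    monomial-cong : ∀ {n} {Γ Δ : Vec Op n} → Pointwise _≋_ Γ Δ → ∀ v → monomial Γ v ≋ monomial Δ v
    monomial-cong []      []      = R.refl
    monomial-cong (e ∷ es) (j ∷ v) = R.*-cong (⇑-cong j e) (monomial-cong es v)

    eval-cong : ∀ {n} {Γ Δ : Vec Op n} → Pointwise _≋_ Γ Δ → ∀ f → eval f Γ ≈ eval f Δ
    eval-cong es []            = refl
    eval-cong es ((c , v) ∷ f) = +-cong (on (monomial-cong es v) c) (eval-cong es f)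

  module ProductAlgebra (M : Mod) where
    open Act M

    product-factor : ∀ m {t} ts → t ∈ ts → m t ≡ 1 → ∃ λ H → product m ts ≋ θ t ⊡ H
    product-factor m {t} (_ ∷ ts) (here ≡.refl) eq = product m ts ,
      R.*-congʳ {product m ts} (R.trans (R.reflexive (≡.cong (θ t ⇑_) eq)) (R.*-identityʳ (θ t)))
    product-factor m {t} (s ∷ ts) (there t∈) eq with H , e ← product-factor m ts t∈ eq =
      θ s ⇑ m s ⊡ H , R.trans (R.*-congˡ {θ s ⇑ m s} e) (R.trans (R.sym (R.*-assoc (θ s ⇑ m s) (θ t) H))
        (R.trans (R.*-congʳ {H} (R.*-comm (θ s ⇑ m s) (θ t))) (R.*-assoc (θ t) (θ s ⇑ m s) H)))

    -- Where ζ acts as 1 every θ t is π, so only the total multiplicity counts; this turns the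
    -- values of f on a line into the line sum.
    product≋π : ζ̂ ≋ 𝟏 → ∀ m ts → product m ts ≋ π̂ ⇑ sum (map m ts)
    product≋π ζ≋𝟏 m []       = R.refl
    product≋π ζ≋𝟏 m (t ∷ ts) = R.trans (R.*-cong (⇑-cong (m t) θ≋π) (product≋π ζ≋𝟏 m ts)) (R.sym (⇑-+ π̂ (m t) (sum (map m ts))))
      where
      θ≋π : θ t ≋ π̂
      θ≋π = R.trans (R.+-congˡ {ẑ} (R.-‿cong (R.trans (⇑-cong t ζ≋𝟏) (𝟏⇑ t))))
        (R.trans (R.+-congʳ {⊟ 𝟏} (R.+-comm 𝟏 π̂)) (R.trans (R.+-assoc π̂ 𝟏 (⊟ 𝟏))
          (R.trans (R.+-congˡ {π̂} (R.-‿inverseʳ 𝟏)) (R.+-identityʳ π̂))))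

  module LineCurves {p : ℕ} (pr : Prime p) (k : ℕ) where
    open Seq pr k
    open Poly pr k
    private
      instance
        N≢0 : NonZero N
        N≢0 = ℕ.m^n≢0 p (suc k) {{prime⇒nonZero pr}}
      module X = Act polynomials
      module A = Act (series p)
    open Theta polynomials using (Divides)
    open TaylorAlgebra polynomials using (eval; VanishesTo; Contact; curve-contact; vanishes-along)
    open Series pr using (Vanishes; Vanishes-≈; Vanishes-π⇑; Vanishes-≤)

    residues : List ℕ
    residues = map toℕ (allFin N)

    toℕ-mod : ∀ m → toℕ (m mod N) ≡ m % N
    toℕ-mod = Residues.Ring.toℕ-mod N

    mod-toℕ : ∀ (i : Fin N) → toℕ i mod N ≡ i
    mod-toℕ = Residues.Ring.mod-toℕ N

    ζ⇑-mod : ∀ m → ζ̂ ⇑ m X.≋ ζ̂ ⇑ (m % N)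
    ζ⇑-mod m = X.R.trans (X.R.reflexive (≡.cong (ζ̂ ⇑_) (ℕ.m≡m%n+[m/n]*n m N)))
      (X.R.trans (X.⇑-+ ζ̂ (m % N) (m / N ℕ.* N)) (X.R.trans (X.R.*-congˡ {ζ̂ ⇑ (m % N)}
        (X.R.trans (X.⇑-* ζ̂ (m / N) N) (X.R.trans (X.⇑-cong (m / N) ζ⇑N) (X.𝟏⇑ (m / N))))) (X.R.*-identityʳ (ζ̂ ⇑ (m % N)))))

    toℕ-line : ∀ (a t u : Fin N) ũ → ũ % N ≡ toℕ u → toℕ (a ⊕ t ⊗ u) ≡ (toℕ a ℕ.+ ũ ℕ.* toℕ t) % N
    toℕ-line a t u ũ ũ≡ = begin
      toℕ (a ⊕ t ⊗ u)                            ≡⟨ toℕ-mod (toℕ a ℕ.+ toℕ (t ⊗ u)) ⟩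
      (toℕ a ℕ.+ toℕ (t ⊗ u)) % N                ≡⟨ ≡.cong (λ x → (toℕ a ℕ.+ x) % N) (toℕ-mod (toℕ t ℕ.* toℕ u)) ⟩
      (toℕ a ℕ.+ (toℕ t ℕ.* toℕ u) % N) % N      ≡⟨ %-+ (toℕ a) (toℕ t ℕ.* toℕ u) ⟩
      (toℕ a ℕ.+ toℕ t ℕ.* toℕ u) % N            ≡⟨ ≡.cong (λ x → (toℕ a ℕ.+ toℕ t ℕ.* x) % N) (≡.sym ũ≡) ⟩
      (toℕ a ℕ.+ toℕ t ℕ.* (ũ % N)) % N          ≡⟨ %-+ (toℕ a) (toℕ t ℕ.* (ũ % N)) ⟨
      (toℕ a ℕ.+ (toℕ t ℕ.* (ũ % N)) % N) % N    ≡⟨ ≡.cong (λ x → (toℕ a ℕ.+ x) % N) (%-* (toℕ t) ũ) ⟩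
      (toℕ a ℕ.+ (toℕ t ℕ.* ũ) % N) % N          ≡⟨ %-+ (toℕ a) (toℕ t ℕ.* ũ) ⟩
      (toℕ a ℕ.+ toℕ t ℕ.* ũ) % N                ≡⟨ ≡.cong (λ x → (toℕ a ℕ.+ x) % N) (ℕ.*-comm (toℕ t) ũ) ⟩
      (toℕ a ℕ.+ ũ ℕ.* toℕ t) % N                ∎
      where
      open ≡.≡-Reasoning
      %-+ : ∀ a b → (a ℕ.+ b % N) % N ≡ (a ℕ.+ b) % N
      %-+ a b = ≡.trans (ℕ.%-distribˡ-+ a (b % N) N) (≡.trans (≡.cong (λ x → (a % N ℕ.+ x) % N) (ℕ.m%n%n≡m%n b N)) (≡.sym (ℕ.%-distribˡ-+ a b N)))
      %-* : ∀ a b → (a ℕ.* (b % N)) % N ≡ (a ℕ.* b) % N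
      %-* a b = ≡.trans (ℕ.%-distribˡ-* a (b % N) N) (≡.trans (≡.cong (λ x → (a % N ℕ.* x) % N) (ℕ.m%n%n≡m%n b N)) (≡.sym (ℕ.%-distribˡ-* a b N)))

    curve : ∀ {n} → Op → Vec ℕ n → Vec ℕ n → Vec Op n → Vec Op n
    curve H []       []       []       = []
    curve H (a ∷ as) (u ∷ us) (G ∷ Gs) = (ζ̂ ⇑ a ⊡ ẑ ⇑ u ⊞ H ⊡ G) ∷ curve H as us Gs

    reduced-curve : ∀ {n} → ℕ → Vec ℕ n → Vec Op n → Vec Op n
    reduced-curve M []       []       = []
    reduced-curve M (u ∷ us) (G ∷ Gs) = (ẑ ⇑ u ⊞ π̂ ⇑ M ⊡ G) ∷ reduced-curve M us Gs

    curve-reduces : ∀ {n} H M → H A.≋ π̂ ⇑ M → ∀ (as us : Vec ℕ n) Gs → Pointwise A._≋_ (curve H as us Gs) (reduced-curve M us Gs)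
    curve-reduces H M e []       []       []       = []
    curve-reduces H M e (a ∷ as) (u ∷ us) (G ∷ Gs) =
      A.R.+-cong (A.R.trans (A.R.*-congʳ {ẑ ⇑ u} ζ⇑≋𝟏) (A.R.*-identityˡ (ẑ ⇑ u))) (A.R.*-congʳ {G} e) ∷ curve-reduces H M e as us Gs
      where
      ζ⇑≋𝟏 : ζ̂ ⇑ a A.≋ 𝟏
      ζ⇑≋𝟏 = A.R.trans (A.⇑-cong a (A.mk≋ λ x → A.refl)) (A.𝟏⇑ a)

    curve-contacts : ∀ {n} (t : Fin N) {H} H′ → H X.≋ θ (toℕ t) ⊡ H′ → ∀ (a u : Vec (Fin N) n) ũ Gs →
      Pointwise (λ ũ u → ũ % N ≡ toℕ u) ũ u →
      Pointwise (Contact (θ (toℕ t))) (curve H (Vec.map toℕ a) ũ Gs) (Vec.map toℕ (a ⊕ᵛ t ·ᵛ u))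
    curve-contacts t H′ e []      []      []      []       []           = []
    curve-contacts t H′ e (a ∷ as) (u ∷ us) (ũ ∷ ũs) (G ∷ Gs) (ũ≡ ∷ ũs≡) =
      curve-contact (toℕ t) (toℕ a) ũ H′ G (toℕ (a ⊕ t ⊗ u)) e
        (X.R.trans (ζ⇑-mod (toℕ a ℕ.+ ũ ℕ.* toℕ t)) (X.R.reflexive (≡.cong (ζ̂ ⇑_) (≡.sym (toℕ-line a t u ũ ũ≡)))))
      ∷ curve-contacts t H′ e as us ũs Gs ũs≡

    support : (Fin N → ℕ) → ℕ
    support g = sum (map (λ t → 1 ℕ.⊓ g t) (allFin N))

    module _ {n : ℕ} (Q : List (Polynomial × Vec ℕ n)) (m M : ℕ) (g : Fin N → ℕ) (support≤M : support g ≤ M)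
             (a u : Vec (Fin N) n) (vanishing : ∀ t → VanishesTo n (m ℕ.* g t) (Vec.map toℕ (a ⊕ᵛ t ·ᵛ u)) Q) where
      private
        χ e : ℕ → ℕ
        χ t = 1 ℕ.⊓ g (t mod N)
        e t = m ℕ.* g (t mod N)
        -- H is divisible by θ t whenever g t ≠ 0, so multiples of it do not move the curve off
        -- those points of the line. The extra power of π makes its reduction exactly π^M.
        H = product χ residues ⊡ π̂ ⇑ (M ∸ support g)

        sum-residues : ∀ (h : ℕ → ℕ) (h′ : Fin N → ℕ) → (∀ t → h (toℕ t) ≡ h′ t) → sum (map h residues) ≡ sum (map h′ (allFin N))
        sum-residues h h′ eq = ≡.cong sum (≡.trans (≡.sym (map-∘ (allFin N))) (map-cong eq (allFin N)))

        sum-scale : ∀ (h : Fin N → ℕ) ts → sum (map (λ t → m ℕ.* h t) ts) ≡ m ℕ.* sum (map h ts)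
        sum-scale h []       = ≡.sym (ℕ.*-zeroʳ m)
        sum-scale h (t ∷ ts) = ≡.trans (≡.cong (m ℕ.* h t ℕ.+_) (sum-scale h ts)) (≡.sym (ℕ.*-distribˡ-+ m (h t) _))

        order-at : ∀ ũ Gs → Pointwise (λ ũ u → ũ % N ≡ toℕ u) ũ u → ∀ t → Divides (θ (toℕ t) ⇑ e (toℕ t)) (eval Q (curve H (Vec.map toℕ a) ũ Gs))
        order-at ũ Gs ũ≡ t = by-cases (g t) ≡.refl
          where
          Γ = curve H (Vec.map toℕ a) ũ Gs
          e≡ : e (toℕ t) ≡ m ℕ.* g t
          e≡ = ≡.cong (λ t → m ℕ.* g t) (mod-toℕ t)
          by-cases : ∀ d → g t ≡ d → Divides (θ (toℕ t) ⇑ e (toℕ t)) (eval Q Γ)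
          by-cases zero    gt≡0 = ≡.subst (λ i → Divides (θ (toℕ t) ⇑ i) (eval Q Γ))
            (≡.sym (≡.trans e≡ (≡.trans (≡.cong (m ℕ.*_) gt≡0) (ℕ.*-zeroʳ m)))) (eval Q Γ , X.refl {eval Q Γ})
          by-cases (suc d) gt≡ = ≡.subst (λ i → Divides (θ (toℕ t) ⇑ i) (eval Q Γ)) (≡.sym e≡)
            (vanishes-along (θ (toℕ t)) n (m ℕ.* g t) (Vec.map toℕ (a ⊕ᵛ t ·ᵛ u)) Q Γ (vanishing t)
              (curve-contacts t (proj₁ factor ⊡ π̂ ⇑ (M ∸ support g)) H≋ a u ũ Gs ũ≡))
            where
            factor = ProductAlgebra.product-factor polynomials χ residues (∈-map⁺ toℕ (∈-allFin t))
                       (≡.trans (≡.cong (λ t → 1 ℕ.⊓ g t) (mod-toℕ t)) (≡.cong (1 ℕ.⊓_) gt≡))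
            H≋ : H X.≋ θ (toℕ t) ⊡ (proj₁ factor ⊡ π̂ ⇑ (M ∸ support g))
            H≋ = X.R.trans (X.R.*-congʳ {π̂ ⇑ (M ∸ support g)} (proj₂ factor)) (X.R.*-assoc (θ (toℕ t)) (proj₁ factor) (π̂ ⇑ (M ∸ support g)))

        ζ≋𝟏 : ζ̂ A.≋ 𝟏
        ζ≋𝟏 = A.mk≋ λ x → A.refl {x}

      -- The curve passes through the point a + tu of the line when z = ζᵗ, for every t with g t ≠ 0.
      line-vanishing : ∀ ũ Gs → Pointwise (λ ũ u → ũ % N ≡ toℕ u) ũ u →
        Vanishes (m ℕ.* sum (map g (allFin N)))
          (TaylorAlgebra.eval (series p) (map (λ (c , v) → Hom.map reduction c , v) Q) (reduced-curve M ũ Gs))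
      line-vanishing ũ Gs ũ≡ = Vanishes-≈ {y = A.act (product e residues) (Hom.map reduction y)}
        (A.trans (A.sym (EvalCong.eval-cong (series p) (curve-reduces H M H≋π (Vec.map toℕ a) ũ Gs) Q̄))
          (A.trans (A.sym (HomEval.hom-eval reduction Q Γ)) (A.trans (Hom.cong reduction y≈) (hom-act reduction (product e residues) y))))
        (Vanishes-≈ (A.on (ProductAlgebra.product≋π (series p) ζ≋𝟏 e residues) (Hom.map reduction y))
          (≡.subst (λ i → Vanishes i (A.act (π̂ ⇑ sum (map e residues)) (Hom.map reduction y)))
            (≡.trans (ℕ.+-identityʳ _) (≡.trans (sum-residues e (λ t → m ℕ.* g t) (λ t → ≡.cong (λ t → m ℕ.* g t) (mod-toℕ t))) (sum-scale g (allFin N))))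
            (Vanishes-π⇑ (sum (map e residues)) {0} {Hom.map reduction y} (Series.vanishes λ _ ()))))
        where
        Γ = curve H (Vec.map toℕ a) ũ Gs
        Q̄ = map (λ (c , v) → Hom.map reduction c , v) Q
        H≋π : H A.≋ π̂ ⇑ M
        H≋π = A.R.trans (A.R.*-congʳ {π̂ ⇑ (M ∸ support g)} (A.R.trans (ProductAlgebra.product≋π (series p) ζ≋𝟏 χ residues)
                (A.R.reflexive (≡.cong (π̂ ⇑_) (sum-residues χ (λ t → 1 ℕ.⊓ g t) (λ t → ≡.cong (λ t → 1 ℕ.⊓ g t) (mod-toℕ t)))))))
              (A.R.trans (A.R.sym (A.⇑-+ π̂ (support g) (M ∸ support g))) (A.R.reflexive (≡.cong (π̂ ⇑_) (ℕ.m+[n∸m]≡n support≤M))))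
        divides = Theta.product-divides polynomials N θ-injective θ-regular e residues
          (All.map⁺ (All.universal Fin.toℕ<n (allFin N))) (Unique.map⁺ Fin.toℕ-injective (Unique.allFin⁺ N)) (eval Q Γ)
          (All.map⁺ (All.universal (order-at ũ Gs ũ≡) (allFin N)))
        y = proj₁ divides
        y≈ = proj₂ divides

-- Triangular families of conditions are no larger than the number of equations

module Independence where

  open import Defs
  open Mods
  open Newton
  open Nodes
  open Recurrence
  open Simplex hiding (curve)
  open Greedy
  open Cyclotomic
  open Taylor
  open Lines
  open import Data.Fin.Base as Fin using (Fin; zero; suc; toℕ)
  import Data.Fin.Properties as Fin
  open import Data.Integer.Base as ℤ using (ℤ; +_; 0ℤ)
  open import Data.Integer.Divisibility.Signed
  import Data.Integer.Properties as ℤ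
  import Data.Integer.Tactic.RingSolver as ℤSolver
  open import Data.List.Base using (List; []; _∷_; _++_; map; length; filter; lookup; concatMap)
  open import Data.List.Properties using (length-++; map-++)
  open import Data.List.Membership.Propositional using (_∈_)
  open import Data.List.Relation.Unary.All as All using (All; []; _∷_)
  import Data.List.Relation.Unary.All.Properties as All
  open import Data.List.Relation.Unary.Any using (here; there)
  import Data.List.Relation.Binary.Pointwise as ListPointwise
  open import Data.Nat.Base as ℕ using (ℕ; zero; suc; NonZero; _≤_; _<_; _^_; _∸_; _%_)
  import Data.Nat.DivMod as ℕ
  open import Data.Nat.DivMod using (_mod_)
  open import Data.Nat.ListAction using (sum)
  open import Data.Nat.Primality using (Prime; prime⇒nonZero)
  import Data.Nat.Properties as ℕ
  open import Data.Product using (∃; _×_; _,_; proj₁; proj₂)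
  open import Data.Sum using (inj₁; inj₂)
  open import Data.Vec.Base as Vec using (Vec; []; _∷_)
  open import Data.Vec.Relation.Binary.Pointwise.Inductive as Pointwise using (Pointwise; []; _∷_)
  open import Function.Base using (_∘_)
  open import Relation.Binary.PropositionalEquality as ≡ using (_≡_; _≢_)
  open import Relation.Nullary using (¬_; contradiction)
  open import Relation.Nullary.Decidable using (decidable-stable)

  dot : ∀ {n} → Vec ℕ n → Vec ℕ n → ℕ
  dot []       []       = 0
  dot (s ∷ ss) (v ∷ vs) = v ℕ.* s ℕ.+ dot ss vs

  -- The monomial x₁^{L - ⟨s,v′⟩} xᵛ, which is x₁ᴸ xᵛ after the substitution xᵣ ↦ xᵣ x₁^{-sᵣ} for r ≥ 2.
  twist : ∀ {n} → ℕ → Vec ℕ n → Vec ℕ (suc n) → Vec ℕ (suc n)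
  twist L s (v₁ ∷ v) = (v₁ ℕ.+ (L ∸ dot s v)) ∷ v

  module TwistAlgebra (M : Mod) where
    open Act M

    -- At the point with coordinates z and γᵣ z^sᵣ, the powers of z from the last coordinates cancel
    -- the correction -⟨s,v′⟩ in the first exponent. So curves can be translated by s at the price
    -- of the unit zᴸ.
    monomial-twist : ∀ {n} L (s : Vec ℕ n) γ (Γ Δ : Vec Op n) v → dot s (Vec.tail v) ≤ L →
      Pointwise (λ (γ , s) δ → δ ≋ γ ⊡ ẑ ⇑ s) (Vec.zip Γ s) Δ → γ ≋ ẑ →
      monomial (γ ∷ Δ) (twist L s v) ≋ ẑ ⇑ L ⊡ monomial (ẑ ∷ Γ) v
    monomial-twist L s γ Γ Δ (v₁ ∷ v) ≤L es eγ = begin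
      γ ⇑ (v₁ ℕ.+ (L ∸ dot s v)) ⊡ monomial Δ v
        ≈⟨ R.*-cong (R.trans (⇑-cong (v₁ ℕ.+ (L ∸ dot s v)) eγ) (⇑-+ ẑ v₁ (L ∸ dot s v))) (twisted s Γ Δ v es) ⟩
      (ẑ ⇑ v₁ ⊡ ẑ ⇑ (L ∸ dot s v)) ⊡ (monomial Γ v ⊡ ẑ ⇑ dot s v)
        ≈⟨ lemma (ẑ ⇑ v₁) (ẑ ⇑ (L ∸ dot s v)) (monomial Γ v) (ẑ ⇑ dot s v) ⟩
      (ẑ ⇑ (L ∸ dot s v) ⊡ ẑ ⇑ dot s v) ⊡ (ẑ ⇑ v₁ ⊡ monomial Γ v)
        ≈⟨ R.*-congʳ {ẑ ⇑ v₁ ⊡ monomial Γ v} (R.trans (R.sym (⇑-+ ẑ (L ∸ dot s v) (dot s v)))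
             (R.reflexive (≡.cong (ẑ ⇑_) (ℕ.m∸n+n≡m ≤L)))) ⟩
      ẑ ⇑ L ⊡ (ẑ ⇑ v₁ ⊡ monomial Γ v) ∎
      where
      open ≋-Reasoning
      lemma : ∀ a b c d → (a ⊡ b) ⊡ (c ⊡ d) ≋ (b ⊡ d) ⊡ (a ⊡ c)
      lemma = solve 4 (λ a b c d → (a :* b) :* (c :* d) := (b :* d) :* (a :* c)) R.refl
        where open Solve
      lemma′ : ∀ a b c d → (a ⊡ b) ⊡ (c ⊡ d) ≋ (a ⊡ c) ⊡ (b ⊡ d)
      lemma′ = solve 4 (λ a b c d → (a :* b) :* (c :* d) := (a :* c) :* (b :* d)) R.refl
        where open Solve
      twisted : ∀ {n} (s : Vec ℕ n) Γ Δ v → Pointwise (λ (γ , s) δ → δ ≋ γ ⊡ ẑ ⇑ s) (Vec.zip Γ s) Δ →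
        monomial Δ v ≋ monomial Γ v ⊡ ẑ ⇑ dot s v
      twisted []      []      []      []      []       = R.sym (R.*-identityʳ 𝟏)
      twisted (s ∷ ss) (γ ∷ Γ) (δ ∷ Δ) (v ∷ vs) (e ∷ es) = R.trans
        (R.*-cong (R.trans (⇑-cong v e) (R.trans (⊡-⇑ γ (ẑ ⇑ s) v) (R.*-congˡ {γ ⇑ v} (R.sym (⇑-* ẑ v s))))) (twisted ss Γ Δ vs es))
        (R.trans (lemma′ (γ ⇑ v) (ẑ ⇑ (v ℕ.* s)) (monomial Γ vs) (ẑ ⇑ dot ss vs))
          (R.*-congˡ {γ ⇑ v ⊡ monomial Γ vs} (R.sym (⇑-+ ẑ (v ℕ.* s) (dot ss vs)))))

  module ShiftAlgebra (M : Mod) where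
    open Act M

    shift-node : ∀ z P d s → (z ⊡ (𝟏 ⊞ P ⊡ d)) ⊡ s ≋ z ⊡ s ⊞ P ⊡ ((z ⊡ s) ⊡ d)
    shift-node = solve 4 (λ z P d s → (z :* (con 1 :+ P :* d)) :* s := z :* s :+ P :* ((z :* s) :* d)) R.refl
      where open Solve

  module Independent {p : ℕ} (pr : Prime p) (k : ℕ) (e : ℕ) .{{_ : NonZero e}} (n′ T : ℕ) where
    open Seq pr k
    open Poly pr k
    open LineCurves pr k
    open Basis pr e n′ T
    open Evaluation p
    open Series pr
    private
      n = suc n′
      instance
        p≢0 : NonZero p
        p≢0 = prime⇒nonZero pr
        N≢0 : NonZero N
        N≢0 = ℕ.m^n≢0 p (suc k)
      module A = Act (series p)
      module NP = NodeProperties pr (series p) char Unit unit unit-𝟏⊞π (λ {u} n → unit-⇑ {u} n) (λ {u} {v} → Unit-⊡ {u} {v})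
    open Node p

    direction : Vec (Fin T) n′ → Vec (Fin N) n′
    direction = Vec.map (λ κ → low e (toℕ κ) mod N)

    Basis : Set
    Basis = List (Label × List (ℤ × Vec ℕ n))

    combination : (B : Basis) → (Fin (length B) → ℤ) → Vec Op n → A.Carrier
    combination []            r Γ = A.0#
    combination ((l , w) ∷ B) r Γ = r zero · evaluate w Γ A.+ combination B (r ∘ suc) Γ

    private
      Σφ : (B : Basis) → (Fin (length B) → ℤ) → Label → ℤ
      Σφ B r (κ , i) = combination B r (labelled κ) i

    -- Back substitution: the functionals of B kill the first witness w, so the coefficients of B
    -- vanish by induction; the first functional then sees only r₀ times its nonzero value on w.
    triangular⇒zero : ∀ {B} → IsTriangular B → ∀ r → All (λ (l , _) → + p ∣ Σφ B r l) B → ∀ j → + p ∣ r j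
    triangular⇒zero {(l , w) ∷ B} ((p∤ , kills) ∷ tri) r (p∣head ∷ p∣) = λ { zero → p∣r₀ ; (suc j) → p∣rs j }
      where
      p∣rs : ∀ j → + p ∣ r (suc j)
      p∣rs = triangular⇒zero tri (r ∘ suc) (rest kills p∣)
        where
        rest : ∀ {C : Basis} → All (λ (l′ , _) → + p ∣ functional l′ w) C → All (λ (l′ , _) → + p ∣ Σφ ((l , w) ∷ B) r l′) C →
               All (λ (l′ , _) → + p ∣ Σφ B (r ∘ suc) l′) C
        rest [] [] = []
        rest (kill ∷ kills) (p∣ ∷ p∣s) = ∣m+n∣m⇒∣n p∣ (∣n⇒∣m*n (r zero) kill) ∷ rest kills p∣s
      p∣rest : ∀ (B : Basis) r l → (∀ j → + p ∣ r j) → + p ∣ Σφ B r l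
      p∣rest []            r l p∣r = divides 0ℤ ≡.refl
      p∣rest ((_ , w) ∷ B) r l p∣r = ∣m∣n⇒∣m+n (∣m⇒∣m*n (functional l w) (p∣r zero)) (p∣rest B (r ∘ suc) l (p∣r ∘ suc))
      p∣r₀ : + p ∣ r zero
      p∣r₀ with prime-∣ (r zero) (functional l w) (∣m+n∣n⇒∣m p∣head (p∣rest B (r ∘ suc) l p∣rs))
      ... | inj₁ p∣r = p∣r
      ... | inj₂ p∣φ = contradiction p∣φ p∤

    scaleSeq : ℤ → Seq → Seq
    scaleSeq c u = record
      { seq = λ s → c ℤ.* seq u s
      ; rec = λ s → ≡.trans (∑-* c p (λ i → seq u (s ℕ.+ i ℕ.* q))) (≡.trans (≡.cong (c ℤ.*_) (rec u s)) (ℤ.*-zeroʳ c)) }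

    ρ-scale : ∀ c u → ρ (scaleSeq c u) ≡ ρ u ℤ.* c
    ρ-scale c u = ≡.trans (∑-cong p λ i → ∑-* c (i ℕ.* q) (seq u)) (≡.trans (∑-* c p _) (ℤ.*-comm c (ρ u)))

    module _ (L : ℕ) (s : Vec ℕ n′) {b : ℕ} where

      term : Fin b → ℤ → Equivariant b
      term j c = record
        { fun = λ y → scaleSeq c (y j)
        ; cong = λ e → mkᵛ λ t → ≡.cong (c ℤ.*_) (at (e j) t)
        ; homo = λ x y → mkᵛ λ t → ℤ.*-distribˡ-+ c (seq (x j) t) (seq (y j) t)
        ; shift-homo = λ x → mkᵛ λ t → ≡.refl }

      twisted-terms : Fin b → List (ℤ × Vec ℕ n) → List (Equivariant b × Vec ℕ n)
      twisted-terms j = map λ (c , v) → term j c , twist L s v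

      -- The combination Σ yⱼ wⱼ of the twisted witnesses with unknowns yⱼ; `emb` remembers the
      -- original positions during the recursion.
      forms : (B : Basis) → (Fin (length B) → Fin b) → List (Equivariant b × Vec ℕ n)
      forms []            emb = []
      forms ((_ , w) ∷ B) emb = twisted-terms (emb zero) w ++ forms B (emb ∘ suc)

    -- Keeps the truncated subtraction in `twist` exact.
    Bounded : ℕ → Vec ℕ n′ → Basis → Set
    Bounded L s = All (λ (_ , w) → All (λ (_ , v) → dot s (Vec.tail v) ≤ L) w)

    private
      bound-terms : ∀ s (w : List (ℤ × Vec ℕ n)) → ∃ λ L → All (λ (_ , v) → dot s (Vec.tail v) ≤ L) w
      bound-terms s []            = 0 , []
      bound-terms s ((_ , v) ∷ w) with L , b ← bound-terms s w =
        dot s (Vec.tail v) ℕ.+ L , ℕ.m≤m+n _ L ∷ All.map (λ ≤L → ℕ.≤-trans ≤L (ℕ.m≤n+m L _)) b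

    bound : ∀ s B → ∃ λ L → Bounded L s B
    bound s []            = 0 , []
    bound s ((l , w) ∷ B) with L₁ , b₁ ← bound-terms s w | L₂ , b₂ ← bound s B =
      L₁ ℕ.+ L₂ , All.map (λ ≤L₁ → ℕ.≤-trans ≤L₁ (ℕ.m≤m+n L₁ L₂)) b₁
                ∷ All.map (All.map λ ≤L₂ → ℕ.≤-trans ≤L₂ (ℕ.m≤n+m L₂ L₁)) b₂

    private
      reduce : ∀ {b} → (Fin b → Seq) → List (Equivariant b × Vec ℕ n) → List (A.Carrier × Vec ℕ n)
      reduce y f = map (λ (c , v) → Hom.map reduction c , v) (Constraints.at-solution pr k _ y f)
      open TaylorAlgebra (series p) using (eval)

      eval-++ : ∀ (f g : List (A.Carrier × Vec ℕ n)) Γ → eval (f ++ g) Γ A.≈ eval f Γ A.+ eval g Γ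
      eval-++ []            g Γ = A.sym (A.+-identityˡ (eval g Γ))
      eval-++ ((c , v) ∷ f) g Γ = A.trans (A.+-congˡ {x} (eval-++ f g Γ)) (A.sym (A.+-assoc x (eval f Γ) (eval g Γ)))
        where x = A.act (monomial Γ v) c

      eval-terms : ∀ L s {b} (y : Fin b → Seq) j w γ Γ Δ → All (λ (_ , v) → dot s (Vec.tail v) ≤ L) w →
        Pointwise (λ (γ , s) δ → δ A.≋ γ ⊡ ẑ ⇑ s) (Vec.zip Γ s) Δ → γ A.≋ ẑ →
        eval (reduce y (twisted-terms L s j w)) (γ ∷ Δ) A.≈ A.act (ẑ ⇑ L) (ρ (y j) · evaluate w (ẑ ∷ Γ))
      eval-terms L s y j [] γ Γ Δ [] es eγ = A.sym (A.trans (A.act-cong (ẑ ⇑ L) (mk≈ λ i → ≡ₚ-reflexive p (ℤ.*-zeroʳ (ρ (y j))))) (A.act-0 (ẑ ⇑ L)))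
      eval-terms L s y j ((c , v) ∷ w) γ Γ Δ (≤L ∷ ≤Ls) es eγ = begin
        A.act (monomial (γ ∷ Δ) (twist L s v)) (Hom.map reduction (ι (scaleSeq c (y j)))) A.+ eval (reduce y (twisted-terms L s j w)) (γ ∷ Δ)
          ≈⟨ A.+-cong (A.trans (A.on (TwistAlgebra.monomial-twist (series p) L s γ Γ Δ v ≤L es eγ) (Hom.map reduction (ι (scaleSeq c (y j)))))
               (A.act-cong (ẑ ⇑ L) (A.trans (A.act-cong mon (reduction-ι (scaleSeq c (y j)))) (act-· mon (ρ (scaleSeq c (y j))) one))))
               (eval-terms L s y j w γ Γ Δ ≤Ls es eγ) ⟩
        A.act (ẑ ⇑ L) (ρ (scaleSeq c (y j)) · A.act mon one) A.+ A.act (ẑ ⇑ L) (ρ (y j) · evaluate w (ẑ ∷ Γ))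
          ≈⟨ A.act-+ (ẑ ⇑ L) (ρ (scaleSeq c (y j)) · A.act mon one) (ρ (y j) · evaluate w (ẑ ∷ Γ)) ⟨
        A.act (ẑ ⇑ L) (ρ (scaleSeq c (y j)) · A.act mon one A.+ ρ (y j) · evaluate w (ẑ ∷ Γ))
          ≈⟨ A.act-cong (ẑ ⇑ L) (mk≈ λ i → ≡ₚ-reflexive p (≡.trans (≡.cong (λ r → r ℤ.* A.act mon one i ℤ.+ ρ (y j) ℤ.* evaluate w (ẑ ∷ Γ) i) (ρ-scale c (y j)))
               (lemma (ρ (y j)) c (A.act mon one i) (evaluate w (ẑ ∷ Γ) i)))) ⟩
        A.act (ẑ ⇑ L) (ρ (y j) · (c · A.act mon one A.+ evaluate w (ẑ ∷ Γ))) ∎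
        where
        open import Relation.Binary.Reasoning.Setoid A.setoid
        mon = monomial (ẑ ∷ Γ) v
        lemma : ∀ r c a b → r ℤ.* c ℤ.* a ℤ.+ r ℤ.* b ≡ r ℤ.* (c ℤ.* a ℤ.+ b)
        lemma = ℤSolver.solve-∀

      eval-forms : ∀ L s {b} (y : Fin b → Seq) (B : Basis) emb γ Γ Δ → Bounded L s B →
        Pointwise (λ (γ , s) δ → δ A.≋ γ ⊡ ẑ ⇑ s) (Vec.zip Γ s) Δ → γ A.≋ ẑ →
        eval (reduce y (forms L s B emb)) (γ ∷ Δ) A.≈ A.act (ẑ ⇑ L) (combination B (ρ ∘ y ∘ emb) (ẑ ∷ Γ))
      eval-forms L s y []            emb γ Γ Δ [] es eγ = A.sym (A.act-0 (ẑ ⇑ L))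
      eval-forms L s y ((l , w) ∷ B) emb γ Γ Δ (≤L ∷ ≤Ls) es eγ = begin
        eval (reduce y (twisted-terms L s (emb zero) w ++ forms L s B (emb ∘ suc))) (γ ∷ Δ)
          ≡⟨ ≡.cong (λ f → eval f (γ ∷ Δ)) (≡.trans (≡.cong (map (λ (c , v) → Hom.map reduction c , v)) (map-++ _ (twisted-terms L s (emb zero) w) _)) (map-++ _ (Constraints.at-solution pr k _ y (twisted-terms L s (emb zero) w)) _)) ⟩
        eval (reduce y (twisted-terms L s (emb zero) w) ++ reduce y (forms L s B (emb ∘ suc))) (γ ∷ Δ)
          ≈⟨ eval-++ (reduce y (twisted-terms L s (emb zero) w)) (reduce y (forms L s B (emb ∘ suc))) (γ ∷ Δ) ⟩
        eval (reduce y (twisted-terms L s (emb zero) w)) (γ ∷ Δ) A.+ eval (reduce y (forms L s B (emb ∘ suc))) (γ ∷ Δ)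
          ≈⟨ A.+-cong (eval-terms L s y (emb zero) w γ Γ Δ ≤L es eγ) (eval-forms L s y B (emb ∘ suc) γ Γ Δ ≤Ls es eγ) ⟩
        A.act (ẑ ⇑ L) (ρ (y (emb zero)) · evaluate w (ẑ ∷ Γ)) A.+ A.act (ẑ ⇑ L) (combination B (ρ ∘ y ∘ emb ∘ suc) (ẑ ∷ Γ))
          ≈⟨ A.act-+ (ẑ ⇑ L) (ρ (y (emb zero)) · evaluate w (ẑ ∷ Γ)) (combination B (ρ ∘ y ∘ emb ∘ suc) (ẑ ∷ Γ)) ⟨
        A.act (ẑ ⇑ L) (combination ((l , w) ∷ B) (ρ ∘ y ∘ emb) (ẑ ∷ Γ)) ∎
        where open import Relation.Binary.Reasoning.Setoid A.setoid

      exponents : ∀ {m} → Vec (Fin T) m → Vec (Fin N) m → Vec ℕ m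
      exponents []      []      = []
      exponents (κ ∷ κs) (s ∷ ss) = (low e (toℕ κ) ℕ.+ toℕ s) ∷ exponents κs ss

      perturbations : ∀ {m} → Vec (Fin T) m → Vec (Fin N) m → Vec Op m
      perturbations []      []      = []
      perturbations (κ ∷ κs) (s ∷ ss) = (ẑ ⇑ (low e (toℕ κ) ℕ.+ toℕ s) ⊡ digits T (high e (toℕ κ))) ∷ perturbations κs ss

      exponents-mod : ∀ {m} (κ : Vec (Fin T) m) s →
        Pointwise (λ ũ u → ũ % N ≡ toℕ u) (exponents κ s) (Vec.map (λ κ → low e (toℕ κ) mod N) κ ⊕ᵛ s)
      exponents-mod []      []      = []
      exponents-mod (κ ∷ κs) (s ∷ ss) = ≡.sym (≡.trans (toℕ-mod (toℕ (l mod N) ℕ.+ toℕ s)) (≡.trans (≡.cong (λ x → (x ℕ.+ toℕ s) % N) (toℕ-mod l))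
        (≡.trans (ℕ.%-distribˡ-+ (l % N) (toℕ s) N) (≡.trans (≡.cong (λ x → (x ℕ.+ toℕ s % N) % N) (ℕ.m%n%n≡m%n l N))
          (≡.sym (ℕ.%-distribˡ-+ l (toℕ s) N)))))) ∷ exponents-mod κs ss
        where l = low e (toℕ κ)

      -- A node times z^s is z^(low + s) plus a multiple of π^(pᵉ), an admissible perturbation of
      -- the curve in direction low + s. This ties each node to the direction given by its low
      -- digits.
      shifted-nodes : ∀ {m} (κ : Vec (Fin T) m) s → Pointwise (λ (γ , s) δ → δ A.≋ γ ⊡ ẑ ⇑ s)
        (Vec.zip (Vec.map (node T e 1) (Vec.map toℕ κ)) (Vec.map toℕ s)) (reduced-curve (p ^ e) (exponents κ s) (perturbations κ s))
      shifted-nodes []      []      = []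
      shifted-nodes (κ ∷ κs) (s ∷ ss) = A.R.sym (A.R.trans (A.R.*-congʳ {ẑ ⇑ toℕ s} expansion)
        (A.R.trans (lemma (ẑ ⇑ l) (π̂ ⇑ (p ^ e)) d (ẑ ⇑ toℕ s))
          (A.R.+-cong z⇑ (A.R.*-congˡ {π̂ ⇑ (p ^ e)} (A.R.*-congʳ {d} z⇑))))) ∷ shifted-nodes κs ss
        where
        l = low e (toℕ κ)
        d = digits T (high e (toℕ κ))
        z⇑ : ẑ ⇑ l ⊡ ẑ ⇑ toℕ s A.≋ ẑ ⇑ (l ℕ.+ toℕ s)
        z⇑ = A.R.sym (A.⇑-+ ẑ l (toℕ s))
        expansion : node T e 1 (toℕ κ) A.≋ ẑ ⇑ l ⊡ (𝟏 ⊞ π̂ ⇑ (p ^ e) ⊡ d)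
        expansion = A.R.trans (NP.node-expansion T e 1 (toℕ κ))
          (A.R.*-cong (A.⇑-cong l (A.R.+-congˡ {𝟏} (A.R.*-identityʳ π̂)))
            (A.R.reflexive (≡.cong (λ r → 𝟏 ⊞ π̂ ⇑ r ⊡ d) (ℕ.*-identityˡ (p ^ e)))))
        lemma : ∀ z P d s → (z ⊡ (𝟏 ⊞ P ⊡ d)) ⊡ s A.≋ z ⊡ s ⊞ P ⊡ ((z ⊡ s) ⊡ d)
        lemma z P d s = ShiftAlgebra.shift-node (series p) z P d s

      unit-ẑ : Unit ẑ
      unit-ẑ = Unit-≋ {ẑ} {𝟏 ⊞ π̂ ⊡ 𝟏} (A.R.+-congˡ {𝟏} (A.R.sym (A.R.*-identityʳ π̂))) (unit-𝟏⊞π 𝟏)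

      -- The curve labelled κ, after the twist by s, perturbs a line in direction (1, direction κ +
      -- s). By `line-vanishing` the reduced polynomial vanishes on it to order m times the line
      -- sum, and the factor zᴸ is a unit.
      combination-vanishes : ∀ m B L {s} → Bounded L (Vec.map toℕ s) B → (y : Fin (length B) → Seq) → ∀ κ i →
        (f : Vec (Fin N) n → ℕ) (a : Vec (Fin N) n) →
        let u = 𝟙 ∷ direction κ ⊕ᵛ s in
        i < m ℕ.* lineSum f u a → support (λ t → f (a ⊕ᵛ t ·ᵛ u)) ≤ p ^ e →
        (∀ x → TaylorAlgebra.VanishesTo polynomials n (m ℕ.* f x) (Vec.map toℕ x)
                 (Constraints.at-solution pr k _ y (forms L (Vec.map toℕ s) B (λ j → j)))) →
        + p ∣ combination B (ρ ∘ y) (labelled κ) i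
      combination-vanishes m B L {s} bounded y κ i f a i< support≤ vanishing =
        below (unit-⇑ {ẑ} L unit-ẑ (m ℕ.* lineSum f u a) (combination B (ρ ∘ y) (labelled κ)) product-vanishes) i i<
        where
        u = 𝟙 ∷ direction κ ⊕ᵛ s
        s̃ = Vec.map toℕ s
        F = forms L s̃ B (λ j → j)
        γ = ẑ ⇑ 1 ⊞ π̂ ⇑ (p ^ e) ⊡ 𝟎
        Γ = Vec.map (node T e 1) (Vec.map toℕ κ)
        Δ = reduced-curve (p ^ e) (exponents κ s) (perturbations κ s)
        head≋ : γ A.≋ ẑ
        head≋ = A.R.trans (A.R.+-cong (A.R.*-identityʳ ẑ) (A.R.zeroʳ (π̂ ⇑ (p ^ e)))) (A.R.+-identityʳ ẑ)
        evaluation : eval (reduce y F) (γ ∷ Δ) A.≈ A.act (ẑ ⇑ L) (combination B (ρ ∘ y) (ẑ ∷ Γ))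
        evaluation = eval-forms L s̃ y B (λ j → j) γ Γ Δ bounded (shifted-nodes κ s) head≋
        curve-vanishes : Vanishes (m ℕ.* lineSum f u a) (eval (reduce y F) (γ ∷ Δ))
        curve-vanishes = line-vanishing (Constraints.at-solution pr k _ y F) m (p ^ e) (λ t → f (a ⊕ᵛ t ·ᵛ u)) support≤ a u
          (λ t → vanishing (a ⊕ᵛ t ·ᵛ u)) (1 ∷ exponents κ s) (𝟎 ∷ perturbations κ s) (≡.sym (toℕ-mod 1) ∷ exponents-mod κ s)
        product-vanishes : Vanishes (m ℕ.* lineSum f u a) (A.act (ẑ ⇑ L) (combination B (ρ ∘ y) (ẑ ∷ Γ)))
        product-vanishes = Vanishes-≈ (A.sym evaluation) curve-vanishes

    module _ (f : Vec (Fin N) n → ℕ) (m : ℕ) (ℓ : Vec (Fin N) n′ → ℕ)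
             (line : ∀ u → ∃ λ a → lineSum f (𝟙 ∷ u) a ≡ ℓ u × support (λ t → f (a ⊕ᵛ t ·ᵛ (𝟙 ∷ u))) ≤ p ^ e) where

      K : ℕ
      K = sum (map (λ x → σ n (m ℕ.* f x)) (allVectors N n))

      -- Otherwise some combination Σ yⱼ wⱼ with yⱼ ∈ Seq, not all reducing to 0, vanishes to order m f x at
      -- every point ζˣ, hence along the lines, and triangularity forces all the reductions of the yⱼ to be 0.
      few-independent : ∀ B → IsTriangular B → ∀ s →
        length (filter (λ ((κ , i) , _) → i ℕ.<? m ℕ.* ℓ (direction κ ⊕ᵛ s)) B) ≤ K
      few-independent B₀ tri₀ s = decidable-stable (_ ℕ.≤? K) λ B≰K → impossible (ℕ.≰⇒> B≰K)
        where
        P? = λ (((κ , i) , _) : Label × List (ℤ × Vec ℕ n)) → i ℕ.<? m ℕ.* ℓ (direction κ ⊕ᵛ s)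
        B = filter P? B₀
        tri : IsTriangular B
        tri = IsTriangular-filter P? tri₀
        s̃ = Vec.map toℕ s
        L = proj₁ (bound s̃ B)
        bounded = proj₂ (bound s̃ B)
        b = length B
        F = forms L s̃ B (λ j → j)
        open Constraints pr k b
        constraints-at : Vec (Fin N) n → List (Equivariant b)
        constraints-at x = constraints n (m ℕ.* f x) (Vec.map toℕ x) F
        equations = concatMap constraints-at (allVectors N n)
        length-equations : ∀ xs → length (concatMap constraints-at xs) ≡ sum (map (λ x → σ n (m ℕ.* f x)) xs)
        length-equations []       = ≡.refl
        length-equations (x ∷ xs) = ≡.trans (length-++ (constraints-at x))
          (≡.cong₂ ℕ._+_ (length-constraints n (m ℕ.* f x) (Vec.map toℕ x) F) (length-equations xs))
        impossible : ¬ K < b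
        impossible K<b = no-solution
          (reduced-solution {m = length equations} (≡.subst (_< b) (≡.sym (length-equations (allVectors N n))) K<b) (lookup equations))
          where
          no-solution : ¬ ∃ λ y → (∀ i → Equivariant.fun (lookup equations i) y ≈ᵛ V.0#) × ∃ λ j → ¬ + p ∣ ρ (y j)
          no-solution (y , solves , j , p∤) =
            p∤ (triangular⇒zero tri (ρ ∘ y) (All.map (λ {b} → vanishes-at b) (All.all-filter P? B₀)) j)
            where
            solved : ∀ Cs → (∀ i → Equivariant.fun (lookup Cs i) y ≈ᵛ V.0#) → All (λ C → Equivariant.fun C y ≈ᵛ V.0#) Cs
            solved []       z = []
            solved (C ∷ Cs) z = z zero ∷ solved Cs (z ∘ suc)
            solved-at : ∀ xs {x} → x ∈ xs → All (λ C → Equivariant.fun C y ≈ᵛ V.0#) (concatMap constraints-at xs) →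
                        All (λ C → Equivariant.fun C y ≈ᵛ V.0#) (constraints-at x)
            solved-at (x ∷ xs) (here ≡.refl) zs = All.++⁻ˡ (constraints-at x) zs
            solved-at (x ∷ xs) (there x∈)    zs = solved-at xs x∈ (All.++⁻ʳ (constraints-at x) zs)
            Q = at-solution y F
            same : ∀ (Q : List (Polynomial × Vec ℕ n)) → ListPointwise.Pointwise (λ (c , v) (d , w) → c ≈ᴾ d × v ≡ w) Q Q
            same []            = ListPointwise.[]
            same ((c , v) ∷ Q) = (mkᴾ (λ i → mkᵛ λ s → ≡.refl) , ≡.refl) ListPointwise.∷ same Q
            vanishing : ∀ x → TaylorAlgebra.VanishesTo polynomials n (m ℕ.* f x) (Vec.map toℕ x) Q
            vanishing x = constraints⇒VanishesTo n (m ℕ.* f x) (Vec.map toℕ x) F y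
              (solved-at (allVectors N n) (∈-allVectors x) (solved equations solves)) Q
              (same Q)
            vanishes-at : ∀ (((κ , i) , _) : Label × List (ℤ × Vec ℕ n)) → i < m ℕ.* ℓ (direction κ ⊕ᵛ s) → + p ∣ combination B (ρ ∘ y) (labelled κ) i
            vanishes-at ((κ , i) , _) i< = combination-vanishes m B L bounded y κ i f (proj₁ (line u))
              (≡.subst (λ l → i < m ℕ.* l) (≡.sym (proj₁ (proj₂ (line u)))) i<) (proj₂ (proj₂ (line u))) vanishing
              where
              u = direction κ ⊕ᵛ s

-- Finite sums, lattice points in simplices, and the limit m → ∞

module Counting where

  open import Defs using (allVectors)
  open Simplex using (simplex; concatUpTo; insert₁)
  open Taylor using (σ)
  open import Data.List.Base using (List; []; _∷_; _++_; map; length; filter; allFin; cartesianProductWith)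
  open import Data.List.Properties using (length-++; length-map; length-tabulate; map-++; map-∘)
  open import Data.List.Membership.Propositional using (_∈_; _∉_)
  open import Data.List.Membership.Propositional.Properties using (∈-∃++; ∈-++⁻; ∈-++⁺ˡ; ∈-++⁺ʳ)
  open import Data.List.Relation.Unary.All as All using (All; []; _∷_)
  import Data.List.Relation.Unary.All.Properties as All
  open import Data.List.Relation.Unary.AllPairs as AllPairs using ([]; _∷_)
  open import Data.List.Relation.Unary.Any using (here; there)
  open import Data.List.Relation.Unary.Unique.Propositional using (Unique)
  import Data.List.Relation.Unary.Unique.Propositional.Properties as Unique
  open import Data.Nat.Base
  open import Data.Nat.ListAction using (sum)
  open import Data.Nat.ListAction.Properties using (sum-++)
  open import Data.Nat.Properties
  open import Data.Nat.Tactic.RingSolver using (solve-∀)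
  open import Data.Product using (∃; _,_; proj₁; proj₂)
  open import Data.Sum using (inj₁; inj₂)
  open import Data.Vec.Base using ([]; _∷_)
  open import Data.Vec.Properties using (∷-injective)
  open import Function.Base using (_∘_)
  open import Relation.Binary.PropositionalEquality
  open import Relation.Nullary using (¬_; Dec; yes; no; contradiction)

  module _ {A : Set} where

    ∑ : List A → (A → ℕ) → ℕ
    ∑ xs f = sum (map f xs)

    ∑-++ : ∀ xs ys f → ∑ (xs ++ ys) f ≡ ∑ xs f + ∑ ys f
    ∑-++ xs ys f = trans (cong sum (map-++ f xs ys)) (sum-++ (map f xs) (map f ys))

    ∑-mono : ∀ xs {f g} → (∀ x → f x ≤ g x) → ∑ xs f ≤ ∑ xs g
    ∑-mono []       f≤g = z≤n
    ∑-mono (x ∷ xs) f≤g = +-mono-≤ (f≤g x) (∑-mono xs f≤g)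

    ∑-mono-∈ : ∀ xs {f g} → (∀ {x} → x ∈ xs → f x ≤ g x) → ∑ xs f ≤ ∑ xs g
    ∑-mono-∈ []       f≤g = z≤n
    ∑-mono-∈ (x ∷ xs) f≤g = +-mono-≤ (f≤g (here refl)) (∑-mono-∈ xs (f≤g ∘ there))

    ∑-cong : ∀ xs {f g} → (∀ x → f x ≡ g x) → ∑ xs f ≡ ∑ xs g
    ∑-cong []       f≡g = refl
    ∑-cong (x ∷ xs) f≡g = cong₂ _+_ (f≡g x) (∑-cong xs f≡g)

    ∑-+ : ∀ xs f g → ∑ xs (λ x → f x + g x) ≡ ∑ xs f + ∑ xs g
    ∑-+ []       f g = refl
    ∑-+ (x ∷ xs) f g = trans (cong (f x + g x +_) (∑-+ xs f g)) (lemma (f x) (g x) (∑ xs f) (∑ xs g))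
      where
      lemma : ∀ a b c d → a + b + (c + d) ≡ a + c + (b + d)
      lemma = solve-∀

    ∑-*ˡ : ∀ c xs f → ∑ xs (λ x → c * f x) ≡ c * ∑ xs f
    ∑-*ˡ c []       f = sym (*-zeroʳ c)
    ∑-*ˡ c (x ∷ xs) f = trans (cong (c * f x +_) (∑-*ˡ c xs f)) (sym (*-distribˡ-+ c (f x) (∑ xs f)))

    ∑-const : ∀ c xs → ∑ xs (λ _ → c) ≡ length xs * c
    ∑-const c []       = refl
    ∑-const c (x ∷ xs) = cong (c +_) (∑-const c xs)

    ∈⇒≤∑ : ∀ {x xs} f → x ∈ xs → f x ≤ ∑ xs f
    ∈⇒≤∑ {xs = x ∷ xs} f (here refl) = m≤m+n (f x) (∑ xs f)
    ∈⇒≤∑ {xs = x ∷ xs} f (there x∈)  = ≤-trans (∈⇒≤∑ f x∈) (m≤n+m (∑ xs f) (f x))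

    ∑-⊆ : ∀ xs ys f → Unique xs → (∀ {x} → x ∈ xs → x ∈ ys) → ∑ xs f ≤ ∑ ys f
    ∑-⊆ []       ys f _ _ = z≤n
    ∑-⊆ (x ∷ xs) ys f (x∉xs ∷ unique) ⊆ys with ∈-∃++ (⊆ys (here refl))
    ... | as , bs , refl = begin
        f x + ∑ xs f              ≤⟨ +-monoʳ-≤ (f x) (∑-⊆ xs (as ++ bs) f unique ⊆rest) ⟩
        f x + ∑ (as ++ bs) f      ≡⟨ cong (f x +_) (∑-++ as bs f) ⟩
        f x + (∑ as f + ∑ bs f)   ≡⟨ lemma (f x) (∑ as f) (∑ bs f) ⟩
        ∑ as f + (f x + ∑ bs f)   ≡⟨ ∑-++ as (x ∷ bs) f ⟨
        ∑ (as ++ x ∷ bs) f        ∎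
      where
      open ≤-Reasoning
      lemma : ∀ a b c → a + (b + c) ≡ b + (a + c)
      lemma = solve-∀
      ⊆rest : ∀ {y} → y ∈ xs → y ∈ as ++ bs
      ⊆rest y∈ with ∈-++⁻ as (⊆ys (there y∈))
      ... | inj₁ y∈as         = ∈-++⁺ˡ y∈as
      ... | inj₂ (here refl)  = contradiction refl (All.lookup x∉xs y∈)
      ... | inj₂ (there y∈bs) = ∈-++⁺ʳ as y∈bs

  ∑-map : ∀ {A B : Set} (g : A → B) xs (f : B → ℕ) → ∑ (map g xs) f ≡ ∑ xs (f ∘ g)
  ∑-map g xs f = cong sum (sym (map-∘ xs))

  ∑-injection : ∀ {A B : Set} (g : A → B) xs ys (f : B → ℕ) → Unique (map g xs) → (∀ {x} → x ∈ xs → g x ∈ ys) →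
    ∑ xs (f ∘ g) ≤ ∑ ys f
  ∑-injection g xs ys f unique ∈ys = subst (_≤ ∑ ys f) (∑-map g xs f) (∑-⊆ (map g xs) ys f unique λ y∈ → go xs y∈ ∈ys)
    where
    go : ∀ xs {y} → y ∈ map g xs → (∀ {x} → x ∈ xs → g x ∈ ys) → y ∈ ys
    go (x ∷ xs) (here refl) ∈ys = ∈ys (here refl)
    go (x ∷ xs) (there y∈)  ∈ys = go xs y∈ (∈ys ∘ there)

  ∑-swap : ∀ {A B : Set} xs ys (f : A → B → ℕ) → ∑ xs (λ x → ∑ ys (f x)) ≡ ∑ ys (λ y → ∑ xs (λ x → f x y))
  ∑-swap []       ys f = sym (trans (∑-const 0 ys) (*-zeroʳ (length ys)))
  ∑-swap (x ∷ xs) ys f = trans (cong (∑ ys (f x) +_) (∑-swap xs ys f)) (sym (∑-+ ys (f x) (λ y → ∑ xs (λ x → f x y))))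

  indicator : {P : Set} → Dec P → ℕ
  indicator (yes _) = 1
  indicator (no  _) = 0

  length-filter≡∑ : ∀ {A : Set} {P : A → Set} (P? : ∀ x → Dec (P x)) xs → length (filter P? xs) ≡ ∑ xs (λ x → indicator (P? x))
  length-filter≡∑ P? [] = refl
  length-filter≡∑ P? (x ∷ xs) with P? x
  ... | yes _ = cong suc (length-filter≡∑ P? xs)
  ... | no  _ = length-filter≡∑ P? xs

  Unique-allVectors : ∀ N n → Unique (allVectors N n)
  Unique-allVectors N zero    = [] ∷ []
  Unique-allVectors N (suc n) = Unique.cartesianProductWith⁺ _∷_ ∷-injective (Unique.allFin⁺ N) (Unique-allVectors N n)

  length-cartesianProductWith : ∀ {A B C : Set} (f : A → B → C) xs ys →
    length (cartesianProductWith f xs ys) ≡ length xs * length ys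
  length-cartesianProductWith f []       ys = refl
  length-cartesianProductWith f (x ∷ xs) ys = trans (length-++ (map (f x) ys))
    (cong₂ _+_ (length-map (f x) ys) (length-cartesianProductWith f xs ys))

  length-allVectors : ∀ N n → length (allVectors N n) ≡ N ^ n
  length-allVectors N zero    = refl
  length-allVectors N (suc n) = trans (length-cartesianProductWith _∷_ (allFin N) (allVectors N n))
    (cong₂ _*_ (length-tabulate {n = N} (λ i → i)) (length-allVectors N n))

  σ-mono : ∀ n {D D′} → D ≤ D′ → σ n D ≤ σ n D′
  σ-mono n {D′ = D′} z≤n = subst (_≤ σ n D′) (sym (σ-0 n)) z≤n
    where
    σ-0 : ∀ n → σ n 0 ≡ 0
    σ-0 zero    = refl
    σ-0 (suc n) = refl
  σ-mono zero    (s≤s _)    = ≤-refl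
  σ-mono (suc n) (s≤s D≤D′) = +-mono-≤ (σ-mono n (s≤s D≤D′)) (σ-mono (suc n) D≤D′)

  σ₁ : ∀ t → σ 1 t ≡ t
  σ₁ zero    = refl
  σ₁ (suc t) = cong suc (σ₁ t)

  module _ (E : ℕ) .{{_ : NonZero E}} where

    -- σ (n + 1) t is the sum of the numbers σ n (t - j), which do not increase with j; the first E
    -- of them are bounded by the one with j = 0.
    σ-block : ∀ n t → σ (suc n) t ≤ E * σ n t + σ (suc n) (t ∸ E)
    σ-block n t = go E t
      where
      open ≤-Reasoning
      go : ∀ e t → σ (suc n) t ≤ e * σ n t + σ (suc n) (t ∸ e)
      go zero    t       = ≤-refl
      go (suc e) zero    = z≤n
      go (suc e) (suc t) = begin
        σ n (suc t) + σ (suc n) t                       ≤⟨ +-monoʳ-≤ (σ n (suc t)) (go e t) ⟩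
        σ n (suc t) + (e * σ n t + σ (suc n) (t ∸ e))   ≤⟨ +-monoʳ-≤ (σ n (suc t)) (+-monoˡ-≤ _ (*-monoʳ-≤ e (σ-mono n (n≤1+n t)))) ⟩
        σ n (suc t) + (e * σ n (suc t) + σ (suc n) (t ∸ e)) ≡⟨ +-assoc (σ n (suc t)) _ _ ⟨
        suc e * σ n (suc t) + σ (suc n) (t ∸ e)         ∎

    private
      sumTo : ℕ → (ℕ → ℕ) → ℕ
      sumTo zero    g = 0
      sumTo (suc s) g = g 0 + sumTo s (g ∘ suc)

      sumTo-mono : ∀ s {f g} → (∀ j → f j ≤ g j) → sumTo s f ≤ sumTo s g
      sumTo-mono zero    f≤g = z≤n
      sumTo-mono (suc s) f≤g = +-mono-≤ (f≤g 0) (sumTo-mono s (f≤g ∘ suc))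

      sumTo-* : ∀ s c f → sumTo s (λ j → c * f j) ≡ c * sumTo s f
      sumTo-* zero    c f = sym (*-zeroʳ c)
      sumTo-* (suc s) c f = trans (cong (c * f 0 +_) (sumTo-* s c (f ∘ suc))) (sym (*-distribˡ-+ c (f 0) _))

      sumTo-cong : ∀ s {f g} → (∀ j → f j ≡ g j) → sumTo s f ≡ sumTo s g
      sumTo-cong zero    f≡g = refl
      sumTo-cong (suc s) f≡g = cong₂ _+_ (f≡g 0) (sumTo-cong s (f≡g ∘ suc))

      length-concatUpTo : ∀ {A : Set} s (f : ℕ → List A) → length (concatUpTo s f) ≡ sumTo s (length ∘ f)
      length-concatUpTo zero    f = refl
      length-concatUpTo (suc s) f = trans (length-++ (f 0)) (cong (length (f 0) +_) (length-concatUpTo s (f ∘ suc)))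

      σ-blocks : ∀ n s t → σ (suc n) t ≤ E * sumTo s (λ j → σ n (t ∸ E * j)) + σ (suc n) (t ∸ E * s)
      σ-blocks n zero    t = ≤-reflexive (sym (cong₂ _+_ (*-zeroʳ E) (cong (λ z → σ (suc n) (t ∸ z)) (*-zeroʳ E))))
      σ-blocks n (suc s) t = begin
        σ (suc n) t
          ≤⟨ σ-block n t ⟩
        E * σ n t + σ (suc n) (t ∸ E)
          ≤⟨ +-monoʳ-≤ (E * σ n t) (σ-blocks n s (t ∸ E)) ⟩
        E * σ n t + (E * sumTo s (λ j → σ n (t ∸ E ∸ E * j)) + σ (suc n) (t ∸ E ∸ E * s))
          ≡⟨ cong₂ (λ a b → E * σ n t + (E * a + b)) (sumTo-cong s λ j → cong (σ n) (shift j)) (cong (σ (suc n)) (shift s)) ⟩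
        E * σ n t + (E * sumTo s (λ j → σ n (t ∸ E * suc j)) + σ (suc n) (t ∸ E * suc s))
          ≡⟨ lemma E (σ n t) _ _ ⟩
        E * (σ n t + sumTo s (λ j → σ n (t ∸ E * suc j))) + σ (suc n) (t ∸ E * suc s)
          ≡⟨ cong (λ z → E * (σ n (t ∸ z) + sumTo s (λ j → σ n (t ∸ E * suc j))) + σ (suc n) (t ∸ E * suc s)) (*-zeroʳ E) ⟨
        E * sumTo (suc s) (λ j → σ n (t ∸ E * j)) + σ (suc n) (t ∸ E * suc s) ∎
        where
        open ≤-Reasoning
        shift : ∀ j → t ∸ E ∸ E * j ≡ t ∸ E * suc j
        shift j = trans (∸-+-assoc t E (E * j)) (cong (t ∸_) (sym (*-suc E j)))
        lemma : ∀ E a b c → E * a + (E * b + c) ≡ E * (a + b) + c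
        lemma = solve-∀

    -- Grouping the values of each of the n′ weighted variables into blocks of length E loses at
    -- most a factor E per variable; the first variable has weight 1.
    σ≤simplex : ∀ n′ t → σ (suc n′) t ≤ E ^ n′ * length (simplex E n′ t)
    σ≤simplex zero t = ≤-reflexive (trans (σ₁ t) (sym (trans (+-identityʳ _) (trans (length-concatUpTo t _) (ones t)))))
      where
      ones : ∀ t → sumTo t (λ _ → 1) ≡ t
      ones zero    = refl
      ones (suc t) = cong suc (ones t)
    σ≤simplex (suc n′) t = begin
      σ (suc (suc n′)) t
        ≤⟨ σ-blocks (suc n′) t t ⟩
      E * sumTo t (λ j → σ (suc n′) (t ∸ E * j)) + σ (suc (suc n′)) (t ∸ E * t)
        ≡⟨ cong (λ z → E * sumTo t (λ j → σ (suc n′) (t ∸ E * j)) + σ (suc (suc n′)) z) (m≤n⇒m∸n≡0 (m≤n*m t E)) ⟩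
      E * sumTo t (λ j → σ (suc n′) (t ∸ E * j)) + 0
        ≡⟨ +-identityʳ _ ⟩
      E * sumTo t (λ j → σ (suc n′) (t ∸ E * j))
        ≤⟨ *-monoʳ-≤ E (sumTo-mono t λ j → σ≤simplex n′ (t ∸ E * j)) ⟩
      E * sumTo t (λ j → E ^ n′ * length (simplex E n′ (t ∸ E * j)))
        ≡⟨ cong (E *_) (sumTo-* t (E ^ n′) _) ⟩
      E * (E ^ n′ * sumTo t (λ j → length (simplex E n′ (t ∸ E * j))))
        ≡⟨ *-assoc E (E ^ n′) _ ⟨
      E ^ suc n′ * sumTo t (λ j → length (simplex E n′ (t ∸ E * j)))
        ≡⟨ cong (E ^ suc n′ *_) (sumTo-cong t λ j → sym (length-map (insert₁ j) (simplex E n′ (t ∸ E * j)))) ⟩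
      E ^ suc n′ * sumTo t (λ j → length (map (insert₁ j) (simplex E n′ (t ∸ E * j))))
        ≡⟨ cong (E ^ suc n′ *_) (length-concatUpTo t _) ⟨
      E ^ suc n′ * length (simplex E (suc n′) t) ∎
      where open ≤-Reasoning

  private
    pow-upper : ∀ D m → suc D ^ suc m ≤ suc m * suc D ^ m + D ^ suc m
    pow-upper D zero    = ≤-reflexive (lemma D)
      where
      lemma : ∀ D → (1 + D) * 1 ≡ 1 * 1 + D * 1
      lemma = solve-∀
    pow-upper D (suc m) = begin
      suc D * suc D ^ suc m                                   ≡⟨⟩
      suc D ^ suc m + D * suc D ^ suc m                       ≤⟨ +-monoʳ-≤ (suc D ^ suc m) (*-monoʳ-≤ D (pow-upper D m)) ⟩
      suc D ^ suc m + D * (suc m * suc D ^ m + D ^ suc m)     ≡⟨ lemma (suc D ^ suc m) D (suc m) (suc D ^ m) (D ^ suc m) ⟩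
      suc D ^ suc m + (suc m * (D * suc D ^ m) + D * D ^ suc m) ≤⟨ +-monoʳ-≤ (suc D ^ suc m) (+-monoˡ-≤ (D * D ^ suc m)
                                                                  (*-monoʳ-≤ (suc m) (*-monoˡ-≤ (suc D ^ m) (n≤1+n D)))) ⟩
      suc D ^ suc m + (suc m * suc D ^ suc m + D ^ suc (suc m)) ≡⟨ +-assoc (suc D ^ suc m) _ _ ⟨
      suc (suc m) * suc D ^ suc m + D ^ suc (suc m)           ∎
      where
      open ≤-Reasoning
      lemma : ∀ s D m x y → s + D * (m * x + y) ≡ s + (m * (D * x) + D * y)
      lemma = solve-∀

    pow-lower : ∀ x m → x ^ suc m + suc m * x ^ m ≤ suc x ^ suc m
    pow-lower x zero    = ≤-reflexive (lemma x)
      where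
      lemma : ∀ x → x * 1 + 1 * 1 ≡ (1 + x) * 1
      lemma = solve-∀
    pow-lower x (suc m) = begin
      x * x ^ suc m + suc (suc m) * x ^ suc m                 ≤⟨ m≤m+n _ (suc m * x ^ m) ⟩
      x * x ^ suc m + suc (suc m) * x ^ suc m + suc m * x ^ m ≡⟨ lemma x (x ^ m) (suc m) ⟩
      suc x * (x ^ suc m + suc m * x ^ m)                     ≤⟨ *-monoʳ-≤ (suc x) (pow-lower x m) ⟩
      suc x * suc x ^ suc m                                   ∎
      where
      open ≤-Reasoning
      lemma : ∀ x y m → x * (x * y) + (1 + m) * (x * y) + m * y ≡ (1 + x) * (x * y + m * y)
      lemma = solve-∀

  -- σ (suc n) D is the binomial coefficient C(D + n, n + 1). Here and in `σ-upper` its recursion is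
  -- compared with the differences of consecutive (n + 1)-st powers.
  σ-lower : ∀ n D → D ^ suc n ≤ suc n ! * σ (suc n) D
  σ-lower zero    D    = ≤-reflexive (trans (*-identityʳ D) (sym (trans (+-identityʳ _) (σ₁ D))))
  σ-lower (suc n) zero = z≤n
  σ-lower (suc n) (suc D) = begin
    suc D ^ suc (suc n)                                              ≤⟨ pow-upper D (suc n) ⟩
    suc (suc n) * suc D ^ suc n + D ^ suc (suc n)                    ≤⟨ +-mono-≤ (*-monoʳ-≤ (suc (suc n)) (σ-lower n (suc D))) (σ-lower (suc n) D) ⟩
    suc (suc n) * (suc n ! * σ (suc n) (suc D)) + suc (suc n) ! * σ (suc (suc n)) D
      ≡⟨ cong (_+ suc (suc n) ! * σ (suc (suc n)) D) (*-assoc (suc (suc n)) (suc n !) (σ (suc n) (suc D))) ⟨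
    suc (suc n) ! * σ (suc n) (suc D) + suc (suc n) ! * σ (suc (suc n)) D
      ≡⟨ *-distribˡ-+ (suc (suc n) !) (σ (suc n) (suc D)) (σ (suc (suc n)) D) ⟨
    suc (suc n) ! * σ (suc (suc n)) (suc D)                          ∎
    where open ≤-Reasoning

  σ-upper : ∀ n D → suc n ! * σ (suc n) D ≤ (D + n) ^ suc n
  σ-upper zero    D    = ≤-reflexive (trans (+-identityʳ _) (trans (σ₁ D) (sym (trans (*-identityʳ (D + 0)) (+-identityʳ D)))))
  σ-upper (suc n) zero = ≤-trans (≤-reflexive (*-zeroʳ (suc (suc n) !))) z≤n
  σ-upper (suc n) (suc D) = begin
    suc (suc n) ! * (σ (suc n) (suc D) + σ (suc (suc n)) D)
      ≡⟨ *-distribˡ-+ (suc (suc n) !) (σ (suc n) (suc D)) (σ (suc (suc n)) D) ⟩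
    suc (suc n) ! * σ (suc n) (suc D) + suc (suc n) ! * σ (suc (suc n)) D
      ≡⟨ cong (_+ suc (suc n) ! * σ (suc (suc n)) D) (*-assoc (suc (suc n)) (suc n !) (σ (suc n) (suc D))) ⟩
    suc (suc n) * (suc n ! * σ (suc n) (suc D)) + suc (suc n) ! * σ (suc (suc n)) D
      ≤⟨ +-mono-≤ (*-monoʳ-≤ (suc (suc n)) (σ-upper n (suc D))) (σ-upper (suc n) D) ⟩
    suc (suc n) * (suc D + n) ^ suc n + (D + suc n) ^ suc (suc n)
      ≡⟨ cong (λ x → suc (suc n) * (suc D + n) ^ suc n + x ^ suc (suc n)) (+-suc D n) ⟩
    suc (suc n) * (suc D + n) ^ suc n + (suc D + n) ^ suc (suc n)
      ≡⟨ +-comm (suc (suc n) * (suc D + n) ^ suc n) _ ⟩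
    (suc D + n) ^ suc (suc n) + suc (suc n) * (suc D + n) ^ suc n
      ≤⟨ pow-lower (suc D + n) (suc n) ⟩
    suc (suc D + n) ^ suc (suc n)
      ≡⟨ cong (_^ suc (suc n)) (+-suc (suc D) n) ⟨
    (suc D + suc n) ^ suc (suc n) ∎
    where open ≤-Reasoning

  ^-distribʳ-* : ∀ n a b → (a * b) ^ n ≡ a ^ n * b ^ n
  ^-distribʳ-* zero    a b = refl
  ^-distribʳ-* (suc n) a b = trans (cong (a * b *_) (^-distribʳ-* n a b)) (lemma a b (a ^ n) (b ^ n))
    where
    lemma : ∀ a b x y → a * b * (x * y) ≡ a * x * (b * y)
    lemma = solve-∀

  -- The constant c is fixed before m, so the error is of lower order in m.
  leading-term : ∀ n a b → ∃ λ c → ∀ m .{{_ : NonZero m}} → (m * a + b) ^ suc n ≤ m ^ suc n * a ^ suc n + m ^ n * c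
  leading-term zero    a b = b , λ m → ≤-reflexive (lemma m a b)
    where
    lemma : ∀ m a b → (m * a + b) * 1 ≡ (m * 1) * (a * 1) + 1 * b
    lemma = solve-∀
  leading-term (suc n) a b with c , ≤c ← leading-term n a b =
    a * c + a ^ suc n * b + b * c , λ m → begin
      (m * a + b) * (m * a + b) ^ suc n
        ≤⟨ *-monoʳ-≤ (m * a + b) (≤c m) ⟩
      (m * a + b) * (m ^ suc n * a ^ suc n + m ^ n * c)
        ≡⟨ lemma m a b (m ^ n) (a ^ suc n) c ⟩
      m * m ^ suc n * (a * a ^ suc n) + (m ^ suc n * (a * c + a ^ suc n * b) + m ^ n * (b * c))
        ≤⟨ +-monoʳ-≤ (m * m ^ suc n * (a * a ^ suc n)) (+-monoʳ-≤ (m ^ suc n * (a * c + a ^ suc n * b)) (*-monoˡ-≤ (b * c) (m≤n*m (m ^ n) m))) ⟩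
      m * m ^ suc n * (a * a ^ suc n) + (m ^ suc n * (a * c + a ^ suc n * b) + m ^ suc n * (b * c))
        ≡⟨ cong (m * m ^ suc n * (a * a ^ suc n) +_) (*-distribˡ-+ (m ^ suc n) (a * c + a ^ suc n * b) (b * c)) ⟨
      m ^ suc (suc n) * a ^ suc (suc n) + m ^ suc n * (a * c + a ^ suc n * b + b * c) ∎
    where
    open ≤-Reasoning
    lemma : ∀ m a b M A c → (m * a + b) * (m * M * A + M * c) ≡ m * (m * M) * (a * A) + (m * M * (a * c + A * b) + M * (b * c))
    lemma = solve-∀

  module _ {A B : Set} (xs : List A) (ys : List B) (f : A → ℕ) (ℓ : B → ℕ) (n C : ℕ) where

    private
      sum-leading : ∀ xs → ∃ λ c → ∀ m .{{_ : NonZero m}} →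
        ∑ xs (λ x → (m * f x + n) ^ suc n) ≤ m ^ suc n * ∑ xs (λ x → f x ^ suc n) + m ^ n * c
      sum-leading [] = 0 , λ m → z≤n
      sum-leading (x ∷ xs) with c₁ , ≤₁ ← leading-term n (f x) n | c₂ , ≤₂ ← sum-leading xs =
        c₁ + c₂ , λ m → ≤-trans (+-mono-≤ (≤₁ m) (≤₂ m)) (≤-reflexive (lemma (m ^ suc n) (f x ^ suc n) (∑ xs (λ x → f x ^ suc n)) (m ^ n) c₁ c₂))
        where
        lemma : ∀ M a s N c d → M * a + N * c + (M * s + N * d) ≡ M * (a + s) + N * (c + d)
        lemma = solve-∀

    -- Comparison of the leading coefficients in m.
    σ-asymptotics : (∀ m → ∑ ys (λ y → σ (suc n) (m * ℓ y)) ≤ C * ∑ xs (λ x → σ (suc n) (m * f x))) →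
      ∑ ys (λ y → ℓ y ^ suc n) ≤ C * ∑ xs (λ x → f x ^ suc n)
    σ-asymptotics bound = ≮⇒≥ impossible
      where
      open ≤-Reasoning
      F L c : ℕ
      F = ∑ xs (λ x → f x ^ suc n)
      L = ∑ ys (λ y → ℓ y ^ suc n)
      c = proj₁ (sum-leading xs)
      scaled : ∀ m .{{_ : NonZero m}} → m ^ suc n * L ≤ C * (m ^ suc n * F + m ^ n * c)
      scaled m = begin
        m ^ suc n * L                                     ≡⟨ ∑-*ˡ (m ^ suc n) ys _ ⟨
        ∑ ys (λ y → m ^ suc n * ℓ y ^ suc n)              ≡⟨ ∑-cong ys (λ y → ^-distribʳ-* (suc n) m (ℓ y)) ⟨
        ∑ ys (λ y → (m * ℓ y) ^ suc n)                    ≤⟨ ∑-mono ys (λ y → σ-lower n (m * ℓ y)) ⟩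
        ∑ ys (λ y → suc n ! * σ (suc n) (m * ℓ y))        ≡⟨ ∑-*ˡ (suc n !) ys _ ⟩
        suc n ! * ∑ ys (λ y → σ (suc n) (m * ℓ y))        ≤⟨ *-monoʳ-≤ (suc n !) (bound m) ⟩
        suc n ! * (C * ∑ xs (λ x → σ (suc n) (m * f x)))  ≡⟨ lemma (suc n !) C _ ⟩
        C * (suc n ! * ∑ xs (λ x → σ (suc n) (m * f x)))  ≡⟨ cong (C *_) (∑-*ˡ (suc n !) xs _) ⟨
        C * ∑ xs (λ x → suc n ! * σ (suc n) (m * f x))    ≤⟨ *-monoʳ-≤ C (∑-mono xs λ x → σ-upper n (m * f x)) ⟩
        C * ∑ xs (λ x → (m * f x + n) ^ suc n)            ≤⟨ *-monoʳ-≤ C (proj₂ (sum-leading xs) m) ⟩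
        C * (m ^ suc n * F + m ^ n * c)                   ∎
        where
        lemma : ∀ a b c → a * (b * c) ≡ b * (a * c)
        lemma = solve-∀
      cancelled : ∀ m .{{_ : NonZero m}} → m * L ≤ C * (m * F + c)
      cancelled m = *-cancelˡ-≤ (m ^ n) {{m^n≢0 m n}} (begin
        m ^ n * (m * L)                    ≡⟨ lemma₁ (m ^ n) m L ⟩
        m ^ suc n * L                      ≤⟨ scaled m ⟩
        C * (m ^ suc n * F + m ^ n * c)    ≡⟨ lemma₂ (m ^ n) C m F c ⟩
        m ^ n * (C * (m * F + c))          ∎)
        where
        lemma₁ : ∀ M m L → M * (m * L) ≡ m * M * L
        lemma₁ = solve-∀
        lemma₂ : ∀ M C m F c → C * (m * M * F + M * c) ≡ M * (C * (m * F + c))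
        lemma₂ = solve-∀
      impossible : ¬ C * F < L
      impossible CF<L = <⇒≱ (n<1+n (C * c)) (+-cancelˡ-≤ (m * (C * F)) m (C * c) (begin
        m * (C * F) + m         ≡⟨ lemma₁ m (C * F) ⟩
        m * suc (C * F)         ≤⟨ *-monoʳ-≤ m CF<L ⟩
        m * L                   ≤⟨ cancelled m ⟩
        C * (m * F + c)         ≡⟨ lemma₂ C m F c ⟩
        m * (C * F) + C * c     ∎))
        where
        -- If L exceeds C F by at least 1, the left side gains m, and this m is the first to beat
        -- the error term C c.
        m = suc (C * c)
        lemma₁ : ∀ m x → m * x + m ≡ m * (1 + x)
        lemma₁ = solve-∀
        lemma₂ : ∀ C m F c → C * (m * F + c) ≡ m * (C * F) + C * c
        lemma₂ = solve-∀

-- The inequality on the chart u₁ = 1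

module Chart where

  open import Defs
  open Counting
  open Greedy
  open Independence
  open Lines using (module LineCurves)
  open Residues
  open Simplex using (simplex)
  open Taylor using (σ)
  open import Data.Integer.Base using (ℤ)
  open import Data.List.Base using (List; _∷_; map; length; filter)
  open import Data.List.Extrema.Nat using (max; xs≤max; argmax-sel)
  open import Data.List.Membership.Propositional using (_∈_)
  open import Data.List.Membership.Propositional.Properties using (∈-map⁺; ∈-map⁻)
  open import Data.List.Relation.Unary.All as All using (All)
  import Data.List.Relation.Unary.Unique.Propositional.Properties as Unique
  open import Data.Nat.Base
  open import Data.Nat.Primality using (Prime; prime⇒nonZero)
  open import Data.Nat.Properties
  open import Data.Product using (∃; _×_; _,_; proj₁)
  open import Data.Sum using (inj₁; inj₂)
  open import Data.Vec.Base as Vec using (Vec; _∷_)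
  open import Function.Base using (id)
  open import Relation.Binary.PropositionalEquality
  open import Relation.Nullary.Decidable using (decidable-stable)

  ∈⇒≤max : ∀ {m xs} → m ∈ xs → m ≤ max 0 xs
  ∈⇒≤max {xs = xs} m∈ = All.lookup (xs≤max 0 xs) m∈

  module _ {N n : ℕ} .{{_ : NonZero N}} (f : Vec (ℤ/ N) n → ℕ) where

    lineSum≤⋆ : ∀ u a → lineSum f u a ≤ (f ⋆) u
    lineSum≤⋆ u a = ∈⇒≤max (∈-map⁺ (lineSum f u) (∈-allVectors a))

    ⋆-attained : ∀ u → ∃ λ a → lineSum f u a ≡ (f ⋆) u
    ⋆-attained u with argmax-sel id 0 (map (lineSum f u) (allVectors N n))
    -- `max 0` returned its default value: then all line sums are 0, and any base point attains the
    -- supremum.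
    ... | inj₁ ≡0 = a , trans (n≤0⇒n≡0 (subst (lineSum f u a ≤_) ≡0 (lineSum≤⋆ u a))) (sym ≡0)
      where a = Vec.replicate n 𝟘
    ... | inj₂ ∈lines with a , _ , eq ← ∈-map⁻ (lineSum f u) ∈lines = a , sym eq

  module ChartInequality {p : ℕ} (pr : Prime p) (k e : ℕ) .{{_ : NonZero e}} (n′ : ℕ) where
    private
      N = p ^ suc k
      n = suc n′
      E = suc e
      instance
        p≢0 : NonZero p
        p≢0 = prime⇒nonZero pr
        N≢0 : NonZero N
        N≢0 = m^n≢0 p (suc k)
      directions = allVectors N n′
    open LineCurves pr k using (support)
    open Vectors N using (negᵛ; translateᵛ)

    module _ (f : Vec (ℤ/ N) n → ℕ) (sparse : ∀ u a → support (λ t → f (a ⊕ᵛ t ·ᵛ (𝟙 ∷ u))) ≤ p ^ e) where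
      private
        ℓ : Vec (ℤ/ N) n′ → ℕ
        ℓ u = (f ⋆) (𝟙 ∷ u)

      module _ (m : ℕ) where
        private
          -- The sum serves as a common upper bound for the orders m ℓ u, and hence as a range for
          -- indices and levels.
          T = ∑ directions (λ u → m * ℓ u)
          K = ∑ (allVectors N n) (λ x → σ n (m * f x))
          module I = Independent pr k e n′ T
          module G = Basis pr e n′ T

          Basis : Set
          Basis = List (G.Label × List (ℤ × Vec ℕ n))

          level : G.Label × List (ℤ × Vec ℕ n) → ℕ
          level ((_ , i) , _) = i

          count : ∀ (B : Basis) → (∀ s → length (filter (λ ((κ , i) , _) → i <? m * ℓ (I.direction κ ⊕ᵛ s)) B) ≤ K) →
            (∀ t → t ≤ T → length (simplex E n′ t) ≤ length (filter (λ ((_ , i) , _) → i <? t) B)) →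
            ∑ directions (λ u → σ n (m * ℓ u)) ≤ (E ^ n′ * N ^ n′) * K
          count B few many = begin
            ∑ directions (λ u → σ n (m * ℓ u))
              ≤⟨ ∑-mono directions (λ u → σ≤simplex E n′ (m * ℓ u)) ⟩
            ∑ directions (λ u → E ^ n′ * length (simplex E n′ (m * ℓ u)))
              ≡⟨ ∑-*ˡ (E ^ n′) directions (λ u → length (simplex E n′ (m * ℓ u))) ⟩
            E ^ n′ * ∑ directions (λ u → length (simplex E n′ (m * ℓ u)))
              ≤⟨ *-monoʳ-≤ (E ^ n′) (∑-mono directions λ u → many (m * ℓ u) (∈⇒≤∑ (λ u → m * ℓ u) (∈-allVectors u))) ⟩
            E ^ n′ * ∑ directions (λ u → length (filter (λ ((_ , i) , _) → i <? m * ℓ u) B))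
              ≡⟨ cong (E ^ n′ *_) (∑-cong directions λ u → length-filter≡∑ (λ ((_ , i) , _) → i <? m * ℓ u) B) ⟩
            E ^ n′ * ∑ directions (λ u → ∑ B (λ b → indicator (level b <? m * ℓ u)))
              ≡⟨ cong (E ^ n′ *_) (∑-swap directions B (λ u b → indicator (level b <? m * ℓ u))) ⟩
            E ^ n′ * ∑ B (λ b → ∑ directions (λ u → indicator (level b <? m * ℓ u)))
              ≤⟨ *-monoʳ-≤ (E ^ n′) (∑-mono B translate-sum) ⟩
            E ^ n′ * ∑ B (λ b → ∑ directions (λ s → indicator (level b <? m * ℓ (I.direction (proj₁ (proj₁ b)) ⊕ᵛ s))))
              ≡⟨ cong (E ^ n′ *_) (∑-swap directions B (λ s b → indicator (level b <? m * ℓ (I.direction (proj₁ (proj₁ b)) ⊕ᵛ s)))) ⟨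
            E ^ n′ * ∑ directions (λ s → ∑ B (λ b → indicator (level b <? m * ℓ (I.direction (proj₁ (proj₁ b)) ⊕ᵛ s))))
              ≡⟨ cong (E ^ n′ *_) (∑-cong directions λ s → length-filter≡∑ (λ ((κ , i) , _) → i <? m * ℓ (I.direction κ ⊕ᵛ s)) B) ⟨
            E ^ n′ * ∑ directions (λ s → length (filter (λ ((κ , i) , _) → i <? m * ℓ (I.direction κ ⊕ᵛ s)) B))
              ≤⟨ *-monoʳ-≤ (E ^ n′) (∑-mono directions few) ⟩
            E ^ n′ * ∑ directions (λ _ → K)
              ≡⟨ cong (E ^ n′ *_) (trans (∑-const K directions) (cong (_* K) (length-allVectors N n′))) ⟩
            E ^ n′ * (N ^ n′ * K)
              ≡⟨ *-assoc (E ^ n′) (N ^ n′) K ⟨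
            (E ^ n′ * N ^ n′) * K ∎
            where
            open ≤-Reasoning
            translate-sum : ∀ b → ∑ directions (λ u → indicator (level b <? m * ℓ u)) ≤
              ∑ directions (λ s → indicator (level b <? m * ℓ (I.direction (proj₁ (proj₁ b)) ⊕ᵛ s)))
            translate-sum b = begin
              ∑ directions h
                ≡⟨ ∑-cong directions (λ u → cong h (translateᵛ d u)) ⟨
              ∑ directions (λ u → h (d ⊕ᵛ (u ⊕ᵛ negᵛ d)))
                ≤⟨ ∑-injection (_⊕ᵛ negᵛ d) directions directions (λ s → h (d ⊕ᵛ s))
                     (Unique.map⁺ (λ {u} {v} eq → trans (sym (translateᵛ d u)) (trans (cong (d ⊕ᵛ_) eq) (translateᵛ d v))) (Unique-allVectors N n′))
                     (λ {u} _ → ∈-allVectors (u ⊕ᵛ negᵛ d)) ⟩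
              ∑ directions (λ s → h (d ⊕ᵛ s)) ∎
              where
              d = I.direction (proj₁ (proj₁ b))
              h : Vec (ℤ/ N) n′ → ℕ
              h u = indicator (level b <? m * ℓ u)

          line : ∀ u → ∃ λ a → lineSum f (𝟙 ∷ u) a ≡ ℓ u × support (λ t → f (a ⊕ᵛ t ·ᵛ (𝟙 ∷ u))) ≤ p ^ e
          line u = let a , attained = ⋆-attained f (𝟙 ∷ u) in a , attained , sparse u a

        -- The bound K on the selected part of the basis is averaged over all translations s of the directions.
        chart-dimension : ∑ directions (λ u → σ n (m * ℓ u)) ≤ (E ^ n′ * N ^ n′) * K
        chart-dimension = decidable-stable (_ ≤? _) λ ≰ → G.basis λ (B , tri , many) →
          ≰ (count B (I.few-independent f m ℓ line B tri) many)

      chart-inequality : ∑ directions (λ u → (f ⋆) (𝟙 ∷ u) ^ n) ≤ (E ^ n′ * N ^ n′) * ∑ (allVectors N n) (λ x → f x ^ n)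
      chart-inequality = σ-asymptotics (allVectors N n) directions f ℓ n′ (E ^ n′ * N ^ n′) chart-dimension

-- Averaging over the sheared charts

module Averaging where

  open import Defs
  open Chart
  open Counting
  open Lines using (module LineCurves)
  open Residues
  open import Algebra.Bundles using (CommutativeRing)
  open import Data.Fin.Base as Fin using (toℕ)
  open import Data.Fin.Properties using (nonZeroIndex)
  open import Data.List.Base using ([]; _∷_; map; length; allFin; filter)
  open import Data.List.Membership.Propositional using (_∈_; find)
  open import Data.List.Membership.Propositional.Properties using (∈-map⁺; ∈-allFin; ∈-filter⁻)
  open import Data.List.Properties using (length-tabulate)
  open import Data.List.Relation.Unary.All as All using (All; []; _∷_)
  import Data.List.Relation.Unary.All.Properties as All
  open import Data.List.Relation.Unary.AllPairs as AllPairs using (AllPairs; []; _∷_)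
  import Data.List.Relation.Unary.AllPairs.Properties as AllPairs
  open import Data.List.Relation.Unary.Unique.Propositional using (Unique)
  import Data.List.Relation.Unary.Unique.Propositional.Properties as Unique
  open import Data.Nat.Base
  open import Data.Nat.Divisibility using (_∣_)
  open import Data.Nat.Primality using (Prime; prime⇒nonZero; prime⇒nonTrivial)
  open import Data.Nat.Properties
  open import Data.Nat.Tactic.RingSolver using (solve-∀)
  open import Data.Product using (∃; _×_; _,_; proj₁; proj₂)
  open import Data.Sum using (inj₁; inj₂)
  open import Data.Vec.Base as Vec using (Vec; []; _∷_)
  import Data.Vec.Relation.Unary.Any as VecAny
  open import Function.Base using (_∘_)
  open import Relation.Binary.PropositionalEquality
  open import Relation.Nullary using (¬_; Dec; yes; no; contradiction)

  ∑-filter : ∀ {A : Set} {Q : A → Set} (Q? : ∀ x → Dec (Q x)) xs f → ∑ (filter Q? xs) f ≡ ∑ xs (λ x → f x * indicator (Q? x))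
  ∑-filter Q? []       f = refl
  ∑-filter Q? (x ∷ xs) f with Q? x
  ... | yes _ = cong₂ _+_ (sym (*-identityʳ (f x))) (∑-filter Q? xs f)
  ... | no  _ = trans (∑-filter Q? xs f) (cong (_+ ∑ xs (λ x → f x * indicator (Q? x))) (sym (*-zeroʳ (f x))))

  Unique-map : ∀ {A B : Set} {R : A → A → Set} {Q : A → Set} (g : A → B) →
    (∀ {x y} → Q x → Q y → g x ≡ g y → ¬ R x y) → ∀ {xs} → AllPairs R xs → All Q xs → Unique (map g xs)
  Unique-map g separated []           []       = []
  Unique-map g separated (rx ∷ pairs) (q ∷ qs) =
    All.map⁺ (All.zipWith (λ (r , q′) eq → separated q q′ eq r) (rx , qs)) ∷ Unique-map g separated pairs qs

  module Average {p : ℕ} (pr : Prime p) (k n′ : ℕ) where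
    private
      n = suc n′
      instance
        p≢0 : NonZero p
        p≢0 = prime⇒nonZero pr
        p>1 : NonTrivial p
        p>1 = prime⇒nonTrivial pr
    open Units pr k
    private
      instance
        N≢0 : NonZero N
        N≢0 = m^n≢0 p (suc k)
      directions = allVectors N n′
    open Vectors N
    open CommutativeRing residueRing using () renaming (zeroˡ to ⊗-zeroˡ)
    open LineCurves pr k using (support)

    private
      inverse-≡ : ∀ {l m : ℤ/ N} → l ⊗ m ≡ 𝟙 {{nonZeroIndex l}} → l ⊗ m ≡ 𝟙 {{N≢0}}
      inverse-≡ eq = eq

      -- Multiplication by l permutes the parameters t, so directions that differ by a unit have the
      -- same lines.
      scale-unit : ∀ {l} → IsUnit l → (f : Vec (ℤ/ N) n → ℕ) → ∀ u a → lineSum f (l ·ᵛ u) a ≤ lineSum f u a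
      scale-unit {l} unit f u a = ≤-trans
        (≤-reflexive (∑-cong (allFin N) λ t → cong (λ v → f (a ⊕ᵛ v)) (·ᵛ-⊗ t l u)))
        (∑-injection (_⊗ l) (allFin N) (allFin N) (λ t → f (a ⊕ᵛ t ·ᵛ u))
          (Unique.map⁺ (IsUnit-cancelʳ unit) (Unique.allFin⁺ N)) (λ {t} _ → ∈-allFin (t ⊗ l)))

      lineSum-shear : ∀ c (f : Vec (ℤ/ N) n → ℕ) u a → lineSum (f ∘ shear c) u a ≡ lineSum f (shear c u) (shear c a)
      lineSum-shear c f u a = ∑-cong (allFin N) λ t → cong f (shear-line c a t u)

    hasUnit? : ∀ {m} (u : Vec (ℤ/ N) m) → Dec (HasUnitCoordinate u)
    hasUnit? = VecAny.any? isUnit?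

    -- Without a unit among the coordinates of u, p divides ⟨c, u⟩ and 1 + ⟨c, u⟩ is a unit. Thus
    -- the directions of a sheared chart are represented in P, and their line sums are at most w.
    unit-shear : ∀ c (u : Vec (ℤ/ N) n′) → HasUnitCoordinate (shear c (𝟙 ∷ u))
    unit-shear c u with hasUnit? u
    ... | yes unit   = VecAny.there unit
    ... | no nonunit = VecAny.here (p∤⇒unit λ p∣ → unit⇒p∤ 𝟙-unit
          (p∣⊕⁻ (pairing c u) 𝟙 (nonunit-pairing c u nonunit) (subst (λ a → p ∣ toℕ a) (⊕-comm 𝟙 (pairing c u)) p∣)))

    slope : Vec (ℤ/ N) n → Vec (ℤ/ N) n′ → ℤ/ N
    slope u c = Vec.head (unshearᵛ c u)

    -- The point u lies in the chart sheared by c: by `normal-scale` it is then a unit times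
    -- `shear c (𝟙 ∷ normal c u)`.
    Good : Vec (ℤ/ N) n → Vec (ℤ/ N) n′ → Set
    Good u c = IsUnit (slope u c)

    good? : ∀ u c → Dec (Good u c)
    good? u c = isUnit? (slope u c)

    slope-⊕ : ∀ u c e → slope u (c ⊕ᵛ e) ⊕ pairing e (Vec.tail u) ≡ slope u c
    slope-⊕ (x ∷ u) c e = trans (cong (λ y → x ⊕ neg y ⊕ pairing e u) (pairing-⊕ c e u)) (lemma x (pairing c u) (pairing e u))
      where
      open import Algebra.Properties.AbelianGroup (CommutativeRing.+-abelianGroup residueRing) using (⁻¹-∙-comm)
      lemma : ∀ x y z → x ⊕ neg (y ⊕ z) ⊕ z ≡ x ⊕ neg y
      lemma x y z = trans (cong (λ w → x ⊕ w ⊕ z) (sym (⁻¹-∙-comm y z))) (trans (⊕-assoc x (neg y ⊕ neg z) z)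
        (cong (x ⊕_) (trans (⊕-assoc (neg y) (neg z) z) (trans (cong (neg y ⊕_) (trans (⊕-comm (neg z) z) (⊕-inverseʳ z)))
          (trans (⊕-comm (neg y) 𝟘) (⊕-identityˡ (neg y)))))))

    -- If the last coordinates contain a unit, some e pairs with them to a unit. The slopes at c and
    -- c + e then differ by a unit and cannot both be divisible by p, so c ↦ c + e injects the bad
    -- shears into the good ones. Otherwise every shear is good.
    half-good : ∀ u → HasUnitCoordinate u → N ^ n′ ≤ 2 * ∑ directions (λ c → indicator (good? u c))
    half-good u@(x ∷ xs) unit = subst (_≤ 2 * good) (length-allVectors N n′) (by-tail (hasUnit? xs))
      where
      open ≤-Reasoning
      good : ℕ
      good = ∑ directions (λ c → indicator (good? u c))
      bad? : ∀ {A : Set} → Dec A → ℕ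
      bad? (yes _) = 0
      bad? (no _)  = 1
      one : ∀ {A : Set} (d : Dec A) → 1 ≡ bad? d + indicator d
      one (yes _) = refl
      one (no _)  = refl
      unshear-slope : ∀ c → slope u c ⊕ pairing c xs ≡ x
      unshear-slope c = cong Vec.head (shear-unshear c u)
      by-tail : Dec (HasUnitCoordinate xs) → length directions ≤ 2 * good
      by-tail (no nonunit) = begin
        length directions                   ≡⟨ *-identityʳ _ ⟨
        length directions * 1               ≡⟨ ∑-const 1 directions ⟨
        ∑ directions (λ _ → 1)              ≤⟨ ∑-mono directions all-good ⟩
        good                                ≤⟨ m≤n*m good 2 ⟩
        2 * good                            ∎
        where
        head-unit : HasUnitCoordinate u → IsUnit x
        head-unit (VecAny.here ux)   = ux
        head-unit (VecAny.there uxs) = contradiction uxs nonunit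
        all-good : ∀ c → 1 ≤ indicator (good? u c)
        all-good c with good? u c
        ... | yes _ = ≤-refl
        ... | no bad = contradiction (subst (λ a → p ∣ toℕ a) (unshear-slope c)
                (p∣⊕ (slope u c) (pairing c xs) (nonunit⇒p∣ bad) (nonunit-pairing c xs nonunit))) (unit⇒p∤ (head-unit unit))
      by-tail (yes unit-xs) with e , unit-e ← unit-pairing unit-xs = begin
        length directions                                              ≡⟨ *-identityʳ _ ⟨
        length directions * 1                                          ≡⟨ ∑-const 1 directions ⟨
        ∑ directions (λ _ → 1)                                         ≡⟨ ∑-cong directions (λ c → one (good? u c)) ⟩
        ∑ directions (λ c → bad? (good? u c) + indicator (good? u c))  ≡⟨ ∑-+ directions _ _ ⟩
        ∑ directions (λ c → bad? (good? u c)) + good                   ≤⟨ +-monoˡ-≤ good (≤-trans (∑-mono directions (moved e unit-e))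
                                                                            (∑-injection (_⊕ᵛ e) directions directions (λ c → indicator (good? u c))
                                                                              (Unique.map⁺ (⊕ᵛ-injective e) (Unique-allVectors N n′))
                                                                              (λ {c} _ → ∈-allVectors (c ⊕ᵛ e)))) ⟩
        good + good                                                    ≡⟨ cong (good +_) (+-identityʳ good) ⟨
        2 * good                                                       ∎
        where
        ⊕ᵛ-comm : ∀ {m} (a b : Vec (ℤ/ N) m) → a ⊕ᵛ b ≡ b ⊕ᵛ a
        ⊕ᵛ-comm []      []      = refl
        ⊕ᵛ-comm (a ∷ as) (b ∷ bs) = cong₂ _∷_ (⊕-comm a b) (⊕ᵛ-comm as bs)
        ⊕ᵛ-assoc : ∀ {m} (a b c : Vec (ℤ/ N) m) → (a ⊕ᵛ b) ⊕ᵛ c ≡ a ⊕ᵛ (b ⊕ᵛ c)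
        ⊕ᵛ-assoc []      []      []      = refl
        ⊕ᵛ-assoc (a ∷ as) (b ∷ bs) (c ∷ cs) = cong₂ _∷_ (⊕-assoc a b c) (⊕ᵛ-assoc as bs cs)
        ⊕ᵛ-injective : ∀ e {c d} → c ⊕ᵛ e ≡ d ⊕ᵛ e → c ≡ d
        ⊕ᵛ-injective e {c} {d} eq = trans (sym (undo c)) (trans (cong (_⊕ᵛ negᵛ e) eq) (undo d))
          where
          undo : ∀ c → (c ⊕ᵛ e) ⊕ᵛ negᵛ e ≡ c
          undo c = trans (⊕ᵛ-assoc c e (negᵛ e)) (trans (⊕ᵛ-comm c (e ⊕ᵛ negᵛ e)) (trans (⊕ᵛ-assoc e (negᵛ e) c)
            (trans (cong (e ⊕ᵛ_) (⊕ᵛ-comm (negᵛ e) c)) (translateᵛ e c))))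
        moved : ∀ e → IsUnit (pairing e xs) → ∀ c → bad? (good? u c) ≤ indicator (good? u (c ⊕ᵛ e))
        moved e unit-e c with good? u c | good? u (c ⊕ᵛ e)
        ... | yes _  | _      = z≤n
        ... | no _   | yes _  = ≤-refl
        ... | no bad | no bad′ = contradiction
                (p∣⊕⁻ (slope u (c ⊕ᵛ e)) (pairing e xs) (nonunit⇒p∣ bad′) (subst (λ a → p ∣ toℕ a) (sym (slope-⊕ u c e)) (nonunit⇒p∣ bad)))
                (unit⇒p∤ unit-e)

    -- The value 𝟘 at non-units is a placeholder; normalised coordinates are compared only at good
    -- points.
    inverse : ∀ a → Dec (IsUnit a) → ℤ/ N
    inverse a (yes (b , _)) = b
    inverse a (no _)        = 𝟘

    normal : Vec (ℤ/ N) n′ → Vec (ℤ/ N) n → Vec (ℤ/ N) n′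
    normal c u = inverse (slope u c) (good? u c) ·ᵛ Vec.tail u

    normal-scale : ∀ c u → Good u c → ∃ λ l → IsUnit l × u ≡ l ·ᵛ shear c (𝟙 ∷ normal c u)
    normal-scale c u good with good? u c
    ... | no bad = contradiction good bad
    ... | yes (m , lm≡𝟙) = l , (m , lm≡𝟙) , trans (sym (shear-unshear c u)) (trans (cong (shear c) (scaled u refl))
                              (shear-scale c l (𝟙 ∷ m ·ᵛ Vec.tail u)))
      where
      l = slope u c
      scaled : ∀ v → v ≡ u → unshearᵛ c v ≡ l ·ᵛ (𝟙 ∷ m ·ᵛ Vec.tail v)
      scaled (x ∷ xs) refl = cong₂ _∷_ (sym (trans (⊗-comm l 𝟙) (⊗-identityˡ l)))
        (sym (trans (·ᵛ-⊗ l m xs) (trans (cong (_·ᵛ xs) (inverse-≡ {slope u c} {m} lm≡𝟙)) (·ᵛ-identityˡ xs))))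

    -- Points with the same normalised tail are unit multiples of one vector. Hence `normal c` is
    -- injective on the good points of P, which are pairwise inequivalent.
    normal-separates : ∀ c {u v} → Good u c → Good v c → normal c u ≡ normal c v → u ∼ v
    normal-separates c {u} {v} good-u good-v eq
      with l , unit-l , u≡ ← normal-scale c u good-u
      with m , (m⁻¹ , mm⁻¹≡𝟙) , v≡ ← normal-scale c v good-v
      = l ⊗ m⁻¹ , p∤⇒unit p∤ , (begin
        u                                ≡⟨ u≡ ⟩
        l ·ᵛ shear c (𝟙 ∷ normal c u)    ≡⟨ cong (λ w → l ·ᵛ shear c (𝟙 ∷ w)) eq ⟩
        l ·ᵛ s                           ≡⟨ cong (l ·ᵛ_) (sym (trans (·ᵛ-⊗ m⁻¹ m s) (trans (cong (_·ᵛ s) (trans (⊗-comm m⁻¹ m) (inverse-≡ {m} {m⁻¹} mm⁻¹≡𝟙))) (·ᵛ-identityˡ s)))) ⟩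
        l ·ᵛ m⁻¹ ·ᵛ m ·ᵛ s               ≡⟨ ·ᵛ-⊗ l m⁻¹ (m ·ᵛ s) ⟩
        (l ⊗ m⁻¹) ·ᵛ m ·ᵛ s              ≡⟨ cong ((l ⊗ m⁻¹) ·ᵛ_) v≡ ⟨
        (l ⊗ m⁻¹) ·ᵛ v                   ∎)
      where
      open ≡-Reasoning
      s = shear c (𝟙 ∷ normal c v)
      p∤ : ¬ p ∣ toℕ (l ⊗ m⁻¹)
      p∤ p∣ = unit⇒p∤ unit-l (subst (λ a → p ∣ toℕ a)
        (trans (⊗-comm m (l ⊗ m⁻¹)) (trans (⊗-assoc l m⁻¹ m) (trans (cong (l ⊗_) (trans (⊗-comm m⁻¹ m) (inverse-≡ {m} {m⁻¹} mm⁻¹≡𝟙))) (trans (⊗-comm l 𝟙) (⊗-identityˡ l)))))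
        (p∣⊗ m (l ⊗ m⁻¹) p∣))

    module _ (P : ProjectiveSpace N n) where

      -- The vectors (1, u) are pairwise inequivalent: if two of them are c x and d x, the first
      -- coordinates give c x₁ = 1 = d x₁, hence c = d.
      many-points : N ^ n′ ≤ ∣ P ∣ᴾ
      many-points = begin
        N ^ n′                          ≡⟨ length-allVectors N n′ ⟨
        length directions               ≡⟨ trans (∑-const 1 directions) (*-identityʳ _) ⟨
        ∑ directions (λ _ → 1)          ≤⟨ ∑-injection (λ u → proj₁ (representative u)) directions (points P) (λ _ → 1)
                                             (Unique.map⁺ injective (Unique-allVectors N n′)) (λ {u} _ → proj₁ (proj₂ (representative u))) ⟩
        ∑ (points P) (λ _ → 1)          ≡⟨ trans (∑-const 1 (points P)) (*-identityʳ _) ⟩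
        ∣ P ∣ᴾ                          ∎
        where
        open ≤-Reasoning
        representative : ∀ (u : Vec (ℤ/ N) n′) → ∃ λ x → x ∈ points P × (𝟙 ∷ u) ∼ x
        representative u = find (exhaustive P (𝟙 ∷ u) (VecAny.here 𝟙-unit))
        same : ∀ {u v : Vec (ℤ/ N) n′} x → (𝟙 ∷ u) ∼ x → (𝟙 ∷ v) ∼ x → u ≡ v
        same (x ∷ xs) (c , _ , eq) (d , _ , eq′) = trans (cong Vec.tail eq) (trans (cong (_·ᵛ xs) c≡d) (sym (cong Vec.tail eq′)))
          where
          c≡d : c ≡ d
          c≡d = IsUnit-cancelʳ {x} (c , trans (⊗-comm x c) (sym (cong Vec.head eq)))
            (trans (sym (cong Vec.head eq)) (cong Vec.head eq′))
        injective : ∀ {u v} → proj₁ (representative u) ≡ proj₁ (representative v) → u ≡ v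
        injective {u} {v} eq = same (proj₁ (representative v))
          (subst ((𝟙 ∷ u) ∼_) eq (proj₂ (proj₂ (representative u)))) (proj₂ (proj₂ (representative v)))

      module _ (f : Vec (ℤ/ N) n → ℕ) where

        f⋆≤w : ∀ {u} → u ∈ points P → (f ⋆) u ≤ maxOver P (f ⋆)
        f⋆≤w u∈ = ∈⇒≤max (∈-map⁺ (f ⋆) u∈)

        lineSum≤w : ∀ v a → HasUnitCoordinate v → lineSum f v a ≤ maxOver P (f ⋆)
        lineSum≤w v a unit with u , u∈P , (c , unit-c , refl) ← find (exhaustive P v unit) =
          ≤-trans (scale-unit {c} unit-c f u a) (≤-trans (lineSum≤⋆ f u a) (f⋆≤w u∈P))

        private
          support≤∑ : ∀ (g : ℤ/ N → ℕ) → support g ≤ ∑ (allFin N) g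
          support≤∑ g = ∑-mono (allFin N) λ t → m⊓n≤n 1 (g t)

          support≤N : ∀ (g : ℤ/ N → ℕ) → support g ≤ N
          support≤N g = ≤-trans (∑-mono (allFin N) λ t → m⊓n≤m 1 (g t))
            (≤-reflexive (trans (∑-const 1 (allFin N)) (trans (*-identityʳ _) (length-tabulate {n = N} (λ i → i)))))

          -- Up to reparametrisation, a line in direction u is the image under the shear of a line
          -- in direction (1, normal c u).
          ⋆≤⋆-shear : ∀ c u → Good u c → (f ⋆) u ≤ ((f ∘ shear c) ⋆) (𝟙 ∷ normal c u)
          ⋆≤⋆-shear c u good with l , unit-l , u≡ ← normal-scale c u good = begin
            (f ⋆) u                                               ≡⟨ proj₂ (⋆-attained f u) ⟨
            lineSum f u a                                         ≡⟨ cong (λ u → lineSum f u a) u≡ ⟩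
            lineSum f (l ·ᵛ shear c w) a                          ≤⟨ scale-unit {l} unit-l f (shear c w) a ⟩
            lineSum f (shear c w) a                               ≡⟨ cong (lineSum f (shear c w)) (shear-unshear c a) ⟨
            lineSum f (shear c w) (shear c (unshearᵛ c a))        ≡⟨ lineSum-shear c f w (unshearᵛ c a) ⟨
            lineSum (f ∘ shear c) w (unshearᵛ c a)                ≤⟨ lineSum≤⋆ (f ∘ shear c) w (unshearᵛ c a) ⟩
            ((f ∘ shear c) ⋆) w                                   ∎
            where
            open ≤-Reasoning
            a = proj₁ (⋆-attained f u)
            w = 𝟙 ∷ normal c u

        F H : ℕ
        F = ∑ (allVectors N n) (λ x → f x ^ n)
        H = ∑ (points P) (λ u → (f ⋆) u ^ n)

        module _ (e₀ : ℕ) .{{_ : NonZero e₀}} (w≤ : maxOver P (f ⋆) ≤ p ^ e₀) where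
          private
            -- The number of points of a line is N = p^(k+1), so pᵉ bounds the support whichever
            -- argument is the minimum; e ≥ 1 because e₀ ≥ 1.
            e = e₀ ⊓ suc k
            E = suc e
            e≢0 : NonZero e
            e≢0 = >-nonZero (⊓-pres-m< (>-nonZero⁻¹ e₀) (s≤s (z≤n {k})))

            sparse : ∀ c u a → support (λ t → f (shear c (a ⊕ᵛ t ·ᵛ (𝟙 ∷ u)))) ≤ p ^ e
            sparse c u a = by-minimum (≤-total e₀ (suc k))
              where
              open ≤-Reasoning
              g = λ t → f (shear c (a ⊕ᵛ t ·ᵛ (𝟙 ∷ u)))
              by-minimum : _ → support g ≤ p ^ e
              by-minimum (inj₁ e₀≤) = subst (λ e → support g ≤ p ^ e) (sym (m≤n⇒m⊓n≡m e₀≤)) (begin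
                support g                                   ≤⟨ support≤∑ g ⟩
                lineSum (f ∘ shear c) (𝟙 ∷ u) a             ≡⟨ lineSum-shear c f (𝟙 ∷ u) a ⟩
                lineSum f (shear c (𝟙 ∷ u)) (shear c a)     ≤⟨ lineSum≤w (shear c (𝟙 ∷ u)) (shear c a) (unit-shear c u) ⟩
                maxOver P (f ⋆)                             ≤⟨ w≤ ⟩
                p ^ e₀                                      ∎)
              by-minimum (inj₂ ≤e₀) = subst (λ e → support g ≤ p ^ e) (sym (m≥n⇒m⊓n≡n ≤e₀)) (support≤N g)

            chart : ∀ c → ∑ (filter (λ u → good? u c) (points P)) (λ u → (f ⋆) u ^ n) ≤ (E ^ n′ * N ^ n′) * F
            chart c = begin
              ∑ goods (λ u → (f ⋆) u ^ n)
                ≤⟨ ∑-mono-∈ goods (λ u∈ → ^-monoˡ-≤ n (⋆≤⋆-shear c _ (proj₂ (∈-filter⁻ (λ u → good? u c) {xs = points P} u∈)))) ⟩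
              ∑ goods (λ u → ((f ∘ shear c) ⋆) (𝟙 ∷ normal c u) ^ n)
                ≤⟨ ∑-injection (normal c) goods directions (λ u → ((f ∘ shear c) ⋆) (𝟙 ∷ u) ^ n)
                     (Unique-map (normal c) (λ {u} {v} gu gv eq ≁ → ≁ (normal-separates c {u} {v} gu gv eq))
                       (AllPairs.filter⁺ (λ u → good? u c) (distinct P)) (All.all-filter (λ u → good? u c) (points P)))
                     (λ {u} _ → ∈-allVectors (normal c u)) ⟩
              ∑ directions (λ u → ((f ∘ shear c) ⋆) (𝟙 ∷ u) ^ n)
                ≤⟨ ChartInequality.chart-inequality pr k e {{e≢0}} n′ (f ∘ shear c) (sparse c) ⟩
              (E ^ n′ * N ^ n′) * ∑ (allVectors N n) (λ x → f (shear c x) ^ n)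
                ≤⟨ *-monoʳ-≤ (E ^ n′ * N ^ n′) (∑-injection (shear c) (allVectors N n) (allVectors N n) (λ x → f x ^ n)
                     (Unique.map⁺ (shear-injective c) (Unique-allVectors N n)) (λ {x} _ → ∈-allVectors (shear c x))) ⟩
              (E ^ n′ * N ^ n′) * F ∎
              where
              open ≤-Reasoning
              goods = filter (λ u → good? u c) (points P)

            averaged : H ≤ 2 * (E ^ n′ * N ^ n′ * F)
            averaged = *-cancelˡ-≤ (N ^ n′) {{m^n≢0 N n′}} (begin
              N ^ n′ * H
                ≡⟨ ∑-*ˡ (N ^ n′) (points P) _ ⟨
              ∑ (points P) (λ u → N ^ n′ * h u)
                ≤⟨ ∑-mono-∈ (points P) (λ {u} u∈ → *-monoˡ-≤ (h u) (half-good u (All.lookup (unimodular P) u∈))) ⟩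
              ∑ (points P) (λ u → 2 * ∑ directions (λ c → indicator (good? u c)) * h u)
                ≡⟨ ∑-cong (points P) (λ u → trans (*-assoc 2 (goods u) (h u)) (cong (2 *_) (trans (*-comm (goods u) (h u)) (sym (∑-*ˡ (h u) directions (λ c → indicator (good? u c))))))) ⟩
              ∑ (points P) (λ u → 2 * ∑ directions (λ c → h u * indicator (good? u c)))
                ≡⟨ ∑-*ˡ 2 (points P) _ ⟩
              2 * ∑ (points P) (λ u → ∑ directions (λ c → h u * indicator (good? u c)))
                ≡⟨ cong (2 *_) (∑-swap (points P) directions _) ⟩
              2 * ∑ directions (λ c → ∑ (points P) (λ u → h u * indicator (good? u c)))
                ≡⟨ cong (2 *_) (∑-cong directions λ c → sym (∑-filter (λ u → good? u c) (points P) h)) ⟩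
              2 * ∑ directions (λ c → ∑ (filter (λ u → good? u c) (points P)) h)
                ≤⟨ *-monoʳ-≤ 2 (∑-mono directions chart) ⟩
              2 * ∑ directions (λ _ → E ^ n′ * N ^ n′ * F)
                ≡⟨ cong (2 *_) (trans (∑-const _ directions) (cong (_* (E ^ n′ * N ^ n′ * F)) (length-allVectors N n′))) ⟩
              2 * (N ^ n′ * (E ^ n′ * N ^ n′ * F))
                ≡⟨ lemma (N ^ n′) (E ^ n′ * N ^ n′ * F) ⟩
              N ^ n′ * (2 * (E ^ n′ * N ^ n′ * F)) ∎)
              where
              open ≤-Reasoning
              h : Vec (ℤ/ N) n → ℕ
              h u = (f ⋆) u ^ n
              goods : Vec (ℤ/ N) n → ℕ
              goods u = ∑ directions (λ c → indicator (good? u c))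
              lemma : ∀ M x → 2 * (M * x) ≡ M * (2 * x)
              lemma = solve-∀

          maximal-bound : H ≤ suc e₀ ^ n * (∣ P ∣ᴾ * F)
          maximal-bound = begin
            H                                 ≤⟨ averaged ⟩
            -- The factor 2 from averaging is absorbed by one more factor E = e + 1 ≥ 2, which
            -- raises the exponent from n - 1 to n.
            2 * (E ^ n′ * N ^ n′ * F)         ≤⟨ *-monoˡ-≤ (E ^ n′ * N ^ n′ * F) (s≤s (>-nonZero⁻¹ e {{e≢0}})) ⟩
            E * (E ^ n′ * N ^ n′ * F)         ≡⟨ lemma E (E ^ n′) (N ^ n′) F ⟩
            E ^ n * (N ^ n′ * F)              ≤⟨ *-mono-≤ (^-monoˡ-≤ n (s≤s (m⊓n≤m e₀ (suc k)))) (*-monoˡ-≤ F many-points) ⟩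
            suc e₀ ^ n * (∣ P ∣ᴾ * F)         ∎
            where
            open ≤-Reasoning
            lemma : ∀ E A B F → E * (A * B * F) ≡ (E * A) * (B * F)
            lemma = solve-∀

-- Passage from natural numbers to rational constants

module Rationals where

  open import Defs using (ℕ→ℚ; _^-_)
  open import Algebra.Bundles using (CommutativeRing)
  import Algebra.Properties.CommutativeSemigroup
  open import Data.Integer.Base as ℤ using (+_)
  import Data.Integer.Properties as ℤ
  open import Data.Nat.Base as ℕ using (ℕ; zero; suc; NonZero)
  import Data.Nat.Properties as ℕ
  open import Data.Rational.Base as ℚ hiding (NonZero)
  open import Data.Rational.Properties
  import Data.Rational.Unnormalised.Base as ℚᵘ
  import Data.Rational.Unnormalised.Properties as ℚᵘ
  open import Algebra.Definitions.RawSemiring +-*-rawSemiring using () renaming (_^_ to _^ℚ_)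
  open import Relation.Binary.PropositionalEquality

  private
    toℚᵘ-ℕ : ∀ m → toℚᵘ (ℕ→ℚ m) ℚᵘ.≃ ℚᵘ.mkℚᵘ (+ m) 0
    toℚᵘ-ℕ m = toℚᵘ-fromℚᵘ (ℚᵘ.mkℚᵘ (+ m) 0)

  ℕ→ℚ-* : ∀ m n → ℕ→ℚ (m ℕ.* n) ≡ ℕ→ℚ m * ℕ→ℚ n
  ℕ→ℚ-* m n = toℚᵘ-injective (ℚᵘ.≃-trans (toℚᵘ-ℕ (m ℕ.* n)) (ℚᵘ.≃-trans (ℚᵘ.*≡* (cong (ℤ._* + 1) (ℤ.pos-* m n)))
    (ℚᵘ.≃-sym (ℚᵘ.≃-trans (toℚᵘ-homo-* (ℕ→ℚ m) (ℕ→ℚ n)) (ℚᵘ.*-cong (toℚᵘ-ℕ m) (toℚᵘ-ℕ n))))))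

  ℕ→ℚ-mono : ∀ {m n} → m ℕ.≤ n → ℕ→ℚ m ≤ ℕ→ℚ n
  ℕ→ℚ-mono {m} {n} m≤n = toℚᵘ-cancel-≤ (ℚᵘ.≤-respˡ-≃ (ℚᵘ.≃-sym (toℚᵘ-ℕ m)) (ℚᵘ.≤-respʳ-≃ (ℚᵘ.≃-sym (toℚᵘ-ℕ n))
    (ℚᵘ.*≤* (ℤ.*-monoʳ-≤-nonNeg (+ 1) (ℤ.+≤+ m≤n)))))

  unit-fraction : ∀ d .{{_ : NonZero d}} → (+ 1 / d) * ℕ→ℚ d ≡ 1ℚ
  unit-fraction (suc d) = toℚᵘ-injective (ℚᵘ.≃-trans (toℚᵘ-homo-* (+ 1 / suc d) (ℕ→ℚ (suc d)))
    (ℚᵘ.≃-trans (ℚᵘ.*-cong (toℚᵘ-fromℚᵘ (ℚᵘ.mkℚᵘ (+ 1) d)) (toℚᵘ-ℕ (suc d)))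
      (ℚᵘ.*≡* (trans (ℤ.*-identityʳ (+ 1 ℤ.* + suc d)) (cong (λ x → + 1 ℤ.* + x) (sym (ℕ.*-identityʳ (suc d))))))))

  0≤unit-fraction : ∀ d .{{_ : NonZero d}} → 0ℚ ≤ + 1 / d
  0≤unit-fraction d = nonNegative⁻¹ (+ 1 / d) {{normalize-nonNeg 1 d}}

  0≤ℕ→ℚ : ∀ m → 0ℚ ≤ ℕ→ℚ m
  0≤ℕ→ℚ m = ℕ→ℚ-mono {0} {m} ℕ.z≤n

  *-mono-≤ˡ : ∀ {r} → 0ℚ ≤ r → ∀ {p q} → p ≤ q → r * p ≤ r * q
  *-mono-≤ˡ {r} 0≤r = *-monoˡ-≤-nonNeg r {{nonNegative 0≤r}}

  *-mono-≤ʳ : ∀ {r} → 0ℚ ≤ r → ∀ {p q} → p ≤ q → p * r ≤ q * r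
  *-mono-≤ʳ {r} 0≤r = *-monoʳ-≤-nonNeg r {{nonNegative 0≤r}}

  0≤* : ∀ {p q} → 0ℚ ≤ p → 0ℚ ≤ q → 0ℚ ≤ p * q
  0≤* {p} 0≤p 0≤q = subst (_≤ p * _) (*-zeroʳ p) (*-mono-≤ˡ 0≤p 0≤q)

  interchange : ∀ a b c d → (a * b) * (c * d) ≡ (a * c) * (b * d)
  interchange = Algebra.Properties.CommutativeSemigroup.interchange (CommutativeRing.*-commutativeSemigroup +-*-commutativeRing)

  module Inverse (q : ℚ) .{{q≢0 : ℚ.NonZero q}} where

    ^-inverse : ∀ n → q ^- n * q ^ℚ n ≡ 1ℚ
    ^-inverse zero    = refl
    ^-inverse (suc n) = trans (interchange (1/ q) ((1/ q) ^ℚ n) q (q ^ℚ n)) (trans (cong₂ _*_ (*-inverseˡ q) (^-inverse n)) (*-identityˡ 1ℚ))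

    module _ (1≤q : 1ℚ ≤ q) where
      0≤1/q : 0ℚ ≤ 1/ q
      0≤1/q = *-cancelʳ-≤-pos q {{positive (<-≤-trans (positive⁻¹ 1ℚ) 1≤q)}}
        (subst₂ _≤_ (sym (*-zeroˡ q)) (sym (*-inverseˡ q)) (nonNegative⁻¹ 1ℚ))

      1/q≤1 : 1/ q ≤ 1ℚ
      1/q≤1 = subst₂ _≤_ (*-identityʳ (1/ q)) (*-inverseˡ q) (*-mono-≤ˡ 0≤1/q 1≤q)

      0≤^- : ∀ n → 0ℚ ≤ q ^- n
      0≤^- zero    = nonNegative⁻¹ 1ℚ
      0≤^- (suc n) = 0≤* 0≤1/q (0≤^- n)

      ^-≤1 : ∀ n → q ^- n ≤ 1ℚ
      ^-≤1 zero    = ≤-refl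
      ^-≤1 (suc n) = ≤-trans (*-mono-≤ˡ 0≤1/q (^-≤1 n)) (≤-trans (≤-reflexive (*-identityʳ (1/ q))) 1/q≤1)

  ℕ→ℚ-^ : ∀ m n → ℕ→ℚ (m ℕ.^ n) ≡ ℕ→ℚ m ^ℚ n
  ℕ→ℚ-^ m zero    = refl
  ℕ→ℚ-^ m (suc n) = trans (ℕ→ℚ-* m (m ℕ.^ n)) (cong (ℕ→ℚ m *_) (ℕ→ℚ-^ m n))

  -- A constant C only has to satisfy C D ≤ 1; the inequality H ≤ D Z F between natural numbers then
  -- carries over to the quotients.
  divide-bound : ∀ {C} D Z H F .{{_ : NonZero Z}} → 0ℚ ≤ C → C * ℕ→ℚ D ≤ 1ℚ → H ℕ.≤ D ℕ.* (Z ℕ.* F) →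
    (C * (+ 1 / Z)) * ℕ→ℚ H ≤ ℕ→ℚ F
  divide-bound {C} D Z H F 0≤C CD≤1 H≤ = begin
    (C * z) * ℕ→ℚ H                          ≤⟨ *-mono-≤ˡ (0≤* 0≤C (0≤unit-fraction Z)) (ℕ→ℚ-mono H≤) ⟩
    (C * z) * ℕ→ℚ (D ℕ.* (Z ℕ.* F))          ≡⟨ cong ((C * z) *_) (trans (ℕ→ℚ-* D (Z ℕ.* F)) (cong (ℕ→ℚ D *_) (ℕ→ℚ-* Z F))) ⟩
    (C * z) * (ℕ→ℚ D * (ℕ→ℚ Z * ℕ→ℚ F))      ≡⟨ interchange C z (ℕ→ℚ D) (ℕ→ℚ Z * ℕ→ℚ F) ⟩
    (C * ℕ→ℚ D) * (z * (ℕ→ℚ Z * ℕ→ℚ F))      ≡⟨ cong ((C * ℕ→ℚ D) *_) (trans (sym (*-assoc z (ℕ→ℚ Z) (ℕ→ℚ F)))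
                                                  (trans (cong (_* ℕ→ℚ F) (unit-fraction Z)) (*-identityˡ (ℕ→ℚ F)))) ⟩
    (C * ℕ→ℚ D) * ℕ→ℚ F                      ≤⟨ *-mono-≤ʳ (0≤ℕ→ℚ F) CD≤1 ⟩
    1ℚ * ℕ→ℚ F                               ≡⟨ *-identityˡ (ℕ→ℚ F) ⟩
    ℕ→ℚ F                                    ∎
    where
    open ≤-Reasoning
    z = + 1 / Z

-- The two constants

open Averaging
open Chart
open Counting
open Rationals
open import Data.Integer.Base using (+_)
open import Data.Nat.Base using (zero; suc; _*_; _+_; _≤_; _<_; NonTrivial; >-nonZero⁻¹)
open import Data.Nat.Primality using (prime⇒nonTrivial; prime⇒nonZero)
open import Data.Nat.Properties
open import Data.Rational.Base as ℚ using (1ℚ; _/_)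
import Data.Rational.Properties as ℚ
open import Relation.Binary.PropositionalEquality using (sym; trans; cong; subst)

module _ {p : ℕ} (pr : Prime p) (k n′ : ℕ) (P : ProjectiveSpace (p ^ suc k) (suc n′))
         (f : Vec (ℤ/ (p ^ suc k)) (suc n′) → ℕ) (f≢0 : ¬ (∀ x → f x ≡ 0)) where
  private
    n = suc n′
    instance
      p>1 : NonTrivial p
      p>1 = prime⇒nonTrivial pr
      p≢0 : NonZero p
      p≢0 = prime⇒nonZero pr
      P≢0 : NonZero ∣ P ∣ᴾ
      P≢0 = ∣P∣≢0 pr (suc k) P
    w = maxOver P (f ⋆)
    F = ∑ (allVectors (p ^ suc k) n) (λ x → f x ^ n)
    H = ∑ (points P) (λ u → (f ⋆) u ^ n)

    F≥1 : 1 ≤ F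
    F≥1 = n≢0⇒n>0 λ F≡0 → f≢0 λ x → m^n≡0⇒m≡0 (f x) n
      (n≤0⇒n≡0 (subst (f x ^ n ≤_) F≡0 (∈⇒≤∑ (λ x → f x ^ n) (∈-allVectors x))))

  maximal-bound′ : H ≤ suc ⌈log[ p ] w ⌉ ^ n * (∣ P ∣ᴾ * F)
  maximal-bound′ with ceilLog p w
  ... | record { exponent = suc e ; above = w≤ } = Average.maximal-bound pr k n′ P f (suc e) w≤
  -- The chart inequality requires e ≥ 1, so w ≤ 1 is treated directly: every f*(u)ⁿ is at most 1,
  -- and F ≥ 1 because f is not identically 0.
  ... | record { exponent = zero  ; above = w≤1 } = begin
      H                                          ≤⟨ ∑-mono-∈ (points P) (λ u∈ → ≤-trans
                                                      (^-monoˡ-≤ n (≤-trans (Average.f⋆≤w pr k n′ P f u∈) w≤1)) (≤-reflexive (^-zeroˡ n))) ⟩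
      ∑ (points P) (λ _ → 1)                     ≡⟨ ∑-const 1 (points P) ⟩
      ∣ P ∣ᴾ * 1                                 ≤⟨ *-monoʳ-≤ ∣ P ∣ᴾ F≥1 ⟩
      ∣ P ∣ᴾ * F                                 ≡⟨ trans (cong (_* (∣ P ∣ᴾ * F)) (^-zeroˡ n)) (*-identityˡ _) ⟨
      1 ^ n * (∣ P ∣ᴾ * F)                       ∎
    where open ≤-Reasoning

  part-i : (w,n≢1,1 : (w , n) ≢ (1 , 1)) → MaximalInequality P f (C₁ pr w n (1<w*n pr (suc k) P f f≢0 w,n≢1,1))
  part-i w,n≢1,1 = divide-bound ((2 * L) ^ n) ∣ P ∣ᴾ H F (0≤unit-fraction ((2 * L) ^ n)) (ℚ.≤-reflexive (unit-fraction ((2 * L) ^ n)))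
    (≤-trans maximal-bound′ (*-monoˡ-≤ (∣ P ∣ᴾ * F) (^-monoˡ-≤ n exponent≤)))
    where
    L = ⌈log[ p ] w * n ⌉
    1<wn : 1 < w * n
    1<wn = 1<w*n pr (suc k) P f f≢0 w,n≢1,1
    instance
      L≢0 : NonZero L
      L≢0 = ⌈log⌉-nonZero p 1<wn
      2L^n≢0 : NonZero ((2 * L) ^ n)
      2L^n≢0 = m^n≢0 (2 * L) n {{m*n≢0 2 L}}
    -- One copy of L covers the added 1, as w n > 1 gives L ≥ 1; the other covers ⌈log_p w⌉, as w ≤
    -- w n.
    exponent≤ : suc ⌈log[ p ] w ⌉ ≤ 2 * L
    exponent≤ = ≤-trans (+-mono-≤ (>-nonZero⁻¹ L) (CeilLog.least (ceilLog p w) L (≤-trans (m≤m*n w n) (CeilLog.above (ceilLog p (w * n))))))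
      (≤-reflexive (cong (_+_ L) (sym (+-identityʳ L))))

  part-ii : MaximalInequality P f (C₂ pr w n)
  part-ii = divide-bound (M ^ n) ∣ P ∣ᴾ H F (0≤* (I.0≤^- 1≤M n) (J.0≤^- 1≤q n)) C*D≤1
    (≤-trans maximal-bound′ (≤-reflexive (cong (λ e → e ^ n * (∣ P ∣ᴾ * F)) (+-comm 1 ⌈log[ p ] w ⌉))))
    where
    M = ⌈log[ p ] w ⌉ + 1
    1≤M : 1ℚ ℚ.≤ ℕ→ℚ M
    1≤M = ℕ→ℚ-mono {1} {M} (m≤n+m 1 ⌈log[ p ] w ⌉)
    q = 1ℚ ℚ.+ (+ n) / p
    1≤q : 1ℚ ℚ.≤ q
    1≤q = ℚ.≤-trans (ℚ.≤-reflexive (sym (ℚ.+-identityʳ 1ℚ))) (ℚ.+-monoʳ-≤ 1ℚ (ℚ.nonNegative⁻¹ ((+ n) / p) {{ℚ.normalize-nonNeg n p}}))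
    instance
      M≢0 : ℚ.NonZero (ℕ→ℚ M)
      M≢0 = ℚ.pos⇒nonZero (ℕ→ℚ M) {{ℚ.positive (ℚ.<-≤-trans (ℚ.positive⁻¹ 1ℚ) 1≤M)}}
      q≢0 : ℚ.NonZero q
      q≢0 = ℚ.pos⇒nonZero q {{ℚ.positive (ℚ.<-≤-trans (ℚ.positive⁻¹ 1ℚ) 1≤q)}}
    module I = Inverse (ℕ→ℚ M)
    module J = Inverse q
    -- M⁻ⁿ cancels against Mⁿ, and the remaining factor (1 + n/p)⁻ⁿ is at most 1.
    C*D≤1 : (ℕ→ℚ M ^- n ℚ.* q ^- n) ℚ.* ℕ→ℚ (M ^ n) ℚ.≤ 1ℚ
    C*D≤1 = ℚ.≤-trans (ℚ.≤-reflexive (trans (cong ((ℕ→ℚ M ^- n ℚ.* q ^- n) ℚ.*_) (trans (ℕ→ℚ-^ M n) (sym (ℚ.*-identityʳ _))))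
        (trans (interchange (ℕ→ℚ M ^- n) (q ^- n) _ 1ℚ) (trans (cong (ℚ._* (q ^- n ℚ.* 1ℚ)) (I.^-inverse n))
          (trans (ℚ.*-identityˡ (q ^- n ℚ.* 1ℚ)) (ℚ.*-identityʳ (q ^- n)))))))
      (J.^-≤1 1≤q n)

theorem1p6 : (n p k : ℕ) .{{_ : NonZero n}} .{{_ : NonZero k}} (pr : Prime p)
    (P : ProjectiveSpace (p ^ k) n)
    (f : Vec (ℤ/ (p ^ k)) n → ℕ) (f≢0 : ¬ (∀ x → f x ≡ 0)) →
    let w = maxOver P (f ⋆) in
    ((w,n≢1,1 : (w , n) ≢ (1 , 1)) →
    MaximalInequality P {{∣P∣≢0 pr k P}} f (C₁ pr w n (1<w*n pr k P f f≢0 w,n≢1,1)))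
    × (p > n →
    MaximalInequality P {{∣P∣≢0 pr k P}} f (C₂ pr w n))
theorem1p6 (suc n′) p (suc k) pr P f f≢0 = part-i pr k n′ P f f≢0 , λ _ → part-ii pr k n′ P f f≢0
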